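{- There is a finite first-order language $L$ such that the property of $\omega$-categoricity distinguishes a $\Pi^0_3$-complete subset of the set of all decidable complete $L$-theories. That is, the set of all $e\in\omega$ such that $\mathrm{sgn}(\varphi_e(x))$ is (total and is) the characteristic function of the set of Gödel numbers of the sentences of a decidable complete $\omega$-categorical $L$-theory is a $\Pi^0_3$-complete set.
   Context: $(\varphi_e)_{e\in\omega}$ is a standard enumeration of the unary partial computable functions. $\mathrm{sgn}(x)=1$ for $x\neq 0$ and $\mathrm{sgn}(0)=0$. A Gödel numbering of the sentences of the finite language $L$ is fixed, and a decidable complete $L$-theory (a consistent, deductively closed, complete set of $L$-sentences) is identified with the computable characteristic function, of the form $\mathrm{sgn}(\varphi_e(x))$, of the set of Gödel numbers of its sentences. A complete theory is $\omega$-categorical (countably categorical) if it has, up to isomorphism, exactly one countably infinite model (and no finite models). A set $X\subseteq\omega$ is $\Pi^0_3$-complete if $X\in\Pi^0_3$ and every $\Pi^0_3$ subset of $\omega$ is many-one reducible to $X$. -}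

module Defs where

open import Level using (Level; 0ℓ) renaming (suc to lsuc)
open import Data.Nat using (ℕ; zero; suc; _+_; _<_)
open import Data.Fin using (Fin; zero; suc; toℕ)
open import Data.Vec using (Vec; []; _∷_; lookup; map)
import Data.List as List
open List using (List; []; _∷_)
open import Data.List.Membership.Propositional using (_∈_)
open import Data.List.Relation.Unary.All using (All)
open import Data.Product using (Σ; ∃; _×_)
open import Data.Sum using (_⊎_)
open import Data.Empty using (⊥)
open import Function.Bundles using (_↔_; _⇔_; Inverse)
open import Relation.Nullary using (¬_)
open import Relation.Unary using (Pred)
open import Relation.Binary.PropositionalEquality using (_≡_)

private
  variable
    ℓ : Level
    k m n : ℕ

triangle : ℕ → ℕ
triangle zero    = 0
triangle (suc n) = suc n + triangle n

-- The Cantor pairing function, a bijection.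
⟨_,_⟩ : ℕ → ℕ → ℕ
⟨ x , y ⟩ = triangle (x + y) + x

-- Programs for the k-ary μ-recursive functions.
data Rec : ℕ → Set where
  zeroᶠ : Rec 0
  sucᶠ  : Rec 1
  proj  : Fin k → Rec k
  comp  : Rec m → Vec (Rec k) m → Rec k
  prim  : Rec k → Rec (2 + k) → Rec (1 + k)
  μ     : Rec (1 + k) → Rec k

-- f [ xs ]⇓ y : the program f halts on input xs with output y.
infix 4 _[_]⇓_ _[_]⇓*_

mutual
  data _[_]⇓_ : Rec k → Vec ℕ k → ℕ → Set where
    zero⇓ : zeroᶠ [ [] ]⇓ 0
    suc⇓  : ∀ {x} → sucᶠ [ x ∷ [] ]⇓ suc x
    proj⇓ : ∀ {xs : Vec ℕ k} (i : Fin k) → proj i [ xs ]⇓ lookup xs i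
    comp⇓ : ∀ {f : Rec m} {gs : Vec (Rec k) m} {xs ys z} →
            gs [ xs ]⇓* ys → f [ ys ]⇓ z → comp f gs [ xs ]⇓ z
    prim-zero⇓ : ∀ {f : Rec k} {g xs y} →
                 f [ xs ]⇓ y → prim f g [ 0 ∷ xs ]⇓ y
    prim-suc⇓  : ∀ {f : Rec k} {g xs x y z} →
                 prim f g [ x ∷ xs ]⇓ y → g [ x ∷ y ∷ xs ]⇓ z →
                 prim f g [ suc x ∷ xs ]⇓ z
    μ⇓ : ∀ {f : Rec (1 + k)} {xs y} →
         (∀ x → x < y → ∃ λ z → f [ x ∷ xs ]⇓ suc z) →
         f [ y ∷ xs ]⇓ 0 → μ f [ xs ]⇓ y

  data _[_]⇓*_ : Vec (Rec k) m → Vec ℕ k → Vec ℕ m → Set where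
    []  : ∀ {xs : Vec ℕ k} → [] [ xs ]⇓* []
    _∷_ : ∀ {g : Rec k} {gs : Vec (Rec k) m} {xs y ys} →
          g [ xs ]⇓ y → gs [ xs ]⇓* ys → (g ∷ gs) [ xs ]⇓* (y ∷ ys)

mutual
  code : Rec k → ℕ
  code zeroᶠ       = ⟨ 0 , 0 ⟩
  code sucᶠ        = ⟨ 1 , 0 ⟩
  code (proj i)    = ⟨ 2 , toℕ i ⟩
  code (comp f gs) = ⟨ 3 , ⟨ code f , codes gs ⟩ ⟩
  code (prim f g)  = ⟨ 4 , ⟨ code f , code g ⟩ ⟩
  code (μ f)       = ⟨ 5 , code f ⟩

  codes : Vec (Rec k) m → ℕ
  codes []       = 0
  codes (g ∷ gs) = suc ⟨ code g , codes gs ⟩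

-- φ e x y : φ_e(x) is defined and equal to y.  When e is not the code of a
-- unary program, φ_e is the nowhere defined function.
φ : ℕ → ℕ → ℕ → Set
φ e x y = Σ (Rec 1) λ f → code f ≡ e × f [ x ∷ [] ]⇓ y

sgn : ℕ → ℕ
sgn zero    = 0
sgn (suc _) = 1

-- sgn(φ_e) is total and is the characteristic function of A.
_Decides_ : ℕ → Pred ℕ ℓ → Set ℓ
e Decides A = ∀ x → ∃ λ y → φ e x y × (A x × sgn y ≡ 1 ⊎ ¬ A x × sgn y ≡ 0)

ComputableSet : Pred ℕ ℓ → Set ℓ
ComputableSet A = ∃ λ e → e Decides A

ComputableFunction : (ℕ → ℕ) → Set
ComputableFunction f = ∃ λ e → ∀ x → φ e x (f x)

mutual
  Σ⁰ : ℕ → Pred ℕ ℓ → Set (lsuc ℓ)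
  Σ⁰ {ℓ} zero    A = Level.Lift (lsuc ℓ) (ComputableSet A)
  Σ⁰ {ℓ} (suc n) A =
    Σ (Pred ℕ ℓ) λ B → Π⁰ n B × (∀ x → A x ⇔ (∃ λ y → B ⟨ x , y ⟩))

  Π⁰ : ℕ → Pred ℕ ℓ → Set (lsuc ℓ)
  Π⁰ {ℓ} zero    A = Level.Lift (lsuc ℓ) (ComputableSet A)
  Π⁰ {ℓ} (suc n) A =
    Σ (Pred ℕ ℓ) λ B → Σ⁰ n B × (∀ x → A x ⇔ (∀ y → B ⟨ x , y ⟩))

_≤ₘ_ : Pred ℕ ℓ → Pred ℕ ℓ → Set ℓ
A ≤ₘ B = ∃ λ f → ComputableFunction f × (∀ x → A x ⇔ B (f x))

Π⁰-Complete : ℕ → Pred ℕ ℓ → Set (lsuc ℓ)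
Π⁰-Complete {ℓ} n X = Π⁰ n X × (∀ (A : Pred ℕ ℓ) → Π⁰ n A → A ≤ₘ X)

record FiniteLanguage : Set where
  field
    #fun     : ℕ
    funArity : Fin #fun → ℕ
    #rel     : ℕ
    relArity : Fin #rel → ℕ

open FiniteLanguage public

private
  variable
    L : FiniteLanguage

-- Terms and formulas have their free variables among n de Bruijn indices;
-- variable zero is bound by the innermost quantifier.
data Term (L : FiniteLanguage) (n : ℕ) : Set where
  var : Fin n → Term L n
  fun : (f : Fin (#fun L)) → Vec (Term L n) (funArity L f) → Term L n

infixr 6 _⇒_
infix  7 _≐_

data Formula (L : FiniteLanguage) (n : ℕ) : Set where
  ⊥̇   : Formula L n
  _≐_ : Term L n → Term L n → Formula L n
  rel : (r : Fin (#rel L)) → Vec (Term L n) (relArity L r) → Formula L n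
  _⇒_ : Formula L n → Formula L n → Formula L n
  all : Formula L (suc n) → Formula L n

¬̇_ : Formula L n → Formula L n
¬̇ A = A ⇒ ⊥̇

Sentence : FiniteLanguage → Set
Sentence L = Formula L 0

mutual
  gödelTerm : Term L n → ℕ
  gödelTerm (var i)    = ⟨ 0 , toℕ i ⟩
  gödelTerm (fun f ts) = ⟨ 1 , ⟨ toℕ f , gödelTerms ts ⟩ ⟩

  gödelTerms : Vec (Term L n) m → ℕ
  gödelTerms []       = 0
  gödelTerms (t ∷ ts) = suc ⟨ gödelTerm t , gödelTerms ts ⟩

gödel : Formula L n → ℕ
gödel ⊥̇          = ⟨ 0 , 0 ⟩
gödel (s ≐ t)    = ⟨ 1 , ⟨ gödelTerm s , gödelTerm t ⟩ ⟩
gödel (rel r ts) = ⟨ 2 , ⟨ toℕ r , gödelTerms ts ⟩ ⟩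
gödel (A ⇒ B)    = ⟨ 3 , ⟨ gödel A , gödel B ⟩ ⟩
gödel (all A)    = ⟨ 4 , gödel A ⟩

mutual
  renameTerm : (Fin m → Fin n) → Term L m → Term L n
  renameTerm ρ (var i)    = var (ρ i)
  renameTerm ρ (fun f ts) = fun f (renameTerms ρ ts)

  renameTerms : (Fin m → Fin n) → Vec (Term L m) k → Vec (Term L n) k
  renameTerms ρ []       = []
  renameTerms ρ (t ∷ ts) = renameTerm ρ t ∷ renameTerms ρ ts

mutual
  substTerm : (Fin m → Term L n) → Term L m → Term L n
  substTerm σ (var i)    = σ i
  substTerm σ (fun f ts) = fun f (substTerms σ ts)

  substTerms : (Fin m → Term L n) → Vec (Term L m) k → Vec (Term L n) k
  substTerms σ []       = []
  substTerms σ (t ∷ ts) = substTerm σ t ∷ substTerms σ ts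

lift : (Fin m → Term L n) → Fin (suc m) → Term L (suc n)
lift σ zero    = var zero
lift σ (suc i) = renameTerm suc (σ i)

substFormula : (Fin m → Term L n) → Formula L m → Formula L n
substFormula σ ⊥̇          = ⊥̇
substFormula σ (s ≐ t)    = substTerm σ s ≐ substTerm σ t
substFormula σ (rel r ts) = rel r (substTerms σ ts)
substFormula σ (A ⇒ B)    = substFormula σ A ⇒ substFormula σ B
substFormula σ (all A)    = all (substFormula (lift σ) A)

weaken : Formula L n → Formula L (suc n)
weaken = substFormula (λ i → var (suc i))

instantiate : Term L n → Fin (suc n) → Term L n
instantiate t zero    = t
instantiate t (suc i) = var i

_[_] : Formula L (suc n) → Term L n → Formula L n
A [ t ] = substFormula (instantiate t) A

infix 4 _⊢_

data _⊢_ {L : FiniteLanguage} :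
         {n : ℕ} → List (Formula L n) → Formula L n → Set where
  hyp : ∀ {n Γ} {A : Formula L n} → A ∈ Γ → Γ ⊢ A
  ⇒I  : ∀ {n Γ} {A B : Formula L n} → (A ∷ Γ) ⊢ B → Γ ⊢ A ⇒ B
  ⇒E  : ∀ {n Γ} {A B : Formula L n} → Γ ⊢ A ⇒ B → Γ ⊢ A → Γ ⊢ B
  raa : ∀ {n Γ} {A : Formula L n} → ((¬̇ A) ∷ Γ) ⊢ ⊥̇ → Γ ⊢ A
  ∀I  : ∀ {n Γ} {A : Formula L (suc n)} → List.map weaken Γ ⊢ A → Γ ⊢ all A
  ∀E  : ∀ {n Γ} {A : Formula L (suc n)} → Γ ⊢ all A → ∀ t → Γ ⊢ A [ t ]
  ≐I  : ∀ {n Γ} {t : Term L n} → Γ ⊢ t ≐ t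
  ≐E  : ∀ {n Γ} {s t : Term L n} (A : Formula L (suc n)) →
        Γ ⊢ s ≐ t → Γ ⊢ A [ s ] → Γ ⊢ A [ t ]
  -- Domains are nonempty.  In well-scoped syntax this does not follow from
  -- the other rules, since there may be no closed terms.
  nonempty : ∀ {n Γ} {A : Formula L n} → List.map weaken Γ ⊢ weaken A → Γ ⊢ A

_⊢ᵀ_ : Pred (Sentence L) 0ℓ → Sentence L → Set
T ⊢ᵀ A = ∃ λ Γ → All T Γ × Γ ⊢ A

record IsCompleteTheory (T : Pred (Sentence L) 0ℓ) : Set where
  field
    consistent        : ¬ (T ⊢ᵀ ⊥̇)
    deductivelyClosed : ∀ A → T ⊢ᵀ A → T A
    complete          : ∀ A → T A ⊎ T (¬̇ A)

record Structure (L : FiniteLanguage) : Set₁ where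
  field
    Carrier : Set
    point   : Carrier
    funᴹ    : (f : Fin (#fun L)) → Vec Carrier (funArity L f) → Carrier
    relᴹ    : (r : Fin (#rel L)) → Vec Carrier (relArity L r) → Set

module _ (M : Structure L) where
  open Structure M

  mutual
    evalTerm : Vec Carrier n → Term L n → Carrier
    evalTerm ρ (var i)    = lookup ρ i
    evalTerm ρ (fun f ts) = funᴹ f (evalTerms ρ ts)

    evalTerms : Vec Carrier n → Vec (Term L n) m → Vec Carrier m
    evalTerms ρ []       = []
    evalTerms ρ (t ∷ ts) = evalTerm ρ t ∷ evalTerms ρ ts

  Satisfies : Vec Carrier n → Formula L n → Set
  Satisfies ρ ⊥̇          = ⊥
  Satisfies ρ (s ≐ t)    = evalTerm ρ s ≡ evalTerm ρ t
  Satisfies ρ (rel r ts) = relᴹ r (evalTerms ρ ts)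
  Satisfies ρ (A ⇒ B)    = Satisfies ρ A → Satisfies ρ B
  Satisfies ρ (all A)    = ∀ a → Satisfies (a ∷ ρ) A

  CountablyInfinite : Set
  CountablyInfinite = Carrier ↔ ℕ

  Finite : Set
  Finite = ∃ λ n → Carrier ↔ Fin n

_⊨_ : Structure L → Pred (Sentence L) 0ℓ → Set
M ⊨ T = ∀ A → T A → Satisfies M [] A

-- The point of a structure only witnesses nonemptiness, so isomorphisms need
-- not preserve it.
record _≅_ {L : FiniteLanguage} (M N : Structure L) : Set where
  private
    module M = Structure M
    module N = Structure N
  field
    bijection : M.Carrier ↔ N.Carrier
  open Inverse bijection using (to)
  field
    fun-≅ : ∀ f xs → to (M.funᴹ f xs) ≡ N.funᴹ f (map to xs)
    rel-≅ : ∀ r xs → M.relᴹ r xs ⇔ N.relᴹ r (map to xs)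

record ωCategorical (T : Pred (Sentence L) 0ℓ) : Set₁ where
  field
    existence  : ∃ λ (M : Structure L) → M ⊨ T × CountablyInfinite M
    uniqueness : ∀ (M N : Structure L) →
                 M ⊨ T → CountablyInfinite M →
                 N ⊨ T → CountablyInfinite N → M ≅ N
    noFinite   : ∀ (M : Structure L) → M ⊨ T → ¬ Finite M

GödelNumbers : Pred (Sentence L) 0ℓ → Pred ℕ 0ℓ
GödelNumbers T x = ∃ λ A → T A × gödel A ≡ x

-- The indices e such that sgn(φ_e) is the characteristic function of (the
-- Gödel numbers of) a complete ω-categorical L-theory; such a theory is
-- decidable by virtue of having an index.
ωCategoricalIndices : FiniteLanguage → Pred ℕ (lsuc 0ℓ)
ωCategoricalIndices L e =
  Σ (Pred (Sentence L) 0ℓ) λ T →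
    IsCompleteTheory T × ωCategorical T × e Decides GödelNumbers T

{-# OPTIONS --safe #-}

-- Membership in Π⁰₃.  By the Ryll-Nardzewski theorem a complete theory T is
-- ω-categorical iff it has no finite models and, for every n, finitely many
-- formulas in n variables exhaust all of them up to T-equivalence.  When T is
-- given by a total φₑ, "finitely many formulas suffice for n" is Σ⁰₂, while
-- being a complete theory without finite models is Π⁰₂.
--
-- Hardness.  For A x ⇔ ∀ n ∃ z ∀ w D(x,n,z,w), let s be active for n if it
-- records a z such that all z′ ≤ z have just been seen to be refuted; so only
-- finitely many s are active for n iff some z satisfies ∀ w D(x,n,z,w).  Let
-- G be a generic graph in which every (n+1)-clique may be forbidden, for each
-- active s, to extend to a clique of size N = ⟨n+1,s⟩, independently of all
-- else.  The type of an m-tuple is determined by its edges and by which of its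
-- subcliques are forbidden to extend to which sizes; so there are finitely many
-- types of m-tuples if finitely many s are active for each n < m, whereas
-- infinitely many s active for n make the formulas "x₀, …, xₙ extend to a clique
-- of size N" pairwise inequivalent.  The graph lives on the natural numbers,
-- each of which codes its links to smaller numbers and the prohibitions that it
-- completes; a one-element extension of a tuple is realised below a computable
-- bound, hence quantifiers can be bounded and the theory is decidable.
module Submission where

open import Defs
open import Level using (0ℓ) renaming (suc to lsuc)
import Level
open import Axiom.ExcludedMiddle using (ExcludedMiddle)
open import Data.Bool using (Bool; true; false)
open import Data.Empty using (⊥; ⊥-elim)
open import Data.Fin using (Fin; zero; suc; toℕ; fromℕ<; #_)
import Data.Fin as Fin
import Data.Fin.Properties as Fin
open import Data.List using (List; []; _∷_; _++_)
import Data.List as List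
import Data.List.Properties as List
open import Data.List.Membership.Propositional using (_∈_)
import Data.List.Membership.Propositional.Properties as List
open import Data.List.Relation.Binary.Subset.Propositional using (_⊆_)
open import Data.List.Relation.Unary.All using (All; []; _∷_)
import Data.List.Relation.Unary.All as All
import Data.List.Relation.Unary.All.Properties as All
open import Data.List.Relation.Unary.Any using (here; there)
import Data.List.Relation.Unary.Any as Any
open import Data.Nat
open import Data.Nat.Properties
open import Data.Nat.Induction using (<-rec)
open import Data.Product using (Σ; ∃; ∃₂; _×_; _,_; proj₁; proj₂)
open import Data.Sum using (_⊎_; inj₁; inj₂; [_,_]′)
open import Data.Unit using (⊤; tt)
open import Data.Vec using (Vec; []; _∷_; lookup; map; tabulate; head; tail)
import Data.Vec
import Data.Vec.Properties as Vec
open import Function using (_∘_; id; case_of_)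
open import Function.Bundles using (_↔_; Inverse; Equivalence; mk⇔; mk↔ₛ′)
open import Relation.Binary.PropositionalEquality hiding ([_])
open import Relation.Nullary using (Dec; yes; no; ¬_)
open import Relation.Nullary.Decidable using (True)
open import Relation.Binary.Definitions using (Tri; tri<; tri≈; tri>)
open import Relation.Unary using (Pred)

-- A vertex that completes a violated clique is not excluded but isolated: `Edge` asks both ends to
-- be `Ok`. So every number is a vertex, prohibitions may be recorded freely, and edges are decided
-- by bounded search. The sizes `size n s` are injective in the pair and exceed n + 1, so a
-- forbidden tuple may itself be a clique, and prohibitions of different sizes do not interfere. The
-- reduction cannot know whether the theory is categorical, so it decides the theory in both cases:
-- a formula with n variables and r quantifiers compares at most n + r elements, and larger sizes
-- are invisible to it even when infinitely many s are active. Evaluation of programs, provability,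
-- failing to be a formula and truth in the graph are each given by finitely many rules on tuples of
-- numbers, whose enumerability is proved once. One Henkin construction, with a notion of
-- consistency and a family of dense sets as parameters, yields models and realises and omits types.

private
  variable
    i j k m n : ℕ

-- Inverting the pairing function; codes of lists.

cond : ℕ → ℕ → ℕ → ℕ
cond zero    a b = b
cond (suc _) a b = a

eqn : ℕ → ℕ → ℕ
eqn x y = 1 ∸ ((x ∸ y) + (y ∸ x))

eqn-≡ : ∀ x → eqn x x ≡ 1
eqn-≡ x rewrite n∸n≡0 x = refl

eqn-≢ : ∀ {x y} → x ≢ y → eqn x y ≡ 0
eqn-≢ {x} {y} x≢y with x ∸ y in p | y ∸ x in q
... | zero  | zero  = ⊥-elim (x≢y (≤-antisym (m∸n≡0⇒m≤n p) (m∸n≡0⇒m≤n q)))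
... | zero  | suc d = 0∸n≡0 d
... | suc c | d     = 0∸n≡0 (c + d)

-- The number of the antidiagonal on which the coded pair lies, that is, the sum of its coordinates.
-- The recursion advances it exactly when a triangular number is reached, so that a primitive
-- recursive program can follow it (`diagonalᶠ`).
diagonal : ℕ → ℕ
diagonal zero    = 0
diagonal (suc p) =
  cond (eqn (triangle (suc (diagonal p))) (suc p)) (suc (diagonal p)) (diagonal p)

cond-eqn : ∀ x y a b → (x ≡ y × a ≡ cond (eqn x y) a b) ⊎ (x ≢ y × b ≡ cond (eqn x y) a b)
cond-eqn x y a b with x ≟ y
... | yes refl = inj₁ (refl , sym (cong (λ c → cond c a b) (eqn-≡ x)))
... | no ne    = inj₂ (ne , sym (cong (λ c → cond c a b) (eqn-≢ ne)))

diagonal-spec : ∀ p → triangle (diagonal p) ≤ p × p < triangle (suc (diagonal p))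
diagonal-spec zero    = z≤n , s≤s z≤n
diagonal-spec (suc p) with diagonal-spec p
   | cond-eqn (triangle (suc (diagonal p))) (suc p) (suc (diagonal p)) (diagonal p)
... | lo , hi | inj₁ (e , q) = subst (λ d → triangle d ≤ suc p × suc p < triangle (suc d)) q
      (≤-reflexive e , subst (_< triangle (2 + diagonal p)) e
          (m<n+m (triangle (suc (diagonal p))) {2 + diagonal p} (s≤s z≤n)))
... | lo , hi | inj₂ (ne , q) = subst (λ d → triangle d ≤ suc p × suc p < triangle (suc d)) q
      (m≤n⇒m≤1+n lo , ≤∧≢⇒< hi (ne ∘ sym))

triangle-mono : ∀ {a b} → a ≤ b → triangle a ≤ triangle b
triangle-mono z≤n     = z≤n
triangle-mono (s≤s p) = s≤s (+-mono-≤ p (triangle-mono p))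

diagonal-unique : ∀ p d → triangle d ≤ p → p < triangle (suc d) → diagonal p ≡ d
diagonal-unique p d lo hi with diagonal-spec p
... | lo′ , hi′ = ≤-antisym (below lo′ hi) (below lo hi′)
  where
  below : ∀ {a b} → triangle a ≤ p → p < triangle (suc b) → a ≤ b
  below {a} {b} l h with a ≤? b
  ... | yes a≤b = a≤b
  ... | no  a≰b = ⊥-elim (<-irrefl refl (<-≤-trans h (≤-trans (triangle-mono (≰⇒> a≰b)) l)))

π₁ π₂ : ℕ → ℕ
π₁ p = p ∸ triangle (diagonal p)
π₂ p = diagonal p ∸ π₁ p

pair-diagonal : ∀ x y → diagonal ⟨ x , y ⟩ ≡ x + y
pair-diagonal x y = diagonal-unique ⟨ x , y ⟩ (x + y) (m≤m+n _ x)
  (subst (⟨ x , y ⟩ <_) (+-comm (triangle (x + y)) (suc (x + y)))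
    (+-monoʳ-< (triangle (x + y)) (s≤s (m≤m+n x y))))

π₁-pair : ∀ x y → π₁ ⟨ x , y ⟩ ≡ x
π₁-pair x y rewrite pair-diagonal x y = m+n∸m≡n (triangle (x + y)) x

π₂-pair : ∀ x y → π₂ ⟨ x , y ⟩ ≡ y
π₂-pair x y rewrite π₁-pair x y | pair-diagonal x y = m+n∸m≡n x y

pair-π : ∀ p → ⟨ π₁ p , π₂ p ⟩ ≡ p
pair-π p with diagonal-spec p
... | lo , hi = trans (cong (λ d → triangle d + π₁ p) (m+[n∸m]≡n π₁≤d)) (m+[n∸m]≡n lo)
  where
  π₁≤d : π₁ p ≤ diagonal p
  π₁≤d = +-cancelˡ-≤ (triangle (diagonal p)) _ _
    (subst₂ _≤_ (sym (m+[n∸m]≡n lo)) (+-comm (diagonal p) _) (≤-pred hi))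

pair-injective : ∀ a b c d → ⟨ a , b ⟩ ≡ ⟨ c , d ⟩ → a ≡ c × b ≡ d
pair-injective a b c d e =
  trans (sym (π₁-pair a b)) (trans (cong π₁ e) (π₁-pair c d)) ,
  trans (sym (π₂-pair a b)) (trans (cong π₂ e) (π₂-pair c d))

cons-injective : ∀ a b c d → suc ⟨ a , b ⟩ ≡ suc ⟨ c , d ⟩ → a ≡ c × b ≡ d
cons-injective a b c d = pair-injective a b c d ∘ suc-injective

pair-mono : ∀ {a b c d} → a ≤ c → b ≤ d → ⟨ a , b ⟩ ≤ ⟨ c , d ⟩
pair-mono p q = +-mono-≤ (triangle-mono (+-mono-≤ p q)) p

n≤triangle : ∀ n → n ≤ triangle n
n≤triangle zero    = z≤n
n≤triangle (suc n) = m≤m+n (suc n) _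

fst≤pair : ∀ a b → a ≤ ⟨ a , b ⟩
fst≤pair a b = m≤n+m a _

snd≤pair : ∀ a b → b ≤ ⟨ a , b ⟩
snd≤pair a b = ≤-trans (≤-trans (m≤n+m b a) (n≤triangle (a + b))) (m≤m+n _ a)

-- A list is coded by 0 or by suc ⟨ head , tail ⟩; lk w i is its i-th entry,
-- and 0 beyond its end.
drops : ℕ → ℕ → ℕ
drops w zero    = w
drops w (suc i) = π₂ (pred (drops w i))

lk : ℕ → ℕ → ℕ
lk w i = π₁ (pred (drops w i))

drops-cons : ∀ a w i → drops (suc ⟨ a , w ⟩) (suc i) ≡ drops w i
drops-cons a w zero    = π₂-pair a w
drops-cons a w (suc i) = cong (π₂ ∘ pred) (drops-cons a w i)

lk-zero : ∀ a w → lk (suc ⟨ a , w ⟩) 0 ≡ a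
lk-zero a w = π₁-pair a w

lk-suc : ∀ a w i → lk (suc ⟨ a , w ⟩) (suc i) ≡ lk w i
lk-suc a w i = cong (π₁ ∘ pred) (drops-cons a w i)

listCode : List ℕ → ℕ
listCode []       = 0
listCode (a ∷ as) = suc ⟨ a , listCode as ⟩

vecCode : Vec ℕ n → ℕ
vecCode []       = 0
vecCode (a ∷ as) = suc ⟨ a , vecCode as ⟩

lk-vecCode : (v : Vec ℕ n) (i : Fin n) → lk (vecCode v) (toℕ i) ≡ lookup v i
lk-vecCode (a ∷ v) zero    = lk-zero a (vecCode v)
lk-vecCode (a ∷ v) (suc i) = trans (lk-suc a (vecCode v) (toℕ i)) (lk-vecCode v i)

sequenceCode : (ℕ → ℕ) → ℕ → ℕ
sequenceCode f zero    = 0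
sequenceCode f (suc n) = suc ⟨ f 0 , sequenceCode (f ∘ suc) n ⟩

lk-sequenceCode : ∀ f n i → i < n → lk (sequenceCode f n) i ≡ f i
lk-sequenceCode f (suc n) zero    _       = lk-zero (f 0) _
lk-sequenceCode f (suc n) (suc i) (s≤s p) =
  trans (lk-suc (f 0) _ i) (lk-sequenceCode (f ∘ suc) n i p)

drops-≤ : ∀ w i → drops w i ≤ w
drops-≤ w zero    = ≤-refl
drops-≤ w (suc i) = ≤-trans (m∸n≤m _ (π₁ p)) (≤-trans (diagonal≤ p) (≤-trans pred[n]≤n (drops-≤ w i)))
  where
  p = pred (drops w i)
  diagonal≤ : ∀ p → diagonal p ≤ p
  diagonal≤ p = ≤-trans (n≤triangle _) (proj₁ (diagonal-spec p))

-- An entry never exceeds the code of its list, so a positive entry, read less one, is strictly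
-- smaller. This descent later makes links point downwards and keeps a description from mentioning
-- the vertex that stores it.
lk-< : ∀ w i {x} → lk w i ≡ suc x → x < w
lk-< w i {x} e = ≤-trans (subst (_≤ pred (drops w i)) e
    (m∸n≤m (pred (drops w i)) (triangle (diagonal (pred (drops w i)))))) (≤-trans pred[n]≤n (drops-≤ w i))

-- Total programs; decidable and enumerable relations.

record Fn (k : ℕ) : Set where
  constructor mkFn
  field
    fn    : Vec ℕ k → ℕ
    prog  : Rec k
    sound : ∀ xs → prog [ xs ]⇓ fn xs
open Fn

record Sub (k m : ℕ) : Set where
  constructor mkSub
  field
    fns    : Vec ℕ k → Vec ℕ m
    progs  : Vec (Rec k) m
    sounds : ∀ xs → progs [ xs ]⇓* fns xs
open Sub

projections⇓ : (f : Fin m → Fin k) (xs : Vec ℕ k) →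
               tabulate (proj ∘ f) [ xs ]⇓* tabulate (lookup xs ∘ f)
projections⇓ {zero}  f xs = []
projections⇓ {suc m} f xs = proj⇓ (f zero) ∷ projections⇓ (f ∘ suc) xs

idˢ : Sub k k
idˢ = mkSub id (tabulate proj)
  (λ xs → subst (_ [ xs ]⇓*_) (Vec.tabulate∘lookup xs) (projections⇓ id xs))

wkˢ : Sub (suc k) k
wkˢ = mkSub tail (tabulate (proj ∘ suc))
  (λ { (x ∷ xs) → subst (_ [ x ∷ xs ]⇓*_) (Vec.tabulate∘lookup xs) (projections⇓ suc (x ∷ xs)) })

[]ˢ : Sub k 0
[]ˢ = mkSub (λ _ → []) [] (λ _ → [])

infixr 5 _∷ˢ_
_∷ˢ_ : Fn k → Sub k m → Sub k (suc m)
e ∷ˢ s = mkSub (λ xs → fn e xs ∷ fns s xs) (prog e ∷ progs s) (λ xs → sound e xs ∷ sounds s xs)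

comps⇓ : ∀ {gs : Vec (Rec m) n} {hs : Vec (Rec k) m} {xs ys zs} →
         hs [ xs ]⇓* ys → gs [ ys ]⇓* zs → map (λ g → comp g hs) gs [ xs ]⇓* zs
comps⇓ h []       = []
comps⇓ h (d ∷ ds) = comp⇓ h d ∷ comps⇓ h ds

infixr 9 _∘ˢ_
_∘ˢ_ : Sub m n → Sub k m → Sub k n
s ∘ˢ t = mkSub (fns s ∘ fns t) (map (λ g → comp g (progs t)) (progs s))
  (λ xs → comps⇓ (sounds t xs) (sounds s (fns t xs)))

app : Fn m → Sub k m → Fn k
app f s = mkFn (fn f ∘ fns s) (comp (prog f) (progs s)) (λ xs → comp⇓ (sounds s xs) (sound f (fns s xs)))

-- Keeps the program and changes only the function that it is known to compute. This hides encodings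
-- such as `fold` behind the intended function, so that later specifications stay readable.
retarget : (f : Fn k) (g : Vec ℕ k → ℕ) → (∀ xs → fn f xs ≡ g xs) → Fn k
retarget f g e = mkFn g (prog f) (λ xs → subst (prog f [ xs ]⇓_) (e xs) (sound f xs))

var′ : Fin k → Fn k
var′ i = mkFn (λ xs → lookup xs i) (proj i) (λ xs → proj⇓ i)

𝕧 : ∀ i {k} {i<k : True (i <? k)} → Fn k
𝕧 i {k} {i<k} = var′ (#_ i {k} {i<k})

zeroF : Fn k
zeroF = mkFn (λ _ → 0) (comp zeroᶠ []) (λ _ → comp⇓ [] zero⇓)

S : Fn k → Fn k
S e = mkFn (λ xs → suc (fn e xs)) (comp sucᶠ (prog e ∷ [])) (λ xs → comp⇓ (sound e xs ∷ []) suc⇓)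

lit : ℕ → Fn k
lit zero    = zeroF
lit (suc n) = S (lit n)

fold : (Vec ℕ k → ℕ) → (Vec ℕ (2 + k) → ℕ) → ℕ → Vec ℕ k → ℕ
fold f g zero    xs = f xs
fold f g (suc x) xs = g (x ∷ fold f g x xs ∷ xs)

prec : Fn k → Fn (2 + k) → Fn (suc k)
prec f g = mkFn (λ { (x ∷ xs) → fold (fn f) (fn g) x xs }) (prim (prog f) (prog g))
  (λ { (x ∷ xs) → run x xs })
  where
  run : ∀ x xs → prim (prog f) (prog g) [ x ∷ xs ]⇓ fold (fn f) (fn g) x xs
  run zero    xs = prim-zero⇓ (sound f xs)
  run (suc x) xs = prim-suc⇓ (run x xs) (sound g _)

binary : (f : Fn 2) (g : ℕ → ℕ → ℕ) → (∀ x y → fn f (x ∷ y ∷ []) ≡ g x y) → Fn k → Fn k → Fn k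
binary f g e a b = retarget (app f (a ∷ˢ b ∷ˢ []ˢ)) (λ xs → g (fn a xs) (fn b xs)) (λ xs → e _ _)

unary : (f : Fn 1) (g : ℕ → ℕ) → (∀ x → fn f (x ∷ []) ≡ g x) → Fn k → Fn k
unary f g e a = retarget (app f (a ∷ˢ []ˢ)) (λ xs → g (fn a xs)) (λ xs → e _)

infixl 6 _+ᶠ_ _∸ᶠ_
_+ᶠ_ : Fn k → Fn k → Fn k
_+ᶠ_ = binary (prec (𝕧 0) (S (𝕧 1))) _+_ run
  where
  run : ∀ x y → fn (prec (𝕧 0) (S (𝕧 1))) (x ∷ y ∷ []) ≡ x + y
  run zero    y = refl
  run (suc x) y = cong suc (run x y)

predᶠ : Fn k → Fn k
predᶠ = unary (prec zeroF (𝕧 0)) pred (λ { zero → refl ; (suc x) → refl })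

_∸ᶠ_ : Fn k → Fn k → Fn k
a ∸ᶠ b = binary (prec (𝕧 0) (predᶠ (𝕧 1))) (λ y x → x ∸ y) run b a
  where
  run : ∀ y x → fn (prec (𝕧 0) (predᶠ (𝕧 1))) (y ∷ x ∷ []) ≡ x ∸ y
  run zero    x = refl
  run (suc y) x = trans (cong pred (run y x)) (pred[m∸n]≡m∸[1+n] x y)

condᶠ : Fn k → Fn k → Fn k → Fn k
condᶠ c a b = retarget (app (prec (𝕧 1) (𝕧 2)) (c ∷ˢ a ∷ˢ b ∷ˢ []ˢ))
  (λ xs → cond (fn c xs) (fn a xs) (fn b xs)) (λ xs → run (fn c xs) _ _)
  where
  run : ∀ c a b → fn (prec {2} (𝕧 1) (𝕧 2)) (c ∷ a ∷ b ∷ []) ≡ cond c a b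
  run zero    a b = refl
  run (suc c) a b = refl

eqnᶠ : Fn k → Fn k → Fn k
eqnᶠ a b = lit 1 ∸ᶠ ((a ∸ᶠ b) +ᶠ (b ∸ᶠ a))

triangleᶠ : Fn k → Fn k
triangleᶠ = unary (prec zeroF (S (𝕧 0) +ᶠ 𝕧 1)) triangle run
  where
  run : ∀ x → fn (prec zeroF (S (𝕧 0) +ᶠ 𝕧 1)) (x ∷ []) ≡ triangle x
  run zero    = refl
  run (suc x) = cong (suc x +_) (run x)

⟪_,_⟫ : Fn k → Fn k → Fn k
⟪ a , b ⟫ = triangleᶠ (a +ᶠ b) +ᶠ a

diagonalᶠ : Fn k → Fn k
diagonalᶠ = unary (prec zeroF step) diagonal run
  where
  step : Fn 2
  step = condᶠ (eqnᶠ (triangleᶠ (S (𝕧 1))) (S (𝕧 0))) (S (𝕧 1)) (𝕧 1)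
  run : ∀ x → fn (prec zeroF step) (x ∷ []) ≡ diagonal x
  run zero    = refl
  run (suc x) = cong (λ d → cond (eqn (triangle (suc d)) (suc x)) (suc d) d) (run x)

π₁ᶠ π₂ᶠ : Fn k → Fn k
π₁ᶠ a = a ∸ᶠ triangleᶠ (diagonalᶠ a)
π₂ᶠ a = diagonalᶠ a ∸ᶠ π₁ᶠ a

dropsᶠ : Fn k → Fn k → Fn k
dropsᶠ w i = binary (prec (𝕧 0) (π₂ᶠ (predᶠ (𝕧 1)))) (λ i w → drops w i) run i w
  where
  run : ∀ i w → fn (prec (𝕧 0) (π₂ᶠ (predᶠ (𝕧 1)))) (i ∷ w ∷ []) ≡ drops w i
  run zero    w = refl
  run (suc i) w = cong (π₂ ∘ pred) (run i w)

lkᶠ : Fn k → Fn k → Fn k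
lkᶠ w i = π₁ᶠ (predᶠ (dropsᶠ w i))

Indicates : ℕ → Set → Set
Indicates c P = (P × c ≡ 1) ⊎ (¬ P × c ≡ 0)

-- The values are exactly 0 and 1, which lets `condᶠ` and subtraction from 1 act as connectives.
record Dc (k : ℕ) : Set₁ where
  field
    ⟦_⟧ᴰ : Vec ℕ k → Set
    χ    : Fn k
    dec  : ∀ xs → Indicates (fn χ xs) (⟦_⟧ᴰ xs)
open Dc

asᴰ : (D : Dc k) (P : Vec ℕ k → Set) → (∀ xs → ⟦ D ⟧ᴰ xs → P xs) → (∀ xs → P xs → ⟦ D ⟧ᴰ xs) → Dc k
asᴰ D P f g = record { ⟦_⟧ᴰ = P ; χ = χ D ; dec = λ xs → case dec D xs of λ
  { (inj₁ (p , e)) → inj₁ (f xs p , e) ; (inj₂ (p , e)) → inj₂ (p ∘ g xs , e) } }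

subᴰ : Dc m → Sub k m → Dc k
subᴰ D s = record { ⟦_⟧ᴰ = ⟦ D ⟧ᴰ ∘ fns s ; χ = app (χ D) s ; dec = dec D ∘ fns s }

infix 4 _≐ᴰ_ _<ᴰ_
_≐ᴰ_ : Fn k → Fn k → Dc k
a ≐ᴰ b = record { ⟦_⟧ᴰ = λ xs → fn a xs ≡ fn b xs ; χ = eqnᶠ a b ; dec = d }
  where
  d : ∀ xs → Indicates (eqn (fn a xs) (fn b xs)) (fn a xs ≡ fn b xs)
  d xs with fn a xs ≟ fn b xs
  ... | yes e = inj₁ (e , trans (cong (λ z → eqn z (fn b xs)) e) (eqn-≡ (fn b xs)))
  ... | no  e = inj₂ (e , eqn-≢ e)

¬ᴰ_ : Dc k → Dc k
¬ᴰ D = record { ⟦_⟧ᴰ = λ xs → ¬ ⟦ D ⟧ᴰ xs ; χ = lit 1 ∸ᶠ χ D ; dec = d }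
  where
  d : ∀ xs → Indicates (1 ∸ fn (χ D) xs) (¬ ⟦ D ⟧ᴰ xs)
  d xs with dec D xs
  ... | inj₁ (p , e) rewrite e = inj₂ ((λ np → np p) , refl)
  ... | inj₂ (p , e) rewrite e = inj₁ (p , refl)

infixr 3 _∧ᴰ_
infixr 2 _∨ᴰ_
_∧ᴰ_ _∨ᴰ_ : Dc k → Dc k → Dc k
D ∧ᴰ E = record { ⟦_⟧ᴰ = λ xs → ⟦ D ⟧ᴰ xs × ⟦ E ⟧ᴰ xs ; χ = condᶠ (χ D) (χ E) zeroF ; dec = d }
  where
  d : ∀ xs → Indicates (cond (fn (χ D) xs) (fn (χ E) xs) 0) (⟦ D ⟧ᴰ xs × ⟦ E ⟧ᴰ xs)
  d xs with dec D xs
  ... | inj₂ (p , e) rewrite e = inj₂ (p ∘ proj₁ , refl)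
  ... | inj₁ (p , e) rewrite e with dec E xs
  ...   | inj₁ (q , e′) = inj₁ ((p , q) , e′)
  ...   | inj₂ (q , e′) = inj₂ (q ∘ proj₂ , e′)

D ∨ᴰ E = record { ⟦_⟧ᴰ = λ xs → ⟦ D ⟧ᴰ xs ⊎ ⟦ E ⟧ᴰ xs ; χ = condᶠ (χ D) (lit 1) (χ E) ; dec = d }
  where
  d : ∀ xs → Indicates (cond (fn (χ D) xs) 1 (fn (χ E) xs)) (⟦ D ⟧ᴰ xs ⊎ ⟦ E ⟧ᴰ xs)
  d xs with dec D xs
  ... | inj₁ (p , e) rewrite e = inj₁ (inj₁ p , refl)
  ... | inj₂ (p , e) rewrite e with dec E xs
  ...   | inj₁ (q , e′) = inj₁ (inj₂ q , e′)
  ...   | inj₂ (q , e′) = inj₂ ([ p , q ]′ , e′)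

∃<ᴰ ∀<ᴰ : Fn k → Dc (suc k) → Dc k
∃<ᴰ {k} e D = record { ⟦_⟧ᴰ = λ xs → ∃ λ i → i < fn e xs × ⟦ D ⟧ᴰ (i ∷ xs) ; χ = app search (e ∷ˢ idˢ)
                     ; dec = λ xs → d (fn e xs) xs }
  where
  search : Fn (suc k)
  search = prec zeroF (condᶠ (𝕧 1) (lit 1) (app (χ D) (𝕧 0 ∷ˢ (wkˢ ∘ˢ wkˢ))))
  d : ∀ b xs → Indicates (fn search (b ∷ xs)) (∃ λ i → i < b × ⟦ D ⟧ᴰ (i ∷ xs))
  d zero    xs = inj₂ ((λ { (_ , () , _) }) , refl)
  d (suc b) xs with d b xs
  ... | inj₁ ((i , i<b , p) , e) rewrite e = inj₁ ((i , m<n⇒m<1+n i<b , p) , refl)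
  ... | inj₂ (q , e) rewrite e with dec D (b ∷ xs)
  ...   | inj₁ (p , e′) = inj₁ ((b , n<1+n b , p) , e′)
  ...   | inj₂ (p , e′) = inj₂ (none , e′)
    where
    none : ¬ (∃ λ i → i < suc b × ⟦ D ⟧ᴰ (i ∷ xs))
    none (i , s≤s i≤b , r) with m≤n⇒m<n∨m≡n i≤b
    ... | inj₁ i<b  = q (i , i<b , r)
    ... | inj₂ refl = p r

Dc-stable : (D : Dc k) → ∀ xs → ¬ ¬ ⟦ D ⟧ᴰ xs → ⟦ D ⟧ᴰ xs
Dc-stable D xs nn with dec D xs
... | inj₁ (p , _) = p
... | inj₂ (p , _) = ⊥-elim (nn p)

∀<ᴰ e D = asᴰ (¬ᴰ ∃<ᴰ e (¬ᴰ D)) (λ xs → ∀ i → i < fn e xs → ⟦ D ⟧ᴰ (i ∷ xs))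
  (λ xs p i i<e → Dc-stable D (i ∷ xs) (λ q → p (i , i<e , q)))
  (λ { xs p (i , i<e , q) → q (p i i<e) })

_<ᴰ_ : Fn k → Fn k → Dc k
a <ᴰ b = asᴰ (S a ∸ᶠ b ≐ᴰ lit 0) (λ xs → fn a xs < fn b xs) (λ xs → m∸n≡0⇒m≤n) (λ xs → m≤n⇒m∸n≡0)

⊤ᴰ : Dc k
⊤ᴰ = asᴰ (lit 0 ≐ᴰ lit 0) (λ _ → ⊤) (λ _ _ → tt) (λ _ _ → refl)

-- Σ⁰₁ normal form: a decidable kernel whose first variable is the witness. The kernel stays
-- accessible because the final Π⁰₃ matrix is assembled from such kernels.
record Re (k : ℕ) : Set₁ where
  field
    ⟦_⟧ᴿ : Vec ℕ k → Set
    ker  : Dc (suc k)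
    into : ∀ xs → ⟦_⟧ᴿ xs → ∃ λ w → ⟦ ker ⟧ᴰ (w ∷ xs)
    outof : ∀ xs w → ⟦ ker ⟧ᴰ (w ∷ xs) → ⟦_⟧ᴿ xs
open Re

asᴿ : (A : Re k) (P : Vec ℕ k → Set) → (∀ xs → ⟦ A ⟧ᴿ xs → P xs) → (∀ xs → P xs → ⟦ A ⟧ᴿ xs) → Re k
asᴿ A P f g = record { ⟦_⟧ᴿ = P ; ker = ker A ; into = λ xs → into A xs ∘ g xs
                     ; outof = λ xs w → f xs ∘ outof A xs w }

subᴿ : Re m → Sub k m → Re k
subᴿ A s = record { ⟦_⟧ᴿ = ⟦ A ⟧ᴿ ∘ fns s ; ker = subᴰ (ker A) (𝕧 0 ∷ˢ (s ∘ˢ wkˢ))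
                  ; into = into A ∘ fns s ; outof = outof A ∘ fns s }

decᴿ : Dc k → Re k
decᴿ D = record { ⟦_⟧ᴿ = ⟦ D ⟧ᴰ ; ker = subᴰ D wkˢ ; into = λ xs p → 0 , p ; outof = λ xs w p → p }

⊥ᴿ : Re k
⊥ᴿ = asᴿ (decᴿ (¬ᴰ ⊤ᴰ)) (λ _ → ⊥) (λ _ f → f tt) (λ _ ())

infixr 3 _∧ᴿ_
infixr 2 _∨ᴿ_
_∧ᴿ_ _∨ᴿ_ : Re k → Re k → Re k
A ∧ᴿ B = record
  { ⟦_⟧ᴿ = λ xs → ⟦ A ⟧ᴿ xs × ⟦ B ⟧ᴿ xs
  ; ker  = subᴰ (ker A) (π₁ᶠ (𝕧 0) ∷ˢ wkˢ) ∧ᴰ subᴰ (ker B) (π₂ᶠ (𝕧 0) ∷ˢ wkˢ)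
  ; into = λ xs (p , q) → case (into A xs p , into B xs q) of λ
      { ((u , p′) , (v , q′)) → ⟨ u , v ⟩ ,
          subst (λ u → ⟦ ker A ⟧ᴰ (u ∷ xs)) (sym (π₁-pair u v)) p′ ,
          subst (λ v → ⟦ ker B ⟧ᴰ (v ∷ xs)) (sym (π₂-pair u v)) q′ }
  ; outof = λ xs w (p , q) → outof A xs _ p , outof B xs _ q }

A ∨ᴿ B = record
  { ⟦_⟧ᴿ = λ xs → ⟦ A ⟧ᴿ xs ⊎ ⟦ B ⟧ᴿ xs
  ; ker  = ker A ∨ᴰ ker B
  ; into = λ xs → λ
      { (inj₁ p) → case into A xs p of λ { (w , q) → w , inj₁ q }
      ; (inj₂ p) → case into B xs p of λ { (w , q) → w , inj₂ q } }
  ; outof = λ xs w → λ { (inj₁ p) → inj₁ (outof A xs w p) ; (inj₂ p) → inj₂ (outof B xs w p) } }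

∃ᴿ : Re (suc k) → Re k
∃ᴿ A = record
  { ⟦_⟧ᴿ = λ xs → ∃ λ y → ⟦ A ⟧ᴿ (y ∷ xs)
  ; ker  = subᴰ (ker A) (π₂ᶠ (𝕧 0) ∷ˢ π₁ᶠ (𝕧 0) ∷ˢ wkˢ)
  ; into = λ xs (y , p) → case into A _ p of λ
      { (w , q) → ⟨ y , w ⟩ ,
          subst₂ (λ w y → ⟦ ker A ⟧ᴰ (w ∷ y ∷ xs)) (sym (π₂-pair y w)) (sym (π₁-pair y w)) q }
  ; outof = λ xs w p → π₁ w , outof A _ _ p }

-- Collection: finitely many witnesses have a common bound. `∀<ᴿ` takes this bound as its own
-- witness, and `active-infinite` obtains from it a stage at which all candidates up to b are
-- refuted.
collect : (Q : ℕ → ℕ → Set) (b : ℕ) → (∀ i → i < b → ∃ λ w → Q w i) →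
          ∃ λ c → ∀ i → i < b → ∃ λ w → w < c × Q w i
collect Q zero    f = 0 , λ _ ()
collect Q (suc b) f with collect Q b (λ i i<b → f i (m<n⇒m<1+n i<b)) | f b (n<1+n b)
... | c , g | w , q = c ⊔ suc w , h
  where
  h : ∀ i → i < suc b → ∃ λ w′ → w′ < c ⊔ suc w × Q w′ i
  h i (s≤s i≤b) with m≤n⇒m<n∨m≡n i≤b
  ... | inj₂ refl = w , m≤n⊔m c (suc w) , q
  ... | inj₁ i<b with g i i<b
  ...   | w′ , w′<c , q′ = w′ , <-≤-trans w′<c (m≤m⊔n c (suc w)) , q′

∀<ᴿ : Fn k → Re (suc k) → Re k
∀<ᴿ e A = record
  { ⟦_⟧ᴿ = λ xs → ∀ i → i < fn e xs → ⟦ A ⟧ᴿ (i ∷ xs)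
  ; ker  = ∀<ᴰ (app e wkˢ) (∃<ᴰ (𝕧 1) (subᴰ (ker A) (𝕧 0 ∷ˢ 𝕧 1 ∷ˢ (wkˢ ∘ˢ wkˢ ∘ˢ wkˢ))))
  ; into = λ xs p → collect (λ w i → ⟦ ker A ⟧ᴰ (w ∷ i ∷ xs)) (fn e xs) (λ i i<e → into A _ (p i i<e))
  ; outof = λ xs c p i i<e → case p i i<e of λ { (w , _ , q) → outof A _ w q } }


retargetˢ : (s : Sub k m) (g : Vec ℕ k → Vec ℕ m) → (∀ xs → fns s xs ≡ g xs) → Sub k m
retargetˢ s g e = mkSub g (progs s) (λ xs → subst (progs s [ xs ]⇓*_) (e xs) (sounds s xs))

unpack : ∀ j → ℕ → Vec ℕ j
unpack zero    c = []
unpack (suc j) c = π₁ (pred c) ∷ unpack j (π₂ (pred c))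

unpack-vecCode : (v : Vec ℕ j) → unpack j (vecCode v) ≡ v
unpack-vecCode []      = refl
unpack-vecCode (x ∷ v) =
  cong₂ _∷_ (π₁-pair x _) (trans (cong (unpack _) (π₂-pair x _)) (unpack-vecCode v))

unpackˢ : ∀ j → Fn k → Sub k j
unpackˢ {k} j e = retargetˢ (proj₁ (raw j e)) (unpack j ∘ fn e) (proj₂ (raw j e))
  where
  raw : ∀ j (e : Fn k) → Σ (Sub k j) λ s → ∀ xs → fns s xs ≡ unpack j (fn e xs)
  raw zero    e = []ˢ , λ _ → refl
  raw (suc j) e with raw j (π₂ᶠ (predᶠ e))
  ... | s , eq = π₁ᶠ (predᶠ e) ∷ˢ s , λ xs → cong (π₁ (pred (fn e xs)) ∷_) (eq xs)

headᶠ : Sub k (suc m) → Fn k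
headᶠ s = mkFn (head ∘ fns s) (head (progs s)) (λ xs → lemma (sounds s xs))
  where
  lemma : ∀ {gs : Vec (Rec k) (suc m)} {xs ys} → gs [ xs ]⇓* ys → head gs [ xs ]⇓ head ys
  lemma (d ∷ _) = d

tailˢ : Sub k (suc m) → Sub k m
tailˢ s = mkSub (tail ∘ fns s) (tail (progs s)) (λ xs → lemma (sounds s xs))
  where
  lemma : ∀ {gs : Vec (Rec k) (suc m)} {xs ys} → gs [ xs ]⇓* ys → tail gs [ xs ]⇓* tail ys
  lemma (_ ∷ ds) = ds

infix 4 _≐ˢ_
_≐ˢ_ : Sub k m → Sub k m → Dc k
_≐ˢ_ {k} s t = let D , f , g = raw s t in asᴰ D (λ xs → fns s xs ≡ fns t xs) f g
  where
  glue : (u v : Vec ℕ (suc m)) → head u ≡ head v → tail u ≡ tail v → u ≡ v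
  glue (_ ∷ _) (_ ∷ _) refl refl = refl
  empty : (u v : Vec ℕ 0) → u ≡ v
  empty [] [] = refl
  raw : (s t : Sub k m) → Σ (Dc k) λ D →
        (∀ xs → ⟦ D ⟧ᴰ xs → fns s xs ≡ fns t xs) × (∀ xs → fns s xs ≡ fns t xs → ⟦ D ⟧ᴰ xs)
  raw {zero}  s t = ⊤ᴰ , (λ xs _ → empty (fns s xs) (fns t xs)) , (λ _ _ → tt)
  raw {suc m} s t with raw (tailˢ s) (tailˢ t)
  ... | D , f , g = ((headᶠ s ≐ᴰ headᶠ t) ∧ᴰ D) , (λ xs (p , q) → glue _ _ p (f xs q)) ,
                    (λ xs e → cong head e , g xs (cong tail e))

-- Rule systems and the enumerability of what they derive.

Fact : Set
Fact = Vec ℕ 5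

-- A schema: parameters that satisfy the decidable side condition turn derivable premises into a
-- derivable conclusion. The facts consist of a tag and four arguments, padded with 0.
record Rule : Set₁ where
  constructor rule
  field
    params : ℕ
    side   : Dc params
    prems  : List (Sub params 5)
    concl  : Sub params 5
open Rule

module _ (rs : List Rule) where

  nth : Fin (List.length rs) → Rule
  nth = List.lookup rs

  data Der : Fact → Set where
    by : ∀ r (v : Vec ℕ (params (nth r))) → ⟦ side (nth r) ⟧ᴰ v →
         All (λ s → Der (fns s v)) (prems (nth r)) → Der (fns (concl (nth r)) v)

-- Der is enumerable: a derivation is laid out as a sequence of facts, each of
-- which follows by a rule from facts further along the sequence.

fact : ℕ → ℕ → Fact
fact w i = unpack 5 (lk w i)

factˢ : Fn k → Fn k → Sub k 5
factˢ w i = unpackˢ 5 (lkᶠ w i)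

Premise : ℕ → ℕ → ℕ → Fact → Set
Premise w l i c = ∃ λ i′ → i′ < l × i < i′ × fact w i′ ≡ c

Step : (r : Rule) → Vec ℕ (params r) → (Fact → Set) → Fact → Set
Step r v Q c = ⟦ side r ⟧ᴰ v × c ≡ fns (concl r) v × All (λ s → Q (fns s v)) (prems r)

-- The variables are the code of the parameters, the position in the sequence, its length and its
-- code.
stepᴰ : Rule → Dc 4
stepᴰ (rule j sd ps c) = asᴰ
  (subᴰ sd v ∧ᴰ (factˢ (𝕧 3) (𝕧 1) ≐ˢ (c ∘ˢ v)) ∧ᴰ premsᴰ ps) Stepped to′ from′
  where
  v : Sub 4 j
  v = unpackˢ j (𝕧 0)
  premᴰ : Sub j 5 → Dc 4
  premᴰ s = ∃<ᴰ (𝕧 2) (𝕧 2 <ᴰ 𝕧 0 ∧ᴰ (factˢ (𝕧 4) (𝕧 0) ≐ˢ (s ∘ˢ v ∘ˢ wkˢ)))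
  premsᴰ : List (Sub j 5) → Dc 4
  premsᴰ []       = ⊤ᴰ
  premsᴰ (s ∷ ss) = premᴰ s ∧ᴰ premsᴰ ss
  Stepped : Vec ℕ 4 → Set
  Stepped (p ∷ i ∷ l ∷ w ∷ []) = Step (rule j sd ps c) (unpack j p) (Premise w l i) (fact w i)
  allPrems : ∀ ss p i l w → ⟦ premsᴰ ss ⟧ᴰ (p ∷ i ∷ l ∷ w ∷ []) →
             All (λ s → Premise w l i (fns s (unpack j p))) ss
  allPrems []       p i l w _       = []
  allPrems (s ∷ ss) p i l w (q , qs) = q ∷ allPrems ss p i l w qs
  unPrems : ∀ ss p i l w → All (λ s → Premise w l i (fns s (unpack j p))) ss →
            ⟦ premsᴰ ss ⟧ᴰ (p ∷ i ∷ l ∷ w ∷ [])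
  unPrems []       p i l w _        = tt
  unPrems (s ∷ ss) p i l w (q ∷ qs) = q , unPrems ss p i l w qs
  to′ : ∀ xs → _ → Stepped xs
  to′ (p ∷ i ∷ l ∷ w ∷ []) (a , b , q) = a , b , allPrems ps p i l w q
  from′ : ∀ xs → Stepped xs → _
  from′ (p ∷ i ∷ l ∷ w ∷ []) (a , b , q) = a , b , unPrems ps p i l w q

Justified : Rule → ℕ → ℕ → ℕ → Set
Justified r w l i = ∃ λ p → ⟦ stepᴰ r ⟧ᴰ (p ∷ i ∷ l ∷ w ∷ [])

justifiedᴿ : List Rule → Re 3
justifiedᴿ []       = ⊥ᴿ
justifiedᴿ (r ∷ rs) = ∃ᴿ (decᴿ (stepᴰ r)) ∨ᴿ justifiedᴿ rs

justified-to : ∀ rs {i l w} → ⟦ justifiedᴿ rs ⟧ᴿ (i ∷ l ∷ w ∷ []) → ∃ λ r → Justified (nth rs r) w l i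
justified-to (r ∷ rs) (inj₁ q) = zero , q
justified-to (r ∷ rs) (inj₂ q) with justified-to rs q
... | r′ , q′ = suc r′ , q′

justified-from : ∀ rs {i l w} r → Justified (nth rs r) w l i → ⟦ justifiedᴿ rs ⟧ᴿ (i ∷ l ∷ w ∷ [])
justified-from (r ∷ rs) zero     q = inj₁ q
justified-from (r ∷ rs) (suc r′) q = inj₂ (justified-from rs r′ q)

module _ (rs : List Rule) where

  certifiedᴿ : Re 5
  certifiedᴿ = ∃ᴿ (∃ᴿ (∀<ᴿ (𝕧 0) (subᴿ (justifiedᴿ rs) (𝕧 0 ∷ˢ 𝕧 1 ∷ˢ 𝕧 2 ∷ˢ []ˢ)) ∧ᴿ
                     decᴿ (∃<ᴰ (𝕧 0) (factˢ (𝕧 2) (𝕧 0) ≐ˢ (wkˢ ∘ˢ wkˢ ∘ˢ wkˢ)))))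

  certified⇒Der : ∀ c → ⟦ certifiedᴿ ⟧ᴿ c → Der rs c
  certified⇒Der c (w , l , just , i , i<l , refl) = run l i i<l (m≤n+m l i)
    where
    -- The fuel `d` bounds the distance from `i` to the end; it decreases because premises lie
    -- strictly further along.
    run : ∀ d i → i < l → l ≤ i + d → Der rs (fact w i)
    run zero    i i<l l≤ = ⊥-elim (<⇒≱ i<l (subst (l ≤_) (+-identityʳ i) l≤))
    run (suc d) i i<l l≤ with justified-to rs (just i i<l)
    ... | r , p , sd , e , ps = subst (Der rs) (sym e) (by r _ sd (All.map prem ps))
      where
      prem : ∀ {c} → Premise w l i c → Der rs c
      prem (i′ , i′<l , i<i′ , e′) = subst (Der rs) e′
        (run d i′ i′<l (≤-trans l≤ (≤-trans (≤-reflexive (+-suc i d)) (+-monoˡ-≤ d i<i′))))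

  data Valid : List Fact → Set where
    []   : Valid []
    cons : ∀ {c l} r v → Step (nth rs r) v (_∈ l) c → Valid l → Valid (c ∷ l)

  Valid-++ : ∀ {l l′} → Valid l → Valid l′ → Valid (l ++ l′)
  Valid-++ []                            V′ = V′
  Valid-++ (cons r v (sd , e , ps) V) V′ =
    cons r v (sd , e , All.map List.∈-++⁺ˡ ps) (Valid-++ V V′)

  derivation : ∀ {c} → Der rs c → ∃ λ l → Valid l × c ∈ l
  derivations : ∀ {j} {v : Vec ℕ j} {ss} → All (λ s → Der rs (fns s v)) ss →
                ∃ λ l → Valid l × All (λ s → fns s v ∈ l) ss
  derivation (by r v sd ds) with derivations ds
  ... | l , V , ps = _ , cons r v (sd , refl , ps) V , here refl
  derivations []       = [] , [] , []
  derivations (d ∷ ds) with derivation d | derivations ds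
  ... | l , V , p | l′ , V′ , ps =
    l ++ l′ , Valid-++ V V′ , List.∈-++⁺ˡ p ∷ All.map (List.∈-++⁺ʳ l) ps

  layout : List Fact → ℕ
  layout l = listCode (List.map vecCode l)

  fact-here : ∀ c l → fact (layout (c ∷ l)) 0 ≡ c
  fact-here c l = trans (cong (unpack 5) (lk-zero (vecCode c) (layout l))) (unpack-vecCode c)

  fact-there : ∀ c l i → fact (layout (c ∷ l)) (suc i) ≡ fact (layout l) i
  fact-there c l i = cong (unpack 5) (lk-suc (vecCode c) (layout l) i)

  position : ∀ {c l} → c ∈ l → ∃ λ i → i < List.length l × fact (layout l) i ≡ c
  position {l = c ∷ l} (here refl) = 0 , s≤s z≤n , fact-here c l
  position {l = c ∷ l} (there p) with position p
  ... | i , i<l , e = suc i , s≤s i<l , trans (fact-there c l i) e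

  Valid⇒justified : ∀ {l} → Valid l → ∀ i → i < List.length l →
                    ∃ λ r → Justified (nth rs r) (layout l) (List.length l) i
  Valid⇒justified {c ∷ l} (cons r v (sd , e , ps) V) zero _ = r , vecCode v ,
    subst (λ v → Step (nth rs r) v (Premise (layout (c ∷ l)) (suc (List.length l)) 0) (fact (layout (c ∷ l)) 0))
      (sym (unpack-vecCode v)) (sd , trans (fact-here c l) e , All.map prem ps)
    where
    prem : ∀ {d} → d ∈ l → Premise (layout (c ∷ l)) (suc (List.length l)) 0 d
    prem p with position p
    ... | i , i<l , e = suc i , s≤s i<l , s≤s z≤n , trans (fact-there c l i) e
  Valid⇒justified {c ∷ l} (cons _ _ _ V) (suc i) (s≤s i<l) with Valid⇒justified V i i<l
  ... | r , p , sd , e , ps = r , p , sd , trans (fact-there c l i) e , All.map prem ps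
    where
    prem : ∀ {d} → Premise (layout l) (List.length l) i d → Premise (layout (c ∷ l)) (suc (List.length l)) (suc i) d
    prem (i′ , i′<l , i<i′ , e) = suc i′ , s≤s i′<l , s≤s i<i′ , trans (fact-there c l i′) e

  Der⇒certified : ∀ c → Der rs c → ⟦ certifiedᴿ ⟧ᴿ c
  Der⇒certified c d with derivation d
  ... | l , V , p with position p
  ...   | q = layout l , List.length l ,
          (λ i i<l → let r , J = Valid⇒justified V i i<l in justified-from rs r J) , q

  derᴿ : Re 5
  derᴿ = asᴿ certifiedᴿ (Der rs) certified⇒Der Der⇒certified

-- The hypothesis of rule induction: a predicate that is sound for every rule holds of all derivable
-- facts. In each application it interprets the numbers in a fact as codes.
Sound : (Fact → Set) → Rule → Set
Sound G r = ∀ v → ⟦ side r ⟧ᴰ v → All (λ s → G (fns s v)) (prems r) → G (fns (concl r) v)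

module _ {rs : List Rule} {G : Fact → Set} (sounds : All (Sound G) rs) where

  Der-sound  : ∀ {c} → Der rs c → G c
  Der-sounds : ∀ {j} {v : Vec ℕ j} {ss} → All (λ s → Der rs (fns s v)) ss → All (λ s → G (fns s v)) ss
  Der-sound (by r v sd ds) = All.lookup sounds (List.∈-lookup r) v sd (Der-sounds ds)
  Der-sounds []       = []
  Der-sounds (d ∷ ds) = Der-sound d ∷ Der-sounds ds

-- A universal enumerable relation for the evaluation of programs.

consᶠ : Fn k → Fn k → Fn k
consᶠ a w = S ⟪ a , w ⟫

infix 4 _⟵_
_⟵_ : Sub k 5 → List (Sub k 5) → Rule
c ⟵ ps = rule _ ⊤ᴰ ps c

-- Facts about programs: [0, k, e]: e codes a k-ary program;
-- [1, k, m, es]: es codes m such programs; [2, e, xs, y]: e halts on xs with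
-- output y; [3, es, xs, ys]: likewise for a vector of programs;
-- [4, e, xs, y]: on x ∷ xs with x < y, e halts with a nonzero output.
evalRules : List Rule
evalRules =
    (tag {0} 0 (lit 0) (lit 0) (lit 0) ⟵ [])
  ∷ (tag {0} 0 (lit 1) (lit ⟨ 1 , 0 ⟩) (lit 0) ⟵ [])
  ∷ rule 2 (𝕧 0 <ᴰ 𝕧 1) [] (tag 0 (𝕧 1) ⟪ lit 2 , 𝕧 0 ⟫ (lit 0))
  ∷ (tag {4} 0 (𝕧 0) ⟪ lit 3 , ⟪ 𝕧 2 , 𝕧 3 ⟫ ⟫ (lit 0) ⟵
       tag 0 (𝕧 1) (𝕧 2) (lit 0) ∷ tag 1 (𝕧 0) (𝕧 1) (𝕧 3) ∷ [])
  ∷ (tag {3} 0 (S (𝕧 0)) ⟪ lit 4 , ⟪ 𝕧 1 , 𝕧 2 ⟫ ⟫ (lit 0) ⟵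
       tag 0 (𝕧 0) (𝕧 1) (lit 0) ∷ tag 0 (S (S (𝕧 0))) (𝕧 2) (lit 0) ∷ [])
  ∷ (tag {2} 0 (𝕧 0) ⟪ lit 5 , 𝕧 1 ⟫ (lit 0) ⟵ tag 0 (S (𝕧 0)) (𝕧 1) (lit 0) ∷ [])
  ∷ (tag {1} 1 (𝕧 0) (lit 0) (lit 0) ⟵ [])
  ∷ (tag {4} 1 (𝕧 0) (S (𝕧 1)) (consᶠ (𝕧 2) (𝕧 3)) ⟵
       tag 0 (𝕧 0) (𝕧 2) (lit 0) ∷ tag 1 (𝕧 0) (𝕧 1) (𝕧 3) ∷ [])
  ∷ (tag {0} 2 (lit 0) (lit 0) (lit 0) ⟵ [])
  ∷ (tag {1} 2 (lit ⟨ 1 , 0 ⟩) (consᶠ (𝕧 0) (lit 0)) (S (𝕧 0)) ⟵ [])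
  ∷ (tag {2} 2 ⟪ lit 2 , 𝕧 0 ⟫ (𝕧 1) (lkᶠ (𝕧 1) (𝕧 0)) ⟵ [])
  ∷ (tag {5} 2 ⟪ lit 3 , ⟪ 𝕧 0 , 𝕧 1 ⟫ ⟫ (𝕧 2) (𝕧 4) ⟵
       tag 3 (𝕧 1) (𝕧 2) (𝕧 3) ∷ tag 2 (𝕧 0) (𝕧 3) (𝕧 4) ∷ [])
  ∷ (tag {4} 2 ⟪ lit 4 , ⟪ 𝕧 0 , 𝕧 1 ⟫ ⟫ (consᶠ (lit 0) (𝕧 2)) (𝕧 3) ⟵ tag 2 (𝕧 0) (𝕧 2) (𝕧 3) ∷ [])
  ∷ (tag {6} 2 ⟪ lit 4 , ⟪ 𝕧 0 , 𝕧 1 ⟫ ⟫ (consᶠ (S (𝕧 3)) (𝕧 2)) (𝕧 5) ⟵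
       tag 2 ⟪ lit 4 , ⟪ 𝕧 0 , 𝕧 1 ⟫ ⟫ (consᶠ (𝕧 3) (𝕧 2)) (𝕧 4) ∷
       tag 2 (𝕧 1) (consᶠ (𝕧 3) (consᶠ (𝕧 4) (𝕧 2))) (𝕧 5) ∷ [])
  ∷ (tag {3} 2 ⟪ lit 5 , 𝕧 0 ⟫ (𝕧 1) (𝕧 2) ⟵
       tag 4 (𝕧 0) (𝕧 1) (𝕧 2) ∷ tag 2 (𝕧 0) (consᶠ (𝕧 2) (𝕧 1)) (lit 0) ∷ [])
  ∷ (tag {2} 4 (𝕧 0) (𝕧 1) (lit 0) ⟵ [])
  ∷ (tag {4} 4 (𝕧 0) (𝕧 1) (S (𝕧 2)) ⟵
       tag 4 (𝕧 0) (𝕧 1) (𝕧 2) ∷ tag 2 (𝕧 0) (consᶠ (𝕧 2) (𝕧 1)) (S (𝕧 3)) ∷ [])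
  ∷ (tag {1} 3 (lit 0) (𝕧 0) (lit 0) ⟵ [])
  ∷ (tag {5} 3 (consᶠ (𝕧 0) (𝕧 1)) (𝕧 2) (consᶠ (𝕧 3) (𝕧 4)) ⟵
       tag 2 (𝕧 0) (𝕧 2) (𝕧 3) ∷ tag 3 (𝕧 1) (𝕧 2) (𝕧 4) ∷ [])
  ∷ []
  where
  tag : ℕ → Fn k → Fn k → Fn k → Sub k 5
  tag t a b c = lit t ∷ˢ a ∷ˢ b ∷ˢ c ∷ˢ lit 0 ∷ˢ []ˢ

EvalDer : ℕ → ℕ → ℕ → ℕ → Set
EvalDer t a b c = Der evalRules (t ∷ a ∷ b ∷ c ∷ 0 ∷ [])

wellFormed : (f : Rec k) → EvalDer 0 k (code f) 0
wellFormeds : (gs : Vec (Rec k) m) → EvalDer 1 k m (codes gs)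
wellFormed zeroᶠ       = by (# 0) [] tt []
wellFormed sucᶠ        = by (# 1) [] tt []
wellFormed (proj i)    = by (# 2) (toℕ i ∷ _ ∷ []) (Fin.toℕ<n i) []
wellFormed (comp f gs) = by (# 3) (_ ∷ _ ∷ code f ∷ codes gs ∷ []) tt (wellFormed f ∷ wellFormeds gs ∷ [])
wellFormed (prim f g)  = by (# 4) (_ ∷ code f ∷ code g ∷ []) tt (wellFormed f ∷ wellFormed g ∷ [])
wellFormed (μ f)       = by (# 5) (_ ∷ code f ∷ []) tt (wellFormed f ∷ [])
wellFormeds []       = by (# 6) (_ ∷ []) tt []
wellFormeds (g ∷ gs) = by (# 7) (_ ∷ _ ∷ code g ∷ codes gs ∷ []) tt (wellFormed g ∷ wellFormeds gs ∷ [])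

evaluate  : ∀ {f : Rec k} {xs y} → f [ xs ]⇓ y → EvalDer 2 (code f) (vecCode xs) y
evaluates : ∀ {gs : Vec (Rec k) m} {xs ys} → gs [ xs ]⇓* ys → EvalDer 3 (codes gs) (vecCode xs) (vecCode ys)
below     : ∀ {f : Rec (suc k)} {xs} y → (∀ x → x < y → ∃ λ z → f [ x ∷ xs ]⇓ suc z) →
            EvalDer 4 (code f) (vecCode xs) y
evaluateNonzero : ∀ {f : Rec k} {xs} (p : ∃ λ z → f [ xs ]⇓ suc z) → EvalDer 2 (code f) (vecCode xs) (suc (proj₁ p))
evaluate zero⇓         = by (# 8) [] tt []
evaluate (suc⇓ {x})    = by (# 9) (x ∷ []) tt []
evaluate (proj⇓ {xs = xs} i) = subst (EvalDer 2 (code (proj i)) (vecCode xs)) (lk-vecCode xs i)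
  (by (# 10) (toℕ i ∷ vecCode xs ∷ []) tt [])
evaluate (comp⇓ {f = f} {gs} {xs} {ys} {z} ds d) = let D = evaluates ds ; E = evaluate d in
  by (# 11) (code f ∷ codes gs ∷ vecCode xs ∷ vecCode ys ∷ z ∷ []) tt (D ∷ E ∷ [])
evaluate (prim-zero⇓ {f = f} {g} {xs} {y} d) = let D = evaluate d in
  by (# 12) (code f ∷ code g ∷ vecCode xs ∷ y ∷ []) tt (D ∷ [])
evaluate (prim-suc⇓ {f = f} {g} {xs} {x} {y} {z} d e) = let D = evaluate d ; E = evaluate e in
  by (# 13) (code f ∷ code g ∷ vecCode xs ∷ x ∷ y ∷ z ∷ []) tt (D ∷ E ∷ [])
evaluate (μ⇓ {f = f} {xs} {y} h d) = let D = below y h ; E = evaluate d in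
  by (# 14) (code f ∷ vecCode xs ∷ y ∷ []) tt (D ∷ E ∷ [])
evaluates {xs = xs} []                  = by (# 17) (vecCode xs ∷ []) tt []
evaluates (_∷_ {g = g} {gs} {xs} {y} {ys} d ds) = let D = evaluate d ; E = evaluates ds in
  by (# 18) (code g ∷ codes gs ∷ vecCode xs ∷ y ∷ vecCode ys ∷ []) tt (D ∷ E ∷ [])
below {f = f} {xs} zero    h = by (# 15) (code f ∷ vecCode xs ∷ []) tt []
below {f = f} {xs} (suc y) h =
  let D = below y (λ x x<y → h x (m<n⇒m<1+n x<y)) ; E = evaluateNonzero (h y (n<1+n y)) in
  by (# 16) (code f ∷ vecCode xs ∷ y ∷ proj₁ (h y (n<1+n y)) ∷ []) tt (D ∷ E ∷ [])
evaluateNonzero (z , d) = evaluate d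

-- Pairing is a function, so an equation between codes cannot be split by matching. The view turns
-- `code f ≡ ⟨ t , u ⟩` into the shape of `f` and an equation for its body.
data RecView : Rec k → ℕ → ℕ → Set where
  zeroⱽ : ∀ {u} → RecView zeroᶠ 0 u
  sucⱽ  : ∀ {u} → RecView sucᶠ 1 u
  projⱽ : ∀ {k u} (i : Fin k) → toℕ i ≡ u → RecView (proj i) 2 u
  compⱽ : ∀ {u} (f : Rec m) (gs : Vec (Rec k) m) → ⟨ code f , codes gs ⟩ ≡ u → RecView (comp f gs) 3 u
  primⱽ : ∀ {u} (f : Rec k) g → ⟨ code f , code g ⟩ ≡ u → RecView (prim f g) 4 u
  μⱽ    : ∀ {u} (f : Rec (suc k)) → code f ≡ u → RecView (μ f) 5 u

recView : (f : Rec k) → ∀ t u → code f ≡ ⟨ t , u ⟩ → RecView f t u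
recView f t u e = split f (pair-injective (tag f) (body f) t u (trans (sym (code-split f)) e))
  where
  tag body : Rec k → ℕ
  tag zeroᶠ      = 0
  tag sucᶠ       = 1
  tag (proj _)   = 2
  tag (comp _ _) = 3
  tag (prim _ _) = 4
  tag (μ _)      = 5
  body zeroᶠ       = 0
  body sucᶠ        = 0
  body (proj i)    = toℕ i
  body (comp f gs) = ⟨ code f , codes gs ⟩
  body (prim f g)  = ⟨ code f , code g ⟩
  body (μ f)       = code f
  code-split : (f : Rec k) → code f ≡ ⟨ tag f , body f ⟩
  code-split zeroᶠ      = refl
  code-split sucᶠ       = refl
  code-split (proj _)   = refl
  code-split (comp _ _) = refl
  code-split (prim _ _) = refl
  code-split (μ _)      = refl
  split : ∀ {t u} (f : Rec k) → tag f ≡ t × body f ≡ u → RecView f t u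
  split zeroᶠ       (refl , q) = zeroⱽ
  split sucᶠ        (refl , q) = sucⱽ
  split (proj i)    (refl , q) = projⱽ i q
  split (comp f gs) (refl , q) = compⱽ f gs q
  split (prim f g)  (refl , q) = primⱽ f g q
  split (μ f)       (refl , q) = μⱽ f q

-- A code does not determine the arity of its program. Tags 2 to 4 therefore speak of every program
-- and input with the given codes, while tags 0 and 1 assert that programs of the given arity exist.
EvalGood : Fact → Set
EvalGood (0 ∷ k ∷ e ∷ _)      = ∃ λ (f : Rec k) → code f ≡ e
EvalGood (1 ∷ k ∷ m ∷ es ∷ _) = ∃ λ (gs : Vec (Rec k) m) → codes gs ≡ es
EvalGood (2 ∷ e ∷ w ∷ y ∷ _)  = ∀ {k} (f : Rec k) xs → code f ≡ e → vecCode xs ≡ w → f [ xs ]⇓ y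
EvalGood (3 ∷ e ∷ w ∷ y ∷ _)  = ∀ {k m} (gs : Vec (Rec k) m) xs → codes gs ≡ e → vecCode xs ≡ w →
                                ∃ λ ys → vecCode ys ≡ y × gs [ xs ]⇓* ys
EvalGood (4 ∷ e ∷ w ∷ y ∷ _)  = ∀ {k} (f : Rec (suc k)) xs → code f ≡ e → vecCode xs ≡ w →
                                ∀ x → x < y → ∃ λ z → f [ x ∷ xs ]⇓ suc z
EvalGood _ = ⊤

private
  Evaluates : ℕ → ℕ → ℕ → Set
  Evaluates e w y = ∀ {k} (f : Rec k) xs → code f ≡ e → vecCode xs ≡ w → f [ xs ]⇓ y

  EvaluateAll : ℕ → ℕ → ℕ → Set
  EvaluateAll e w y = ∀ {k m} (gs : Vec (Rec k) m) xs → codes gs ≡ e → vecCode xs ≡ w →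
                      ∃ λ ys → vecCode ys ≡ y × gs [ xs ]⇓* ys

  NonzeroBelow : ℕ → ℕ → ℕ → Set
  NonzeroBelow e w y = ∀ {k} (f : Rec (suc k)) xs → code f ≡ e → vecCode xs ≡ w →
                       ∀ x → x < y → ∃ λ z → f [ x ∷ xs ]⇓ suc z

  evZero : ∀ {f : Rec k} {u xs} → RecView f 0 u → f [ xs ]⇓ 0
  evZero {xs = []} zeroⱽ = zero⇓

  evSuc : ∀ {x u} {f : Rec k} {xs} → RecView f 1 u → vecCode xs ≡ suc ⟨ x , 0 ⟩ → f [ xs ]⇓ suc x
  evSuc {x = x} {xs = x′ ∷ []} sucⱽ e =
    subst (λ y → sucᶠ [ x′ ∷ [] ]⇓ suc y) (proj₁ (cons-injective x′ 0 x 0 e)) suc⇓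

  evProj : ∀ {i w} {f : Rec k} {xs} → RecView f 2 i → vecCode xs ≡ w → f [ xs ]⇓ lk w i
  evProj {xs = xs} (projⱽ i refl) refl = subst (proj i [ xs ]⇓_) (sym (lk-vecCode xs i)) (proj⇓ i)

  evComp : ∀ {w a b ys z u} {f : Rec k} {xs} → EvaluateAll b w ys → Evaluates a ys z → RecView f 3 u →
           u ≡ ⟨ a , b ⟩ → vecCode xs ≡ w → f [ xs ]⇓ z
  evComp {a = a} {b} {xs = xs} p q (compⱽ g hs r) s e = run (pair-injective (code g) (codes hs) a b (trans r s))
    where
    run : code g ≡ a × codes hs ≡ b → _
    run (a≡ , b≡) with ys , c , ds ← p hs xs b≡ e = comp⇓ ds (q g ys a≡ c)

  evPrimZero : ∀ {a b w y u} {f : Rec k} {xs} → Evaluates a w y → RecView f 4 u →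
               u ≡ ⟨ a , b ⟩ → vecCode xs ≡ suc ⟨ 0 , w ⟩ → f [ xs ]⇓ y
  evPrimZero {a = a} {b} {w} {y} {xs = x ∷ xs} p (primⱽ g h r) s e =
    run (pair-injective (code g) (code h) a b (trans r s)) (cons-injective x (vecCode xs) 0 w e)
    where
    run : code g ≡ a × code h ≡ b → x ≡ 0 × vecCode xs ≡ w → prim g h [ x ∷ xs ]⇓ y
    run (a≡ , b≡) (refl , w≡) = prim-zero⇓ (p g xs a≡ w≡)

  evPrimSuc : ∀ {a b w x y z u} {f : Rec k} {xs} → Evaluates u (suc ⟨ x , w ⟩) y →
              Evaluates b (suc ⟨ x , suc ⟨ y , w ⟩ ⟩) z → code f ≡ u → RecView f 4 ⟨ a , b ⟩ →
              vecCode xs ≡ suc ⟨ suc x , w ⟩ → f [ xs ]⇓ z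
  evPrimSuc {a = a} {b} {w} {x} {y} {z} {u} {xs = x′ ∷ xs} p q c (primⱽ g h r) e =
    run (pair-injective (code g) (code h) a b r) (cons-injective x′ (vecCode xs) (suc x) w e)
    where
    run : code g ≡ a × code h ≡ b → x′ ≡ suc x × vecCode xs ≡ w → prim g h [ x′ ∷ xs ]⇓ z
    run (a≡ , b≡) (refl , w≡) = prim-suc⇓ (p (prim g h) (x ∷ xs) c (cong (λ w → suc ⟨ x , w ⟩) w≡))
      (q h (x ∷ y ∷ xs) b≡ (cong (λ w → suc ⟨ x , suc ⟨ y , w ⟩ ⟩) w≡))

  evMu : ∀ {a w y} {f : Rec k} {xs} → NonzeroBelow a w y → Evaluates a (suc ⟨ y , w ⟩) 0 → RecView f 5 a →
         vecCode xs ≡ w → f [ xs ]⇓ y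
  evMu {y = y} {xs = xs} p q (μⱽ g r) e = μ⇓ (p g xs r e) (q g (y ∷ xs) r (cong (λ w → suc ⟨ y , w ⟩) e))

  evBelow : ∀ {a w y z} → NonzeroBelow a w y → Evaluates a (suc ⟨ y , w ⟩) (suc z) → NonzeroBelow a w (suc y)
  evBelow {y = y} {z} p q f xs e e′ x (s≤s x≤y) with m≤n⇒m<n∨m≡n x≤y
  ... | inj₁ x<y  = p f xs e e′ x x<y
  ... | inj₂ refl = z , q f (x ∷ xs) e (cong (λ w → suc ⟨ x , w ⟩) e′)

  evNil : ∀ {w} → EvaluateAll 0 w 0
  evNil [] xs e e′ = [] , refl , []

  evCons : ∀ {a b w y ys} → Evaluates a w y → EvaluateAll b w ys →
           EvaluateAll (suc ⟨ a , b ⟩) w (suc ⟨ y , ys ⟩)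
  evCons {a} {b} {w} {y} {ys} p q (g ∷ gs) xs e e′ = run (cons-injective (code g) (codes gs) a b e)
    where
    run : code g ≡ a × codes gs ≡ b → ∃ λ zs → vecCode zs ≡ suc ⟨ y , ys ⟩ × (g ∷ gs) [ xs ]⇓* zs
    run (a≡ , b≡) with zs , c , ds ← q gs xs b≡ e′ = y ∷ zs , cong (λ w → suc ⟨ y , w ⟩) c , p g xs a≡ e′ ∷ ds

evalSound : All (Sound EvalGood) evalRules
evalSound =
    (λ { [] _ _ → zeroᶠ , refl })
  ∷ (λ { [] _ _ → sucᶠ , refl })
  ∷ (λ { (i ∷ k ∷ []) i<k _ → proj (fromℕ< i<k) , cong ⟨ 2 ,_⟩ (Fin.toℕ-fromℕ< i<k) })
  ∷ (λ { (k ∷ m ∷ _ ∷ _ ∷ []) _ ((f , refl) ∷ (gs , refl) ∷ []) → comp f gs , refl })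
  ∷ (λ { (k ∷ _ ∷ _ ∷ []) _ ((f , refl) ∷ (g , refl) ∷ []) → prim f g , refl })
  ∷ (λ { (k ∷ _ ∷ []) _ ((f , refl) ∷ []) → μ f , refl })
  ∷ (λ { (k ∷ []) _ _ → [] , refl })
  ∷ (λ { (k ∷ m ∷ _ ∷ _ ∷ []) _ ((g , refl) ∷ (gs , refl) ∷ []) → g ∷ gs , refl })
  ∷ (λ { [] _ _ f xs e e′ → evZero (recView f 0 0 e) })
  ∷ (λ { (x ∷ []) _ _ f xs e e′ → evSuc {x = x} (recView f 1 0 e) e′ })
  ∷ (λ { (i ∷ w ∷ []) _ _ f xs e e′ → evProj {i = i} {w} (recView f 2 i e) e′ })
  ∷ (λ { (a ∷ b ∷ w ∷ ys ∷ z ∷ []) _ (p ∷ q ∷ []) f xs e e′ →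
         evComp {w = w} {a} {b} {ys} {z} p q (recView f 3 ⟨ a , b ⟩ e) refl e′ })
  ∷ (λ { (a ∷ b ∷ w ∷ y ∷ []) _ (p ∷ []) f xs e e′ →
         evPrimZero {a = a} {b} {w} {y} p (recView f 4 ⟨ a , b ⟩ e) refl e′ })
  ∷ (λ { (a ∷ b ∷ w ∷ x ∷ y ∷ z ∷ []) _ (p ∷ q ∷ []) f xs e e′ →
         evPrimSuc {a = a} {b} {w} {x} {y} {z} p q e (recView f 4 ⟨ a , b ⟩ e) e′ })
  ∷ (λ { (a ∷ w ∷ y ∷ []) _ (p ∷ q ∷ []) f xs e e′ → evMu {a = a} {w} {y} p q (recView f 5 a e) e′ })
  ∷ (λ { (a ∷ w ∷ []) _ _ f xs e e′ x () })
  ∷ (λ { (a ∷ w ∷ y ∷ z ∷ []) _ (p ∷ q ∷ []) → evBelow {a} {w} {y} {z} p q })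
  ∷ (λ { (w ∷ []) _ _ → evNil {w} })
  ∷ (λ { (a ∷ b ∷ w ∷ y ∷ ys ∷ []) _ (p ∷ q ∷ []) → evCons {a} {b} {w} {y} {ys} p q })
  ∷ []

-- The analogue of Kleene's T predicate. The first conjunct supplies a unary program with code e, to
-- which the second, a statement about all programs with that code, is applied.
universalᴿ : Re 3
universalᴿ = asᴿ
  (subᴿ (derᴿ evalRules) (lit 0 ∷ˢ lit 1 ∷ˢ 𝕧 0 ∷ˢ lit 0 ∷ˢ lit 0 ∷ˢ []ˢ) ∧ᴿ
   subᴿ (derᴿ evalRules) (lit 2 ∷ˢ 𝕧 0 ∷ˢ consᶠ (𝕧 1) (lit 0) ∷ˢ 𝕧 2 ∷ˢ lit 0 ∷ˢ []ˢ))
  (λ { (e ∷ x ∷ y ∷ []) → φ e x y })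
  (λ { (e ∷ x ∷ y ∷ []) (p , q) → case Der-sound {G = EvalGood} evalSound p of λ
         { (f , c) → f , c , Der-sound {G = EvalGood} evalSound q f (x ∷ []) c refl } })
  (λ { (e ∷ x ∷ y ∷ []) (f , refl , d) → wellFormed f , evaluate d })

deterministic  : ∀ {f : Rec k} {xs y y′} → f [ xs ]⇓ y → f [ xs ]⇓ y′ → y ≡ y′
deterministics : ∀ {gs : Vec (Rec k) m} {xs ys ys′} → gs [ xs ]⇓* ys → gs [ xs ]⇓* ys′ → ys ≡ ys′
deterministic zero⇓ zero⇓ = refl
deterministic suc⇓ suc⇓ = refl
deterministic (proj⇓ i) (proj⇓ .i) = refl
deterministic (comp⇓ ds d) (comp⇓ ds′ d′) with refl ← deterministics ds ds′ = deterministic d d′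
deterministic (prim-zero⇓ d) (prim-zero⇓ d′) = deterministic d d′
deterministic (prim-suc⇓ d e) (prim-suc⇓ d′ e′) with refl ← deterministic d d′ = deterministic e e′
deterministic (μ⇓ {y = y} h d) (μ⇓ {y = y′} h′ d′) with <-cmp y y′
... | tri≈ _ refl _ = refl
... | tri< y<y′ _ _ with z , d″ ← h′ y y<y′ with () ← deterministic d d″
... | tri> _ _ y′<y with z , d″ ← h y′ y′<y with () ← deterministic d″ d′
deterministics [] [] = refl
deterministics (d ∷ ds) (d′ ∷ ds′) with refl ← deterministic d d′ | refl ← deterministics ds ds′ = refl

-- Programs with the same code agree, without appeal to injectivity of `code`: a run of one becomes
-- a derivation, which mentions only the code, and is read back as a run of the other.
φ-transport : ∀ {f : Rec 1} {x y} → φ (code f) x y → f [ x ∷ [] ]⇓ y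
φ-transport {f} {x} (g , c , d) =
  Der-sound {G = EvalGood} evalSound (subst (λ e → EvalDer 2 e (vecCode (x ∷ [])) _) c (evaluate d)) f (x ∷ []) refl refl

φ-deterministic : ∀ {e x y y′} → φ e x y → φ e x y′ → y ≡ y′
φ-deterministic (f , refl , d) q = deterministic d (φ-transport q)

-- Syntax of the language of graphs and arithmetised provability.

module _ {L : FiniteLanguage} where

  substTerm-cong  : {σ τ : Fin m → Term L n} → (∀ i → σ i ≡ τ i) → ∀ t → substTerm σ t ≡ substTerm τ t
  substTerms-cong : {σ τ : Fin m → Term L n} → (∀ i → σ i ≡ τ i) → (ts : Vec (Term L m) k) →
                    substTerms σ ts ≡ substTerms τ ts
  substTerm-cong e (var i)    = e i
  substTerm-cong e (fun f ts) = cong (fun f) (substTerms-cong e ts)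
  substTerms-cong e []       = refl
  substTerms-cong e (t ∷ ts) = cong₂ _∷_ (substTerm-cong e t) (substTerms-cong e ts)

  substFormula-cong : {σ τ : Fin m → Term L n} → (∀ i → σ i ≡ τ i) → ∀ A → substFormula σ A ≡ substFormula τ A
  substFormula-cong e ⊥̇          = refl
  substFormula-cong e (s ≐ t)    = cong₂ _≐_ (substTerm-cong e s) (substTerm-cong e t)
  substFormula-cong e (rel r ts) = cong (rel r) (substTerms-cong e ts)
  substFormula-cong e (A ⇒ B)    = cong₂ _⇒_ (substFormula-cong e A) (substFormula-cong e B)
  substFormula-cong e (all A)    = cong all (substFormula-cong (λ { zero → refl ; (suc i) → cong (renameTerm suc) (e i) }) A)

  ⊢-weaken : ∀ {Γ Δ : List (Formula L n)} {A} → Γ ⊆ Δ → Γ ⊢ A → Δ ⊢ A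
  ⊢-weaken s (hyp p)        = hyp (s p)
  ⊢-weaken s (⇒I d)         = ⇒I (⊢-weaken (λ { (here e) → here e ; (there p) → there (s p) }) d)
  ⊢-weaken s (⇒E d e)       = ⇒E (⊢-weaken s d) (⊢-weaken s e)
  ⊢-weaken s (raa d)        = raa (⊢-weaken (λ { (here e) → here e ; (there p) → there (s p) }) d)
  ⊢-weaken s (∀I d)         = ∀I (⊢-weaken (⊆-map s) d)
    where
    ⊆-map : ∀ {Γ Δ : List (Formula L n)} → Γ ⊆ Δ → List.map weaken Γ ⊆ List.map weaken Δ
    ⊆-map s p with _ , q , refl ← List.∈-map⁻ weaken p = List.∈-map⁺ weaken (s q)
  ⊢-weaken s (∀E d t)       = ∀E (⊢-weaken s d) t
  ⊢-weaken s ≐I             = ≐I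
  ⊢-weaken s (≐E A d e)     = ≐E A (⊢-weaken s d) (⊢-weaken s e)
  ⊢-weaken s (nonempty d)   = nonempty (⊢-weaken (⊆-map s) d)
    where
    ⊆-map : ∀ {Γ Δ : List (Formula L n)} → Γ ⊆ Δ → List.map weaken Γ ⊆ List.map weaken Δ
    ⊆-map s p with _ , q , refl ← List.∈-map⁻ weaken p = List.∈-map⁺ weaken (s q)

𝓖 : FiniteLanguage
𝓖 = record { #fun = 0 ; funArity = λ () ; #rel = 1 ; relArity = λ _ → 2 }

edge : Fin n → Fin n → Formula 𝓖 n
edge i j = rel zero (var i ∷ var j ∷ [])

-- Without function symbols every term is a variable. Inductions go through this eliminator so that
-- the impossible terms are discharged once.
formulaElim : ∀ {ℓ} (P : ∀ {n} → Formula 𝓖 n → Set ℓ) →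
  (∀ {n} → P {n} ⊥̇) →
  (∀ {n} (i j : Fin n) → P (var i ≐ var j)) →
  (∀ {n} (i j : Fin n) → P (edge i j)) →
  (∀ {n} {A B : Formula 𝓖 n} → P A → P B → P (A ⇒ B)) →
  (∀ {n} {A : Formula 𝓖 (suc n)} → P A → P (all A)) →
  ∀ {n} (A : Formula 𝓖 n) → P A
formulaElim P b e r i a ⊥̇ = b
formulaElim P b e r i a (var x ≐ var y) = e x y
formulaElim P b e r i a (fun () _ ≐ _)
formulaElim P b e r i a (var _ ≐ fun () _)
formulaElim P b e r i a (rel zero (var x ∷ var y ∷ [])) = r x y
formulaElim P b e r i a (rel zero (fun () _ ∷ _))
formulaElim P b e r i a (rel zero (var _ ∷ fun () _ ∷ []))
formulaElim P b e r i a (A ⇒ B) = i (formulaElim P b e r i a A) (formulaElim P b e r i a B)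
formulaElim P b e r i a (all A) = a (formulaElim P b e r i a A)

ren : (Fin m → Fin n) → Formula 𝓖 m → Formula 𝓖 n
ren f = substFormula (var ∘ f)

liftᶠ : (Fin m → Fin n) → Fin (suc m) → Fin (suc n)
liftᶠ f zero    = zero
liftᶠ f (suc i) = suc (f i)

ren-all : (f : Fin m → Fin n) (A : Formula 𝓖 (suc m)) → ren f (all A) ≡ all (ren (liftᶠ f) A)
ren-all f A = cong all (substFormula-cong (λ { zero → refl ; (suc i) → refl }) A)

inst : Fin n → Fin (suc n) → Fin n
inst j zero    = j
inst j (suc i) = i

[]-ren : (A : Formula 𝓖 (suc n)) (j : Fin n) → A [ var j ] ≡ ren (inst j) A
[]-ren A j = substFormula-cong (λ { zero → refl ; (suc i) → refl }) A

eqCode edgeCode impCode : ℕ → ℕ → ℕ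
eqCode i j   = ⟨ 1 , ⟨ ⟨ 0 , i ⟩ , ⟨ 0 , j ⟩ ⟩ ⟩
edgeCode i j = ⟨ 2 , ⟨ 0 , suc ⟨ ⟨ 0 , i ⟩ , suc ⟨ ⟨ 0 , j ⟩ , 0 ⟩ ⟩ ⟩ ⟩
impCode a b  = ⟨ 3 , ⟨ a , b ⟩ ⟩

data FormulaView : Formula 𝓖 n → ℕ → ℕ → Set where
  ⊥ⱽ    : ∀ {n u} → FormulaView {n} ⊥̇ 0 u
  ≐ⱽ    : ∀ {u} (i j : Fin n) → ⟨ ⟨ 0 , toℕ i ⟩ , ⟨ 0 , toℕ j ⟩ ⟩ ≡ u → FormulaView (var i ≐ var j) 1 u
  edgeⱽ : ∀ {u} (i j : Fin n) → ⟨ 0 , suc ⟨ ⟨ 0 , toℕ i ⟩ , suc ⟨ ⟨ 0 , toℕ j ⟩ , 0 ⟩ ⟩ ⟩ ≡ u →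
          FormulaView (edge i j) 2 u
  ⇒ⱽ    : ∀ {u} (A B : Formula 𝓖 n) → ⟨ gödel A , gödel B ⟩ ≡ u → FormulaView (A ⇒ B) 3 u
  allⱽ  : ∀ {u} (A : Formula 𝓖 (suc n)) → gödel A ≡ u → FormulaView (all A) 4 u

formulaView : (A : Formula 𝓖 n) → ∀ t u → gödel A ≡ ⟨ t , u ⟩ → FormulaView A t u
formulaView A t u e =
  let t′ , u′ , e′ , f = split A in f (pair-injective t′ u′ t u (trans (sym e′) e))
  where
  split : (A : Formula 𝓖 n) → ∃₂ λ t′ u′ → gödel A ≡ ⟨ t′ , u′ ⟩ ×
          (∀ {t u} → t′ ≡ t × u′ ≡ u → FormulaView A t u)
  split = formulaElim (λ A → ∃₂ λ t′ u′ → gödel A ≡ ⟨ t′ , u′ ⟩ × (∀ {t u} → t′ ≡ t × u′ ≡ u → FormulaView A t u))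
    (0 , 0 , refl , λ { (refl , q) → ⊥ⱽ })
    (λ i j → 1 , _ , refl , λ { (refl , q) → ≐ⱽ i j q })
    (λ i j → 2 , _ , refl , λ { (refl , q) → edgeⱽ i j q })
    (λ {_} {A} {B} _ _ → 3 , _ , refl , λ { (refl , q) → ⇒ⱽ A B q })
    (λ {_} {A} _ → 4 , _ , refl , λ { (refl , q) → allⱽ A q })

eqBody-injective : ∀ i j i′ j′ → ⟨ ⟨ 0 , i ⟩ , ⟨ 0 , j ⟩ ⟩ ≡ ⟨ ⟨ 0 , i′ ⟩ , ⟨ 0 , j′ ⟩ ⟩ → i ≡ i′ × j ≡ j′
eqBody-injective i j i′ j′ e =
  let p , q = pair-injective ⟨ 0 , i ⟩ ⟨ 0 , j ⟩ ⟨ 0 , i′ ⟩ ⟨ 0 , j′ ⟩ e in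
  proj₂ (pair-injective 0 i 0 i′ p) , proj₂ (pair-injective 0 j 0 j′ q)

edgeBody-injective : ∀ i j i′ j′ →
  ⟨ 0 , suc ⟨ ⟨ 0 , i ⟩ , suc ⟨ ⟨ 0 , j ⟩ , 0 ⟩ ⟩ ⟩ ≡ ⟨ 0 , suc ⟨ ⟨ 0 , i′ ⟩ , suc ⟨ ⟨ 0 , j′ ⟩ , 0 ⟩ ⟩ ⟩ →
  i ≡ i′ × j ≡ j′
edgeBody-injective i j i′ j′ e =
  let p = proj₂ (pair-injective 0 (suc ⟨ ⟨ 0 , i ⟩ , suc ⟨ ⟨ 0 , j ⟩ , 0 ⟩ ⟩) 0 (suc ⟨ ⟨ 0 , i′ ⟩ , suc ⟨ ⟨ 0 , j′ ⟩ , 0 ⟩ ⟩) e)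
      q , r = cons-injective ⟨ 0 , i ⟩ (suc ⟨ ⟨ 0 , j ⟩ , 0 ⟩) ⟨ 0 , i′ ⟩ (suc ⟨ ⟨ 0 , j′ ⟩ , 0 ⟩) p
      s , _ = cons-injective ⟨ 0 , j ⟩ 0 ⟨ 0 , j′ ⟩ 0 r in
  proj₂ (pair-injective 0 i 0 i′ q) , proj₂ (pair-injective 0 j 0 j′ s)

gödel-injective : (A B : Formula 𝓖 n) → gödel A ≡ gödel B → A ≡ B
gödel-injective = formulaElim (λ A → ∀ B → gödel A ≡ gödel B → A ≡ B)
  (λ B e → bot (formulaView B 0 0 (sym e)))
  (λ i j B e → equ i j (formulaView B 1 _ (sym e)) refl)
  (λ i j B e → edg i j (formulaView B 2 _ (sym e)) refl)
  (λ {_} {A} {B} p q C e → imp p q (formulaView C 3 ⟨ gödel A , gödel B ⟩ (sym e)) refl)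
  (λ {_} {A} p C e → univ p (formulaView C 4 (gödel A) (sym e)))
  where
  bot : ∀ {n} {B : Formula 𝓖 n} → FormulaView B 0 0 → ⊥̇ ≡ B
  bot ⊥ⱽ = refl
  equ : ∀ (i j : Fin n) {B u} → FormulaView B 1 u → u ≡ ⟨ ⟨ 0 , toℕ i ⟩ , ⟨ 0 , toℕ j ⟩ ⟩ → (var i ≐ var j) ≡ B
  equ i j (≐ⱽ i′ j′ e) r = let p , q = eqBody-injective (toℕ i′) (toℕ j′) (toℕ i) (toℕ j) (trans e r) in
    cong₂ (λ i j → var i ≐ var j) (Fin.toℕ-injective (sym p)) (Fin.toℕ-injective (sym q))
  edg : ∀ (i j : Fin n) {B u} → FormulaView B 2 u →
        u ≡ ⟨ 0 , suc ⟨ ⟨ 0 , toℕ i ⟩ , suc ⟨ ⟨ 0 , toℕ j ⟩ , 0 ⟩ ⟩ ⟩ → edge i j ≡ B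
  edg i j (edgeⱽ i′ j′ e) r = let p , q = edgeBody-injective (toℕ i′) (toℕ j′) (toℕ i) (toℕ j) (trans e r) in
    cong₂ edge (Fin.toℕ-injective (sym p)) (Fin.toℕ-injective (sym q))
  imp : ∀ {A B C : Formula 𝓖 n} {u} → (∀ A′ → gödel A ≡ gödel A′ → A ≡ A′) → (∀ B′ → gödel B ≡ gödel B′ → B ≡ B′) →
        FormulaView C 3 u → u ≡ ⟨ gödel A , gödel B ⟩ → (A ⇒ B) ≡ C
  imp {A = A} {B} p q (⇒ⱽ A′ B′ e) r = let s , t = pair-injective (gödel A′) (gödel B′) (gödel A) (gödel B) (trans e r) in
    cong₂ _⇒_ (p A′ (sym s)) (q B′ (sym t))
  univ : ∀ {A : Formula 𝓖 (suc n)} {C} → (∀ A′ → gödel A ≡ gödel A′ → A ≡ A′) →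
         FormulaView C 4 (gödel A) → all A ≡ C
  univ p (allⱽ A′ e) = cong all (p A′ (sym e))

gödels : List (Formula 𝓖 n) → ℕ
gödels Γ = listCode (List.map gödel Γ)

gödels-injective : (Γ Δ : List (Formula 𝓖 n)) → gödels Γ ≡ gödels Δ → Γ ≡ Δ
gödels-injective []      []      e = refl
gödels-injective (A ∷ Γ) (B ∷ Δ) e =
  let p , q = cons-injective (gödel A) (gödels Γ) (gödel B) (gödels Δ) e in
  cong₂ _∷_ (gödel-injective A B p) (gödels-injective Γ Δ q)

eqᶠ edgeᶠ impᶠ : Fn k → Fn k → Fn k
eqᶠ i j   = ⟪ lit 1 , ⟪ ⟪ lit 0 , i ⟫ , ⟪ lit 0 , j ⟫ ⟫ ⟫
edgeᶠ i j = ⟪ lit 2 , ⟪ lit 0 , S ⟪ ⟪ lit 0 , i ⟫ , S ⟪ ⟪ lit 0 , j ⟫ , lit 0 ⟫ ⟫ ⟫ ⟫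
impᶠ a b  = ⟪ lit 3 , ⟪ a , b ⟫ ⟫

-- A renaming is represented by any list whose leading entries are its values. This condition and
-- the next two test these entries against the successor, the substitution of variable j for
-- variable 0, and the lifting under a quantifier.
shiftᴰ : Fn k → Fn k → Dc k
shiftᴰ n ρ = ∀<ᴰ n (lkᶠ (app ρ wkˢ) (𝕧 0) ≐ᴰ S (𝕧 0))

instᴰ : Fn k → Fn k → Fn k → Dc k
instᴰ n ρ j = (lkᶠ ρ (lit 0) ≐ᴰ j) ∧ᴰ ∀<ᴰ n (lkᶠ (app ρ wkˢ) (S (𝕧 0)) ≐ᴰ 𝕧 0)

liftᴰ : Fn k → Fn k → Fn k → Dc k
liftᴰ n ρ ρ′ = (lkᶠ ρ′ (lit 0) ≐ᴰ lit 0) ∧ᴰ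
  ∀<ᴰ n (lkᶠ (app ρ′ wkˢ) (S (𝕧 0)) ≐ᴰ S (lkᶠ (app ρ wkˢ) (𝕧 0)))

-- Facts: [0, m, ρ, a, b]: b is the formula a in m variables renamed along the
-- list ρ; [1, n, γ, γ′]: the context γ′ is the weakening of γ;
-- [2, n, γ, a]: a is provable from γ in n variables.
proofRules : List Rule
proofRules =
    (tag {2} 0 (𝕧 0) (𝕧 1) (lit 0) (lit 0) ⟵ [])
  ∷ rule 4 ((𝕧 2 <ᴰ 𝕧 0) ∧ᴰ (𝕧 3 <ᴰ 𝕧 0)) []
      (tag 0 (𝕧 0) (𝕧 1) (eqᶠ (𝕧 2) (𝕧 3)) (eqᶠ (lkᶠ (𝕧 1) (𝕧 2)) (lkᶠ (𝕧 1) (𝕧 3))))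
  ∷ rule 4 ((𝕧 2 <ᴰ 𝕧 0) ∧ᴰ (𝕧 3 <ᴰ 𝕧 0)) []
      (tag 0 (𝕧 0) (𝕧 1) (edgeᶠ (𝕧 2) (𝕧 3)) (edgeᶠ (lkᶠ (𝕧 1) (𝕧 2)) (lkᶠ (𝕧 1) (𝕧 3))))
  ∷ (tag {6} 0 (𝕧 0) (𝕧 1) (impᶠ (𝕧 2) (𝕧 3)) (impᶠ (𝕧 4) (𝕧 5)) ⟵
       tag 0 (𝕧 0) (𝕧 1) (𝕧 2) (𝕧 4) ∷ tag 0 (𝕧 0) (𝕧 1) (𝕧 3) (𝕧 5) ∷ [])
  ∷ rule 5 (liftᴰ (𝕧 0) (𝕧 1) (𝕧 2)) (tag 0 (S (𝕧 0)) (𝕧 2) (𝕧 3) (𝕧 4) ∷ [])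
      (tag 0 (𝕧 0) (𝕧 1) ⟪ lit 4 , 𝕧 3 ⟫ ⟪ lit 4 , 𝕧 4 ⟫)
  ∷ (tag {1} 1 (𝕧 0) (lit 0) (lit 0) (lit 0) ⟵ [])
  ∷ rule 6 (shiftᴰ (𝕧 0) (𝕧 1)) (tag 0 (𝕧 0) (𝕧 1) (𝕧 4) (𝕧 5) ∷ tag 1 (𝕧 0) (𝕧 2) (𝕧 3) (lit 0) ∷ [])
      (tag 1 (𝕧 0) (consᶠ (𝕧 4) (𝕧 2)) (consᶠ (𝕧 5) (𝕧 3)) (lit 0))
  -- The premise with tag 1 guarantees that the context consists of codes of formulas.
  ∷ (tag {4} 2 (𝕧 0) (consᶠ (𝕧 3) (𝕧 1)) (𝕧 3) (lit 0) ⟵ tag 1 (𝕧 0) (consᶠ (𝕧 3) (𝕧 1)) (𝕧 2) (lit 0) ∷ [])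
  ∷ (tag {5} 2 (𝕧 0) (consᶠ (𝕧 3) (𝕧 1)) (𝕧 4) (lit 0) ⟵
       tag 1 (𝕧 0) (consᶠ (𝕧 3) (𝕧 1)) (𝕧 2) (lit 0) ∷ tag 2 (𝕧 0) (𝕧 1) (𝕧 4) (lit 0) ∷ [])
  ∷ (tag {4} 2 (𝕧 0) (𝕧 1) (impᶠ (𝕧 2) (𝕧 3)) (lit 0) ⟵ tag 2 (𝕧 0) (consᶠ (𝕧 2) (𝕧 1)) (𝕧 3) (lit 0) ∷ [])
  ∷ (tag {4} 2 (𝕧 0) (𝕧 1) (𝕧 3) (lit 0) ⟵
       tag 2 (𝕧 0) (𝕧 1) (impᶠ (𝕧 2) (𝕧 3)) (lit 0) ∷ tag 2 (𝕧 0) (𝕧 1) (𝕧 2) (lit 0) ∷ [])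
  ∷ (tag {3} 2 (𝕧 0) (𝕧 1) (𝕧 2) (lit 0) ⟵ tag 2 (𝕧 0) (consᶠ (impᶠ (𝕧 2) (lit 0)) (𝕧 1)) (lit 0) (lit 0) ∷ [])
  ∷ (tag {4} 2 (𝕧 0) (𝕧 1) ⟪ lit 4 , 𝕧 3 ⟫ (lit 0) ⟵
       tag 1 (𝕧 0) (𝕧 1) (𝕧 2) (lit 0) ∷ tag 2 (S (𝕧 0)) (𝕧 2) (𝕧 3) (lit 0) ∷ [])
  ∷ rule 6 ((𝕧 4 <ᴰ 𝕧 0) ∧ᴰ instᴰ (𝕧 0) (𝕧 3) (𝕧 4))
      (tag 2 (𝕧 0) (𝕧 1) ⟪ lit 4 , 𝕧 2 ⟫ (lit 0) ∷ tag 0 (S (𝕧 0)) (𝕧 3) (𝕧 2) (𝕧 5) ∷ [])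
      (tag 2 (𝕧 0) (𝕧 1) (𝕧 5) (lit 0))
  ∷ rule 4 (𝕧 3 <ᴰ 𝕧 0) (tag 1 (𝕧 0) (𝕧 1) (𝕧 2) (lit 0) ∷ []) (tag 2 (𝕧 0) (𝕧 1) (eqᶠ (𝕧 3) (𝕧 3)) (lit 0))
  ∷ rule 9 (instᴰ (𝕧 0) (𝕧 7) (𝕧 2) ∧ᴰ instᴰ (𝕧 0) (𝕧 8) (𝕧 3))
      (tag 2 (𝕧 0) (𝕧 1) (eqᶠ (𝕧 2) (𝕧 3)) (lit 0) ∷ tag 2 (𝕧 0) (𝕧 1) (𝕧 4) (lit 0) ∷
       tag 0 (S (𝕧 0)) (𝕧 7) (𝕧 6) (𝕧 4) ∷ tag 0 (S (𝕧 0)) (𝕧 8) (𝕧 6) (𝕧 5) ∷ [])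
      (tag 2 (𝕧 0) (𝕧 1) (𝕧 5) (lit 0))
  ∷ rule 6 (shiftᴰ (𝕧 0) (𝕧 5))
      (tag 1 (𝕧 0) (𝕧 1) (𝕧 2) (lit 0) ∷ tag 0 (𝕧 0) (𝕧 5) (𝕧 3) (𝕧 4) ∷ tag 2 (S (𝕧 0)) (𝕧 2) (𝕧 4) (lit 0) ∷ [])
      (tag 2 (𝕧 0) (𝕧 1) (𝕧 3) (lit 0))
  ∷ []
  where
  tag : ℕ → Fn k → Fn k → Fn k → Fn k → Sub k 5
  tag t a b c d = lit t ∷ˢ a ∷ˢ b ∷ˢ c ∷ˢ d ∷ˢ []ˢ

ProofDer : ℕ → ℕ → ℕ → ℕ → ℕ → Set
ProofDer t a b c d = Der proofRules (t ∷ a ∷ b ∷ c ∷ d ∷ [])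

listOf : (Fin m → Fin n) → ℕ
listOf f = vecCode (tabulate (toℕ ∘ f))

lk-listOf : (f : Fin m → Fin n) → ∀ i → lk (listOf f) (toℕ i) ≡ toℕ (f i)
lk-listOf f i = trans (lk-vecCode (tabulate (toℕ ∘ f)) i) (Vec.lookup∘tabulate (toℕ ∘ f) i)

onFin : (P : ℕ → Set) → (∀ (i : Fin n) → P (toℕ i)) → ∀ i → i < n → P i
onFin P p i i<n = subst P (Fin.toℕ-fromℕ< i<n) (p (fromℕ< i<n))

renames : (A : Formula 𝓖 m) (f : Fin m → Fin n) → ProofDer 0 m (listOf f) (gödel A) (gödel (ren f A))
renames A f = formulaElim (λ {m} A → ∀ {n} (f : Fin m → Fin n) → ProofDer 0 m (listOf f) (gödel A) (gödel (ren f A)))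
  (λ {m} f → by (# 0) (m ∷ listOf f ∷ []) tt [])
  (λ {m} i j f → subst₂ (λ a b → ProofDer 0 m (listOf f) (eqCode (toℕ i) (toℕ j)) (eqCode a b))
    (lk-listOf f i) (lk-listOf f j)
    (by (# 1) (m ∷ listOf f ∷ toℕ i ∷ toℕ j ∷ []) (Fin.toℕ<n i , Fin.toℕ<n j) []))
  (λ {m} i j f → subst₂ (λ a b → ProofDer 0 m (listOf f) (edgeCode (toℕ i) (toℕ j)) (edgeCode a b))
    (lk-listOf f i) (lk-listOf f j)
    (by (# 2) (m ∷ listOf f ∷ toℕ i ∷ toℕ j ∷ []) (Fin.toℕ<n i , Fin.toℕ<n j) []))
  (λ {m} {A} {B} p q f → let d = p f ; e = q f in
    by (# 3) (m ∷ listOf f ∷ gödel A ∷ gödel B ∷ gödel (ren f A) ∷ gödel (ren f B) ∷ []) tt (d ∷ e ∷ []))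
  (λ {m} {A} p f → let d = p (liftᶠ f) in
    subst (λ B → ProofDer 0 m (listOf f) ⟨ 4 , gödel A ⟩ (gödel B)) (sym (ren-all f A))
    (by (# 4) (m ∷ listOf f ∷ listOf (liftᶠ f) ∷ gödel A ∷ gödel (ren (liftᶠ f) A) ∷ [])
      (lk-listOf (liftᶠ f) zero ,
       onFin (λ i → lk (listOf (liftᶠ f)) (suc i) ≡ suc (lk (listOf f) i))
         (λ i → trans (lk-listOf (liftᶠ f) (suc i)) (cong suc (sym (lk-listOf f i)))))
      (d ∷ [])))
  A f

weakens : (Γ : List (Formula 𝓖 n)) → ProofDer 1 n (gödels Γ) (gödels (List.map weaken Γ)) 0
weakens {n} []      = by (# 5) (n ∷ []) tt []
weakens {n} (A ∷ Γ) = let d = renames A suc ; e = weakens Γ in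
  by (# 6) (n ∷ listOf {n} suc ∷ gödels Γ ∷ gödels (List.map weaken Γ) ∷ gödel A ∷ gödel (weaken A) ∷ [])
    (onFin (λ i → lk (listOf {n} suc) i ≡ suc i) (lk-listOf suc)) (d ∷ e ∷ [])

proves-hyp : ∀ {Γ} {A : Formula 𝓖 n} → A ∈ Γ → ProofDer 2 n (gödels Γ) (gödel A) 0
proves-hyp {n} {B ∷ Γ} (here refl) = let d = weakens (B ∷ Γ) in
  by (# 7) (n ∷ gödels Γ ∷ gödels (List.map weaken (B ∷ Γ)) ∷ gödel B ∷ []) tt (d ∷ [])
proves-hyp {n} {B ∷ Γ} {A} (there p) = let d = weakens (B ∷ Γ) ; e = proves-hyp p in
  by (# 8) (n ∷ gödels Γ ∷ gödels (List.map weaken (B ∷ Γ)) ∷ gödel B ∷ gödel A ∷ []) tt (d ∷ e ∷ [])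

inst-spec : (j : Fin n) → ⟦ instᴰ (𝕧 0) (𝕧 1) (𝕧 2) ⟧ᴰ (n ∷ listOf (inst j) ∷ toℕ j ∷ [])
inst-spec j = lk-listOf (inst j) zero , onFin (λ i → lk (listOf (inst j)) (suc i) ≡ i) (lk-listOf (inst j) ∘ suc)

renames-inst : (A : Formula 𝓖 (suc n)) (j : Fin n) →
               ProofDer 0 (suc n) (listOf (inst j)) (gödel A) (gödel (A [ var j ]))
renames-inst A j = subst (λ B → ProofDer 0 _ (listOf (inst j)) (gödel A) (gödel B)) (sym ([]-ren A j)) (renames A (inst j))

proves : ∀ {Γ} {A : Formula 𝓖 n} → Γ ⊢ A → ProofDer 2 n (gödels Γ) (gödel A) 0
proves (hyp p) = proves-hyp p
proves {n} {Γ} (⇒I {A = A} {B} d) = let D = proves d in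
  by (# 9) (n ∷ gödels Γ ∷ gödel A ∷ gödel B ∷ []) tt (D ∷ [])
proves {n} {Γ} (⇒E {A = A} {B} d e) = let D = proves d ; E = proves e in
  by (# 10) (n ∷ gödels Γ ∷ gödel A ∷ gödel B ∷ []) tt (D ∷ E ∷ [])
proves {n} {Γ} (raa {A = A} d) = let D = proves d in by (# 11) (n ∷ gödels Γ ∷ gödel A ∷ []) tt (D ∷ [])
proves {n} {Γ} (∀I {A = A} d) = let D = proves d ; E = weakens Γ in
  by (# 12) (n ∷ gödels Γ ∷ gödels (List.map weaken Γ) ∷ gödel A ∷ []) tt (E ∷ D ∷ [])
proves {n} {Γ} (∀E {A = A} d (var j)) = let D = proves d ; E = renames-inst A j in
  by (# 13) (n ∷ gödels Γ ∷ gödel A ∷ listOf (inst j) ∷ toℕ j ∷ gödel (A [ var j ]) ∷ [])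
    (Fin.toℕ<n j , inst-spec j) (D ∷ E ∷ [])
proves (∀E d (fun () _))
proves {n} {Γ} (≐I {t = var i}) = let E = weakens Γ in
  by (# 14) (n ∷ gödels Γ ∷ gödels (List.map weaken Γ) ∷ toℕ i ∷ []) (Fin.toℕ<n i) (E ∷ [])
proves (≐I {t = fun () _})
proves {n} {Γ} (≐E {s = var i} {var j} A d e) =
  let D = proves d ; E = proves e ; F = renames-inst A i ; G = renames-inst A j in
  by (# 15) (n ∷ gödels Γ ∷ toℕ i ∷ toℕ j ∷ gödel (A [ var i ]) ∷ gödel (A [ var j ]) ∷ gödel A ∷
             listOf (inst i) ∷ listOf (inst j) ∷ [])
    (inst-spec i , inst-spec j) (D ∷ E ∷ F ∷ G ∷ [])
proves (≐E {s = fun () _} A d e)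
proves (≐E {s = var _} {fun () _} A d e)
proves {n} {Γ} (nonempty {A = A} d) = let D = proves d ; E = weakens Γ ; F = renames A suc in
  by (# 16) (n ∷ gödels Γ ∷ gödels (List.map weaken Γ) ∷ gödel A ∷ gödel (weaken A) ∷ listOf {n} suc ∷ [])
    (onFin (λ i → lk (listOf {n} suc) i ≡ suc i) (lk-listOf suc)) (E ∷ F ∷ D ∷ [])

-- Quantifying over all maps that the list represents leaves open the number of target variables,
-- which the codes do not carry.
Renames : ℕ → ℕ → ℕ → ℕ → Set
Renames m ρ a b = ∃ λ (A : Formula 𝓖 m) → gödel A ≡ a ×
  (∀ {n} (f : Fin m → Fin n) → (∀ i → lk ρ (toℕ i) ≡ toℕ (f i)) → b ≡ gödel (ren f A))

Weakens : ℕ → ℕ → ℕ → Set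
Weakens n γ γ′ = ∃ λ (Γ : List (Formula 𝓖 n)) → gödels Γ ≡ γ × γ′ ≡ gödels (List.map weaken Γ)

Proves : ℕ → ℕ → ℕ → Set
Proves n γ a = ∃₂ λ (Γ : List (Formula 𝓖 n)) A → gödels Γ ≡ γ × gödel A ≡ a × Γ ⊢ A

ProofGood : Fact → Set
ProofGood (0 ∷ m ∷ ρ ∷ a ∷ b ∷ []) = Renames m ρ a b
ProofGood (1 ∷ n ∷ γ ∷ γ′ ∷ _)     = Weakens n γ γ′
ProofGood (2 ∷ n ∷ γ ∷ a ∷ _)      = Proves n γ a
ProofGood _ = ⊤

private
  renImp : ∀ {m ρ a b a′ b′} → Renames m ρ a a′ → Renames m ρ b b′ → Renames m ρ (impCode a b) (impCode a′ b′)
  renImp (A , a≡ , p) (B , b≡ , q) = (A ⇒ B) , cong₂ impCode a≡ b≡ , λ f h → cong₂ impCode (p f h) (q f h)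

  renAll : ∀ {m ρ ρ′ a b} → ⟦ liftᴰ (𝕧 0) (𝕧 1) (𝕧 2) ⟧ᴰ (m ∷ ρ ∷ ρ′ ∷ []) → Renames (suc m) ρ′ a b →
           Renames m ρ ⟨ 4 , a ⟩ ⟨ 4 , b ⟩
  renAll (z , s) (A , a≡ , p) = all A , cong ⟨ 4 ,_⟩ a≡ , λ f h →
    trans (cong ⟨ 4 ,_⟩ (p (liftᶠ f) (λ { zero → z ; (suc i) → trans (s (toℕ i) (Fin.toℕ<n i)) (cong suc (h i)) })))
      (sym (cong gödel (ren-all f A)))

  shifted : ∀ {n ρ a b} → ⟦ shiftᴰ (𝕧 0) (𝕧 1) ⟧ᴰ (n ∷ ρ ∷ []) → Renames n ρ a b →
            ∃ λ (A : Formula 𝓖 n) → gödel A ≡ a × b ≡ gödel (weaken A)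
  shifted s (A , a≡ , p) = A , a≡ , p suc (λ i → s (toℕ i) (Fin.toℕ<n i))

  instantiated : ∀ {n ρ a b} (j : Fin n) → ⟦ instᴰ (𝕧 0) (𝕧 1) (𝕧 2) ⟧ᴰ (n ∷ ρ ∷ toℕ j ∷ []) → Renames (suc n) ρ a b →
                 ∃ λ (A : Formula 𝓖 (suc n)) → gödel A ≡ a × b ≡ gödel (A [ var j ])
  instantiated j (z , s) (A , a≡ , p) = A , a≡ ,
    trans (p (inst j) (λ { zero → z ; (suc i) → s (toℕ i) (Fin.toℕ<n i) })) (sym (cong gödel ([]-ren A j)))

  wkCons : ∀ {n γ γ′ a a′} → (∃ λ (A : Formula 𝓖 n) → gödel A ≡ a × a′ ≡ gödel (weaken A)) → Weakens n γ γ′ →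
           Weakens n (suc ⟨ a , γ ⟩) (suc ⟨ a′ , γ′ ⟩)
  wkCons (A , a≡ , a′≡) (Γ , γ≡ , γ′≡) =
    A ∷ Γ , cong₂ (λ a γ → suc ⟨ a , γ ⟩) a≡ γ≡ , cong₂ (λ a γ → suc ⟨ a , γ ⟩) a′≡ γ′≡

  uncons : ∀ {a γ} (Γ : List (Formula 𝓖 n)) → gödels Γ ≡ suc ⟨ a , γ ⟩ →
           ∃₂ λ A Δ → Γ ≡ A ∷ Δ × gödel A ≡ a × gödels Δ ≡ γ
  uncons {a = a} {γ} (A ∷ Γ) e = A , Γ , refl , cons-injective (gödel A) (gödels Γ) a γ e

  prvHyp : ∀ {n γ γ′ a} → Weakens n (suc ⟨ a , γ ⟩) γ′ → Proves n (suc ⟨ a , γ ⟩) a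
  prvHyp {γ = γ} {a = a} (Γ , e , _) = run (uncons Γ e)
    where
    run : (∃₂ λ A Δ → Γ ≡ A ∷ Δ × gödel A ≡ a × gödels Δ ≡ γ) → Proves _ (suc ⟨ a , γ ⟩) a
    run (A , Δ , refl , a≡ , _) = A ∷ Δ , A , e , a≡ , hyp (here refl)

  prvWeaken : ∀ {n γ γ′ a b} → Weakens n (suc ⟨ b , γ ⟩) γ′ → Proves n γ a → Proves n (suc ⟨ b , γ ⟩) a
  prvWeaken {γ = γ} {a = a} {b} (Γ , e , _) (Γ′ , A , γ≡ , a≡ , d) = run (uncons Γ e)
    where
    run : (∃₂ λ B Δ → Γ ≡ B ∷ Δ × gödel B ≡ b × gödels Δ ≡ γ) → Proves _ (suc ⟨ b , γ ⟩) a
    run (B , Δ , refl , _ , δ≡) = B ∷ Δ , A , e , a≡ ,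
      ⊢-weaken there (subst (_⊢ A) (gödels-injective Γ′ Δ (trans γ≡ (sym δ≡))) d)

  prvImpI : ∀ {n γ a b} → Proves n (suc ⟨ a , γ ⟩) b → Proves n γ (impCode a b)
  prvImpI {γ = γ} {a} {b} (Γ , B , e , b≡ , d) = run (uncons Γ e)
    where
    run : (∃₂ λ A Δ → Γ ≡ A ∷ Δ × gödel A ≡ a × gödels Δ ≡ γ) → Proves _ γ (impCode a b)
    run (A , Δ , refl , a≡ , δ≡) = Δ , A ⇒ B , δ≡ , cong₂ impCode a≡ b≡ , ⇒I d

  prvImpE : ∀ {n γ a b} → Proves n γ (impCode a b) → Proves n γ a → Proves n γ b
  prvImpE {n} {γ} {a} {b} (Γ , C , γ≡ , c≡ , d) (Γ′ , A , γ′≡ , a≡ , e) = run d (formulaView C 3 ⟨ a , b ⟩ c≡) refl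
    where
    run : ∀ {C u} → Γ ⊢ C → FormulaView C 3 u → u ≡ ⟨ a , b ⟩ → Proves n γ b
    run d (⇒ⱽ A′ B r) s = let p , q = pair-injective (gödel A′) (gödel B) a b (trans r s) in
      Γ , B , γ≡ , q , ⇒E d (subst₂ _⊢_ (gödels-injective Γ′ Γ (trans γ′≡ (sym γ≡)))
                                        (gödel-injective A A′ (trans a≡ (sym p))) e)

  prvRaa : ∀ {n γ a} → Proves n (suc ⟨ impCode a 0 , γ ⟩) 0 → Proves n γ a
  prvRaa {n} {γ} {a} (Γ , B , e , b≡ , d) = run (uncons Γ e)
    where
    run₂ : ∀ {C : Formula 𝓖 n} {u Δ} → FormulaView C 3 u → u ≡ ⟨ a , 0 ⟩ → gödels Δ ≡ γ → C ∷ Δ ⊢ ⊥̇ → Proves n γ a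
    run₂ {Δ = Δ} (⇒ⱽ A F r) s δ≡ d = let p , q = pair-injective (gödel A) (gödel F) a 0 (trans r s) in
      Δ , A , δ≡ , p , raa (subst (λ F → (A ⇒ F) ∷ Δ ⊢ ⊥̇) (gödel-injective F ⊥̇ q) d)
    run : (∃₂ λ C Δ → Γ ≡ C ∷ Δ × gödel C ≡ impCode a 0 × gödels Δ ≡ γ) → Proves n γ a
    run (C , Δ , refl , c≡ , δ≡) = run₂ (formulaView C 3 ⟨ a , 0 ⟩ c≡) refl δ≡
      (subst (C ∷ Δ ⊢_) (gödel-injective B ⊥̇ b≡) d)

  prvAllI : ∀ {n γ γ′ a} → Weakens n γ γ′ → Proves (suc n) γ′ a → Proves n γ ⟨ 4 , a ⟩
  prvAllI (Γ , γ≡ , γ′≡) (Δ , A , δ≡ , a≡ , d) = Γ , all A , γ≡ , cong ⟨ 4 ,_⟩ a≡ ,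
    ∀I (subst (_⊢ A) (gödels-injective Δ (List.map weaken Γ) (trans δ≡ γ′≡)) d)

  prvAllE : ∀ {n γ a b} (j : Fin n) → Proves n γ ⟨ 4 , a ⟩ →
            (∃ λ (A : Formula 𝓖 (suc n)) → gödel A ≡ a × b ≡ gödel (A [ var j ])) → Proves n γ b
  prvAllE {n} {γ} {a} {b} j (Γ , C , γ≡ , c≡ , d) (A , a≡ , b≡) = run d (formulaView C 4 a c≡)
    where
    run : ∀ {C} → Γ ⊢ C → FormulaView C 4 a → Proves n γ b
    run d (allⱽ A′ r) = Γ , A [ var j ] , γ≡ , sym b≡ ,
      ∀E (subst (λ A → Γ ⊢ all A) (gödel-injective A′ A (trans r (sym a≡))) d) (var j)

  prvEqE : ∀ {n γ i j a b c} → Proves n γ (eqCode i j) → Proves n γ a →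
           (∀ (i′ : Fin n) → toℕ i′ ≡ i → ∃ λ (C : Formula 𝓖 (suc n)) → gödel C ≡ c × a ≡ gödel (C [ var i′ ])) →
           (∀ (j′ : Fin n) → toℕ j′ ≡ j → ∃ λ (C : Formula 𝓖 (suc n)) → gödel C ≡ c × b ≡ gödel (C [ var j′ ])) →
           Proves n γ b
  prvEqE {n} {γ} {i} {j} {a} {b} (Γ , E , γ≡ , e≡ , d) (Γ′ , A , γ′≡ , a≡ , e) f g =
    run d (formulaView E 1 ⟨ ⟨ 0 , i ⟩ , ⟨ 0 , j ⟩ ⟩ e≡) refl
    where
    run : ∀ {E u} → Γ ⊢ E → FormulaView E 1 u → u ≡ ⟨ ⟨ 0 , i ⟩ , ⟨ 0 , j ⟩ ⟩ → Proves n γ b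
    run d (≐ⱽ i′ j′ r) s =
      let p , q = eqBody-injective (toℕ i′) (toℕ j′) i j (trans r s)
          C , c≡ , a≡′ = f i′ p
          C′ , c′≡ , b≡ = g j′ q in
      Γ , C′ [ var j′ ] , γ≡ , sym b≡ ,
      ≐E C′ d (subst₂ _⊢_ (gödels-injective Γ′ Γ (trans γ′≡ (sym γ≡)))
        (trans (gödel-injective A (C [ var i′ ]) (trans a≡ a≡′))
               (cong _[ var i′ ] (gödel-injective C C′ (trans c≡ (sym c′≡))))) e)

  prvNonempty : ∀ {n γ γ′ a a′} → Weakens n γ γ′ → (∃ λ (A : Formula 𝓖 n) → gödel A ≡ a × a′ ≡ gödel (weaken A)) →
                Proves (suc n) γ′ a′ → Proves n γ a
  prvNonempty (Γ , γ≡ , γ′≡) (A , a≡ , a′≡) (Δ , B , δ≡ , b≡ , d) = Γ , A , γ≡ , a≡ ,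
    nonempty (subst₂ _⊢_ (gödels-injective Δ (List.map weaken Γ) (trans δ≡ γ′≡))
      (gödel-injective B (weaken A) (trans b≡ a′≡)) d)

proofSound : All (Sound ProofGood) proofRules
proofSound =
    (λ { (m ∷ ρ ∷ []) _ _ → ⊥̇ , refl , λ f h → refl })
  ∷ (λ { (m ∷ ρ ∷ i ∷ j ∷ []) (i<m , j<m) _ → var (fromℕ< i<m) ≐ var (fromℕ< j<m) ,
         cong₂ eqCode (Fin.toℕ-fromℕ< i<m) (Fin.toℕ-fromℕ< j<m) ,
         λ f h → cong₂ eqCode (at f h i i<m) (at f h j j<m) })
  ∷ (λ { (m ∷ ρ ∷ i ∷ j ∷ []) (i<m , j<m) _ → edge (fromℕ< i<m) (fromℕ< j<m) ,
         cong₂ edgeCode (Fin.toℕ-fromℕ< i<m) (Fin.toℕ-fromℕ< j<m) ,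
         λ f h → cong₂ edgeCode (at f h i i<m) (at f h j j<m) })
  ∷ (λ { (m ∷ ρ ∷ a ∷ b ∷ a′ ∷ b′ ∷ []) _ (p ∷ q ∷ []) → renImp {m} {ρ} {a} {b} {a′} {b′} p q })
  ∷ (λ { (m ∷ ρ ∷ ρ′ ∷ a ∷ b ∷ []) s (p ∷ []) → renAll {m} {ρ} {ρ′} {a} {b} s p })
  ∷ (λ { (n ∷ []) _ _ → [] , refl , refl })
  ∷ (λ { (n ∷ ρ ∷ γ ∷ γ′ ∷ a ∷ a′ ∷ []) s (p ∷ q ∷ []) → wkCons {n} {γ} {γ′} {a} {a′} (shifted {n} {ρ} {a} {a′} s p) q })
  ∷ (λ { (n ∷ γ ∷ γ′ ∷ a ∷ []) _ (p ∷ []) → prvHyp {n} {γ} {γ′} {a} p })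
  ∷ (λ { (n ∷ γ ∷ γ′ ∷ b ∷ a ∷ []) _ (p ∷ q ∷ []) → prvWeaken {n} {γ} {γ′} {a} {b} p q })
  ∷ (λ { (n ∷ γ ∷ a ∷ b ∷ []) _ (p ∷ []) → prvImpI {n} {γ} {a} {b} p })
  ∷ (λ { (n ∷ γ ∷ a ∷ b ∷ []) _ (p ∷ q ∷ []) → prvImpE {n} {γ} {a} {b} p q })
  ∷ (λ { (n ∷ γ ∷ a ∷ []) _ (p ∷ []) → prvRaa {n} {γ} {a} p })
  ∷ (λ { (n ∷ γ ∷ γ′ ∷ a ∷ []) _ (p ∷ q ∷ []) → prvAllI {n} {γ} {γ′} {a} p q })
  ∷ (λ { (n ∷ γ ∷ a ∷ ρ ∷ j ∷ b ∷ []) (j<n , s) (p ∷ q ∷ []) →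
         prvAllE {n} {γ} {a} {b} (fromℕ< j<n) p (atIndex n ρ j a b s q (fromℕ< j<n) (Fin.toℕ-fromℕ< j<n)) })
  ∷ (λ { (n ∷ γ ∷ γ′ ∷ i ∷ []) i<n ((Γ , γ≡ , _) ∷ []) → Γ , var (fromℕ< i<n) ≐ var (fromℕ< i<n) , γ≡ ,
         cong₂ eqCode (Fin.toℕ-fromℕ< i<n) (Fin.toℕ-fromℕ< i<n) , ≐I })
  ∷ (λ { (n ∷ γ ∷ i ∷ j ∷ a ∷ b ∷ c ∷ ρ ∷ σ ∷ []) (s , t) (p ∷ q ∷ u ∷ v ∷ []) →
         prvEqE {n} {γ} {i} {j} {a} {b} {c} p q (atIndex n ρ i c a s u) (atIndex n σ j c b t v) })
  ∷ (λ { (n ∷ γ ∷ γ′ ∷ a ∷ a′ ∷ ρ ∷ []) s (p ∷ q ∷ r ∷ []) →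
         prvNonempty {n} {γ} {γ′} {a} {a′} p (shifted {n} {ρ} {a} {a′} s q) r })
  ∷ []
  where
  at : ∀ {m n ρ} (f : Fin m → Fin n) → (∀ i → lk ρ (toℕ i) ≡ toℕ (f i)) → ∀ i (i<m : i < m) →
       lk ρ i ≡ toℕ (f (fromℕ< i<m))
  at {ρ = ρ} f h i i<m = trans (cong (lk ρ) (sym (Fin.toℕ-fromℕ< i<m))) (h (fromℕ< i<m))
  atIndex : ∀ n ρ j a b → ⟦ instᴰ (𝕧 0) (𝕧 1) (𝕧 2) ⟧ᴰ (n ∷ ρ ∷ j ∷ []) → Renames (suc n) ρ a b →
            (j′ : Fin n) → toℕ j′ ≡ j → ∃ λ (A : Formula 𝓖 (suc n)) → gödel A ≡ a × b ≡ gödel (A [ var j′ ])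
  atIndex n ρ j a b s q j′ refl = instantiated {n} {ρ} {a} {b} j′ s q

-- Renaming facts are derivable for codes of formulas and for nothing else, so they double as a test
-- for being a formula; the identity renaming gives completeness.
formulaᴿ : Re 2
formulaᴿ = asᴿ (∃ᴿ (∃ᴿ (subᴿ (derᴿ proofRules) (lit 0 ∷ˢ 𝕧 2 ∷ˢ 𝕧 0 ∷ˢ 𝕧 3 ∷ˢ 𝕧 1 ∷ˢ []ˢ))))
  (λ { (n ∷ a ∷ []) → ∃ λ (A : Formula 𝓖 n) → gödel A ≡ a })
  (λ { (n ∷ a ∷ []) (b , ρ , d) → let A , e , _ = Der-sound {G = ProofGood} proofSound d in A , e })
  (λ { (n ∷ a ∷ []) (A , refl) → gödel (ren id A) , listOf {n} id , renames A id })

theoremᴿ : Re 1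
theoremᴿ = asᴿ (subᴿ (derᴿ proofRules) (lit 2 ∷ˢ lit 0 ∷ˢ lit 0 ∷ˢ 𝕧 0 ∷ˢ lit 0 ∷ˢ []ˢ))
  (λ { (a ∷ []) → ∃ λ (A : Sentence 𝓖) → gödel A ≡ a × [] ⊢ A })
  (λ { (a ∷ []) d → fromProves (Der-sound {G = ProofGood} proofSound d) })
  (λ { (a ∷ []) (A , refl , d) → proves d })
  where
  fromProves : ∀ {a} → Proves 0 0 a → ∃ λ (A : Sentence 𝓖) → gödel A ≡ a × [] ⊢ A
  fromProves (Γ , A , γ≡ , a≡ , d) = A , a≡ , subst (_⊢ A) (gödels-injective Γ [] γ≡) d

-- Classical satisfaction, soundness, and choices from enumerations.

module _ (em : {P : Set} → Dec P) where

  infix 1 _⟷_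
  _⟷_ : ∀ {a b} → Set a → Set b → Set (a Level.⊔ b)
  A ⟷ B = (A → B) × (B → A)

  ⟷-refl : ∀ {A : Set} → A ⟷ A
  ⟷-refl = id , id

  ⟷-sym : ∀ {A B : Set} → A ⟷ B → B ⟷ A
  ⟷-sym (f , g) = g , f

  ⟷-trans : ∀ {A B C : Set} → A ⟷ B → B ⟷ C → A ⟷ C
  ⟷-trans (f , g) (f′ , g′) = f′ ∘ f , g ∘ g′

  ⟷-→ : ∀ {A B C D : Set} → A ⟷ B → C ⟷ D → (A → C) ⟷ (B → D)
  ⟷-→ (f , g) (f′ , g′) = (λ h → f′ ∘ h ∘ g) , (λ h → g′ ∘ h ∘ f)

  ⟷-≡ : ∀ {A B : Set} → A ≡ B → A ⟷ B
  ⟷-≡ refl = ⟷-refl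

  stable : ∀ {A : Set} → ¬ ¬ A → A
  stable {A} nn with em {A}
  ... | yes a = a
  ... | no na = ⊥-elim (nn na)

  -- Soundness

  module _ {L : FiniteLanguage} (M : Structure L) where
    open Structure M

    eval-rename  : ∀ {f : Fin m → Fin n} {ρ ρ′} → (∀ i → lookup ρ (f i) ≡ lookup ρ′ i) →
                   ∀ t → evalTerm M ρ (renameTerm f t) ≡ evalTerm M ρ′ t
    evals-rename : ∀ {f : Fin m → Fin n} {ρ ρ′} → (∀ i → lookup ρ (f i) ≡ lookup ρ′ i) →
                   (ts : Vec (Term L m) k) → evalTerms M ρ (renameTerms f ts) ≡ evalTerms M ρ′ ts
    eval-rename h (var i)    = h i
    eval-rename h (fun f ts) = cong (funᴹ f) (evals-rename h ts)
    evals-rename h []       = refl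
    evals-rename h (t ∷ ts) = cong₂ _∷_ (eval-rename h t) (evals-rename h ts)

    eval-subst  : ∀ {σ : Fin m → Term L n} {ρ ρ′} → (∀ i → evalTerm M ρ (σ i) ≡ lookup ρ′ i) →
                  ∀ t → evalTerm M ρ (substTerm σ t) ≡ evalTerm M ρ′ t
    evals-subst : ∀ {σ : Fin m → Term L n} {ρ ρ′} → (∀ i → evalTerm M ρ (σ i) ≡ lookup ρ′ i) →
                  (ts : Vec (Term L m) k) → evalTerms M ρ (substTerms σ ts) ≡ evalTerms M ρ′ ts
    eval-subst h (var i)    = h i
    eval-subst h (fun f ts) = cong (funᴹ f) (evals-subst h ts)
    evals-subst h []       = refl
    evals-subst h (t ∷ ts) = cong₂ _∷_ (eval-subst h t) (evals-subst h ts)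

    sat-subst : ∀ {σ : Fin m → Term L n} {ρ ρ′} → (∀ i → evalTerm M ρ (σ i) ≡ lookup ρ′ i) →
                ∀ A → Satisfies M ρ (substFormula σ A) ⟷ Satisfies M ρ′ A
    sat-subst h ⊥̇          = ⟷-refl
    sat-subst h (s ≐ t)    = ⟷-≡ (cong₂ _≡_ (eval-subst h s) (eval-subst h t))
    sat-subst h (rel r ts) = ⟷-≡ (cong (relᴹ r) (evals-subst h ts))
    sat-subst h (A ⇒ B)    = ⟷-→ (sat-subst h A) (sat-subst h B)
    sat-subst {σ = σ} {ρ} {ρ′} h (all A) = (λ p a → proj₁ (sat-subst (h′ a) A) (p a)) ,
        (λ p a → proj₂ (sat-subst (h′ a) A) (p a))
      where
      h′ : ∀ a i → evalTerm M (a ∷ ρ) (lift σ i) ≡ lookup (a ∷ ρ′) i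
      h′ a zero    = refl
      h′ a (suc i) = trans (eval-rename (λ _ → refl) (σ i)) (h i)

    sat-weaken : ∀ {ρ : Vec Carrier n} {a} A → Satisfies M (a ∷ ρ) (weaken A) ⟷ Satisfies M ρ A
    sat-weaken = sat-subst (λ _ → refl)

    sat-[] : ∀ {ρ : Vec Carrier n} A t → Satisfies M ρ (A [ t ]) ⟷ Satisfies M (evalTerm M ρ t ∷ ρ) A
    sat-[] A t = sat-subst (λ { zero → refl ; (suc i) → refl }) A

    ⊢-sound : ∀ {Γ : List (Formula L n)} {A} → Γ ⊢ A → ∀ ρ → (∀ {B} → B ∈ Γ → Satisfies M ρ B) → Satisfies M ρ A
    ⊢-sound (hyp p)    ρ s = s p
    ⊢-sound (⇒I d)     ρ s = λ a → ⊢-sound d ρ (λ { (here refl) → a ; (there p) → s p })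
    ⊢-sound (⇒E d e)   ρ s = ⊢-sound d ρ s (⊢-sound e ρ s)
    ⊢-sound (raa d)    ρ s = stable (λ na → ⊢-sound d ρ (λ { (here refl) → na ; (there p) → s p }))
    ⊢-sound (∀I d)     ρ s = λ a → ⊢-sound d (a ∷ ρ) (weakened s)
      where
      weakened : ∀ {Γ : List (Formula L n)} {ρ a} → (∀ {B} → B ∈ Γ → Satisfies M ρ B) →
                 ∀ {B} → B ∈ List.map weaken Γ → Satisfies M (a ∷ ρ) B
      weakened s p with B , q , refl ← List.∈-map⁻ weaken p = proj₂ (sat-weaken B) (s q)
    ⊢-sound (∀E {A = A} d t) ρ s = proj₂ (sat-[] A t) (⊢-sound d ρ s (evalTerm M ρ t))
    ⊢-sound ≐I         ρ s = refl
    ⊢-sound (≐E {s = t} {u} A d e) ρ s = proj₂ (sat-[] A u)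
      (subst (λ a → Satisfies M (a ∷ ρ) A) (⊢-sound d ρ s) (proj₁ (sat-[] A t) (⊢-sound e ρ s)))
    ⊢-sound (nonempty {A = A} d) ρ s = proj₁ (sat-weaken A) (⊢-sound d (point ∷ ρ) (weakened s))
      where
      weakened : ∀ {Γ : List (Formula L n)} {ρ a} → (∀ {B} → B ∈ Γ → Satisfies M ρ B) →
                 ∀ {B} → B ∈ List.map weaken Γ → Satisfies M (a ∷ ρ) B
      weakened s p with B , q , refl ← List.∈-map⁻ weaken p = proj₂ (sat-weaken B) (s q)

  Th : ∀ {L} → Structure L → Pred (Sentence L) 0ℓ
  Th M A = Satisfies M [] A

  Th-complete : ∀ {L} (M : Structure L) → IsCompleteTheory (Th M)
  Th-complete M = record
    { consistent        = λ { (Γ , s , d) → ⊢-sound M d [] (All.lookup s) }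
    ; deductivelyClosed = λ { A (Γ , s , d) → ⊢-sound M d [] (All.lookup s) }
    ; complete          = λ A → case em of λ { (yes p) → inj₁ p ; (no p) → inj₂ p }
    }

  infixr 8 _∧̇_
  _∧̇_ iff : ∀ {L} → Formula L n → Formula L n → Formula L n
  A ∧̇ B   = ¬̇ (A ⇒ ¬̇ B)
  iff A B = (A ⇒ B) ∧̇ (B ⇒ A)

  ∃̇ : ∀ {L} → Formula L (suc n) → Formula L n
  ∃̇ A = ¬̇ all (¬̇ A)

  ⋀ : ∀ {L} → List (Formula L n) → Formula L n
  ⋀ []      = ⊥̇ ⇒ ⊥̇
  ⋀ (A ∷ Γ) = A ∧̇ ⋀ Γ

  allⁿ : ∀ {L} n → Formula L n → Sentence L
  allⁿ zero    A = A
  allⁿ (suc n) A = allⁿ n (all A)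

  -- Variable 0 is equal to one of the variables 1, …, k.
  amongVars : ∀ {L} k → k ≤ n → Formula L (suc n)
  amongVars zero    _   = ⊥̇
  amongVars (suc k) k<n = ¬̇ (var zero ≐ var (suc (fromℕ< k<n))) ⇒ amongVars k (<⇒≤ k<n)

  moreThan : ∀ {L} → ℕ → Sentence L
  moreThan n = allⁿ n (¬̇ all (amongVars n ≤-refl))

  -- Shared by structures and by Henkin sets, in which equality is only an
  -- equivalence relation.
  record Tarskian {X : Set} (Eq : X → X → Set) : Set₁ where
    field
      tr   : Formula 𝓖 n → Vec X n → Set
      tr-⊥ : ∀ {ρ : Vec X n} → ¬ tr ⊥̇ ρ
      tr-≐ : ∀ {ρ : Vec X n} i j → tr (var i ≐ var j) ρ ⟷ Eq (lookup ρ i) (lookup ρ j)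
      tr-⇒ : ∀ {ρ : Vec X n} A B → tr (A ⇒ B) ρ ⟷ (tr A ρ → tr B ρ)
      tr-∀ : ∀ {ρ : Vec X n} A → tr (all A) ρ ⟷ (∀ a → tr A (a ∷ ρ))

    tr-¬ : ∀ {ρ : Vec X n} A → tr (¬̇ A) ρ ⟷ (¬ tr A ρ)
    tr-¬ A = (λ p a → tr-⊥ (proj₁ (tr-⇒ A ⊥̇) p a)) , (λ p → proj₂ (tr-⇒ A ⊥̇) (⊥-elim ∘ p))

    tr-∧ : ∀ {ρ : Vec X n} A B → tr (A ∧̇ B) ρ ⟷ (tr A ρ × tr B ρ)
    tr-∧ A B =
      (λ p → stable (λ q → proj₁ (tr-¬ _) p (proj₂ (tr-⇒ _ _) (λ a → proj₂ (tr-¬ _) (λ b → q (a , b)))))) ,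
      (λ { (a , b) → proj₂ (tr-¬ _) (λ p → proj₁ (tr-¬ _) (proj₁ (tr-⇒ _ _) p a) b) })

    tr-iff : ∀ {ρ : Vec X n} A B → tr (iff A B) ρ ⟷ (tr A ρ ⟷ tr B ρ)
    tr-iff A B =
      (λ p → let q , r = proj₁ (tr-∧ _ _) p in proj₁ (tr-⇒ _ _) q , proj₁ (tr-⇒ _ _) r) ,
      (λ { (q , r) → proj₂ (tr-∧ _ _) (proj₂ (tr-⇒ _ _) q , proj₂ (tr-⇒ _ _) r) })

    tr-∃ : ∀ {ρ : Vec X n} A → tr (∃̇ A) ρ ⟷ (∃ λ a → tr A (a ∷ ρ))
    tr-∃ A =
      (λ p → stable (λ q → proj₁ (tr-¬ _) p (proj₂ (tr-∀ _) (λ a → proj₂ (tr-¬ _) (λ r → q (a , r)))))) ,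
      (λ { (a , r) → proj₂ (tr-¬ _) (λ p → proj₁ (tr-¬ _) (proj₁ (tr-∀ _) p a) r) })

    tr-⋀ : ∀ {ρ : Vec X n} Γ → tr (⋀ Γ) ρ ⟷ All (λ A → tr A ρ) Γ
    tr-⋀ []      = (λ _ → []) , (λ _ → proj₂ (tr-⇒ ⊥̇ ⊥̇) id)
    tr-⋀ (A ∷ Γ) =
      (λ p → let a , q = proj₁ (tr-∧ A (⋀ Γ)) p in a ∷ proj₁ (tr-⋀ Γ) q) ,
      (λ { (a ∷ q) → proj₂ (tr-∧ A (⋀ Γ)) (a , proj₂ (tr-⋀ Γ) q) })

    tr-allⁿ : ∀ n A → tr (allⁿ n A) [] ⟷ (∀ (ρ : Vec X n) → tr A ρ)
    tr-allⁿ zero    A = (λ { p [] → p }) , (λ p → p [])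
    tr-allⁿ (suc n) A =
      (λ { p (a ∷ ρ) → proj₁ (tr-∀ A) (proj₁ (tr-allⁿ n (all A)) p ρ) a }) ,
      (λ p → proj₂ (tr-allⁿ n (all A)) (λ ρ → proj₂ (tr-∀ A) (λ a → p (a ∷ ρ))))

    tr-amongVars : ∀ k (k≤n : k ≤ n) {a} {ρ : Vec X n} →
                   tr (amongVars k k≤n) (a ∷ ρ) ⟷ (∃ λ i → toℕ i < k × Eq a (lookup ρ i))
    tr-amongVars zero    _   = (⊥-elim ∘ tr-⊥) , (λ { (_ , () , _) })
    tr-amongVars (suc k) k<n {a} {ρ} = to′ , from′
      where
      to′ : _ → ∃ λ i → toℕ i < suc k × Eq a (lookup ρ i)
      to′ p with em {Eq a (lookup ρ (fromℕ< k<n))}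
      ... | yes q = fromℕ< k<n , s≤s (≤-reflexive (Fin.toℕ-fromℕ< k<n)) , q
      ... | no  q with i , i<k , r ← proj₁ (tr-amongVars k (<⇒≤ k<n))
                       (proj₁ (tr-⇒ _ _) p (proj₂ (tr-¬ _) (q ∘ proj₁ (tr-≐ _ _)))) = i , m<n⇒m<1+n i<k , r
      from′ : (∃ λ i → toℕ i < suc k × Eq a (lookup ρ i)) → tr (amongVars (suc k) k<n) (a ∷ ρ)
      from′ (i , s≤s i≤k , q) = proj₂ (tr-⇒ _ _) (λ r → case m≤n⇒m<n∨m≡n i≤k of λ
        { (inj₁ i<k) → proj₂ (tr-amongVars k (<⇒≤ k<n)) (i , i<k , q)
        ; (inj₂ i≡k) → ⊥-elim (proj₁ (tr-¬ _) r (proj₂ (tr-≐ zero (suc (fromℕ< k<n)))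
            (subst (λ i → Eq a (lookup ρ i)) (Fin.toℕ-injective (trans i≡k (sym (Fin.toℕ-fromℕ< k<n)))) q))) })

    tr-moreThan : ∀ n → tr (moreThan n) [] ⟷ (∀ (ρ : Vec X n) → ∃ λ a → ∀ i → ¬ Eq a (lookup ρ i))
    tr-moreThan n = ⟷-trans (tr-allⁿ n _) ((λ p ρ → to′ ρ (p ρ)) , (λ p ρ → from′ ρ (p ρ)))
      where
      to′ : ∀ ρ → tr (¬̇ all (amongVars n ≤-refl)) ρ → ∃ λ a → ∀ i → ¬ Eq a (lookup ρ i)
      to′ ρ p = stable (λ q → proj₁ (tr-¬ _) p (proj₂ (tr-∀ _) (λ a → proj₂ (tr-amongVars n ≤-refl)
        (stable (λ r → q (a , λ i e → r (i , Fin.toℕ<n i , e)))))))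
      from′ : ∀ ρ → (∃ λ a → ∀ i → ¬ Eq a (lookup ρ i)) → tr (¬̇ all (amongVars n ≤-refl)) ρ
      from′ ρ (a , p) = proj₂ (tr-¬ _) (λ q →
        let i , _ , e = proj₁ (tr-amongVars n ≤-refl) (proj₁ (tr-∀ _) q a) in p i e)

  satisfaction : (M : Structure 𝓖) → Tarskian {Structure.Carrier M} _≡_
  satisfaction M = record
    { tr = λ A ρ → Satisfies M ρ A ; tr-⊥ = id ; tr-≐ = λ _ _ → ⟷-refl ; tr-⇒ = λ _ _ → ⟷-refl ; tr-∀ = λ _ → ⟷-refl }

  module Sat (M : Structure 𝓖) = Tarskian (satisfaction M)

  -- Enumerations

  least : (P : ℕ → Set) → ∃ P → ∃ λ n → P n × (∀ m → m < n → ¬ P m)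
  least P (n , p) = <-rec (λ n → P n → ∃ λ n → P n × (∀ m → m < n → ¬ P m)) step n p
    where
    step : ∀ n → (∀ {m} → m < n → P m → ∃ λ n → P n × (∀ m → m < n → ¬ P m)) →
           P n → ∃ λ n → P n × (∀ m → m < n → ¬ P m)
    step n rec p with em {∃ λ m → m < n × P m}
    ... | yes (m , m<n , q) = rec m<n q
    ... | no none           = n , p , λ m m<n q → none (m , m<n , q)

  enumerate : ∀ {X : Set} (c : X → ℕ) → (∀ x y → c x ≡ c y → x ≡ y) → X → ∃ λ (e : ℕ → X) → ∀ x → ∃ λ i → e i ≡ x
  enumerate {X} c inj x₀ = e , λ x → c x , hit x
    where
    e : ℕ → X
    e i with em {∃ λ x → c x ≡ i}
    ... | yes (x , _) = x
    ... | no _        = x₀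
    hit : ∀ x → e (c x) ≡ x
    hit x with em {∃ λ y → c y ≡ c x}
    ... | yes (y , p) = inj y x p
    ... | no none     = ⊥-elim (none (x , refl))

  increasing : (r : ℕ → ℕ) → (∀ a → r a < r (suc a)) → ∀ {a b} → a < b → r a < r b
  increasing r s {a} {suc b} (s≤s a≤b) with m≤n⇒m<n∨m≡n a≤b
  ... | inj₁ a<b  = <-trans (increasing r s a<b) (s b)
  ... | inj₂ refl = s b

  enumerateSubset : (P : ℕ → Set) → (∀ n → ∃ λ i → n ≤ i × P i) →
                    ∃ λ (r : ℕ → ℕ) → (∀ a → r a < r (suc a)) × (∀ a → P (r a)) × (∀ i → P i → ∃ λ a → r a ≡ i)
  enumerateSubset P inf = r , step , member , λ i p → reach (suc i) i (<-≤-trans (n<1+n i) (grow (suc i))) p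
    where
    next : ∀ n → ∃ λ i → (n ≤ i × P i) × (∀ m → m < i → ¬ (n ≤ m × P m))
    next n = least (λ i → n ≤ i × P i) (inf n)
    r : ℕ → ℕ
    r zero    = proj₁ (next 0)
    r (suc a) = proj₁ (next (suc (r a)))
    step : ∀ a → r a < r (suc a)
    step a = proj₁ (proj₁ (proj₂ (next (suc (r a)))))
    member : ∀ a → P (r a)
    member zero    = proj₂ (proj₁ (proj₂ (next 0)))
    member (suc a) = proj₂ (proj₁ (proj₂ (next (suc (r a)))))
    grow : ∀ a → a ≤ r a
    grow zero    = z≤n
    grow (suc a) = ≤-trans (s≤s (grow a)) (step a)
    reach : ∀ b i → i < r b → P i → ∃ λ a → r a ≡ i
    reach zero    i i<r p = ⊥-elim (proj₂ (proj₂ (next 0)) i i<r (z≤n , p))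
    reach (suc b) i i<r p with <-cmp i (r b)
    ... | tri< i<rb _ _ = reach b i i<rb p
    ... | tri≈ _ e _    = b , sym e
    ... | tri> _ _ rb<i = ⊥-elim (proj₂ (proj₂ (next (suc (r b)))) i i<r (rb<i , p))

  -- The least elements of the classes, in increasing order. There are infinitely many: an element
  -- outside the classes of 0, ..., n - 1 has its least equivalent at or above n.
  transversal : (R : ℕ → ℕ → Set) → (∀ {i} → R i i) → (∀ {i j} → R i j → R j i) → (∀ {i j k} → R i j → R j k → R i k) →
                (∀ n → ∃ λ i → ∀ j → j < n → ¬ R i j) →
                ∃ λ (r : ℕ → ℕ) → (∀ a b → R (r a) (r b) → a ≡ b) × (∀ i → ∃ λ a → R i (r a))
  transversal R rfl sm tr inf = r , unique , cover
    where
    New : ℕ → Set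
    New i = ∀ j → j < i → ¬ R i j
    first : ∀ i → ∃ λ k → R i k × New k
    first i with k , p , min ← least (R i) (i , rfl) = k , p , λ j j<k q → min j j<k (tr p q)
    many : ∀ n → ∃ λ i → n ≤ i × New i
    many n with i , p ← inf n with k , q , new ← first i =
      k , ≮⇒≥ (λ k<n → p k k<n q) , new
    enum = enumerateSubset New many
    r = proj₁ enum
    new : ∀ a → New (r a)
    new = proj₁ (proj₂ (proj₂ enum))
    unique : ∀ a b → R (r a) (r b) → a ≡ b
    unique a b p with <-cmp a b
    ... | tri≈ _ e _   = e
    ... | tri< a<b _ _ = ⊥-elim (new b (r a) (increasing r (proj₁ (proj₂ enum)) a<b) (sm p))
    ... | tri> _ _ b<a = ⊥-elim (new a (r b) (increasing r (proj₁ (proj₂ enum)) b<a) p)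
    cover : ∀ i → ∃ λ a → R i (r a)
    cover i = let k , p , n = first i ; a , e = proj₂ (proj₂ (proj₂ enum)) k n in a , subst (R i) (sym e) p

  choose : ∀ {I J : Set} (R : J → I → Set) (js : List J) →
           ∃ λ (Δ : List I) → ∀ {j} → j ∈ js → ∀ i → R j i → ∃ λ δ → δ ∈ Δ × R j δ
  choose R []       = [] , λ ()
  choose R (j ∷ js) with choose R js | em {∃ (R j)}
  ... | Δ , p | yes (δ , q) = δ ∷ Δ , λ { (here refl) i r → δ , here refl , q
                                        ; (there s) i r → case p s i r of λ { (δ′ , t , q′) → δ′ , there t , q′ } }
  ... | Δ , p | no none     = Δ , λ { (here refl) i r → ⊥-elim (none (i , r)) ; (there s) i r → p s i r }

  -- Each predicate cuts every class in two, and `choose` keeps a representative of each inhabited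
  -- half. This later turns finitely many atomic questions into finitely many types, and these into
  -- finitely many formulas.
  finiteIndex : ∀ {K I : Set} (p : K → I → Set) (ks : List K) →
                ∃ λ (Δ : List I) → ∀ i → ∃ λ δ → δ ∈ Δ × (∀ {k} → k ∈ ks → p k i ⟷ p k δ)
  -- Without predicates one representative suffices, and none exists if `I` is empty; choosing along
  -- a trivial relation covers both cases.
  finiteIndex {I = I} p [] with choose {I = I} (λ { tt _ → ⊤ }) (tt ∷ [])
  ... | Δ , q = Δ , λ i → case q (here refl) i tt of λ { (δ , r , _) → δ , r , λ () }
  finiteIndex {I = I} p (k ∷ ks) with finiteIndex p ks
  ... | Δ , q = Δ′ , split
    where
    Similar : I × Bool → I → Set
    Similar (δ , true)  i = (∀ {k} → k ∈ ks → p k i ⟷ p k δ) × p k i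
    Similar (δ , false) i = (∀ {k} → k ∈ ks → p k i ⟷ p k δ) × ¬ p k i
    chosen = choose Similar (List.map (_, true) Δ ++ List.map (_, false) Δ)
    Δ′ = proj₁ chosen
    split : ∀ i → ∃ λ δ → δ ∈ Δ′ × (∀ {k′} → k′ ∈ k ∷ ks → p k′ i ⟷ p k′ δ)
    split i with q i | em {p k i}
    ... | δ , r , s | yes t with proj₂ chosen (List.∈-++⁺ˡ (List.∈-map⁺ (_, true) r)) i (s , t)
    ...   | δ′ , r′ , s′ , t′ = δ′ , r′ , λ { (here refl) → (λ _ → t′) , (λ _ → t)
                                            ; (there u) → ⟷-trans (s u) (⟷-sym (s′ u)) }
    split i | δ , r , s | no t with proj₂ chosen (List.∈-++⁺ʳ (List.map (_, true) Δ) (List.∈-map⁺ (_, false) r)) i (s , t)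
    ...   | δ′ , r′ , s′ , t′ = δ′ , r′ , λ { (here refl) → (⊥-elim ∘ t) , (⊥-elim ∘ t′)
                                            ; (there u) → ⟷-trans (s u) (⟷-sym (s′ u)) }

  -- Henkin constructions.

  -- An instance (n , A , ν) is the formula A with its variables replaced by the
  -- constants ν, which are numbers.
  Inst : Set
  Inst = Σ ℕ λ n → Formula 𝓖 n × Vec ℕ n

  vecCode-injective : (u v : Vec ℕ n) → vecCode u ≡ vecCode v → u ≡ v
  vecCode-injective []      []      e = refl
  vecCode-injective (x ∷ u) (y ∷ v) e = let p , q = cons-injective x (vecCode u) y (vecCode v) e in
    cong₂ _∷_ p (vecCode-injective u v q)

  enumInst : ∃ λ (e : ℕ → Inst) → ∀ I → ∃ λ i → e i ≡ I
  enumInst = enumerate instCode injective (0 , ⊥̇ , [])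
    where
    instCode : Inst → ℕ
    instCode (n , A , ν) = ⟨ n , ⟨ gödel A , vecCode ν ⟩ ⟩
    same : ∀ {n m} {A : Formula 𝓖 n} {B : Formula 𝓖 m} {ν κ} → n ≡ m → gödel A ≡ gödel B × vecCode ν ≡ vecCode κ →
           _≡_ {A = Inst} (n , A , ν) (m , B , κ)
    same {n} {A = A} {B} {ν} {κ} refl (p , q) =
      cong₂ (λ A ν → n , A , ν) (gödel-injective A B p) (vecCode-injective ν κ q)
    injective : ∀ I J → instCode I ≡ instCode J → I ≡ J
    injective (n , A , ν) (m , B , κ) e =
      let p , q = pair-injective n ⟨ gödel A , vecCode ν ⟩ m ⟨ gödel B , vecCode κ ⟩ e in
      same p (pair-injective (gödel A) (vecCode ν) (gödel B) (vecCode κ) q)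

  -- The local contradictions to which `henkin` and the laws of equality appeal. The two renaming
  -- clauses identify instances that become the same sentence once the constants are filled in.
  data Clash (Γ : List Inst) : Set where
    ⊥ᶜ   : ∀ {n ν} → (n , ⊥̇ , ν) ∈ Γ → Clash Γ
    ¬ᶜ   : ∀ {n A ν} → (n , A , ν) ∈ Γ → (n , ¬̇ A , ν) ∈ Γ → Clash Γ
    ⇒ᶜ   : ∀ {n A B ν} → (n , A ⇒ B , ν) ∈ Γ → (n , A , ν) ∈ Γ → (n , ¬̇ B , ν) ∈ Γ → Clash Γ
    ⇒ᶜ₁  : ∀ {n A B ν} → (n , ¬̇ (A ⇒ B) , ν) ∈ Γ → (n , ¬̇ A , ν) ∈ Γ → Clash Γ
    ⇒ᶜ₂  : ∀ {n A B ν} → (n , ¬̇ (A ⇒ B) , ν) ∈ Γ → (n , B , ν) ∈ Γ → Clash Γ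
    ∀ᶜ   : ∀ {n A ν c} → (n , all A , ν) ∈ Γ → (suc n , ¬̇ A , c ∷ ν) ∈ Γ → Clash Γ
    ≐ᶜ   : ∀ {n i ν} → (n , ¬̇ (var i ≐ var i) , ν) ∈ Γ → Clash Γ
    ≐ᶜ′  : ∀ {n A ν c d} → (2 , var zero ≐ var (suc zero) , c ∷ d ∷ []) ∈ Γ →
           (suc n , A , c ∷ ν) ∈ Γ → (suc n , ¬̇ A , d ∷ ν) ∈ Γ → Clash Γ
    renᶜ : ∀ {m n A κ ν} (f : Fin m → Fin n) → (∀ i → lookup ν (f i) ≡ lookup κ i) →
           (n , ren f A , ν) ∈ Γ → (m , ¬̇ A , κ) ∈ Γ → Clash Γ
    renᶜ′ : ∀ {m n A κ ν} (f : Fin m → Fin n) → (∀ i → lookup ν (f i) ≡ lookup κ i) →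
           (m , A , κ) ∈ Γ → (n , ¬̇ ren f A , ν) ∈ Γ → Clash Γ

  -- What the construction needs of a notion of consistency. Unprovability of a contradiction is one
  -- instance and yields a countable model; satisfiability in a given structure is the other and
  -- serves to realise and to omit types.
  record ConsistencyProperty (Con : List Inst → Set) : Set where
    field
      start   : Con []
      decide  : ∀ {Γ n} A ν → Con Γ → Con ((n , A , ν) ∷ Γ) ⊎ Con ((n , ¬̇ A , ν) ∷ Γ)
      witness : ∀ {Γ n A ν} → Con ((n , ¬̇ all A , ν) ∷ Γ) →
                ∃ λ c → Con ((suc n , ¬̇ A , c ∷ ν) ∷ (n , ¬̇ all A , ν) ∷ Γ)
      noClash : ∀ {Γ} → Con Γ → ¬ Clash Γ

  -- A sequence of consistent sets which decides every instance, chooses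
  -- witnesses and meets the given dense sets; its union is a Henkin set.
  module Generic {Con} (cp : ConsistencyProperty Con) (Extra : ℕ → List Inst → Set)
                 (dense : ∀ i Γ → Con Γ → ∃ λ Δ → Con Δ × Γ ⊆ Δ × Extra i Δ) where
    open ConsistencyProperty cp

    Decided : Inst → List Inst → Set
    Decided (n , A , ν) Γ = (n , A , ν) ∈ Γ ⊎
      ((n , ¬̇ A , ν) ∈ Γ × (∀ B → A ≡ all B → ∃ λ c → (suc n , ¬̇ B , c ∷ ν) ∈ Γ))

    logicStep : ∀ I Γ → Con Γ → ∃ λ Δ → Con Δ × Γ ⊆ Δ × Decided I Δ
    logicStep (n , A , ν) Γ p with decide A ν p
    ... | inj₁ q = _ , q , there , inj₁ (here refl)
    ... | inj₂ q with em {∃ λ B → A ≡ all B}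
    ...   | no none = _ , q , there , inj₂ (here refl , λ B e → ⊥-elim (none (B , e)))
    ...   | yes (B , refl) with witness q
    ...     | c , r = _ , r , there ∘ there , inj₂ (there (here refl) , λ { _ refl → c , here refl })

    Decided-mono : ∀ I {Γ Δ} → Γ ⊆ Δ → Decided I Γ → Decided I Δ
    Decided-mono I s (inj₁ p)       = inj₁ (s p)
    Decided-mono I s (inj₂ (p , q)) = inj₂ (s p , λ B e → let c , r = q B e in c , s r)

    step : ∀ i Γ → Con Γ → ∃ λ Δ → Con Δ × Γ ⊆ Δ × Decided (proj₁ enumInst i) Δ × Extra i Δ
    step i Γ p with logicStep (proj₁ enumInst i) Γ p
    ... | Δ , q , s , d with dense i Δ q
    ...   | Δ′ , q′ , s′ , x = Δ′ , q′ , s′ ∘ s , Decided-mono _ s′ d , x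

    chain : ℕ → ∃ Con
    chain zero    = [] , start
    chain (suc i) = let Γ , p = chain i ; Δ , q , _ = step i Γ p in Δ , q

    stage : ℕ → List Inst
    stage i = proj₁ (chain i)

    stage-mono : ∀ {i j} → i ≤ j → stage i ⊆ stage j
    stage-mono {j = zero}  z≤n p = p
    stage-mono {i} {suc j} i≤j p with m≤n⇒m<n∨m≡n i≤j
    ... | inj₂ refl = p
    ... | inj₁ (s≤s i≤j′) = proj₁ (proj₂ (proj₂ (step j (stage j) (proj₂ (chain j))))) (stage-mono i≤j′ p)

    extra-met : ∀ i → Extra i (stage (suc i))
    extra-met i = proj₂ (proj₂ (proj₂ (proj₂ (step i (stage i) (proj₂ (chain i))))))

    G : Inst → Set
    G I = ∃ λ i → I ∈ stage i

    G-decided : ∀ I → ∃ λ i → Decided I (stage i)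
    G-decided I = let i , e = proj₂ enumInst I in suc i ,
      subst (λ J → Decided J (stage (suc i))) e (proj₁ (proj₂ (proj₂ (proj₂ (step i (stage i) (proj₂ (chain i)))))))

    G-¬ : ∀ {n} {A : Formula 𝓖 n} {ν} → ¬ G (n , A , ν) → G (n , ¬̇ A , ν)
    G-¬ {n} {A} {ν} p with G-decided (n , A , ν)
    ... | i , inj₁ q       = ⊥-elim (p (i , q))
    ... | i , inj₂ (q , _) = i , q

    clash₁ : ∀ {I} → G I → ¬ (∀ {Γ} → I ∈ Γ → Clash Γ)
    clash₁ (i , p) f = noClash (proj₂ (chain i)) (f p)

    clash₂ : ∀ {I J} → G I → G J → ¬ (∀ {Γ} → I ∈ Γ → J ∈ Γ → Clash Γ)
    clash₂ (i , p) (j , q) f = noClash (proj₂ (chain (i ⊔ j)))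
      (f (stage-mono (m≤m⊔n i j) p) (stage-mono (m≤n⊔m i j) q))

    clash₃ : ∀ {I J K} → G I → G J → G K → ¬ (∀ {Γ} → I ∈ Γ → J ∈ Γ → K ∈ Γ → Clash Γ)
    clash₃ (i , p) (j , q) (k , r) f = noClash (proj₂ (chain (i ⊔ j ⊔ k)))
      (f (stage-mono (≤-trans (m≤m⊔n i j) (m≤m⊔n _ k)) p) (stage-mono (≤-trans (m≤n⊔m i j) (m≤m⊔n _ k)) q)
         (stage-mono (m≤n⊔m (i ⊔ j) k) r))

    G-ren : ∀ {m n} {A : Formula 𝓖 m} {κ ν} (f : Fin m → Fin n) → (∀ i → lookup ν (f i) ≡ lookup κ i) →
            G (n , ren f A , ν) ⟷ G (m , A , κ)
    G-ren f h = (λ p → stable (λ q → clash₂ p (G-¬ q) (renᶜ f h))) ,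
                (λ p → stable (λ q → clash₂ p (G-¬ q) (renᶜ′ f h)))

    infix 4 _~_
    _~_ : ℕ → ℕ → Set
    c ~ d = G (2 , var zero ≐ var (suc zero) , c ∷ d ∷ [])

    G-≐ : ∀ {n} {ν : Vec ℕ n} i j → G (n , var i ≐ var j , ν) ⟷ lookup ν i ~ lookup ν j
    G-≐ i j = G-ren (λ { zero → i ; (suc _) → j }) (λ { zero → refl ; (suc zero) → refl })

    G-leibniz : ∀ {n} {A : Formula 𝓖 (suc n)} {ν c d} → c ~ d → G (suc n , A , c ∷ ν) → G (suc n , A , d ∷ ν)
    G-leibniz e p = stable (λ q → clash₃ e p (G-¬ q) ≐ᶜ′)

    ~-refl : ∀ {c} → c ~ c
    ~-refl {c} = proj₁ (G-≐ {ν = c ∷ []} zero zero) (stable (λ q → clash₁ (G-¬ q) ≐ᶜ))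

    ~-sym : ∀ {c d} → c ~ d → d ~ c
    ~-sym e = G-leibniz e ~-refl

    ~-trans : ∀ {c d e} → c ~ d → d ~ e → c ~ e
    ~-trans p q = G-leibniz (~-sym p) q

    henkin : Tarskian _~_
    henkin = record
      { tr   = λ {n} A ν → G (n , A , ν)
      ; tr-⊥ = λ p → clash₁ p ⊥ᶜ
      ; tr-≐ = G-≐
      ; tr-⇒ = λ A B →
          (λ p q → stable (λ r → clash₃ p q (G-¬ r) ⇒ᶜ)) ,
          (λ f → stable (λ r → clash₂ (G-¬ r) (G-¬ {A = A} (λ a → clash₂ (G-¬ r) (f a) ⇒ᶜ₂)) ⇒ᶜ₁))
      ; tr-∀ = λ A → (λ p c → stable (λ r → clash₂ p (G-¬ r) ∀ᶜ)) , univ A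
      }
      where
      univ : ∀ {n} {ν : Vec ℕ n} A → (∀ c → G (suc n , A , c ∷ ν)) → G (n , all A , ν)
      univ {n} {ν} A f with G-decided (n , all A , ν)
      ... | i , inj₁ p       = i , p
      ... | i , inj₂ (_ , w) with c , q ← w A refl = ⊥-elim (clash₂ (f c) (i , q) ¬ᶜ)

    open Tarskian henkin

    G-edge : ∀ {a b c d} → a ~ b → c ~ d → G (2 , edge zero (suc zero) , a ∷ c ∷ []) →
             G (2 , edge zero (suc zero) , b ∷ d ∷ [])
    -- `G-leibniz` replaces only the first constant, so the second one is moved to the front and
    -- back.
    G-edge {a} {b} {c} {d} p q r = proj₁ (G-ren swap (swapped b d))
        (G-leibniz q (proj₂ (G-ren swap (swapped b c)) (G-leibniz p r)))
      where
      swap : Fin 2 → Fin 2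
      swap zero    = suc zero
      swap (suc _) = zero
      swapped : ∀ x y i → lookup (y ∷ x ∷ []) (swap i) ≡ lookup (x ∷ y ∷ []) i
      swapped x y zero       = refl
      swapped x y (suc zero) = refl

    G-edge-≐ : ∀ {n} {ν : Vec ℕ n} i j → G (n , edge i j , ν) ⟷ G (2 , edge zero (suc zero) , lookup ν i ∷ lookup ν j ∷ [])
    G-edge-≐ i j = G-ren (λ { zero → i ; (suc _) → j }) (λ { zero → refl ; (suc zero) → refl })

    tr-resp : ∀ {n} (A : Formula 𝓖 n) {ν ν′} → (∀ i → lookup ν i ~ lookup ν′ i) → tr A ν → tr A ν′
    tr-resp A h = proj₁ (both A h)
      where
      both : ∀ {n} (A : Formula 𝓖 n) {ν ν′} → (∀ i → lookup ν i ~ lookup ν′ i) → tr A ν ⟷ tr A ν′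
      both = formulaElim (λ {n} A → ∀ {ν ν′} → (∀ i → lookup ν i ~ lookup ν′ i) → tr A ν ⟷ tr A ν′)
        (λ h → (⊥-elim ∘ tr-⊥) , (⊥-elim ∘ tr-⊥))
        (λ i j h → ⟷-trans (tr-≐ i j) (⟷-trans
          ((λ e → ~-trans (~-sym (h i)) (~-trans e (h j))) , (λ e → ~-trans (h i) (~-trans e (~-sym (h j)))))
          (⟷-sym (tr-≐ i j))))
        (λ i j h → ⟷-trans (G-edge-≐ i j) (⟷-trans
          (G-edge (h i) (h j) , G-edge (~-sym (h i)) (~-sym (h j))) (⟷-sym (G-edge-≐ i j))))
        (λ {_} {A} {B} p q h → ⟷-trans (tr-⇒ A B) (⟷-trans (⟷-→ (p h) (q h)) (⟷-sym (tr-⇒ A B))))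
        (λ {_} {A} p h → ⟷-trans (tr-∀ A) (⟷-trans
          ((λ f a → proj₁ (p (λ { zero → ~-refl ; (suc i) → h i })) (f a)) ,
           (λ f a → proj₂ (p (λ { zero → ~-refl ; (suc i) → h i })) (f a))) (⟷-sym (tr-∀ A))))

    -- No quotient is formed: as there are infinitely many classes of constants, a transversal
    -- indexes them by the natural numbers, and equality in the model is genuine.
    module Model (infinite : ∀ n → tr (moreThan n) []) where

      private
        new : ∀ n → ∃ λ i → ∀ j → j < n → ¬ i ~ j
        new n = let a , p = proj₁ (tr-moreThan n) (infinite n) (tabulate toℕ) in a , λ j j<n e →
          p (fromℕ< j<n) (subst (a ~_) (sym (trans (Vec.lookup∘tabulate toℕ (fromℕ< j<n)) (Fin.toℕ-fromℕ< j<n))) e)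
        trans-data = transversal _~_ ~-refl ~-sym ~-trans new

      r : ℕ → ℕ
      r = proj₁ trans-data

      r-injective : ∀ a b → r a ~ r b → a ≡ b
      r-injective = proj₁ (proj₂ trans-data)

      r-cover : ∀ i → ∃ λ a → i ~ r a
      r-cover = proj₂ (proj₂ trans-data)

      model : Structure 𝓖
      model = record
        { Carrier = ℕ ; point = 0 ; funᴹ = λ ()
        ; relᴹ = λ { _ (a ∷ b ∷ []) → tr (edge zero (suc zero)) (r a ∷ r b ∷ []) } }

      truth : ∀ {n} (A : Formula 𝓖 n) ρ → Satisfies model ρ A ⟷ tr A (map r ρ)
      truth = formulaElim (λ {n} A → ∀ ρ → Satisfies model ρ A ⟷ tr A (map r ρ))
        (λ ρ → ⊥-elim , (⊥-elim ∘ tr-⊥))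
        (λ i j ρ → ⟷-trans ((λ e → ~-reflexive
            (trans (Vec.lookup-map i r ρ) (trans (cong r e) (sym (Vec.lookup-map j r ρ))))) ,
            (λ e → r-injective _ _ (subst₂ _~_ (Vec.lookup-map i r ρ) (Vec.lookup-map j r ρ) e))) (⟷-sym (tr-≐ i j)))
        (λ i j ρ → ⟷-sym (⟷-trans (G-edge-≐ i j)
          (⟷-≡ (cong₂ (λ a b → tr (edge zero (suc zero)) (a ∷ b ∷ [])) (Vec.lookup-map i r ρ) (Vec.lookup-map j r ρ)))))
        (λ {_} {A} {B} p q ρ → ⟷-trans (⟷-→ (p ρ) (q ρ)) (⟷-sym (tr-⇒ A B)))
        (λ {_} {A} p ρ → (λ f → proj₂ (tr-∀ A) (λ c → let a , e = r-cover c in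
                                  G-leibniz (~-sym e) (proj₁ (p (a ∷ ρ)) (f a)))) ,
                         (λ f a → proj₂ (p (a ∷ ρ)) (proj₁ (tr-∀ A) f (r a))))
        where
        ~-reflexive : ∀ {c d} → c ≡ d → c ~ d
        ~-reflexive refl = ~-refl

      represent : ∀ {n} (ν : Vec ℕ n) → ∃ λ ρ → ∀ i → lookup ν i ~ lookup (map r ρ) i
      represent []      = [] , λ ()
      represent (c ∷ ν) = let a , e = r-cover c ; ρ , h = represent ν in a ∷ ρ , λ { zero → e ; (suc i) → h i }

  ren-cong : {f g : Fin m → Fin n} → (∀ i → f i ≡ g i) → ∀ A → ren f A ≡ ren g A
  ren-cong h = substFormula-cong (λ i → cong var (h i))

  ren-∘ : (f : Fin m → Fin n) (g : Fin k → Fin m) (A : Formula 𝓖 k) → ren f (ren g A) ≡ ren (f ∘ g) A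
  ren-∘ f g A = formulaElim (λ {k} A → ∀ {m n} (f : Fin m → Fin n) (g : Fin k → Fin m) → ren f (ren g A) ≡ ren (f ∘ g) A)
    (λ f g → refl) (λ i j f g → refl) (λ i j f g → refl) (λ p q f g → cong₂ _⇒_ (p f g) (q f g))
    (λ {_} {A} p f g → trans (cong (ren f) (ren-all g A)) (trans (ren-all f (ren (liftᶠ g) A))
      (trans (cong all (trans (p (liftᶠ f) (liftᶠ g)) (ren-cong (λ { zero → refl ; (suc i) → refl }) A)))
        (sym (ren-all (f ∘ g) A)))))
    A f g

  at : (ℕ → Fin n) → Inst → Formula 𝓖 n
  at h (m , A , ν) = ren (h ∘ lookup ν) A

  body : (ℕ → Fin n) → Vec ℕ m → Formula 𝓖 (suc m) → Formula 𝓖 (suc n)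
  body h ν A = substFormula (lift (var ∘ h ∘ lookup ν)) A

  body-[] : ∀ (h : ℕ → Fin n) c (ν : Vec ℕ m) A → body h ν A [ var (h c) ] ≡ ren (h ∘ lookup (c ∷ ν)) A
  body-[] h c ν A = trans ([]-ren (body h ν A) (h c))
    (trans (cong (ren (inst (h c))) (substFormula-cong {τ = var ∘ liftᶠ (h ∘ lookup ν)}
        (λ { zero → refl ; (suc i) → refl }) A))
      (trans (ren-∘ (inst (h c)) (liftᶠ (h ∘ lookup ν)) A) (ren-cong (λ { zero → refl ; (suc i) → refl }) A)))

  vecBound : (ν : Vec ℕ k) → ∃ λ c → ∀ i → lookup ν i < c
  vecBound []      = 0 , λ ()
  vecBound (x ∷ ν) = let c , p = vecBound ν in
    suc x ⊔ c , λ { zero → m≤m⊔n (suc x) c ; (suc i) → <-≤-trans (p i) (m≤n⊔m (suc x) c) }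

  bounded : (Γ : List Inst) → ∃ λ b → ∀ {n A ν} → (n , A , ν) ∈ Γ → ∀ i → lookup ν i < b
  bounded []                = 0 , λ ()
  bounded ((n , A , ν) ∷ Γ) = let b , p = bounded Γ ; c , q = vecBound ν in
    b ⊔ c , λ { (here refl) i → <-≤-trans (q i) (m≤n⊔m b c) ; (there s) i → <-≤-trans (p s i) (m≤m⊔n b c) }

  updated : ∀ {A : Set} → ℕ → A → (ℕ → A) → ℕ → A
  updated c a h d with d ≟ c
  ... | yes _ = a
  ... | no _  = h d

  updated-≡ : ∀ {A : Set} c (a : A) h → updated c a h c ≡ a
  updated-≡ c a h with c ≟ c
  ... | yes _ = refl
  ... | no c≢c = ⊥-elim (c≢c refl)

  updated-< : ∀ {A : Set} {c d} (a : A) h → d < c → updated c a h d ≡ h d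
  updated-< {c = c} {d} a h d<c with d ≟ c
  ... | yes refl = ⊥-elim (<-irrefl refl d<c)
  ... | no _     = refl

  clashed : ∀ {Γ} (h : ℕ → Fin n) → Clash Γ → List.map (at h) Γ ⊢ ⊥̇
  clashed {n} {Γ} h c = run c
    where
    use : ∀ {I} → I ∈ Γ → List.map (at h) Γ ⊢ at h I
    use p = hyp (List.∈-map⁺ (at h) p)
    renamed : ∀ {m k} {A : Formula 𝓖 m} {κ} {ν : Vec ℕ k} (f : Fin m → Fin k) → (∀ i → lookup ν (f i) ≡ lookup κ i) →
              at h (k , ren f A , ν) ≡ at h (m , A , κ)
    renamed {A = A} {ν = ν} f e = trans (ren-∘ (h ∘ lookup ν) f A) (ren-cong (λ i → cong h (e i)) A)
    run : Clash Γ → List.map (at h) Γ ⊢ ⊥̇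
    run (⊥ᶜ p)       = use p
    run (¬ᶜ p q)     = ⇒E (use q) (use p)
    run (⇒ᶜ p q r)   = ⇒E (use r) (⇒E (use p) (use q))
    run (⇒ᶜ₁ p q)    = ⇒E (use p) (⇒I (raa (⇒E (⊢-weaken (there ∘ there) (use q)) (hyp (there (here refl))))))
    run (⇒ᶜ₂ p q)    = ⇒E (use p) (⇒I (⊢-weaken there (use q)))
    run (∀ᶜ {A = A} {ν} {c} p q) = ⇒E (use q) (subst (_ ⊢_) (body-[] h c ν A) (∀E (use p) (var (h c))))
    run (≐ᶜ p)       = ⇒E (use p) ≐I
    run (≐ᶜ′ {A = A} {ν} {c} {d} p q r) = ⇒E (use r) (subst (_ ⊢_) (body-[] h d ν A)
      (≐E (body h ν A) (use p) (subst (_ ⊢_) (sym (body-[] h c ν A)) (use q))))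
    run (renᶜ {A = A} {κ} {ν} f e p q)  = ⇒E (use q) (subst (_ ⊢_) (renamed {A = A} {κ} {ν} f e) (use p))
    run (renᶜ′ {A = A} {κ} {ν} f e p q) = ⇒E (use q) (subst (_ ⊢_) (sym (renamed {A = A} {κ} {ν} f e)) (use p))

  -- Syntactic consistency: the constants are read as variables.
  module _ (T : Pred (Sentence 𝓖) 0ℓ) where

    closed : Sentence 𝓖 → Formula 𝓖 n
    closed = ren λ ()

    Refutes : (ℕ → Fin n) → List Inst → Set
    Refutes h Γ = ∃ λ Δ → All T Δ × List.map closed Δ ++ List.map (at h) Γ ⊢ ⊥̇

    -- The number of variables may differ from list to list, because each new witness is read as an
    -- additional variable.
    Consistent : List Inst → Set
    Consistent Γ = ∃₂ λ n (h : ℕ → Fin n) → ¬ Refutes h Γ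

    private
      swap : ∀ {A : Formula 𝓖 n} {Θ} Δ → Δ ++ A ∷ Θ ⊆ A ∷ (Δ ++ Θ)
      swap []      p         = p
      swap (B ∷ Δ) (here e)  = there (here e)
      swap (B ∷ Δ) (there p) with swap Δ p
      ... | here e  = here e
      ... | there q = there (there q)

      left : ∀ {Θ : List (Formula 𝓖 n)} Δ₁ Δ₂ → List.map closed Δ₁ ++ Θ ⊆ List.map closed (Δ₁ ++ Δ₂) ++ Θ
      left []       Δ₂ p         = List.∈-++⁺ʳ (List.map closed Δ₂) p
      left (B ∷ Δ₁) Δ₂ (here e)  = here e
      left (B ∷ Δ₁) Δ₂ (there p) = there (left Δ₁ Δ₂ p)

      right : ∀ {Θ : List (Formula 𝓖 n)} Δ₁ Δ₂ → List.map closed Δ₂ ++ Θ ⊆ List.map closed (Δ₁ ++ Δ₂) ++ Θ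
      right []       Δ₂ p = p
      right (B ∷ Δ₁) Δ₂ p = there (right Δ₁ Δ₂ p)

      closed-weaken : ∀ A → weaken (closed {n} A) ≡ closed A
      closed-weaken A = trans (ren-∘ suc (λ ()) A) (ren-cong (λ ()) A)

    refute-both : ∀ (h : ℕ → Fin n) {Γ m} (A : Formula 𝓖 m) ν →
                  Refutes h ((m , A , ν) ∷ Γ) → Refutes h ((m , ¬̇ A , ν) ∷ Γ) → Refutes h Γ
    refute-both h A ν (Δ₁ , t₁ , d₁) (Δ₂ , t₂ , d₂) = Δ₁ ++ Δ₂ , All.++⁺ t₁ t₂ ,
      ⇒E (⊢-weaken (left Δ₁ Δ₂) (⇒I (⊢-weaken (swap (List.map closed Δ₁)) d₁)))
         (⊢-weaken (right Δ₁ Δ₂) (raa (⊢-weaken (swap (List.map closed Δ₂)) d₂)))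

    -- The new constant lies above all others and can be read as a fresh variable 0. A refutation
    -- then proves `A` of that variable, and generalising contradicts the denial of `all A`.
    refute-witness : ∀ (h : ℕ → Fin n) {Γ m} (A : Formula 𝓖 (suc m)) ν c →
                     (∀ {k B κ} → (k , B , κ) ∈ (m , ¬̇ all A , ν) ∷ Γ → ∀ i → lookup κ i < c) →
                     Refutes (updated c zero (suc ∘ h)) ((suc m , ¬̇ A , c ∷ ν) ∷ (m , ¬̇ all A , ν) ∷ Γ) →
                     Refutes h ((m , ¬̇ all A , ν) ∷ Γ)
    refute-witness {n} h {Γ} {m} A ν c fresh (Δ , t , d) = Δ , t ,
      ⇒E (hyp (List.∈-++⁺ʳ (List.map closed Δ) (here refl)))
         (∀I (subst₂ _⊢_ context formula (raa (⊢-weaken (swap (List.map closed Δ)) d))))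
      where
      h′ = updated c zero (suc ∘ h)
      Γ₀ = (m , ¬̇ all A , ν) ∷ Γ
      entry : ∀ {I} → I ∈ Γ₀ → at h′ I ≡ weaken (at h I)
      entry {k , B , κ} p = sym (trans (ren-∘ suc (h ∘ lookup κ) B)
          (ren-cong (λ i → sym (updated-< zero (suc ∘ h) (fresh p i))) B))
      context : List.map closed Δ ++ List.map (at h′) Γ₀ ≡ List.map weaken (List.map closed Δ ++ List.map (at h) Γ₀)
      context = trans (cong₂ _++_
          (trans (List.map-cong (λ B → sym (closed-weaken B)) Δ) (List.map-∘ Δ))
          (trans (List.map-cong-local (All.tabulate entry)) (List.map-∘ Γ₀)))
        (sym (List.map-++ weaken (List.map closed Δ) (List.map (at h) Γ₀)))
      formula : ren (h′ ∘ lookup (c ∷ ν)) A ≡ body h ν A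
      formula = substFormula-cong (λ { zero → cong var (updated-≡ c zero (suc ∘ h))
                                     ; (suc i) → cong var (updated-< zero (suc ∘ h) (fresh (here refl) i)) }) A

    consistency : ¬ (T ⊢ᵀ ⊥̇) → ConsistencyProperty Consistent
    consistency con = record
      -- Constants have to be read as some variable, so the scope is 1 even for the empty list; the
      -- rule `nonempty` brings a refutation back to sentences.
      { start   = 1 , (λ _ → zero) , λ { (Δ , t , d) → con (Δ , t , nonempty (subst (_⊢ ⊥̇) (context Δ) d)) }
      ; decide  = choose-sign
      ; witness = wit
      ; noClash = λ { {Γ} (n , h , c) k → c ([] , [] , clashed h k) }
      }
      where
      context : ∀ Δ → List.map (closed {1}) Δ ++ [] ≡ List.map weaken Δ
      context Δ = trans (List.++-identityʳ _) (List.map-cong (ren-cong λ ()) Δ)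
      choose-sign : ∀ {Γ n} A ν → Consistent Γ → Consistent ((n , A , ν) ∷ Γ) ⊎ Consistent ((n , ¬̇ A , ν) ∷ Γ)
      choose-sign {Γ} {n} A ν (m , h , c) with em {Refutes h ((n , A , ν) ∷ Γ)}
      ... | no p  = inj₁ (m , h , p)
      ... | yes p = inj₂ (m , h , λ q → c (refute-both h A ν p q))
      wit : ∀ {Γ n A ν} → Consistent ((n , ¬̇ all A , ν) ∷ Γ) → ∃ λ c →
          Consistent ((suc n , ¬̇ A , c ∷ ν) ∷ (n , ¬̇ all A , ν) ∷ Γ)
      wit {Γ} {n} {A} {ν} (m , h , p) = let c , q = bounded ((n , ¬̇ all A , ν) ∷ Γ) in
        c , suc m , updated c zero (suc ∘ h) , λ r → p (refute-witness h A ν c q r)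

    axiom-consistent : ∀ {A ν Γ} → T A → Consistent Γ → ¬ (0 , ¬̇ A , ν) ∈ Γ
    axiom-consistent {A} t (n , h , c) p = c (A ∷ [] , t ∷ [] ,
      ⇒E (hyp (there (List.∈-map⁺ (at h) p))) (hyp (here (ren-cong (λ ()) A))))

  SatInst : (M : Structure 𝓖) → (ℕ → Structure.Carrier M) → Inst → Set
  SatInst M h (n , A , ν) = Satisfies M (map h ν) A

  -- Finite satisfiability in M, with p asserted of the constants 0, …, n₀ - 1.
  module _ (M : Structure 𝓖) {n₀ : ℕ} (p : Pred (Formula 𝓖 n₀) 0ℓ) where
    open Structure M

    FinSat : List Inst → Set
    FinSat Γ = ∀ Δ → All p Δ → ∃ λ h → (∀ {I} → I ∈ Γ → SatInst M h I) × All (Satisfies M (map h (tabulate toℕ))) Δ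

    private
      map-cong-lookup : ∀ {h h′ : ℕ → Carrier} (ν : Vec ℕ k) → (∀ i → h (lookup ν i) ≡ h′ (lookup ν i)) → map h ν ≡ map h′ ν
      map-cong-lookup []      e = refl
      map-cong-lookup (c ∷ ν) e = cong₂ _∷_ (e zero) (map-cong-lookup ν (e ∘ suc))

      renamed : ∀ h {m k} {A : Formula 𝓖 m} {κ} {ν : Vec ℕ k} (f : Fin m → Fin k) → (∀ i → lookup ν (f i) ≡ lookup κ i) →
                Satisfies M (map h ν) (ren f A) ⟷ Satisfies M (map h κ) A
      renamed h {A = A} {κ} {ν} f e = sat-subst M (λ i →
        trans (Vec.lookup-map (f i) h ν) (trans (cong h (e i)) (sym (Vec.lookup-map i h κ)))) A

    finSat-noClash : ∀ {Γ} → FinSat Γ → ¬ Clash Γ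
    finSat-noClash {Γ} fs c with fs [] []
    ... | h , s , _ = run c
      where
      run : Clash Γ → ⊥
      run (⊥ᶜ p)     = s p
      run (¬ᶜ p q)   = s q (s p)
      run (⇒ᶜ p q r) = s r (s p (s q))
      run (⇒ᶜ₁ p q)  = s p (λ a → ⊥-elim (s q a))
      run (⇒ᶜ₂ p q)  = s p (λ _ → s q)
      run (∀ᶜ p q)   = s q (s p _)
      run (≐ᶜ p)     = s p refl
      run (≐ᶜ′ {A = A} {ν} p q r) = s r (subst (λ a → Satisfies M (a ∷ map h ν) A) (s p) (s q))
      run (renᶜ {A = A} {κ} {ν} f e p q)  = s q (proj₁ (renamed h {A = A} {κ} {ν} f e) (s p))
      run (renᶜ′ {A = A} {κ} {ν} f e p q) = s q (proj₂ (renamed h {A = A} {κ} {ν} f e) (s p))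

    finSat : (∀ Δ → All p Δ → ∃ λ ρ → All (Satisfies M ρ) Δ) → ConsistencyProperty FinSat
    finSat fs = record { start = start ; decide = choose-sign ; witness = wit ; noClash = finSat-noClash }
      where
      start : FinSat []
      start Δ t with ρ , s ← fs Δ t = h , (λ ()) , subst (λ ρ → All (Satisfies M ρ) Δ) (sym h-ρ) s
        where
        h : ℕ → Carrier
        h c with c <? n₀
        ... | yes c<n = lookup ρ (fromℕ< c<n)
        ... | no _    = point
        h-toℕ : ∀ i → h (toℕ i) ≡ lookup ρ i
        h-toℕ i with toℕ i <? n₀
        ... | yes i<n = cong (lookup ρ) (Fin.fromℕ<-toℕ i i<n)
        ... | no i≮n  = ⊥-elim (i≮n (Fin.toℕ<n i))
        h-ρ : map h (tabulate toℕ) ≡ ρ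
        h-ρ = trans (sym (Vec.tabulate-∘ h toℕ)) (trans (Vec.tabulate-cong h-toℕ) (Vec.tabulate∘lookup ρ))
      choose-sign : ∀ {Γ n} A ν → FinSat Γ → FinSat ((n , A , ν) ∷ Γ) ⊎ FinSat ((n , ¬̇ A , ν) ∷ Γ)
      choose-sign {Γ} {n} A ν c with em {FinSat ((n , A , ν) ∷ Γ)}
      ... | yes q = inj₁ q
      -- If `Δ` were unsatisfiable together with the negation, any assignment for `Δ` and `Δ₁`
      -- jointly would satisfy `A`; as `Δ₁` is arbitrary, adding `A` would have been possible.
      ... | no q  = inj₂ λ Δ t → stable λ none → q λ Δ₁ t₁ → choice Δ t none Δ₁ t₁ (c (Δ ++ Δ₁) (All.++⁺ t t₁))
        where
        choice : ∀ Δ t → ¬ (∃ λ h → (∀ {I} → I ∈ (n , ¬̇ A , ν) ∷ Γ → SatInst M h I) ×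
            All (Satisfies M (map h (tabulate toℕ))) Δ) →
                 ∀ Δ₁ t₁ → (∃ λ h → (∀ {I} → I ∈ Γ → SatInst M h I) × All (Satisfies M (map h (tabulate toℕ))) (Δ ++ Δ₁)) →
                 ∃ λ h → (∀ {I} → I ∈ (n , A , ν) ∷ Γ → SatInst M h I) × All (Satisfies M (map h (tabulate toℕ))) Δ₁
        choice Δ t none Δ₁ t₁ (h , s , u) = h ,
          (λ { (here refl) → stable (λ r → none (h , (λ { (here refl) → r ; (there p) → s p }) , All.++⁻ˡ Δ u)) ;
              (there p) → s p }) ,
          All.++⁻ʳ Δ u
      wit : ∀ {Γ n A ν} → FinSat ((n , ¬̇ all A , ν) ∷ Γ) → ∃ λ c → FinSat ((suc n , ¬̇ A , c ∷ ν) ∷ (n , ¬̇ all A , ν) ∷ Γ)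
      wit {Γ} {n} {A} {ν} fs = c , λ Δ t → extend Δ (fs Δ t)
        where
        Γ₀ = (n , ¬̇ all A , ν) ∷ Γ
        -- Beyond the constants of `Γ₀` and also beyond 0, ..., n₀ - 1, which stand for the
        -- variables of the type.
        c = proj₁ (bounded Γ₀) ⊔ n₀
        fresh : ∀ {n A ν} → (n , A , ν) ∈ Γ₀ → ∀ i → lookup ν i < c
        fresh q i = <-≤-trans (proj₂ (bounded Γ₀) q i) (m≤m⊔n (proj₁ (bounded Γ₀)) n₀)
        extend : ∀ Δ → (∃ λ h → (∀ {I} → I ∈ Γ₀ → SatInst M h I) × All (Satisfies M (map h (tabulate toℕ))) Δ) →
                 ∃ λ h → (∀ {I} → I ∈ (suc n , ¬̇ A , c ∷ ν) ∷ Γ₀ → SatInst M h I) ×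
                     All (Satisfies M (map h (tabulate toℕ))) Δ
        extend Δ (h , s , u) with em {∃ λ a → ¬ Satisfies M (a ∷ map h ν) A}
        ... | no none     = ⊥-elim (s (here refl) (λ a → stable (λ q → none (a , q))))
        ... | yes (a , q) = h′ , (λ { (here refl) →
            subst₂ (λ a ρ → ¬ Satisfies M (a ∷ ρ) A) (sym (updated-≡ c a h)) (sym (old (fresh (here refl)))) q
                                    ; (there r) → kept r (s r) }) ,
                            subst (λ ρ → All (Satisfies M ρ) Δ) (sym (old base)) u
          where
          h′ = updated c a h
          old : ∀ {k} {ν : Vec ℕ k} → (∀ i → lookup ν i < c) → map h′ ν ≡ map h ν
          old {ν = ν} b = map-cong-lookup ν (λ i → updated-< a h (b i))
          kept : ∀ {I} → I ∈ Γ₀ → SatInst M h I → SatInst M h′ I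
          kept {k , B , κ} r s = subst (λ ρ → Satisfies M ρ B) (sym (old (fresh r))) s
          base : ∀ i → lookup (tabulate {n = n₀} toℕ) i < c
          base i = subst (_< c) (sym (Vec.lookup∘tabulate toℕ i)) (<-≤-trans (Fin.toℕ<n i) (m≤n⊔m (proj₁ (bounded Γ₀)) n₀))

    finSat-true : ∀ {A Γ ν} → Satisfies M [] A → FinSat Γ → ¬ (0 , ¬̇ A , ν) ∈ Γ
    finSat-true {ν = []} t fs q with fs [] []
    ... | h , s , _ = s q t

    finSat-type : ∀ {A Γ} → p A → FinSat Γ → ¬ (n₀ , ¬̇ A , tabulate toℕ) ∈ Γ
    finSat-type {A} t fs q with fs (A ∷ []) (t ∷ [])
    ... | h , s , (u ∷ []) = s q u

  -- The Ryll-Nardzewski theorem.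

  Infinite Finitary : Pred (Sentence 𝓖) 0ℓ → Set
  Infinite T = ∀ n → T (moreThan n)
  Finitary T = ∀ n → ∃ λ (Δ : List (Formula 𝓖 n)) → ∀ ψ → ∃ λ δ → δ ∈ Δ × T (allⁿ n (iff ψ δ))

  module _ {T : Pred (Sentence 𝓖) 0ℓ} (T-complete : IsCompleteTheory T) {M : Structure 𝓖} (M⊨T : M ⊨ T) where

    truths : ∀ A → T A ⟷ Satisfies M [] A
    truths A = M⊨T A , λ s → case IsCompleteTheory.complete T-complete A of λ
      { (inj₁ t) → t ; (inj₂ t) → ⊥-elim (M⊨T (¬̇ A) t s) }

  countablyInfinite⇒moreThan : (M : Structure 𝓖) → CountablyInfinite M → ∀ n → Satisfies M [] (moreThan n)
  countablyInfinite⇒moreThan M c n = proj₂ (Sat.tr-moreThan M n) fresh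
    where
    open Inverse c
    fresh : ∀ ρ → ∃ λ a → ∀ i → a ≢ lookup ρ i
    fresh ρ = let b , p = vecBound (map to ρ) in from b , λ i e →
      <-irrefl (trans (Vec.lookup-map i to ρ) (trans (cong to (sym e)) (strictlyInverseˡ b))) (p i)

  moreThan⇒¬finite : (M : Structure 𝓖) → (∀ n → Satisfies M [] (moreThan n)) → ¬ Finite M
  moreThan⇒¬finite M inf (n , c) =
    let a , p = proj₁ (Sat.tr-moreThan M n) (inf n) (tabulate from) in
    p (to a) (sym (trans (Vec.lookup∘tabulate from (to a)) (strictlyInverseʳ a)))
    where open Inverse c

  iso-sat : ∀ {M N : Structure 𝓖} (i : M ≅ N) (A : Formula 𝓖 n) ρ →
            Satisfies M ρ A ⟷ Satisfies N (map (Inverse.to (_≅_.bijection i)) ρ) A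
  iso-sat {M = M} {N} iso = formulaElim (λ A → ∀ ρ → Satisfies M ρ A ⟷ Satisfies N (map to ρ) A)
    (λ ρ → ⟷-refl)
    (λ i j ρ → (λ e → trans (Vec.lookup-map i to ρ) (trans (cong to e) (sym (Vec.lookup-map j to ρ)))) ,
               (λ e → injective (trans (sym (Vec.lookup-map i to ρ)) (trans e (Vec.lookup-map j to ρ)))))
    (λ i j ρ → ⟷-trans (Equivalence.to (rel-≅ zero _) , Equivalence.from (rel-≅ zero _))
       (⟷-≡ (cong₂ (λ a b → Structure.relᴹ N zero (a ∷ b ∷ [])) (sym (Vec.lookup-map i to ρ))
           (sym (Vec.lookup-map j to ρ)))))
    (λ p q ρ → ⟷-→ (p ρ) (q ρ))
    (λ {_} {A} p ρ → (λ s b → subst (λ b → Satisfies N (b ∷ map to ρ) A) (strictlyInverseˡ b)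
        (proj₁ (p (from b ∷ ρ)) (s (from b)))) ,
                     (λ s a → proj₂ (p (a ∷ ρ)) (s (to a))))
    where
    open _≅_ iso
    open Inverse bijection
    injective : ∀ {x y} → to x ≡ to y → x ≡ y
    injective {x} {y} e = trans (sym (strictlyInverseʳ x)) (trans (cong from e) (strictlyInverseʳ y))

  module BackAndForth {A B : Set} (cA : A ↔ ℕ) (cB : B ↔ ℕ) (P : List (A × B) → Set) (start : P [])
    (forth : ∀ {l} → P l → ∀ a → ∃ λ b → P ((a , b) ∷ l)) (back : ∀ {l} → P l → ∀ b → ∃ λ a → P ((a , b) ∷ l))
    (functional : ∀ {l p q} → P l → p ∈ l → q ∈ l → (proj₁ p ≡ proj₁ q) ⟷ (proj₂ p ≡ proj₂ q)) where

    private
      module A = Inverse cA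
      module B = Inverse cB

    stepAB : ∀ i l → P l → ∃ λ b → ∃ λ a → P ((a , B.from i) ∷ (A.from i , b) ∷ l)
    stepAB i l p = let b , q = forth p (A.from i) ; a , r = back q (B.from i) in b , a , r

    run : ℕ → ∃ P
    run zero    = [] , start
    run (suc i) = let l , p = run i ; b , a , r = stepAB i l p in _ , r

    runs : ℕ → List (A × B)
    runs i = proj₁ (run i)

    runs-mono : ∀ {i j} → i ≤ j → runs i ⊆ runs j
    runs-mono {j = zero}  z≤n p = p
    runs-mono {i} {suc j} i≤j p with m≤n⇒m<n∨m≡n i≤j
    ... | inj₂ refl       = p
    ... | inj₁ (s≤s i≤j′) = there (there (runs-mono i≤j′ p))

    -- The partner chosen at the stage that handles the argument. By `functional` every list is a
    -- partial injection, and since the stages are cumulative the two maps are mutually inverse.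
    f : A → B
    f a = proj₁ (stepAB (A.to a) (runs (A.to a)) (proj₂ (run (A.to a))))

    g : B → A
    g b = proj₁ (proj₂ (stepAB (B.to b) (runs (B.to b)) (proj₂ (run (B.to b)))))

    f-run : ∀ a → ∃ λ i → (a , f a) ∈ runs i
    f-run a = suc (A.to a) , there (here (cong (_, f a) (sym (A.strictlyInverseʳ a))))

    g-run : ∀ b → ∃ λ i → (g b , b) ∈ runs i
    g-run b = suc (B.to b) , here (cong (g b ,_) (sym (B.strictlyInverseʳ b)))

    together : ∀ {p q} → (∃ λ i → p ∈ runs i) → (∃ λ i → q ∈ runs i) → ∃ λ l → P l × p ∈ l × q ∈ l
    together (i , p) (j , q) = _ , proj₂ (run (i ⊔ j)) , runs-mono (m≤m⊔n i j) p , runs-mono (m≤n⊔m i j) q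

    bijection : A ↔ B
    bijection = mk↔ₛ′ f g
      (λ b → let l , p , q , r = together (f-run (g b)) (g-run b) in proj₁ (functional p q r) refl)
      (λ a → let l , p , q , r = together (g-run (f a)) (f-run a) in proj₂ (functional p q r) refl)

  module _ (M N : Structure 𝓖)
    (finM : ∀ n → ∃ λ (Δ : List (Formula 𝓖 n)) → ∀ ψ → ∃ λ δ → δ ∈ Δ ×
            (∀ ρ → Satisfies M ρ ψ ⟷ Satisfies M ρ δ) × (∀ ρ → Satisfies N ρ ψ ⟷ Satisfies N ρ δ)) where

    -- Up to equivalence there are finitely many formulas, so the conjunction of those true of
    -- `a ∷ ρ` with the negations of the others isolates its type. That this conjunction has a
    -- solution is itself a formula about the tuple, hence transfers to `N`.
    extendType : ∀ {n} ρ σ → (∀ (ψ : Formula 𝓖 n) → Satisfies M ρ ψ ⟷ Satisfies N σ ψ) → ∀ a → ∃ λ b →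
                 ∀ (ψ : Formula 𝓖 (suc n)) → Satisfies M (a ∷ ρ) ψ ⟷ Satisfies N (b ∷ σ) ψ
    extendType {n} ρ σ same a = b , λ ψ → let δ , p , m , m′ = f ψ in
        ⟷-trans (m (a ∷ ρ)) (⟷-trans (signed-same δ (All.lookup sat-N (List.∈-map⁺ signed p))) (⟷-sym (m′ (b ∷ σ))))
      where
      Δ = proj₁ (finM (suc n))
      f = proj₂ (finM (suc n))
      signed : Formula 𝓖 (suc n) → Formula 𝓖 (suc n)
      signed δ with em {Satisfies M (a ∷ ρ) δ}
      ... | yes _ = δ
      ... | no _  = ¬̇ δ
      signed-M : ∀ δ → Satisfies M (a ∷ ρ) (signed δ)
      signed-M δ with em {Satisfies M (a ∷ ρ) δ}
      ... | yes s = s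
      ... | no s  = s
      signed-same : ∀ δ {b} → Satisfies N (b ∷ σ) (signed δ) → Satisfies M (a ∷ ρ) δ ⟷ Satisfies N (b ∷ σ) δ
      signed-same δ t with em {Satisfies M (a ∷ ρ) δ}
      ... | yes s = (λ _ → t) , (λ _ → s)
      ... | no s  = (⊥-elim ∘ s) , (⊥-elim ∘ t)
      conj = ⋀ (List.map signed Δ)
      found = proj₁ (Sat.tr-∃ N conj) (proj₁ (same (∃̇ conj)) (proj₂ (Sat.tr-∃ M conj)
        (a , proj₂ (Sat.tr-⋀ M (List.map signed Δ)) (All.map⁺ (All.tabulate (λ {δ} _ → signed-M δ))))))
      b = proj₁ found
      sat-N : All (Satisfies N (b ∷ σ)) (List.map signed Δ)
      sat-N = proj₁ (Sat.tr-⋀ N (List.map signed Δ)) (proj₂ found)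

  module _ {T : Pred (Sentence 𝓖) 0ℓ} (T-complete : IsCompleteTheory T) where
    open IsCompleteTheory T-complete

    finitary-iso : Finitary T → ∀ M N → M ⊨ T → CountablyInfinite M → N ⊨ T → CountablyInfinite N → M ≅ N
    finitary-iso fin M N M⊨T cM N⊨T cN = record
      { bijection = BF.bijection
      ; fun-≅     = λ ()
      ; rel-≅     = λ { zero (a ∷ b ∷ []) →
          let l , p , q , r = BF.together (BF.f-run a) (BF.f-run b) ; s , t = related p q r in mk⇔ s t }
      }
      where
      module MN = Structure
      _×ᴹ_ : Set
      _×ᴹ_ = MN.Carrier M × MN.Carrier N
      both : ∀ M N → M ⊨ T → N ⊨ T → ∀ n → ∃ λ (Δ : List (Formula 𝓖 n)) → ∀ ψ → ∃ λ δ → δ ∈ Δ ×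
             (∀ ρ → Satisfies M ρ ψ ⟷ Satisfies M ρ δ) × (∀ ρ → Satisfies N ρ ψ ⟷ Satisfies N ρ δ)
      both M N m n k = let Δ , f = fin k in Δ , λ ψ → let δ , p , t = f ψ in δ , p ,
        (λ ρ → proj₁ (Sat.tr-iff M ψ δ) (proj₁ (Sat.tr-allⁿ M k (iff ψ δ)) (m _ t) ρ)) ,
        (λ ρ → proj₁ (Sat.tr-iff N ψ δ) (proj₁ (Sat.tr-allⁿ N k (iff ψ δ)) (n _ t) ρ))
      firsts : (l : List _×ᴹ_) → Vec (MN.Carrier M) (List.length l)
      firsts []            = []
      firsts ((a , _) ∷ l) = a ∷ firsts l
      seconds : (l : List _×ᴹ_) → Vec (MN.Carrier N) (List.length l)
      seconds []            = []
      seconds ((_ , b) ∷ l) = b ∷ seconds l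
      P : List _×ᴹ_ → Set
      P l = ∀ ψ → Satisfies M (firsts l) ψ ⟷ Satisfies N (seconds l) ψ
      index : ∀ {p l} → p ∈ l → ∃ λ i → lookup (firsts l) i ≡ proj₁ p × lookup (seconds l) i ≡ proj₂ p
      index (here refl) = zero , refl , refl
      index (there p)   = let i , e = index p in suc i , e
      functional : ∀ {l p q} → P l → p ∈ l → q ∈ l → (proj₁ p ≡ proj₁ q) ⟷ (proj₂ p ≡ proj₂ q)
      functional h p q = let i , e , e′ = index p ; j , d , d′ = index q in
        ⟷-trans (⟷-≡ (cong₂ _≡_ (sym e) (sym d))) (⟷-trans (h (var i ≐ var j)) (⟷-≡ (cong₂ _≡_ e′ d′)))
      related : ∀ {l a b c d} → P l → (a , b) ∈ l → (c , d) ∈ l →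
                MN.relᴹ M zero (a ∷ c ∷ []) ⟷ MN.relᴹ N zero (b ∷ d ∷ [])
      related h p q = let i , e , e′ = index p ; j , d , d′ = index q in
        ⟷-trans (⟷-≡ (cong₂ (λ a c → MN.relᴹ M zero (a ∷ c ∷ [])) (sym e) (sym d)))
          (⟷-trans (h (edge i j)) (⟷-≡ (cong₂ (λ a c → MN.relᴹ N zero (a ∷ c ∷ [])) e′ d′)))
      start : P []
      start ψ = ⟷-trans (⟷-sym (truths T-complete M⊨T ψ)) (truths T-complete N⊨T ψ)
      forth : ∀ {l} → P l → ∀ a → ∃ λ b → P ((a , b) ∷ l)
      forth {l} h a = extendType M N (both M N M⊨T N⊨T) (firsts l) (seconds l) h a
      back : ∀ {l} → P l → ∀ b → ∃ λ a → P ((a , b) ∷ l)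
      back {l} h b = let a , k = extendType N M (both N M N⊨T M⊨T) (seconds l) (firsts l) (⟷-sym ∘ h) b in a , ⟷-sym ∘ k
      module BF = BackAndForth cM cN P start forth back functional

    infinite-model : Infinite T → ∃ λ (M : Structure 𝓖) → M ⊨ T × CountablyInfinite M
    infinite-model inf = Mod.model , (λ A t → proj₂ (Mod.truth A []) (T⊆G A t)) , mk↔ₛ′ id id (λ _ → refl) (λ _ → refl)
      where
      module Gen = Generic (consistency T consistent) (λ _ _ → ⊤) (λ i Γ p → Γ , p , id , tt)
      T⊆G : ∀ A → T A → Gen.G (0 , A , [])
      T⊆G A t = stable (λ q → let i , p = Gen.G-¬ q in axiom-consistent T t (proj₂ (Gen.chain i)) p)
      module Mod = Gen.Model (λ n → T⊆G (moreThan n) (inf n))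

    infinite-finitary⇒ωCategorical : Infinite T → Finitary T → ωCategorical T
    infinite-finitary⇒ωCategorical inf fin = record
      { existence  = infinite-model inf
      ; uniqueness = finitary-iso fin
      ; noFinite   = λ M M⊨T → moreThan⇒¬finite M (λ n → M⊨T _ (inf n))
      }

  exs : ∀ N → Formula 𝓖 (N + n) → Formula 𝓖 n
  exs zero    A = A
  exs (suc N) A = exs N (∃̇ A)

  sat-exs : ∀ (M : Structure 𝓖) N (A : Formula 𝓖 (N + n)) ρ →
            Satisfies M ρ (exs N A) ⟷ (∃ λ β → Satisfies M (β Data.Vec.++ ρ) A)
  sat-exs M zero    A ρ = (λ s → [] , s) , (λ { ([] , s) → s })
  sat-exs M (suc N) A ρ = ⟷-trans (sat-exs M N (∃̇ A) ρ)
    ((λ { (β , s) → let b , t = proj₁ (Sat.tr-∃ M A) s in b ∷ β , t }) ,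
     (λ { (b ∷ β , s) → β , proj₂ (Sat.tr-∃ M A) (b , s) }))

  clip : ∀ N → ℕ → Fin (suc N)
  clip N c with c <? suc N
  ... | yes c<N = fromℕ< c<N
  ... | no _    = zero

  toℕ-clip : ∀ N {c} → c < suc N → toℕ (clip N c) ≡ c
  toℕ-clip N {c} c<N with c <? suc N
  ... | yes p = Fin.toℕ-fromℕ< p
  ... | no q  = ⊥-elim (q c<N)

  module _ (M : Structure 𝓖) (Γ : List Inst) {n : ℕ} (ν : Vec ℕ n) where
    open Structure M

    -- For the omission of types: condenses the commitments made so far into a formula about the
    -- constants `ν` alone. The constants become existentially quantified variables, tied to the
    -- free variables by equations.
    isolating : ∃ λ (θ : Formula 𝓖 n) → ∀ ρ →
      Satisfies M ρ θ ⟷ (∃ λ (h : ℕ → Carrier) → (∀ {I} → I ∈ Γ → SatInst M h I) × map h ν ≡ ρ)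
    isolating = exs (suc N) (⋀ (facts ++ equations)) , λ ρ →
        ⟷-trans (sat-exs M (suc N) (⋀ (facts ++ equations)) ρ) (to′ ρ , from′ ρ)
      where
      N = proj₁ (bounded Γ) ⊔ proj₁ (vecBound ν)
      constant : ℕ → Fin (suc N + n)
      constant c = clip N c Fin.↑ˡ n
      equation : Fin n → Formula 𝓖 (suc N + n)
      equation i = var (constant (lookup ν i)) ≐ var (suc N Fin.↑ʳ i)
      facts equations : List (Formula 𝓖 (suc N + n))
      facts     = List.map (at constant) Γ
      equations = List.map equation (List.allFin n)
      module _ (β : Vec Carrier (suc N)) (ρ : Vec Carrier n) (h : ℕ → Carrier) where
        fact-sat : ∀ {k A} {κ : Vec ℕ k} → (∀ i → lookup β (clip N (lookup κ i)) ≡ h (lookup κ i)) →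
                   Satisfies M (β Data.Vec.++ ρ) (at constant (k , A , κ)) ⟷ Satisfies M (map h κ) A
        fact-sat {A = A} {κ} e = sat-subst M (λ i →
          trans (Vec.lookup-++ˡ β ρ (clip N (lookup κ i))) (trans (e i) (sym (Vec.lookup-map i h κ)))) A
        equation-sat : ∀ i → lookup β (clip N (lookup ν i)) ≡ h (lookup ν i) →
                       Satisfies M (β Data.Vec.++ ρ) (equation i) ⟷ (lookup (map h ν) i ≡ lookup ρ i)
        equation-sat i e = ⟷-≡ (cong₂ _≡_
          (trans (Vec.lookup-++ˡ β ρ (clip N (lookup ν i))) (trans e (sym (Vec.lookup-map i h ν))))
          (Vec.lookup-++ʳ β ρ i))
      to′ : ∀ ρ → (∃ λ β → Satisfies M (β Data.Vec.++ ρ) (⋀ (facts ++ equations))) →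
            ∃ λ h → (∀ {I} → I ∈ Γ → SatInst M h I) × map h ν ≡ ρ
      to′ ρ (β , s) = h ,
        (λ { {k , A , κ} p → proj₁ (fact-sat β ρ h {A = A} (λ _ → refl))
            (All.lookup all-sat (List.∈-++⁺ˡ (List.∈-map⁺ (at constant) p))) }) ,
        trans (sym (Vec.tabulate∘lookup (map h ν))) (trans (Vec.tabulate-cong (λ i →
          proj₁ (equation-sat β ρ h i refl) (All.lookup all-sat
              (List.∈-++⁺ʳ facts (List.∈-map⁺ equation (List.∈-allFin i))))))
          (Vec.tabulate∘lookup ρ))
        where
        h : ℕ → Carrier
        h c = lookup β (clip N c)
        all-sat = proj₁ (Sat.tr-⋀ M (facts ++ equations)) s
      from′ : ∀ ρ → (∃ λ h → (∀ {I} → I ∈ Γ → SatInst M h I) × map h ν ≡ ρ) →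
              ∃ λ β → Satisfies M (β Data.Vec.++ ρ) (⋀ (facts ++ equations))
      from′ ρ (h , s , refl) = β , proj₂ (Sat.tr-⋀ M (facts ++ equations))
        (All.++⁺ (All.map⁺ {xs = Γ} {f = at constant} (All.tabulate (λ { {k , A , κ} p → proj₂ (fact-sat β ρ h {A = A} (λ i →
                    assigned (<-≤-trans (proj₂ (bounded Γ) p i) (m≤m⊔n (proj₁ (bounded Γ)) _)))) (s p) })))
                 (All.map⁺ {xs = List.allFin n} {f = equation} (All.tabulate (λ {i} _ → proj₂ (equation-sat β ρ h i
                    (assigned (<-≤-trans (proj₂ (vecBound ν) i) (m≤n⊔m (proj₁ (bounded Γ)) _)))) refl))))
        where
        β = tabulate {n = suc N} (h ∘ toℕ)
        assigned : ∀ {c} → c < N → lookup β (clip N c) ≡ h c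
        assigned c<N = trans (Vec.lookup∘tabulate (h ∘ toℕ) _) (cong h (toℕ-clip N (m<n⇒m<1+n c<N)))


  module _ (M : Structure 𝓖) (inf : ∀ n → Satisfies M [] (moreThan n)) where

    -- The consistency property holds the constants 0, ..., n - 1 to the type from the start, so
    -- they realise it in the generic model.
    realiseType : {p : Pred (Formula 𝓖 n) 0ℓ} → (∀ Δ → All p Δ → ∃ λ ρ → All (Satisfies M ρ) Δ) →
      ∃ λ (N : Structure 𝓖) → CountablyInfinite N × N ⊨ Th M × ∃ λ ρ → ∀ χ → p χ → Satisfies N ρ χ
    realiseType {n} {p} satisfiable = Mod.model , mk↔ₛ′ id id (λ _ → refl) (λ _ → refl) ,
        (λ A t → proj₂ (Mod.truth A []) (inherited A t)) , ρ , realised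
      where
      module Gen = Generic (finSat M p satisfiable) (λ _ _ → ⊤) (λ i Γ q → Γ , q , id , tt)
      inherited : ∀ A → Satisfies M [] A → Gen.G (0 , A , [])
      inherited A t = stable (λ q → let i , r = Gen.G-¬ q in finSat-true M p t (proj₂ (Gen.chain i)) r)
      module Mod = Gen.Model (λ m → inherited (moreThan m) (inf m))
      ρ = proj₁ (Mod.represent (tabulate {n = n} toℕ))
      realised : ∀ χ → p χ → Satisfies Mod.model ρ χ
      realised χ a = proj₂ (Mod.truth χ ρ) (Gen.tr-resp χ (proj₂ (Mod.represent (tabulate toℕ)))
        (stable (λ r → let i , q = Gen.G-¬ r in finSat-type M p a (proj₂ (Gen.chain i)) q)))

    private
      Nothing : Formula 𝓖 0 → Set
      Nothing _ = ⊥

      Omitted : (q : Formula 𝓖 n → Set) → ℕ → List Inst → Set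
      Omitted {n} q i Γ = ∃ λ ψ → q ψ × (n , ¬̇ ψ , unpack n i) ∈ Γ

      nothing-satisfied : ∀ Δ → All Nothing Δ → ∃ λ (ρ : Vec (Structure.Carrier M) 0) → All (Satisfies M ρ) Δ
      nothing-satisfied []      _        = [] , []
      nothing-satisfied (_ ∷ _) (() ∷ _)

      -- If no formula of the type could be denied of the tuple, the formula isolating the tuple
      -- over `Γ` would imply the whole type, which the hypothesis rules out.
      omit : (q : Formula 𝓖 n → Set) →
             (∀ θ → (∃ λ ρ → Satisfies M ρ θ) → ¬ (∀ ψ → q ψ → ∀ ρ → Satisfies M ρ θ → Satisfies M ρ ψ)) →
             ∀ i Γ → FinSat M Nothing Γ → ∃ λ Δ → FinSat M Nothing Δ × Γ ⊆ Δ × Omitted q i Δ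
      omit {n} q nonprincipal i Γ fs = extend (stable notOmitted)
        where
        ν = unpack n i
        Extends : Set
        Extends = ∃ λ ψ → q ψ × FinSat M Nothing ((n , ¬̇ ψ , ν) ∷ Γ)
        extend : Extends → ∃ λ Δ → FinSat M Nothing Δ × Γ ⊆ Δ × Omitted q i Δ
        extend (ψ , t , fs′) = (n , ¬̇ ψ , ν) ∷ Γ , fs′ , there , ψ , t , here refl
        notOmitted : ¬ ¬ Extends
        notOmitted none = nonprincipal (proj₁ iso) θ-sat implied
          where
          iso = isolating M Γ ν
          θ-sat : ∃ λ ρ → Satisfies M ρ (proj₁ iso)
          θ-sat = let h , s , _ = fs [] [] in map h ν , proj₂ (proj₂ iso (map h ν)) (h , s , refl)
          implied : ∀ ψ → q ψ → ∀ ρ → Satisfies M ρ (proj₁ iso) → Satisfies M ρ ψ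
          implied ψ t ρ u = let h , s , e = proj₁ (proj₂ iso ρ) u in stable (λ v → none (ψ , t , λ
            { [] _ → h , (λ { (here refl) → subst (λ ρ → ¬ Satisfies M ρ ψ) (sym e) v ; (there p) → s p }) , []
            ; (_ ∷ _) (() ∷ _) }))

    omitType : (q : Formula 𝓖 n → Set) →
      (∀ θ → (∃ λ ρ → Satisfies M ρ θ) → ¬ (∀ ψ → q ψ → ∀ ρ → Satisfies M ρ θ → Satisfies M ρ ψ)) →
      ∃ λ (N : Structure 𝓖) → CountablyInfinite N × N ⊨ Th M × ∀ ρ → ∃ λ ψ → q ψ × ¬ Satisfies N ρ ψ
    omitType {n} q nonprincipal = Mod.model , mk↔ₛ′ id id (λ _ → refl) (λ _ → refl) ,
        (λ A t → proj₂ (Mod.truth A []) (inherited A t)) , omitted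
      where
      module Gen = Generic (finSat M Nothing nothing-satisfied) (Omitted q) (omit q nonprincipal)
      inherited : ∀ A → Satisfies M [] A → Gen.G (0 , A , [])
      inherited A t = stable (λ q → let i , r = Gen.G-¬ q in finSat-true M Nothing t (proj₂ (Gen.chain i)) r)
      module Mod = Gen.Model (λ m → inherited (moreThan m) (inf m))
      omitted : ∀ ρ → ∃ λ ψ → q ψ × ¬ Satisfies Mod.model ρ ψ
      omitted ρ =
        -- The dense set with this number concerns exactly the constants that represent `ρ`.
        let ψ , t , p = Gen.extra-met (vecCode (map Mod.r ρ))
            g = subst (λ ν → Gen.G (n , ¬̇ ψ , ν)) (unpack-vecCode (map Mod.r ρ)) (suc (vecCode (map Mod.r ρ)) , p)
        in ψ , t , proj₂ (Mod.truth (¬̇ ψ) ρ) g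

  module _ {T : Pred (Sentence 𝓖) 0ℓ} (T-complete : IsCompleteTheory T) (cat : ωCategorical T) where
    open ωCategorical cat
    open IsCompleteTheory T-complete

    private
      M = proj₁ existence
      M⊨T = proj₁ (proj₂ existence)
      module M = Structure M

      T-true : ∀ A → Satisfies M [] A → T A
      T-true A = proj₂ (truths T-complete {M} M⊨T A)

    ωCategorical⇒infinite : Infinite T
    ωCategorical⇒infinite n = T-true (moreThan n) (countablyInfinite⇒moreThan M (proj₂ (proj₂ existence)) n)

    Atom : Formula 𝓖 n → Set
    Atom θ = (∃ λ ρ → Satisfies M ρ θ) ×
             (∀ ψ → (∀ ρ → Satisfies M ρ θ → Satisfies M ρ ψ) ⊎ (∀ ρ → Satisfies M ρ θ → ¬ Satisfies M ρ ψ))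

    NonAtom : Formula 𝓖 n → Set
    NonAtom χ = ∃ λ θ → Atom θ × χ ≡ ¬̇ θ

    -- If finitely many atoms cover M, a formula is determined by the atoms that imply it.
    atoms-cover⇒finite : (Δ : List (Formula 𝓖 n)) → All NonAtom Δ → ¬ (∃ λ ρ → All (Satisfies M ρ) Δ) →
      ∃ λ (Θ : List (Formula 𝓖 n)) → ∀ ψ → ∃ λ δ → δ ∈ Θ × T (allⁿ n (iff ψ δ))
    atoms-cover⇒finite {n} Δ atoms none = let Θ , f = finiteIndex Implied Δ in
      Θ , λ ψ → let δ , p , s = f ψ in δ , p , T-true _ (proj₂ (Sat.tr-allⁿ M n (iff ψ δ)) (λ ρ →
        proj₂ (Sat.tr-iff M ψ δ) (along ρ ψ δ s , along ρ δ ψ (⟷-sym ∘ s))))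
      where
      Implied : Formula 𝓖 n → Formula 𝓖 n → Set
      Implied χ ψ = ∀ ρ → ¬ Satisfies M ρ χ → Satisfies M ρ ψ
      along : ∀ ρ ψ ψ′ → (∀ {χ} → χ ∈ Δ → Implied χ ψ ⟷ Implied χ ψ′) → Satisfies M ρ ψ → Satisfies M ρ ψ′
      along ρ ψ ψ′ s t = stable λ u → none (ρ , All.tabulate λ {χ} p → stable λ v → u (holds p (All.lookup atoms p) v))
        where
        holds : ∀ {χ} → χ ∈ Δ → NonAtom χ → ¬ Satisfies M ρ χ → Satisfies M ρ ψ′
        holds p (θ , (_ , decides) , refl) v with decides ψ
        ... | inj₁ imp = proj₁ (s p) (λ σ w → imp σ (stable w)) ρ v
        ... | inj₂ imp = ⊥-elim (imp ρ (stable v) t)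

    -- Otherwise some model realises a type containing no atom, while another
    -- omits that type.
    ωCategorical⇒finitary : Finitary T
    ωCategorical⇒finitary n = stable λ notFinite →
      let N₁ , c₁ , t₁ , ρ , realised = realiseType M inf {p = NonAtom} (λ Δ a → stable (λ none → notFinite (atoms-cover⇒finite Δ a none)))
          N₂ , c₂ , t₂ , omitted = omitType M inf (Satisfies N₁ ρ) (nonprincipal N₁ ρ realised)
          iso = uniqueness N₁ N₂ (λ A t → t₁ A (M⊨T A t)) c₁ (λ A t → t₂ A (M⊨T A t)) c₂
          ψ , t , s = omitted (map (Inverse.to (_≅_.bijection iso)) ρ)
      in s (proj₁ (iso-sat iso ψ ρ) t)
      where
      inf : ∀ m → Satisfies M [] (moreThan m)
      inf = countablyInfinite⇒moreThan M (proj₂ (proj₂ existence))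
      nonprincipal : ∀ N (ρ : Vec (Structure.Carrier N) n) → (∀ χ → NonAtom χ → Satisfies N ρ χ) →
        ∀ θ → (∃ λ σ → Satisfies M σ θ) → ¬ (∀ ψ → Satisfies N ρ ψ → ∀ σ → Satisfies M σ θ → Satisfies M σ ψ)
      nonprincipal N ρ realised θ θ-sat implied =
        -- A satisfiable formula that implies this complete type is an atom, but the type contains
        -- the negation of every atom.
        implied (¬̇ θ) (realised (¬̇ θ) (θ , θ-atom , refl)) (proj₁ θ-sat) (proj₂ θ-sat) (proj₂ θ-sat)
        where
        θ-atom : Atom θ
        θ-atom = θ-sat , λ ψ → case em {Satisfies N ρ ψ} of λ { (yes t) → inj₁ (implied ψ t) ; (no t) →
            inj₂ (implied (¬̇ ψ) t) }

  -- Membership in Π⁰₃.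

  Dc⇒computable : ∀ {ℓ} (D : Dc 1) → ComputableSet {ℓ} (λ x → Level.Lift ℓ (⟦ D ⟧ᴰ (x ∷ [])))
  Dc⇒computable D = code (prog (χ D)) , λ x → fn (χ D) (x ∷ []) , (prog (χ D) , refl , sound (χ D) (x ∷ [])) ,
    indicate (dec D (x ∷ []))
    where
    indicate : ∀ {c P ℓ} → Indicates c P → Level.Lift ℓ P × sgn c ≡ 1 ⊎ ¬ Level.Lift ℓ P × sgn c ≡ 0
    indicate (inj₁ (p , refl)) = inj₁ (Level.lift p , refl)
    indicate (inj₂ (p , refl)) = inj₂ ((λ q → p (Level.lower q)) , refl)

  Π₃-intro : ∀ {ℓ} {A : Pred ℕ ℓ} (K : Dc 4) →
             (∀ x → A x ⟷ (∀ y → ∃ λ z → ∀ w → ⟦ K ⟧ᴰ (w ∷ z ∷ y ∷ x ∷ []))) → Π⁰ 3 A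
  Π₃-intro {ℓ} {A} K h = B , (C , (D , Level.lift (Dc⇒computable D₁) , λ x → mk⇔ id id) , λ x → mk⇔ id id) ,
    λ x → mk⇔ (to′ x) (from′ x)
    where
    D₁ : Dc 1
    D₁ = subᴰ K (π₂ᶠ (𝕧 0) ∷ˢ π₂ᶠ (π₁ᶠ (𝕧 0)) ∷ˢ π₂ᶠ (π₁ᶠ (π₁ᶠ (𝕧 0))) ∷ˢ π₁ᶠ (π₁ᶠ (π₁ᶠ (𝕧 0))) ∷ˢ []ˢ)
    B C D : Pred ℕ ℓ
    D u = Level.Lift ℓ (⟦ D₁ ⟧ᴰ (u ∷ []))
    C u = ∀ w → D ⟨ u , w ⟩
    B u = ∃ λ z → C ⟨ u , z ⟩
    unpaired : ∀ {x y z w a b c d} → w ≡ a → z ≡ b → y ≡ c → x ≡ d →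
               ⟦ K ⟧ᴰ (w ∷ z ∷ y ∷ x ∷ []) → ⟦ K ⟧ᴰ (a ∷ b ∷ c ∷ d ∷ [])
    unpaired refl refl refl refl k = k
    zyx : ∀ x y z w → let u = π₁ ⟨ ⟨ ⟨ x , y ⟩ , z ⟩ , w ⟩ in
          π₂ u ≡ z × π₂ (π₁ u) ≡ y × π₁ (π₁ u) ≡ x
    zyx x y z w =
      trans (cong π₂ e) (π₂-pair ⟨ x , y ⟩ z) ,
      trans (cong π₂ e′) (π₂-pair x y) ,
      trans (cong π₁ e′) (π₁-pair x y)
      where
      e = π₁-pair ⟨ ⟨ x , y ⟩ , z ⟩ w
      e′ = trans (cong π₁ e) (π₁-pair ⟨ x , y ⟩ z)
    to′ : ∀ x → A x → ∀ y → B ⟨ x , y ⟩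
    to′ x a y = let z , k = proj₁ (h x) a y in z , λ w → let p , q , r = zyx x y z w in
      Level.lift (unpaired (sym (π₂-pair ⟨ ⟨ x , y ⟩ , z ⟩ w)) (sym p) (sym q) (sym r) (k w))
    from′ : ∀ x → (∀ y → B ⟨ x , y ⟩) → A x
    from′ x b = proj₂ (h x) (λ y → let z , k = b y in z , λ w → let p , q , r = zyx x y z w in
      unpaired (π₂-pair ⟨ ⟨ x , y ⟩ , z ⟩ w) p q r (Level.lower (k w)))

  -- The first variable is a prospective witness of A.
  infixr 2 _⊃ᴿ_
  _⊃ᴿ_ : Re k → Re k → Re (suc k)
  A ⊃ᴿ B = asᴿ (decᴿ (¬ᴰ ker A) ∨ᴿ subᴿ B wkˢ) (λ { (w ∷ xs) → ⟦ ker A ⟧ᴰ (w ∷ xs) → ⟦ B ⟧ᴿ xs })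
    (λ { (w ∷ xs) (inj₁ n) p → ⊥-elim (n p) ; (w ∷ xs) (inj₂ q) _ → q })
    (λ { (w ∷ xs) f → case dec (ker A) (w ∷ xs) of λ { (inj₁ (p , _)) → inj₂ (f p) ; (inj₂ (n , _)) → inj₁ n } })

  -- An implication between enumerable predicates is Π⁰₂: the quantifier over prospective witnesses
  -- of the premise comes out in front.
  ⊃ᴿ-spec : (A B : Re k) → ∀ xs → (∀ w → ⟦ A ⊃ᴿ B ⟧ᴿ (w ∷ xs)) ⟷ (⟦ A ⟧ᴿ xs → ⟦ B ⟧ᴿ xs)
  ⊃ᴿ-spec A B xs = (λ f a → let w , p = into A xs a in f w p) , (λ f w p → f (outof A xs w p))

  allCode : ℕ → ℕ → ℕ
  allCode zero    c = c
  allCode (suc n) c = ⟨ 4 , allCode n c ⟩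

  allCode-shift : ∀ n c → allCode n ⟨ 4 , c ⟩ ≡ allCode (suc n) c
  allCode-shift zero    c = refl
  allCode-shift (suc n) c = cong ⟨ 4 ,_⟩ (allCode-shift n c)

  gödel-allⁿ : ∀ n (A : Formula 𝓖 n) → gödel (allⁿ n A) ≡ allCode n (gödel A)
  gödel-allⁿ zero    A = refl
  gödel-allⁿ (suc n) A = trans (gödel-allⁿ n (all A)) (allCode-shift n (gödel A))

  -- Opaque, since nested pairs would be unfolded into huge normal forms.
  opaque
    implCode : ℕ → ℕ → ℕ
    implCode = impCode

    implCode-def : ∀ a b → impCode a b ≡ implCode a b
    implCode-def a b = refl

  gödel-⇒ : (A B : Formula 𝓖 n) → gödel (A ⇒ B) ≡ implCode (gödel A) (gödel B)
  gödel-⇒ A B = implCode-def (gödel A) (gödel B)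

  notCode : ℕ → ℕ
  notCode a = implCode a 0

  iffCode : ℕ → ℕ → ℕ
  iffCode a b = notCode (implCode (implCode a b) (notCode (implCode b a)))

  amongCode : ℕ → ℕ
  amongCode zero    = 0
  amongCode (suc k) = implCode (notCode (eqCode 0 (suc k))) (amongCode k)

  moreThanCode : ℕ → ℕ
  moreThanCode n = allCode n (notCode ⟨ 4 , amongCode n ⟩)

  gödel-¬ : (A : Formula 𝓖 n) → gödel (¬̇ A) ≡ notCode (gödel A)
  gödel-¬ A = gödel-⇒ A ⊥̇

  gödel-among : ∀ k (k≤n : k ≤ n) → gödel (amongVars {n} {𝓖} k k≤n) ≡ amongCode k
  gödel-among zero    _   = refl
  gödel-among (suc k) k<n = trans (gödel-⇒ (¬̇ E) (amongVars k (<⇒≤ k<n)))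
    (cong₂ implCode (trans (gödel-¬ E) (cong (λ i → notCode (eqCode 0 (suc i))) (Fin.toℕ-fromℕ< k<n)))
                    (gödel-among k (<⇒≤ k<n)))
    where E = var zero ≐ var (suc (fromℕ< k<n))

  gödel-iff : (A B : Formula 𝓖 n) → gödel (iff A B) ≡ iffCode (gödel A) (gödel B)
  gödel-iff A B = trans (gödel-¬ (A⇒B ⇒ ¬̇ B⇒A)) (cong notCode (trans (gödel-⇒ A⇒B (¬̇ B⇒A))
    (cong₂ implCode (gödel-⇒ A B) (trans (gödel-¬ B⇒A) (cong notCode (gödel-⇒ B A))))))
    where A⇒B = A ⇒ B ; B⇒A = B ⇒ A

  gödel-allⁿ-iff : ∀ n (A B : Formula 𝓖 n) → gödel (allⁿ n (iff A B)) ≡ allCode n (iffCode (gödel A) (gödel B))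
  gödel-allⁿ-iff n A B = trans (gödel-allⁿ n (iff A B)) (cong (allCode n) (gödel-iff A B))

  gödel-moreThan : ∀ n → gödel (moreThan {𝓖} n) ≡ moreThanCode n
  gödel-moreThan n = trans (gödel-allⁿ n (¬̇ all (amongVars n ≤-refl))) (cong (allCode n)
    (trans (gödel-¬ (all (amongVars n ≤-refl))) (cong (λ c → notCode ⟨ 4 , c ⟩) (gödel-among n ≤-refl))))

  implᶠ : Fn k → Fn k → Fn k
  implᶠ a b = retarget (impᶠ a b) (λ xs → implCode (fn a xs) (fn b xs)) (λ xs → implCode-def (fn a xs) (fn b xs))

  notᶠ : Fn k → Fn k
  notᶠ a = implᶠ a (lit 0)

  iffᶠ : Fn k → Fn k → Fn k
  iffᶠ a b = notᶠ (implᶠ (implᶠ a b) (notᶠ (implᶠ b a)))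

  allCodeᶠ : Fn k → Fn k → Fn k
  allCodeᶠ = binary (prec (𝕧 0) ⟪ lit 4 , 𝕧 1 ⟫) allCode run
    where
    run : ∀ n c → fn (prec (𝕧 0) ⟪ lit 4 , 𝕧 1 ⟫) (n ∷ c ∷ []) ≡ allCode n c
    run zero    c = refl
    run (suc n) c = cong ⟨ 4 ,_⟩ (run n c)

  amongCodeᶠ : Fn k → Fn k
  amongCodeᶠ = unary (prec (lit 0) (implᶠ (notᶠ (eqᶠ (lit 0) (S (𝕧 0)))) (𝕧 1))) amongCode run
    where
    run : ∀ n → fn (prec (lit 0) (implᶠ (notᶠ (eqᶠ (lit 0) (S (𝕧 0)))) (𝕧 1))) (n ∷ []) ≡ amongCode n
    run zero    = refl
    run (suc n) = cong (implCode (notCode (eqCode 0 (suc n)))) (run n)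

  moreThanᶠ : Fn k → Fn k
  moreThanᶠ n = allCodeᶠ n (notᶠ ⟪ lit 4 , amongCodeᶠ n ⟫)

  implCode-inv : ∀ (C : Formula 𝓖 n) a b → gödel C ≡ implCode a b → ∃₂ λ A B → C ≡ (A ⇒ B) × gödel A ≡ a × gödel B ≡ b
  implCode-inv C a b e = run (formulaView C 3 ⟨ a , b ⟩ (trans e (sym (implCode-def a b)))) refl
    where
    run : ∀ {C u} → FormulaView C 3 u → u ≡ ⟨ a , b ⟩ → ∃₂ λ A B → C ≡ (A ⇒ B) × gödel A ≡ a × gödel B ≡ b
    run (⇒ⱽ A B r) s = A , B , refl , pair-injective (gödel A) (gödel B) a b (trans r s)

  allCode-inv : ∀ n c (S : Sentence 𝓖) → gödel S ≡ allCode n c → ∃ λ (A : Formula 𝓖 n) → gödel A ≡ c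
  allCode-inv zero    c S e = S , e
  allCode-inv (suc n) c S e = let A , p = allCode-inv n ⟨ 4 , c ⟩ S (trans e (sym (allCode-shift n c))) in
    run (formulaView A 4 c p)
    where
    run : ∀ {A : Formula 𝓖 n} → FormulaView A 4 c → ∃ λ (B : Formula 𝓖 (suc n)) → gödel B ≡ c
    run (allⱽ B r) = B , r

  iffCode-inv : ∀ (C : Formula 𝓖 n) a b → gödel C ≡ iffCode a b → ∃ λ (B : Formula 𝓖 n) → gödel B ≡ b
  iffCode-inv C a b e =
    let P , _ , _ , p , _ = implCode-inv C (implCode (implCode a b) (notCode (implCode b a))) 0 e
        Q , _ , _ , q , _ = implCode-inv P (implCode a b) (notCode (implCode b a)) p
        _ , B , _ , _ , r = implCode-inv Q a b q
    in B , r

  -- The conditions on an index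

  Accepts : ℕ → ℕ → Set
  Accepts e x = ∃ λ y → φ e x (suc y)

  acceptsᴿ : Re 2
  acceptsᴿ = asᴿ (∃ᴿ (subᴿ universalᴿ (𝕧 1 ∷ˢ 𝕧 2 ∷ˢ S (𝕧 0) ∷ˢ []ˢ))) (λ { (e ∷ x ∷ []) → Accepts e x })
    (λ { (e ∷ x ∷ []) p → p }) (λ { (e ∷ x ∷ []) p → p })

  haltsᴿ : Re 2
  haltsᴿ = asᴿ (∃ᴿ (subᴿ universalᴿ (𝕧 1 ∷ˢ 𝕧 2 ∷ˢ 𝕧 0 ∷ˢ []ˢ))) (λ { (e ∷ x ∷ []) → ∃ λ y → φ e x y })
    (λ { (e ∷ x ∷ []) p → p }) (λ { (e ∷ x ∷ []) p → p })

  IsSentence IsTheorem : ℕ → Set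
  IsSentence x = ∃ λ (A : Sentence 𝓖) → gödel A ≡ x
  IsTheorem x  = ∃ λ (A : Sentence 𝓖) → gödel A ≡ x × [] ⊢ A

  -- Theorems and modus ponens amount to deductive closure, as finitely many premises are discharged
  -- by `⇒I`. The code of `⊥̇` is 0. Each clause asserts an enumerable condition, or an implication
  -- between two of them, for all n or once, so the whole is Π⁰₂.
  record Closed (e : ℕ) : Set where
    field
      total     : ∀ n → ∃ λ y → φ e n y
      sentences : ∀ n → Accepts e n → IsSentence n
      theorems  : ∀ n → IsTheorem n → Accepts e n
      mp        : ∀ n → Accepts e (implCode (π₁ n) (π₂ n)) × Accepts e (π₁ n) → Accepts e (π₂ n)
      no-⊥      : φ e 0 0
      decides   : ∀ n → IsSentence n → Accepts e n ⊎ Accepts e (notCode n)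
      infinite  : ∀ n → Accepts e (moreThanCode n)

  private
    -- Variables: n, e.
    haltsᵢ sentenceᵢ acceptsᵢ theoremᵢ mpᵢ mpᵢ′ decidesᵢ infiniteᵢ no-⊥ᵢ : Re 2
    haltsᵢ    = subᴿ haltsᴿ (𝕧 1 ∷ˢ 𝕧 0 ∷ˢ []ˢ)
    sentenceᵢ = subᴿ formulaᴿ (lit 0 ∷ˢ 𝕧 0 ∷ˢ []ˢ)
    acceptsᵢ  = subᴿ acceptsᴿ (𝕧 1 ∷ˢ 𝕧 0 ∷ˢ []ˢ)
    theoremᵢ  = subᴿ theoremᴿ (𝕧 0 ∷ˢ []ˢ)
    mpᵢ       = subᴿ acceptsᴿ (𝕧 1 ∷ˢ implᶠ (π₁ᶠ (𝕧 0)) (π₂ᶠ (𝕧 0)) ∷ˢ []ˢ) ∧ᴿ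
                subᴿ acceptsᴿ (𝕧 1 ∷ˢ π₁ᶠ (𝕧 0) ∷ˢ []ˢ)
    mpᵢ′      = subᴿ acceptsᴿ (𝕧 1 ∷ˢ π₂ᶠ (𝕧 0) ∷ˢ []ˢ)
    decidesᵢ  = acceptsᵢ ∨ᴿ subᴿ acceptsᴿ (𝕧 1 ∷ˢ notᶠ (𝕧 0) ∷ˢ []ˢ)
    infiniteᵢ = subᴿ acceptsᴿ (𝕧 1 ∷ˢ moreThanᶠ (𝕧 0) ∷ˢ []ˢ)
    no-⊥ᵢ     = subᴿ universalᴿ (𝕧 1 ∷ˢ lit 0 ∷ˢ lit 0 ∷ˢ []ˢ)

  opaque
    closedᴿ : Re 3
    closedᴿ =
      subᴿ haltsᵢ wkˢ ∧ᴿ (acceptsᵢ ⊃ᴿ sentenceᵢ) ∧ᴿ (theoremᵢ ⊃ᴿ acceptsᵢ) ∧ᴿ (mpᵢ ⊃ᴿ mpᵢ′) ∧ᴿ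
      subᴿ no-⊥ᵢ wkˢ ∧ᴿ (sentenceᵢ ⊃ᴿ decidesᵢ) ∧ᴿ subᴿ infiniteᵢ wkˢ

    closedᴿ-spec : ∀ e → (∀ n w → ⟦ closedᴿ ⟧ᴿ (w ∷ n ∷ e ∷ [])) ⟷ Closed e
    closedᴿ-spec e = to′ , from′
      where
      to′ : (∀ n w → ⟦ closedᴿ ⟧ᴿ (w ∷ n ∷ e ∷ [])) → Closed e
      to′ f = record
        { total     = λ n → proj₁ (f n 0)
        ; sentences = λ n → proj₁ (⊃ᴿ-spec acceptsᵢ sentenceᵢ (n ∷ e ∷ [])) (λ w → proj₁ (proj₂ (f n w)))
        ; theorems  = λ n → proj₁ (⊃ᴿ-spec theoremᵢ acceptsᵢ (n ∷ e ∷ [])) (λ w → proj₁ (proj₂ (proj₂ (f n w))))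
        ; mp        = λ n → proj₁ (⊃ᴿ-spec mpᵢ mpᵢ′ (n ∷ e ∷ [])) (λ w → proj₁ (proj₂ (proj₂ (proj₂ (f n w)))))
        ; no-⊥      = proj₁ (proj₂ (proj₂ (proj₂ (proj₂ (f 0 0)))))
        ; decides   = λ n → proj₁ (⊃ᴿ-spec sentenceᵢ decidesᵢ (n ∷ e ∷ []))
                        (λ w → proj₁ (proj₂ (proj₂ (proj₂ (proj₂ (proj₂ (f n w)))))))
        ; infinite  = λ n → proj₂ (proj₂ (proj₂ (proj₂ (proj₂ (proj₂ (f n 0))))))
        }
      from′ : Closed e → ∀ n w → ⟦ closedᴿ ⟧ᴿ (w ∷ n ∷ e ∷ [])
      from′ c n w = total n , proj₂ (⊃ᴿ-spec acceptsᵢ sentenceᵢ (n ∷ e ∷ [])) (sentences n) w ,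
        proj₂ (⊃ᴿ-spec theoremᵢ acceptsᵢ (n ∷ e ∷ [])) (theorems n) w ,
        proj₂ (⊃ᴿ-spec mpᵢ mpᵢ′ (n ∷ e ∷ [])) (mp n) w , no-⊥ ,
        proj₂ (⊃ᴿ-spec sentenceᵢ decidesᵢ (n ∷ e ∷ [])) (decides n) w , infinite n
        where open Closed c

  -- Δ codes a number of formulas together with their list.
  Unlisted : ℕ → ℕ → ℕ → ℕ → Set
  Unlisted e n Δ ψ = (∃ λ (A : Formula 𝓖 n) → gödel A ≡ ψ) ×
    (∀ i → i < π₁ Δ → φ e (allCode n (iffCode ψ (lk (π₂ Δ) i))) 0)

  opaque
    unlistedᴿ : Re 4
    unlistedᴿ = asᴿ
      (subᴿ formulaᴿ (𝕧 2 ∷ˢ 𝕧 0 ∷ˢ []ˢ) ∧ᴿ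
       ∀<ᴿ (π₁ᶠ (𝕧 1)) (subᴿ universalᴿ
         (𝕧 4 ∷ˢ allCodeᶠ (𝕧 3) (iffᶠ (𝕧 1) (lkᶠ (π₂ᶠ (𝕧 2)) (𝕧 0))) ∷ˢ lit 0 ∷ˢ []ˢ)))
      (λ { (ψ ∷ Δ ∷ n ∷ e ∷ []) → Unlisted e n Δ ψ })
      (λ { (ψ ∷ Δ ∷ n ∷ e ∷ []) p → p }) (λ { (ψ ∷ Δ ∷ n ∷ e ∷ []) p → p })

    unlistedᴿ-spec : ∀ e n Δ ψ → ⟦ unlistedᴿ ⟧ᴿ (ψ ∷ Δ ∷ n ∷ e ∷ []) ⟷ Unlisted e n Δ ψ
    unlistedᴿ-spec e n Δ ψ = ⟷-refl

  -- Rejection is a halting computation with value 0. Hence `Unlisted` is enumerable, and this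
  -- condition has the form ∀∃∀ over a decidable matrix.
  FinitaryIndex : ℕ → Set
  FinitaryIndex e = ∀ n → ∃ λ Δ → ∀ ψ → ¬ Unlisted e n Δ ψ

  -- One matrix for both conditions, which share n. Here y codes n with a prospective witness for
  -- `Closed`, z codes a witness of `closedᴿ` with the list of formulas, and w codes a formula with
  -- a prospective witness that it is unlisted.
  indexᴰ : Dc 4
  indexᴰ = subᴰ (ker closedᴿ) (π₁ᶠ (𝕧 1) ∷ˢ π₂ᶠ (𝕧 2) ∷ˢ π₁ᶠ (𝕧 2) ∷ˢ 𝕧 3 ∷ˢ []ˢ) ∧ᴰ
           (¬ᴰ subᴰ (ker unlistedᴿ) (π₂ᶠ (𝕧 0) ∷ˢ π₁ᶠ (𝕧 0) ∷ˢ π₂ᶠ (𝕧 1) ∷ˢ π₁ᶠ (𝕧 2) ∷ˢ 𝕧 3 ∷ˢ []ˢ))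

  indexᴰ-spec : ∀ e → (∀ y → ∃ λ z → ∀ w → ⟦ indexᴰ ⟧ᴰ (w ∷ z ∷ y ∷ e ∷ [])) ⟷ (Closed e × FinitaryIndex e)
  indexᴰ-spec e = to′ , from′
    where
    at₂ : (P : ℕ → ℕ → Set) → ∀ a b → P (π₁ ⟨ a , b ⟩) (π₂ ⟨ a , b ⟩) ⟷ P a b
    at₂ P a b = ⟷-≡ (cong₂ P (π₁-pair a b) (π₂-pair a b))
    C : ℕ → ℕ → ℕ → Set
    C v w n = ⟦ ker closedᴿ ⟧ᴰ (v ∷ w ∷ n ∷ e ∷ [])
    U : ℕ → ℕ → ℕ → ℕ → Set
    U v ψ Δ n = ⟦ ker unlistedᴿ ⟧ᴰ (v ∷ ψ ∷ Δ ∷ n ∷ e ∷ [])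
    K : ℕ → ℕ → ℕ → Set
    K w z y = C (π₁ z) (π₂ y) (π₁ y) × ¬ U (π₂ w) (π₁ w) (π₂ z) (π₁ y)
    to′ : (∀ y → ∃ λ z → ∀ w → K w z y) → Closed e × FinitaryIndex e
    to′ f = proj₁ (closedᴿ-spec e) (λ n w → let z , k = f ⟨ n , w ⟩ in
              outof closedᴿ (w ∷ n ∷ e ∷ []) (π₁ z) (proj₁ (at₂ (λ n w → C (π₁ z) w n) n w) (proj₁ (k 0)))) ,
            (λ n → let z , k = f ⟨ n , 0 ⟩ in π₂ z , λ ψ u → let v , u′ = into unlistedᴿ (ψ ∷ π₂ z ∷ n ∷ e ∷ []) (proj₂ (unlistedᴿ-spec e n (π₂ z) ψ) u) in
              proj₂ (k ⟨ ψ , v ⟩) (proj₂ (at₂ (λ ψ v → U v ψ (π₂ z) (π₁ ⟨ n , 0 ⟩)) ψ v)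
                (subst (U v ψ (π₂ z)) (sym (π₁-pair n 0)) u′)))
    from′ : Closed e × FinitaryIndex e → ∀ y → ∃ λ z → ∀ w → K w z y
    from′ (c , f) y =
      let Δ , g = f (π₁ y)
          v , p = into closedᴿ (π₂ y ∷ π₁ y ∷ e ∷ []) (proj₂ (closedᴿ-spec e) c (π₁ y) (π₂ y))
      in ⟨ v , Δ ⟩ , λ w →
           subst (λ v → C v (π₂ y) (π₁ y)) (sym (π₁-pair v Δ)) p ,
           λ u → g (π₁ w) (proj₁ (unlistedᴿ-spec e (π₁ y) Δ (π₁ w)) (outof unlistedᴿ (π₁ w ∷ Δ ∷ π₁ y ∷ e ∷ []) (π₂ w)
             (subst (λ Δ → U (π₂ w) (π₁ w) Δ (π₁ y)) (π₂-pair v Δ) u)))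

  lk-listCode : ∀ {x as} → x ∈ as → ∃ λ i → i < List.length as × lk (listCode as) i ≡ x
  lk-listCode {as = a ∷ as} (here refl) = 0 , s≤s z≤n , lk-zero a (listCode as)
  lk-listCode {as = a ∷ as} (there p)   = let i , l , q = lk-listCode p in
    suc i , s≤s l , trans (lk-suc a (listCode as) i) q

  module _ {e : ℕ} {T : Pred (Sentence 𝓖) 0ℓ} (D : e Decides GödelNumbers T) where

    accepts⟷ : ∀ x → Accepts e x ⟷ GödelNumbers T x
    accepts⟷ x = (λ { (y , p) → to′ p (D x) }) , from′ (D x)
      where
      to′ : ∀ {y} → φ e x (suc y) → (∃ λ y → φ e x y ×
          (GödelNumbers T x × sgn y ≡ 1 ⊎ ¬ GödelNumbers T x × sgn y ≡ 0)) → GödelNumbers T x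
      to′ p (y , q , inj₁ (g , _)) = g
      to′ p (y , q , inj₂ (_ , s)) with refl ← φ-deterministic p q = case s of λ ()
      from′ : (∃ λ y → φ e x y × (GödelNumbers T x × sgn y ≡ 1 ⊎ ¬ GödelNumbers T x × sgn y ≡ 0)) →
          GödelNumbers T x → Accepts e x
      from′ (suc y , q , _)        g = y , q
      from′ (zero  , q , inj₁ (_ , ())) g
      from′ (zero  , q , inj₂ (n , _)) g = ⊥-elim (n g)

    rejects : ∀ x → ¬ GödelNumbers T x → φ e x 0
    rejects x n = go (D x)
      where
      go : (∃ λ y → φ e x y × (GödelNumbers T x × sgn y ≡ 1 ⊎ ¬ GödelNumbers T x × sgn y ≡ 0)) → φ e x 0
      go (zero , q , _)             = q
      go (suc y , q , inj₁ (g , _)) = ⊥-elim (n g)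
      go (suc y , q , inj₂ (_ , ()))

  accepts-¬0 : ∀ {e x} → Accepts e x → ¬ φ e x 0
  accepts-¬0 (y , p) q with () ← φ-deterministic p q

  index⇒conditions : ∀ e → ωCategoricalIndices 𝓖 e → Closed e × FinitaryIndex e
  index⇒conditions e (T , complete , cat , D) = record
    { total     = λ n → let y , p , _ = D n in y , p
    ; sentences = λ n a → let A , _ , p = proj₁ (accepts⟷ D n) a in A , p
    ; theorems  = λ { n (A , p , d) → acc n A p (deductivelyClosed A ([] , [] , d)) }
    ; mp        = λ { n (a , b) → mp n (proj₁ (accepts⟷ D _) a) (proj₁ (accepts⟷ D _) b) }
    ; no-⊥      = rejects D 0 λ { (A , t , p) →
        consistent (⊥̇ ∷ [] , subst T (gödel-injective A ⊥̇ p) t ∷ [] , hyp (here refl)) }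
    ; decides   = λ { n (A , refl) → [ inj₁ ∘ acc (gödel A) A refl , inj₂ ∘
        acc (notCode (gödel A)) (¬̇ A) (gödel-¬ A) ]′ (T-decides A) }
    ; infinite  = λ n → acc (moreThanCode n) (moreThan n) (gödel-moreThan n) (ωCategorical⇒infinite complete cat n)
    } , finitary
    where
    open IsCompleteTheory complete renaming (complete to T-decides)
    acc : ∀ x A → gödel A ≡ x → T A → Accepts e x
    acc x A p t = proj₂ (accepts⟷ D x) (A , t , p)
    mp : ∀ n → GödelNumbers T (implCode (π₁ n) (π₂ n)) → GödelNumbers T (π₁ n) → Accepts e (π₂ n)
    mp n (C , t , p) (A , u , q) = go (implCode-inv C (π₁ n) (π₂ n) p)
      where
      go : (∃₂ λ A′ B → C ≡ (A′ ⇒ B) × gödel A′ ≡ π₁ n × gödel B ≡ π₂ n) → Accepts e (π₂ n)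
      go (A′ , B , c≡ , a≡ , b≡) = acc (π₂ n) B b≡ (deductivelyClosed B
        ((A′ ⇒ B) ∷ A′ ∷ [] , subst T c≡ t ∷ subst T (gödel-injective A A′ (trans q (sym a≡))) u ∷ [] ,
         ⇒E (hyp (here refl)) (hyp (there (here refl)))))
    finitary : FinitaryIndex e
    finitary n = ⟨ List.length codes′ , listCode codes′ ⟩ , λ { ψ ((A , refl) , r) → refuted A r }
      where
      Δ = proj₁ (ωCategorical⇒finitary complete cat n)
      listed = proj₂ (ωCategorical⇒finitary complete cat n)
      codes′ = List.map gödel Δ
      len = List.length codes′
      refuted : ∀ A → (∀ i → i < π₁ ⟨ len , listCode codes′ ⟩ →
                  φ e (allCode n (iffCode (gödel A) (lk (π₂ ⟨ len , listCode codes′ ⟩) i))) 0) → ⊥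
      refuted A r =
        let δ , p , t = listed A
            i , i<l , q = lk-listCode (List.∈-map⁺ gödel p)
        in accepts-¬0 (acc _ (allⁿ n (iff A δ)) (gödel-allⁿ-iff n A δ) t)
             (subst (λ c → φ e (allCode n (iffCode (gödel A) c)) 0)
               (trans (cong (λ l → lk l i) (π₂-pair len (listCode codes′))) q)
               (r i (subst (i <_) (sym (π₁-pair len (listCode codes′))) i<l)))

  conditions⇒index : ∀ e → Closed e → FinitaryIndex e → ωCategoricalIndices 𝓖 e
  conditions⇒index e c f = T , T-complete , infinite-finitary⇒ωCategorical T-complete T-infinite T-finitary , T-decided
    where
    open Closed c
    T : Pred (Sentence 𝓖) 0ℓ
    T A = Accepts e (gödel A)
    T-mp : ∀ {A B} → T (A ⇒ B) → T A → T B
    T-mp {A} {B} t u = subst (Accepts e) (π₂-pair a b) (mp ⟨ a , b ⟩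
      (subst₂ (λ a b → Accepts e (implCode a b)) (sym (π₁-pair a b)) (sym (π₂-pair a b))
          (subst (Accepts e) (gödel-⇒ A B) t) ,
       subst (Accepts e) (sym (π₁-pair a b)) u))
      where a = gödel A ; b = gödel B
    T-closed : ∀ Γ A → All T Γ → Γ ⊢ A → T A
    T-closed []      A []       d = theorems (gödel A) (A , refl , d)
    T-closed (B ∷ Γ) A (t ∷ ts) d = T-mp {B} {A} (T-closed Γ (B ⇒ A) ts (⇒I d)) t
    T-complete : IsCompleteTheory T
    T-complete = record
      { consistent        = λ { (Γ , ts , d) → accepts-¬0 (T-closed Γ ⊥̇ ts d) no-⊥ }
      ; deductivelyClosed = λ { A (Γ , ts , d) → T-closed Γ A ts d }
      ; complete          = λ A → [ inj₁ , inj₂ ∘ subst (Accepts e) (sym (gödel-¬ A)) ]′ (decides (gödel A) (A , refl))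
      }
    T-infinite : Infinite T
    T-infinite n = subst (Accepts e) (sym (gödel-moreThan n)) (infinite n)
    T-finitary : Finitary T
    T-finitary n = Θ , λ ψ → let i , i<k , δ , p , a = found ψ ; δ′ , q , p′ = representative i<k δ p in
        δ′ , q , subst (Accepts e) (trans (cong (λ c → allCode n (iffCode (gödel ψ) c)) (sym p′))
            (sym (gödel-allⁿ-iff n ψ δ′))) a
      where
      Δ = proj₁ (f n)
      Codes : ℕ → Formula 𝓖 n → Set
      Codes i A = gödel A ≡ lk (π₂ Δ) i
      -- A listed number need not code a formula in n variables; one formula is kept for each entry
      -- that does.
      chosen = choose Codes (List.upTo (π₁ Δ))
      Θ = proj₁ chosen
      representative : ∀ {i} → i < π₁ Δ → ∀ δ → Codes i δ → ∃ λ δ′ → δ′ ∈ Θ × Codes i δ′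
      representative i<k δ p = proj₂ chosen (List.∈-upTo⁺ i<k) δ p
      found : ∀ ψ → ∃ λ i → i < π₁ Δ × ∃ λ δ → Codes i δ × Accepts e (allCode n (iffCode (gödel ψ) (lk (π₂ Δ) i)))
      found ψ = stable λ none → proj₂ (f n) (gödel ψ) ((ψ , refl) , λ i i<k → reject none i i<k (total _))
        where
        reject : ¬ (∃ λ i → i < π₁ Δ × ∃ λ δ → Codes i δ × Accepts e (allCode n (iffCode (gödel ψ) (lk (π₂ Δ) i)))) →
                 ∀ i → i < π₁ Δ → (∃ λ y → φ e (allCode n (iffCode (gödel ψ) (lk (π₂ Δ) i))) y) →
                 φ e (allCode n (iffCode (gödel ψ) (lk (π₂ Δ) i))) 0
        reject none i i<k (zero , p)  = p
        reject none i i<k (suc y , p) =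
          -- An accepted number codes a sentence; taking off the quantifiers and the equivalence
          -- shows that the listed entry codes a formula.
          let S , q = sentences _ (y , p)
              B , b≡ = allCode-inv n (iffCode (gödel ψ) (lk (π₂ Δ) i)) S q
              δ , d≡ = iffCode-inv B (gödel ψ) (lk (π₂ Δ) i) b≡
          in ⊥-elim (none (i , i<k , δ , d≡ , y , p))
    T-decided : e Decides GödelNumbers T
    T-decided x = go (total x)
      where
      go : (∃ λ y → φ e x y) → ∃ λ y → φ e x y × (GödelNumbers T x × sgn y ≡ 1 ⊎ ¬ GödelNumbers T x × sgn y ≡ 0)
      go (zero , p)  = 0 , p , inj₂ ((λ { (A , t , refl) → accepts-¬0 t p }) , refl)
      go (suc y , p) = suc y , p , inj₁ ((let A , q = sentences x (y , p) in A ,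
          (y , subst (λ x → φ e x (suc y)) (sym q) p) , q) , refl)

  ωCategoricalIndices-Π₃ : Π⁰ 3 (ωCategoricalIndices 𝓖)
  ωCategoricalIndices-Π₃ = Π₃-intro indexᴰ (λ e →
    (λ i → proj₂ (indexᴰ-spec e) (index⇒conditions e i)) ,
    (λ k → let c , f = proj₁ (indexᴰ-spec e) k in conditions⇒index e c f))

  -- The generic graph with prohibitions.

  -- Every number y is read as a finite set, which records links to smaller
  -- numbers and, for tuples of smaller numbers together with y, that they are
  -- not to be extended to a clique of a given size.

  mem : ℕ → ℕ → Set
  mem u y = ∃ λ i → i < y × lk y i ≡ suc u

  mem-< : ∀ {u y} → mem u y → u < y
  mem-< {y = y} (i , _ , e) = lk-< y i e

  setCode : List ℕ → ℕ
  setCode us = listCode (List.map suc us)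

  length≤listCode : ∀ as → List.length as ≤ listCode as
  length≤listCode []       = z≤n
  length≤listCode (a ∷ as) = s≤s (≤-trans (length≤listCode as) (snd≤pair a (listCode as)))

  mem-setCode : ∀ us {u} → u ∈ us → mem u (setCode us)
  mem-setCode us p = let i , i<l , e = lk-listCode (List.∈-map⁺ suc p) in
    i , <-≤-trans i<l (length≤listCode (List.map suc us)) , e

  setCode-mem : ∀ us {u} → mem u (setCode us) → u ∈ us
  setCode-mem us {u} (i , _ , e) = find us i e
    where
    find : ∀ us i → lk (setCode us) i ≡ suc u → u ∈ us
    find []       i e = ⊥-elim (none i e)
      where
      none : ∀ i → lk 0 i ≢ suc u
      none i e = case lk-< 0 i e of λ ()
    find (v ∷ us) zero    e = here (suc-injective (trans (sym e) (lk-zero (suc v) (setCode us))))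
    find (v ∷ us) (suc i) e = there (find us i (trans (sym (lk-suc (suc v) (setCode us) i)) e))

  opaque
    -- Members of four disjoint kinds: links to smaller vertices; `dummy`, padding that pushes a
    -- vertex beyond a given bound; `junk`, which spoils a vertex on purpose; and prohibitions, with
    -- tags from 2 on.
    link dummy : ℕ → ℕ
    link z  = ⟨ 0 , z ⟩
    dummy k = ⟨ 1 , suc k ⟩

    junk : ℕ
    junk = ⟨ 1 , 0 ⟩

    forbid : ℕ → ℕ → ℕ
    forbid N K = ⟨ 2 + N , K ⟩

    link-injective : ∀ {a b} → link a ≡ link b → a ≡ b
    link-injective {a} {b} e = proj₂ (pair-injective 0 a 0 b e)

    forbid-injective : ∀ {N K N′ K′} → forbid N K ≡ forbid N′ K′ → N ≡ N′ × K ≡ K′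
    forbid-injective {N} {K} {N′} {K′} e = let p , q = pair-injective (2 + N) K (2 + N′) K′ e in
      suc-injective (suc-injective p) , q

    link≢forbid : ∀ {a N K} → link a ≢ forbid N K
    link≢forbid {a} {N} {K} e = case proj₁ (pair-injective 0 a (2 + N) K e) of λ ()

    link≢dummy : ∀ {a k} → link a ≢ dummy k
    link≢dummy {a} {k} e = case proj₁ (pair-injective 0 a 1 (suc k) e) of λ ()

    forbid≢dummy : ∀ {N K k} → forbid N K ≢ dummy k
    forbid≢dummy {N} {K} {k} e = case proj₁ (pair-injective (2 + N) K 1 (suc k) e) of λ ()

    junk≢link : ∀ {a} → junk ≢ link a
    junk≢link {a} e = case proj₁ (pair-injective 1 0 0 a e) of λ ()

    junk≢forbid : ∀ {N K} → junk ≢ forbid N K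
    junk≢forbid {N} {K} e = case proj₁ (pair-injective 1 0 (2 + N) K e) of λ ()

    junk≢dummy : ∀ {k} → junk ≢ dummy k
    junk≢dummy {k} e = case proj₂ (pair-injective 1 0 1 (suc k) e) of λ ()

    ≤link : ∀ a → a ≤ link a
    ≤link a = snd≤pair 0 a

    <dummy : ∀ k → k < dummy k
    <dummy k = snd≤pair 1 (suc k)

    ≤forbid : ∀ N K → K ≤ forbid N K
    ≤forbid N K = snd≤pair (2 + N) K

    size≤forbid : ∀ N K → N ≤ forbid N K
    size≤forbid N K = ≤-trans (m≤n+m N 2) (fst≤pair (2 + N) K)

    link-mono : ∀ {a b} → a ≤ b → link a ≤ link b
    link-mono {a} {b} = pair-mono {0} {a} {0} {b} z≤n

    forbid-mono : ∀ {N N′ K K′} → N ≤ N′ → K ≤ K′ → forbid N K ≤ forbid N′ K′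
    forbid-mono {N} {N′} p q = pair-mono (+-monoʳ-≤ 2 p) q

    link-def : ∀ z → ⟨ 0 , z ⟩ ≡ link z
    link-def z = refl

    dummy-def : ∀ k → ⟨ 1 , suc k ⟩ ≡ dummy k
    dummy-def k = refl

    junk-def : ⟨ 1 , 0 ⟩ ≡ junk
    junk-def = refl

    forbid-def : ∀ N K → ⟨ 2 + N , K ⟩ ≡ forbid N K
    forbid-def N K = refl

    -- Injective, so that a size reveals the pair which it serves. The coordinate `suc n` makes the
    -- size exceed n + 1, so that the forbidden tuple alone is never large enough to violate its
    -- prohibition.
    size : ℕ → ℕ → ℕ
    size n s = ⟨ suc n , s ⟩

    size-def : ∀ n s → ⟨ suc n , s ⟩ ≡ size n s
    size-def n s = refl

    size-injective : ∀ {n s n′ s′} → size n s ≡ size n′ s′ → n ≡ n′ × s ≡ s′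
    size-injective {n} {s} {n′} {s′} e = let p , q = pair-injective (suc n) s (suc n′) s′ e in suc-injective p , q

    size-> : ∀ n s → suc n < size n s
    size-> n s = +-monoˡ-≤ (suc n) (s≤s (z≤n {n + s + triangle (n + s)}))

    size≥ : ∀ n s → s ≤ size n s
    size≥ n s = snd≤pair (suc n) s

    size-mono-< : ∀ {n s s′} → s < s′ → size n s < size n s′
    size-mono-< {n} {s} {s′} p = +-monoˡ-< (suc n) (<-≤-trans (m<n+m (triangle (suc n + s)) {suc (suc n + s)} (s≤s z≤n))
      (triangle-mono {suc (suc n + s)} {suc n + s′} (subst (_≤ suc n + s′) (+-suc (suc n) s) (+-monoʳ-≤ (suc n) p))))

  linkᶠ dummyᶠ : Fn k → Fn k
  linkᶠ a  = retarget ⟪ lit 0 , a ⟫ (link ∘ fn a) (link-def ∘ fn a)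
  dummyᶠ a = retarget ⟪ lit 1 , S a ⟫ (dummy ∘ fn a) (dummy-def ∘ fn a)

  junkᶠ : Fn k
  junkᶠ = retarget ⟪ lit 1 , lit 0 ⟫ (λ _ → junk) (λ _ → junk-def)

  forbidᶠ sizeᶠ : Fn k → Fn k → Fn k
  forbidᶠ a b = retarget ⟪ S (S a) , b ⟫ (λ xs → forbid (fn a xs) (fn b xs)) (λ xs → forbid-def (fn a xs) (fn b xs))
  sizeᶠ a b   = retarget ⟪ S a , b ⟫ (λ xs → size (fn a xs) (fn b xs)) (λ xs → size-def (fn a xs) (fn b xs))

  -- The code of ℓ copies of v, hence the largest code of a list of at most ℓ entries that are at
  -- most v.
  bnd : ℕ → ℕ → ℕ
  bnd zero    v = 0
  bnd (suc ℓ) v = suc ⟨ v , bnd ℓ v ⟩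

  bnd-monoˡ : ∀ {ℓ ℓ′} v → ℓ ≤ ℓ′ → bnd ℓ v ≤ bnd ℓ′ v
  bnd-monoˡ v z≤n     = z≤n
  bnd-monoˡ v (s≤s p) = s≤s (pair-mono {v} {_} {v} ≤-refl (bnd-monoˡ v p))

  listCode≤bnd : ∀ {as v} → All (_≤ v) as → listCode as ≤ bnd (List.length as) v
  listCode≤bnd []       = z≤n
  listCode≤bnd (p ∷ ps) = s≤s (pair-mono p (listCode≤bnd ps))

  sequenceCode≤bnd : ∀ f n {v} → (∀ i → i < n → f i ≤ v) → sequenceCode f n ≤ bnd n v
  sequenceCode≤bnd f zero    h = z≤n
  sequenceCode≤bnd f (suc n) h = s≤s (pair-mono (h 0 (s≤s z≤n))
      (sequenceCode≤bnd (f ∘ suc) n (λ i i<n → h (suc i) (s≤s i<n))))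

  select : (ℕ → Set) → ℕ → List ℕ
  select Q zero    = []
  select Q (suc U) with em {Q U}
  ... | yes _ = U ∷ select Q U
  ... | no _  = select Q U

  ∈-select : ∀ Q U {u} → u < U → Q u → u ∈ select Q U
  ∈-select Q (suc U) (s≤s u≤U) q with em {Q U} | m≤n⇒m<n∨m≡n u≤U
  ... | yes _ | inj₁ u<U  = there (∈-select Q U u<U q)
  ... | yes _ | inj₂ refl = here refl
  ... | no _  | inj₁ u<U  = ∈-select Q U u<U q
  ... | no ¬q | inj₂ refl = ⊥-elim (¬q q)

  select-∈ : ∀ Q U {u} → u ∈ select Q U → u < U × Q u
  select-∈ Q (suc U) p with em {Q U}
  select-∈ Q (suc U) (here refl) | yes q = n<1+n U , q
  select-∈ Q (suc U) (there p)   | yes _ = let l , q = select-∈ Q U p in m<n⇒m<1+n l , q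
  select-∈ Q (suc U) p           | no _  = let l , q = select-∈ Q U p in m<n⇒m<1+n l , q

  length-select : ∀ Q U → List.length (select Q U) ≤ U
  length-select Q zero    = z≤n
  length-select Q (suc U) with em {Q U}
  ... | yes _ = s≤s (length-select Q U)
  ... | no _  = m≤n⇒m≤1+n (length-select Q U)

  argmax : ∀ (z : ℕ → ℕ) n → ∃ λ i → i < suc n × (∀ j → j < suc n → z j ≤ z i)
  argmax z zero = 0 , s≤s z≤n , λ { zero _ → ≤-refl ; (suc j) (s≤s ()) }
  argmax z (suc n) with argmax z n
  ... | i , i<n , max with ≤-total (z i) (z (suc n))
  ...   | inj₁ p = suc n , ≤-refl , λ j j≤ → case m≤n⇒m<n∨m≡n (≤-pred j≤) of λ
                     { (inj₁ j<n) → ≤-trans (max j j<n) p ; (inj₂ refl) → ≤-refl }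
  ...   | inj₂ p = i , m<n⇒m<1+n i<n , λ j j≤ → case m≤n⇒m<n∨m≡n (≤-pred j≤) of λ
                     { (inj₁ j<n) → max j j<n ; (inj₂ refl) → p }

  RawEdge : ℕ → ℕ → Set
  RawEdge y z = mem (link z) y ⊎ mem (link y) z

  RawEdge-sym : ∀ {y z} → RawEdge y z → RawEdge z y
  RawEdge-sym (inj₁ p) = inj₂ p
  RawEdge-sym (inj₂ p) = inj₁ p

  RawEdge-irrefl : ∀ {y} → ¬ RawEdge y y
  RawEdge-irrefl {y} e = <-irrefl refl (<-≤-trans (mem-< ([ id , id ]′ e)) (≤link y))

  RawEdge-< : ∀ {y z} → z ≤ y → RawEdge y z → mem (link z) y
  RawEdge-< z≤y (inj₁ p) = p
  RawEdge-< {y} z≤y (inj₂ p) = ⊥-elim (<-irrefl refl (<-≤-trans (mem-< p) (≤-trans z≤y (≤link y))))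

  Clique : ℕ → (ℕ → ℕ) → Set
  Clique N z = ∀ i j → i < j → j < N → RawEdge (z i) (z j)

  -- K describes the tuple z₀, …, zₙ from the point of view of y, which is replaced by 0.
  Describes : ℕ → ℕ → ℕ → (ℕ → ℕ) → Set
  Describes n K y z = ∀ j → j < suc n → (z j ≡ y × lk K j ≡ 0) ⊎ lk K j ≡ suc (z j)

  -- Some member of the tuple stores the prohibition. It is larger than any description it stores,
  -- so its own number cannot occur there, and `Describes` puts 0 instead. The bound on `K` makes
  -- this a bounded search.
  Forbidden : ℕ → ℕ → (ℕ → ℕ) → Set
  Forbidden N n z = ∃ λ i → i < suc n × ∃ λ K → K < z i × mem (forbid N K) (z i) × Describes n K (z i) z

  Forbidden-cong : ∀ {N n z z′} → (∀ j → j < suc n → z j ≡ z′ j) → Forbidden N n z → Forbidden N n z′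
  Forbidden-cong {N} e (i , i<n , K , K< , p , d) = i , i<n , K , subst (K <_) (e i i<n) K< ,
      subst (mem (forbid N K)) (e i i<n) p ,
    λ j j<n → case d j j<n of λ
      { (inj₁ (p , q)) → inj₁ (trans (sym (e j j<n)) (trans p (e i i<n)) , q)
      ; (inj₂ q) → inj₂ (trans q (cong suc (e j j<n))) }

  Clique-distinct : ∀ {N z i j} → Clique N z → i < N → j < N → z i ≡ z j → i ≡ j
  Clique-distinct {N} {z} {i} {j} c i<N j<N e with <-cmp i j
  ... | tri≈ _ i≡j _ = i≡j
  ... | tri< i<j _ _ = ⊥-elim (RawEdge-irrefl (subst (RawEdge (z i)) (sym e) (c i j i<j j<N)))
  ... | tri> _ _ j<i = ⊥-elim (RawEdge-irrefl (subst (RawEdge (z j)) e (c j i j<i i<N)))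

  -- No vertex is linked to itself, so the elements of a clique are distinct. In this way the number
  -- of available elements bounds the cliques that matter.
  Clique-size : ∀ {N z m} (v : Fin m → ℕ) → Clique N z → (g : ℕ → Fin m) → (∀ j → j < N → z j ≡ v (g j)) → N ≤ m
  Clique-size {N} {z} {m} v c g e = Fin.injective⇒≤ {f = g ∘ toℕ} λ {i} {j} p →
    Fin.toℕ-injective (Clique-distinct c (Fin.toℕ<n i) (Fin.toℕ<n j)
      (trans (e (toℕ i) (Fin.toℕ<n i)) (trans (cong v p) (sym (e (toℕ j) (Fin.toℕ<n j))))))

  module Graph (act : ℕ → ℕ → Set) where

    -- The vertex is the greatest element of a clique that violates an active prohibition. Blaming
    -- the greatest element suffices to spoil the clique and depends only on smaller numbers.
    Bad : ℕ → Set
    Bad y = ∃₂ λ n s → ∃ λ (z : ℕ → ℕ) → act n s × Clique (size n s) z × Forbidden (size n s) n z ×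
            (∀ i → i < size n s → z i ≤ y) × ∃ λ i → i < size n s × z i ≡ y

    Ok : ℕ → Set
    Ok y = ¬ mem junk y × ¬ Bad y

    Edge : ℕ → ℕ → Set
    Edge y z = Ok y × Ok z × RawEdge y z

    Edge-sym : ∀ {y z} → Edge y z → Edge z y
    Edge-sym (p , q , e) = q , p , RawEdge-sym e

    OkClique : ℕ → (ℕ → ℕ) → Set
    OkClique N z = (∀ i → i < N → Ok (z i)) × Clique N z

    OkClique-cong : ∀ {N z z′} → (∀ j → j < N → z j ≡ z′ j) → OkClique N z → OkClique N z′
    OkClique-cong e (o , c) = (λ i i<N → subst Ok (e i i<N) (o i i<N)) ,
      λ i j i<j j<N → subst₂ RawEdge (e i (<-trans i<j j<N)) (e j j<N) (c i j i<j j<N)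

    OkClique-≤ : ∀ {N N′ z} → N ≤ N′ → OkClique N′ z → OkClique N z
    OkClique-≤ p (o , c) = (λ i i<N → o i (<-≤-trans i<N p)) , λ i j i<j j<N → c i j i<j (<-≤-trans j<N p)

    -- The greatest element of a forbidden clique would be bad.
    notForbidden : ∀ {n s z} → act n s → OkClique (size n s) z → ¬ Forbidden (size n s) n z
    notForbidden {n} {s} {z} a (o , c) f = run (size n s) refl
      where
      run : ∀ N → N ≡ size n s → ⊥
      run zero    e = case subst (suc n <_) (sym e) (size-> n s) of λ ()
      run (suc N) e =
        let i , i<N , max = argmax z N ; j<N = λ j (p : j < size n s) → subst (j <_) (sym e) p
        in proj₂ (o i (subst (i <_) e i<N))
             (n , s , z , a , c , f , (λ j p → max j (j<N j p)) , i , subst (i <_) e i<N , refl)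

    -- Besides edges, only the prohibitions of active sizes up to q are compared,
    -- and only for cliques: those of other tuples have no effect on the graph.
    record Sim (q : ℕ) {m : ℕ} (ρ σ : Vec ℕ m) : Set where
      field
        sim-≡ : ∀ i j → lookup ρ i ≡ lookup ρ j ⟷ lookup σ i ≡ lookup σ j
        sim-E : ∀ i j → Edge (lookup ρ i) (lookup ρ j) ⟷ Edge (lookup σ i) (lookup σ j)
        sim-O : ∀ i → Ok (lookup ρ i) ⟷ Ok (lookup σ i)
        sim-F : ∀ {n s} → act n s → size n s ≤ q → (g : ℕ → Fin m) → OkClique (suc n) (lookup ρ ∘ g) →
                Forbidden (size n s) n (lookup ρ ∘ g) ⟷ Forbidden (size n s) n (lookup σ ∘ g)

      sim-C : ∀ {N} (g : ℕ → Fin m) → OkClique N (lookup ρ ∘ g) ⟷ OkClique N (lookup σ ∘ g)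
      sim-C g =
        (λ { (o , c) → (λ i p → proj₁ (sim-O (g i)) (o i p)) , λ i j p q →
             proj₂ (proj₂ (proj₁ (sim-E (g i) (g j)) (o i (<-trans p q) , o j q , c i j p q))) }) ,
        (λ { (o , c) → (λ i p → proj₂ (sim-O (g i)) (o i p)) , λ i j p q →
             proj₂ (proj₂ (proj₂ (sim-E (g i) (g j)) (o i (<-trans p q) , o j q , c i j p q))) })

    open Sim

    Sim-refl : ∀ {q m} {ρ : Vec ℕ m} → Sim q ρ ρ
    Sim-refl = record { sim-≡ = λ _ _ → ⟷-refl ; sim-E = λ _ _ → ⟷-refl ; sim-O = λ _ → ⟷-refl ; sim-F = λ _ _ _ _ → ⟷-refl }

    Sim-sym : ∀ {q m} {ρ σ : Vec ℕ m} → Sim q ρ σ → Sim q σ ρ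
    Sim-sym s = record
      { sim-≡ = λ i j → ⟷-sym (sim-≡ s i j) ; sim-E = λ i j → ⟷-sym (sim-E s i j) ; sim-O = λ i → ⟷-sym (sim-O s i)
      ; sim-F = λ a p g c → ⟷-sym (sim-F s a p g (proj₂ (sim-C s g) c)) }

    Sim-reindex : ∀ {q m k} {ρ σ : Vec ℕ m} {ρ′ σ′ : Vec ℕ k} (r : Fin k → Fin m) →
                  (∀ i → lookup ρ′ i ≡ lookup ρ (r i)) → (∀ i → lookup σ′ i ≡ lookup σ (r i)) → Sim q ρ σ → Sim q ρ′ σ′
    Sim-reindex r e e′ s = record
      { sim-≡ = λ i j → ⟷-trans (⟷-≡ (cong₂ _≡_ (e i) (e j)))
          (⟷-trans (sim-≡ s (r i) (r j)) (⟷-≡ (sym (cong₂ _≡_ (e′ i) (e′ j)))))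
      ; sim-E = λ i j → ⟷-trans (⟷-≡ (cong₂ Edge (e i) (e j)))
          (⟷-trans (sim-E s (r i) (r j)) (⟷-≡ (sym (cong₂ Edge (e′ i) (e′ j)))))
      ; sim-O = λ i → ⟷-trans (⟷-≡ (cong Ok (e i))) (⟷-trans (sim-O s (r i)) (⟷-≡ (sym (cong Ok (e′ i)))))
      ; sim-F = λ a p g c → ⟷-trans
          (Forbidden-cong (λ j _ → e (g j)) , Forbidden-cong (λ j _ → sym (e (g j))))
          (⟷-trans (sim-F s a p (r ∘ g) (OkClique-cong (λ j _ → e (g j)) c))
            (Forbidden-cong (λ j _ → sym (e′ (g j))) , Forbidden-cong (λ j _ → e′ (g j))))
      }

    private
      avoid : ∀ {m n} (g : ℕ → Fin (suc m)) → (∀ j → j < suc n → g j ≢ zero) →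
              ∃ λ (g′ : ℕ → Fin m) → ∀ j → j < suc n → g j ≡ suc (g′ j)
      avoid {m} {n} g h with g 0 in e₀
      ... | zero   = ⊥-elim (h 0 (s≤s z≤n) e₀)
      ... | suc d₀ = (λ j → pre (g j)) , λ j j<n → pre-suc (g j) (h j j<n)
        where
        pre : Fin (suc m) → Fin m
        pre zero    = d₀
        pre (suc i) = i
        pre-suc : ∀ i → i ≢ zero → i ≡ suc (pre i)
        pre-suc zero    h = ⊥-elim (h refl)
        pre-suc (suc i) h = refl

      avoiding-F : ∀ {q m n s c d} {ρ σ : Vec ℕ m} → Sim q ρ σ → act n s → size n s ≤ q → (g : ℕ → Fin (suc m)) →
        (∀ j → j < suc n → g j ≢ zero) → OkClique (suc n) (lookup (c ∷ ρ) ∘ g) →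
        Forbidden (size n s) n (lookup (c ∷ ρ) ∘ g) ⟷ Forbidden (size n s) n (lookup (d ∷ σ) ∘ g)
      avoiding-F {c = c} {d} {ρ} {σ} s a p g h k =
        let g′ , e = avoid g h in ⟷-trans
          (Forbidden-cong (λ j j<n → cong (lookup (c ∷ ρ)) (e j j<n)) ,
              Forbidden-cong (λ j j<n → sym (cong (lookup (c ∷ ρ)) (e j j<n))))
          (⟷-trans (sim-F s a p g′ (OkClique-cong (λ j j<n → cong (lookup (c ∷ ρ)) (e j j<n)) k))
            (Forbidden-cong (λ j j<n → sym (cong (lookup (d ∷ σ)) (e j j<n))) ,
                Forbidden-cong (λ j j<n → cong (lookup (d ∷ σ)) (e j j<n))))

    -- The first exceeds every link and prohibition that an extension of a tuple below B may need;
    -- the second also covers padding, junk and the old elements.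
    bound₁ bound₂ : ℕ → ℕ → ℕ
    bound₁ q B = suc (link B + forbid q (bnd q (suc B)))
    bound₂ q B = bound₁ q B + suc (dummy B) + suc junk + suc (suc B)

    -- All one-element extensions of tuples from 0, …, B are realised up to bound q B.
    bound : ℕ → ℕ → ℕ
    bound q B = bnd (suc (suc (bound₁ q B))) (bound₂ q B)

    ≤bnd : ∀ ℓ v → v ≤ bnd (suc ℓ) v
    ≤bnd ℓ v = m≤n⇒m≤1+n (fst≤pair v (bnd ℓ v))

    setCode-≤bound : ∀ q B us → List.length us ≤ suc (suc (bound₁ q B)) → All (λ u → suc u ≤ bound₂ q B) us →
        setCode us ≤ bound q B
    setCode-≤bound q B us l h = ≤-trans (listCode≤bnd (All.map⁺ {xs = us} {f = suc} h))
      (bnd-monoˡ (bound₂ q B) (subst (_≤ suc (suc (bound₁ q B))) (sym (List.length-map suc us)) l))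

    -- The one-element extension property. As `suc m ≤ q`, a clique within the extended tuple has
    -- size at most q, so `Sim q` compares every prohibition that could make the new element bad.
    module Extension {q m B : ℕ} {ρ σ : Vec ℕ m} (s : Sim q ρ σ) (m<q : suc m ≤ q) (σ≤B : ∀ i → lookup σ i ≤ B) (c : ℕ) where

      Realised : Set
      Realised = ∃ λ d → d ≤ bound q B × Sim q (c ∷ ρ) (d ∷ σ)

      old : ∀ i → c ≡ lookup ρ i → Realised
      old i e = lookup σ i ,
        ≤-trans (σ≤B i) (≤-trans (≤-trans (n≤1+n B)
            (≤-trans (n≤1+n (suc B)) (m≤n+m (suc (suc B)) (bound₁ q B + suc (dummy B) + suc junk))))
          (≤bnd (suc (bound₁ q B)) (bound₂ q B))) ,
        Sim-reindex r (λ { zero → e ; (suc j) → refl }) (λ { zero → refl ; (suc j) → refl }) s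
        where
        r : Fin (suc m) → Fin m
        r zero    = i
        r (suc j) = j

      module New (new : ∀ i → c ≢ lookup ρ i) where

        module Fresh (d : ℕ) (B<d : B < d) where

          d≢σ : ∀ i → d ≢ lookup σ i
          d≢σ i e = <-irrefl refl (<-≤-trans B<d (≤-trans (≤-reflexive e) (σ≤B i)))

          fresh-≡ : ∀ i j → lookup (c ∷ ρ) i ≡ lookup (c ∷ ρ) j ⟷ lookup (d ∷ σ) i ≡ lookup (d ∷ σ) j
          fresh-≡ zero    zero    = (λ _ → refl) , (λ _ → refl)
          fresh-≡ zero    (suc j) = (⊥-elim ∘ new j) , (⊥-elim ∘ d≢σ j)
          fresh-≡ (suc i) zero    = (⊥-elim ∘ new i ∘ sym) , (⊥-elim ∘ d≢σ i ∘ sym)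
          fresh-≡ (suc i) (suc j) = sim-≡ s i j

        -- An element that is not `Ok` is isolated and lies in no `OkClique`, so it is matched by
        -- any new element containing junk; the padding makes it new.
        junkCase : ¬ Ok c → Realised
        junkCase c-bad = d , d≤ , record { sim-≡ = fresh-≡ ; sim-E = E ; sim-O = O ; sim-F = F }
          where
          us : List ℕ
          us = junk ∷ dummy B ∷ []
          d : ℕ
          d = setCode us
          d≤ : d ≤ bound q B
          d≤ = setCode-≤bound q B us (s≤s (s≤s z≤n))
            (≤-trans (m≤n+m (suc junk) (bound₁ q B + suc (dummy B))) (m≤m+n _ (suc (suc B))) ∷
             ≤-trans (≤-trans (m≤n+m (suc (dummy B)) (bound₁ q B)) (m≤m+n _ (suc junk))) (m≤m+n _ (suc (suc B))) ∷ [])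
          B<d : B < d
          B<d = <-trans (<dummy B) (mem-< {dummy B} {d} (mem-setCode us (there (here refl))))
          open Fresh d B<d
          d-bad : ¬ Ok d
          d-bad (o , _) = o (mem-setCode us (here refl))
          O : ∀ i → Ok (lookup (c ∷ ρ) i) ⟷ Ok (lookup (d ∷ σ) i)
          O zero    = (⊥-elim ∘ c-bad) , (⊥-elim ∘ d-bad)
          O (suc i) = sim-O s i
          E : ∀ i j → Edge (lookup (c ∷ ρ) i) (lookup (c ∷ ρ) j) ⟷ Edge (lookup (d ∷ σ) i) (lookup (d ∷ σ) j)
          E zero    j       = (λ { (o , _) → ⊥-elim (c-bad o) }) , (λ { (o , _) → ⊥-elim (d-bad o) })
          E (suc i) zero    = (λ { (_ , o , _) → ⊥-elim (c-bad o) }) , (λ { (_ , o , _) → ⊥-elim (d-bad o) })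
          E (suc i) (suc j) = sim-E s i j
          F : ∀ {n t} → act n t → size n t ≤ q → (g : ℕ → Fin (suc m)) → OkClique (suc n) (lookup (c ∷ ρ) ∘ g) →
              Forbidden (size n t) n (lookup (c ∷ ρ) ∘ g) ⟷ Forbidden (size n t) n (lookup (d ∷ σ) ∘ g)
          F a p g k = avoiding-F s a p g (λ j j<n e → c-bad (subst Ok (cong (lookup (c ∷ ρ)) e) (proj₁ k j j<n))) k

        module OkCase (c-ok : Ok c) where

          keyEntry : Fin (suc m) → ℕ
          keyEntry zero    = 0
          keyEntry (suc i) = suc (lookup σ i)

          keyCode : ℕ → (ℕ → Fin (suc m)) → ℕ
          keyCode n g = sequenceCode (keyEntry ∘ g) (suc n)

          -- The members of the set `d`: links that copy the edges of `c`, and the prohibitions on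
          -- cliques of `c ∷ ρ`, whichever element stores them there. As the greatest element of its
          -- tuple, `d` can store them all itself.
          Linked Prohibited Wanted : ℕ → Set
          Linked u     = ∃ λ i → u ≡ link (lookup σ i) × Edge c (lookup ρ i)
          Prohibited u = ∃₂ λ n t → act n t × size n t ≤ q × ∃ λ (g : ℕ → Fin (suc m)) →
            OkClique (suc n) (lookup (c ∷ ρ) ∘ g) × Forbidden (size n t) n (lookup (c ∷ ρ) ∘ g) ×
            u ≡ forbid (size n t) (keyCode n g)
          Wanted u = Linked u ⊎ Prohibited u

          keyCode-≤ : ∀ n t g → size n t ≤ q → keyCode n g ≤ bnd q (suc B)
          keyCode-≤ n t g p = ≤-trans (sequenceCode≤bnd (keyEntry ∘ g) (suc n) (λ i _ → entry (g i)))
            (bnd-monoˡ (suc B) (≤-trans (<⇒≤ (size-> n t)) p))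
            where
            entry : ∀ i → keyEntry i ≤ suc B
            entry zero    = z≤n
            entry (suc i) = s≤s (σ≤B i)

          Wanted-< : ∀ {u} → Wanted u → u < bound₁ q B
          Wanted-< (inj₁ (i , refl , _)) = s≤s (≤-trans (link-mono (σ≤B i)) (m≤m+n (link B) _))
          Wanted-< (inj₂ (n , t , _ , p , g , _ , _ , refl)) =
            s≤s (≤-trans (forbid-mono p (keyCode-≤ n t g p)) (m≤n+m _ (link B)))

          us : List ℕ
          us = dummy B ∷ select Wanted (bound₁ q B)
          d : ℕ
          d = setCode us

          d≤ : d ≤ bound q B
          d≤ = setCode-≤bound q B us (s≤s (m≤n⇒m≤1+n (length-select Wanted (bound₁ q B))))
            (≤-trans (≤-trans (m≤n+m (suc (dummy B)) (bound₁ q B)) (m≤m+n _ (suc junk))) (m≤m+n _ (suc (suc B))) ∷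
             All.tabulate (λ p → ≤-trans (proj₁ (select-∈ Wanted (bound₁ q B) p))
               (≤-trans (≤-trans (m≤m+n (bound₁ q B) (suc (dummy B))) (m≤m+n _ (suc junk))) (m≤m+n _ (suc (suc B))))))

          B<d : B < d
          B<d = <-trans (<dummy B) (mem-< {dummy B} {d} (mem-setCode us (here refl)))

          open Fresh d B<d

          wanted : ∀ {u} → Wanted u → mem u d
          wanted w = mem-setCode us (there (∈-select Wanted (bound₁ q B) (Wanted-< w) w))

          members : ∀ {u} → mem u d → u ≡ dummy B ⊎ Wanted u
          members p with setCode-mem us p
          ... | here e  = inj₁ e
          ... | there r = inj₂ (proj₂ (select-∈ Wanted (bound₁ q B) r))

          link-members : ∀ {x} → mem (link x) d → ∃ λ i → x ≡ lookup σ i × Edge c (lookup ρ i)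
          link-members p with members p
          ... | inj₁ e                         = ⊥-elim (link≢dummy e)
          ... | inj₂ (inj₁ (i , e , k))        = i , link-injective e , k
          ... | inj₂ (inj₂ (_ , _ , _ , _ , _ , _ , _ , e)) = ⊥-elim (link≢forbid e)

          forbid-members : ∀ {N K} → mem (forbid N K) d → Prohibited (forbid N K)
          forbid-members p with members p
          ... | inj₁ e                  = ⊥-elim (forbid≢dummy e)
          ... | inj₂ (inj₁ (_ , e , _)) = ⊥-elim (link≢forbid (sym e))
          ... | inj₂ (inj₂ w)           = w

          raw : ∀ i → RawEdge d (lookup σ i) ⟷ Edge c (lookup ρ i)
          raw i = to′ , λ e → inj₁ (wanted (inj₁ (i , refl , e)))
            where
            to′ : RawEdge d (lookup σ i) → Edge c (lookup ρ i)
            to′ e = let j , p , k = link-members (RawEdge-< (≤-trans (σ≤B i) (<⇒≤ B<d)) e) in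
              subst (Edge c) (proj₂ (sim-≡ s j i) (sym p)) k

          keyCode-lk : ∀ n g j → j < suc n → lk (keyCode n g) j ≡ keyEntry (g j)
          keyCode-lk n g = lk-sequenceCode (keyEntry ∘ g) (suc n)

          described : ∀ n g → Describes n (keyCode n g) d (lookup (d ∷ σ) ∘ g)
          described n g j j<n = entry (g j) (keyCode-lk n g j j<n)
            where
            entry : ∀ i → lk (keyCode n g) j ≡ keyEntry i → (lookup (d ∷ σ) i ≡ d × lk (keyCode n g) j ≡ 0) ⊎
                lk (keyCode n g) j ≡ suc (lookup (d ∷ σ) i)
            entry zero    e = inj₁ (refl , e)
            entry (suc i) e = inj₂ e

          -- A key determines its tuple: indices with the same entry denote equal elements of
          -- `d ∷ σ`, hence of `c ∷ ρ` by similarity.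
          same-description : ∀ n g g′ → Describes n (keyCode n g′) d (lookup (d ∷ σ) ∘ g) →
                             ∀ j → j < suc n → lookup (c ∷ ρ) (g j) ≡ lookup (c ∷ ρ) (g′ j)
          same-description n g g′ h j j<n = matched (g j) (g′ j) (keyCode-lk n g′ j j<n) (h j j<n)
            where
            matched : ∀ i i′ {x} → x ≡ keyEntry i′ → (lookup (d ∷ σ) i ≡ d × x ≡ 0) ⊎ x ≡ suc (lookup (d ∷ σ) i) →
                      lookup (c ∷ ρ) i ≡ lookup (c ∷ ρ) i′
            matched zero    zero     e _             = refl
            matched (suc i) zero     e (inj₁ (p , _)) = ⊥-elim (d≢σ i (sym p))
            matched (suc i) zero     e (inj₂ p)      = case trans (sym e) p of λ ()
            matched i       (suc i′) e (inj₁ (_ , p)) = case trans (sym e) p of λ ()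
            matched zero    (suc i′) e (inj₂ p)      = ⊥-elim (d≢σ i′ (suc-injective (trans (sym p) e)))
            matched (suc i) (suc i′) e (inj₂ p)      = proj₂ (sim-≡ s i i′) (suc-injective (trans (sym p) e))

          F : ∀ {n t} → act n t → size n t ≤ q → (g : ℕ → Fin (suc m)) → OkClique (suc n) (lookup (c ∷ ρ) ∘ g) →
              Forbidden (size n t) n (lookup (c ∷ ρ) ∘ g) ⟷ Forbidden (size n t) n (lookup (d ∷ σ) ∘ g)
          F {n} {t} a p g k with em {∃ λ j → j < suc n × g j ≡ zero}
          ... | no none = avoiding-F s a p g (λ j j<n e → none (j , j<n , e)) k
          ... | yes (j₀ , j₀<n , e₀) = to′ , from′
            where
            z₀ : lookup (d ∷ σ) (g j₀) ≡ d
            z₀ = cong (lookup (d ∷ σ)) e₀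
            to′ : Forbidden (size n t) n (lookup (c ∷ ρ) ∘ g) → Forbidden (size n t) n (lookup (d ∷ σ) ∘ g)
            to′ f = j₀ , j₀<n , keyCode n g , subst (keyCode n g <_) (sym z₀)
                (≤-<-trans (≤forbid (size n t) (keyCode n g)) (mem-< prohibited)) ,
              subst (mem (forbid (size n t) (keyCode n g))) (sym z₀) prohibited ,
              subst (λ y → Describes n (keyCode n g) y (lookup (d ∷ σ) ∘ g)) (sym z₀) (described n g)
              where
              prohibited : mem (forbid (size n t) (keyCode n g)) d
              prohibited = wanted (inj₂ (n , t , a , p , g , k , f , refl))
            fromNew : ∀ {K} → mem (forbid (size n t) K) d → Describes n K d (lookup (d ∷ σ) ∘ g) →
                      Forbidden (size n t) n (lookup (c ∷ ρ) ∘ g)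
            fromNew p h with forbid-members p
            ... | n′ , t′ , _ , _ , g′ , _ , f , e with forbid-injective e
            ...   | e₁ , refl with size-injective e₁
            ...     | refl , refl = Forbidden-cong (λ j j<n → sym (same-description n g g′ h j j<n)) f
            from′ : Forbidden (size n t) n (lookup (d ∷ σ) ∘ g) → Forbidden (size n t) n (lookup (c ∷ ρ) ∘ g)
            from′ (i , i<n , K , K< , p , h) = split (g i) refl
              where
              split : ∀ x → g i ≡ x → Forbidden (size n t) n (lookup (c ∷ ρ) ∘ g)
              split zero    e = fromNew (subst (mem (forbid (size n t) K)) (cong (lookup (d ∷ σ)) e) p)
                (subst (λ y → Describes n K y (lookup (d ∷ σ) ∘ g)) (cong (lookup (d ∷ σ)) e) h)
              -- An old element cannot store it: its description would mention `d` and thus exceed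
              -- `d`, although it is smaller than the old element.
              split (suc x) e with h j₀ j₀<n
              ... | inj₁ (e′ , _) = ⊥-elim (d≢σ x (trans (sym z₀) (trans e′ (cong (lookup (d ∷ σ)) e))))
              ... | inj₂ e′ = ⊥-elim (<-irrefl refl (<-trans (lk-< K j₀ (trans e′ (cong suc z₀)))
                      (<-≤-trans K< (≤-trans (≤-reflexive (cong (lookup (d ∷ σ)) e)) (≤-trans (σ≤B x)
                        (<⇒≤ B<d))))))

          -- A clique with greatest element `d` consists of `d` and elements linked to it, all of
          -- which come from σ. It pulls back to a clique of good vertices in `c ∷ ρ` with the same
          -- prohibition, contrary to `notForbidden`.
          d-ok : Ok d
          d-ok = notJunk , notBad
            where
            notJunk : ¬ mem junk d
            notJunk p with members p
            ... | inj₁ e                  = junk≢dummy e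
            ... | inj₂ (inj₁ (_ , e , _)) = junk≢link e
            ... | inj₂ (inj₂ (_ , _ , _ , _ , _ , _ , _ , e)) = junk≢forbid e
            notBad : ¬ Bad d
            notBad (n , t , z , a , k , f , z≤d , i₀ , i₀<N , z₀) =
              notForbidden a k′ (proj₂ (F a N≤q g (OkClique-≤ (<⇒≤ (size-> n t)) k′))
                (Forbidden-cong (λ j j<n → place-≡ j (<-trans j<n (size-> n t))) f))
              where
              N = size n t
              place : ∀ j → j < N → ∃ λ x → z j ≡ lookup (d ∷ σ) x × (x ≡ zero ⊎ ∃ λ i → x ≡ suc i × Edge c (lookup ρ i))
              place j j<N with z j ≟ d
              ... | yes e = zero , e , inj₁ refl
              ... | no ne = let i , e , l = link-members (RawEdge-< (z≤d j j<N) (toward (<-cmp j i₀))) in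
                            suc i , e , inj₂ (i , refl , l)
                where
                toward : Tri (j < i₀) (j ≡ i₀) (i₀ < j) → RawEdge d (z j)
                toward (tri< l _ _) = subst (λ y → RawEdge y (z j)) z₀ (RawEdge-sym (k j i₀ l i₀<N))
                toward (tri≈ _ e _) = ⊥-elim (ne (trans (cong z e) z₀))
                toward (tri> _ _ l) = subst (λ y → RawEdge y (z j)) z₀ (k i₀ j l j<N)
              g : ℕ → Fin (suc m)
              g j with j <? N
              ... | yes j<N = proj₁ (place j j<N)
              ... | no _    = zero
              place-≡ : ∀ j → j < N → z j ≡ lookup (d ∷ σ) (g j)
              place-≡ j j<N with j <? N
              ... | yes p = proj₁ (proj₂ (place j p))
              ... | no p  = ⊥-elim (p j<N)
              place-E : ∀ j → j < N → g j ≡ zero ⊎ ∃ λ i → g j ≡ suc i × Edge c (lookup ρ i)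
              place-E j j<N with j <? N
              ... | yes p = proj₂ (proj₂ (place j p))
              ... | no p  = ⊥-elim (p j<N)
              N≤q : N ≤ q
              N≤q = ≤-trans (Clique-size (lookup (d ∷ σ)) k g place-≡) m<q
              pull : ∀ x y → x ≡ zero ⊎ (∃ λ i → x ≡ suc i × Edge c (lookup ρ i)) →
                     y ≡ zero ⊎ (∃ λ i → y ≡ suc i × Edge c (lookup ρ i)) →
                     RawEdge (lookup (d ∷ σ) x) (lookup (d ∷ σ) y) → RawEdge (lookup (c ∷ ρ) x) (lookup (c ∷ ρ) y)
              pull _ _ (inj₁ refl) (inj₁ refl) e = ⊥-elim (RawEdge-irrefl e)
              pull _ _ (inj₁ refl) (inj₂ (_ , refl , l)) e = proj₂ (proj₂ l)
              pull _ _ (inj₂ (_ , refl , l)) (inj₁ refl) e = RawEdge-sym (proj₂ (proj₂ l))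
              pull _ _ (inj₂ (i , refl , l)) (inj₂ (j , refl , l′)) e = proj₂ (proj₂ (proj₂ (sim-E s i j)
                (proj₁ (sim-O s i) (proj₁ (proj₂ l)) , proj₁ (sim-O s j) (proj₁ (proj₂ l′)) , e)))
              okAt : ∀ x → x ≡ zero ⊎ (∃ λ i → x ≡ suc i × Edge c (lookup ρ i)) → Ok (lookup (c ∷ ρ) x)
              okAt _ (inj₁ refl)           = c-ok
              okAt _ (inj₂ (_ , refl , l)) = proj₁ (proj₂ l)
              k′ : OkClique N (lookup (c ∷ ρ) ∘ g)
              k′ = (λ i i<N → okAt (g i) (place-E i i<N)) , λ i j i<j j<N →
                let i<N = <-trans i<j j<N in pull (g i) (g j) (place-E i i<N) (place-E j j<N)
                  (subst₂ RawEdge (place-≡ i i<N) (place-≡ j j<N) (k i j i<j j<N))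

          E₀ : ∀ i → Edge c (lookup ρ i) ⟷ Edge d (lookup σ i)
          E₀ i = (λ e → d-ok , proj₁ (sim-O s i) (proj₁ (proj₂ e)) , proj₂ (raw i) e) ,
              (λ e → proj₁ (raw i) (proj₂ (proj₂ e)))

          E : ∀ i j → Edge (lookup (c ∷ ρ) i) (lookup (c ∷ ρ) j) ⟷ Edge (lookup (d ∷ σ) i) (lookup (d ∷ σ) j)
          E zero    zero    = (λ e → ⊥-elim (RawEdge-irrefl (proj₂ (proj₂ e)))) ,
              (λ e → ⊥-elim (RawEdge-irrefl (proj₂ (proj₂ e))))
          E zero    (suc j) = E₀ j
          E (suc i) zero    = ⟷-trans (Edge-sym , Edge-sym) (⟷-trans (E₀ i) (Edge-sym , Edge-sym))
          E (suc i) (suc j) = sim-E s i j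

          realised : Realised
          realised = d , d≤ , record
            { sim-≡ = fresh-≡ ; sim-E = E ; sim-F = F
            ; sim-O = λ { zero → (λ _ → d-ok) , (λ _ → c-ok) ; (suc i) → sim-O s i } }

      realise : Realised
      realise with em {∃ λ i → c ≡ lookup ρ i} | em {Ok c}
      ... | yes (i , e) | _       = old i e
      ... | no none     | yes c-ok = New.OkCase.realised (λ i e → none (i , e)) c-ok
      ... | no none     | no c-bad = New.junkCase (λ i e → none (i , e)) c-bad

  -- Categoricity of the graph's theory and the number of active s.

  quantifiers : ∀ {n} → Formula 𝓖 n → ℕ
  quantifiers ⊥̇         = 0
  quantifiers (_ ≐ _)   = 0
  quantifiers (rel _ _) = 0
  quantifiers (A ⇒ B)   = quantifiers A ⊔ quantifiers B
  quantifiers (all A)   = suc (quantifiers A)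

  ext : ℕ → Formula 𝓖 n
  ext zero            = ⊥̇ ⇒ ⊥̇
  ext {n = n} (suc j) = ∃̇ (⋀ (List.map (λ i → edge zero (suc i)) (List.allFin n)) ∧̇ ext j)

  Listable : Set → Set
  Listable A = ∃ λ (l : List A) → ∀ a → a ∈ l

  listable-× : ∀ {A B : Set} → Listable A → Listable B → Listable (A × B)
  listable-× (l , f) (l′ , g) = List.cartesianProduct l l′ , λ { (a , b) → List.∈-cartesianProduct⁺ (f a) (g b) }

  listable-⊎ : ∀ {A B : Set} → Listable A → Listable B → Listable (A ⊎ B)
  listable-⊎ (l , f) (l′ , g) = List.map inj₁ l ++ List.map inj₂ l′ , λ
    { (inj₁ a) → List.∈-++⁺ˡ (List.∈-map⁺ inj₁ (f a)) ; (inj₂ b) → List.∈-++⁺ʳ (List.map inj₁ l) (List.∈-map⁺ inj₂ (g b)) }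

  listable-Fin : Listable (Fin n)
  listable-Fin = List.allFin _ , List.∈-allFin

  listable-Vec : ∀ {A : Set} k → Listable A → Listable (Vec A k)
  listable-Vec zero    a = [] ∷ [] , λ { [] → here refl }
  listable-Vec (suc k) a = let l , f = listable-× a (listable-Vec k a) in
    List.map (λ (x , v) → x ∷ v) l , λ { (x ∷ v) → List.∈-map⁺ (λ (x , v) → x ∷ v) (f (x , v)) }

  module _ (act : ℕ → ℕ → Set) where
    open Graph act
    open Sim

    graph : Structure 𝓖
    graph = record { Carrier = ℕ ; point = 0 ; funᴹ = λ () ; relᴹ = λ { _ (a ∷ b ∷ []) → Edge a b } }

    -- The variables and the quantifiers still to come never exceed q in total, so at each
    -- quantifier there is room for one more element in the extension property.
    sim-truth : ∀ {n} q (A : Formula 𝓖 n) → n + quantifiers A ≤ q → ∀ {ρ σ} → Sim q ρ σ →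
                Satisfies graph ρ A ⟷ Satisfies graph σ A
    sim-truth q = formulaElim (λ {n} A → n + quantifiers A ≤ q → ∀ {ρ σ} → Sim q ρ σ → Satisfies graph ρ A ⟷
        Satisfies graph σ A)
      (λ _ s → ⟷-refl)
      (λ i j _ s → sim-≡ s i j)
      (λ i j _ s → sim-E s i j)
      (λ {n} {A} {B} p p′ h s → ⟷-→
        (p (≤-trans (+-monoʳ-≤ n (m≤m⊔n (quantifiers A) (quantifiers B))) h) s)
        (p′ (≤-trans (+-monoʳ-≤ n (m≤n⊔m (quantifiers A) (quantifiers B))) h) s))
      (λ {n} {A} p h {ρ} {σ} s → let h′ = ≤-trans (≤-reflexive (sym (+-suc n (quantifiers A)))) h in
        (λ t d → let c , _ , s′ = extend (≤-trans (s≤s (m≤m+n n _)) h′) (Sim-sym s) d in proj₂ (p h′ s′) (t c)) ,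
        (λ t c → let d , _ , s′ = extend (≤-trans (s≤s (m≤m+n n _)) h′) s c in proj₂ (p h′ s′) (t d)))
      where
      extend : ∀ {n} {ρ σ : Vec ℕ n} → suc n ≤ q → Sim q ρ σ → ∀ c → ∃ λ d → d ≤ bound q (proj₁ (vecBound σ)) ×
          Sim q (c ∷ ρ) (d ∷ σ)
      extend {σ = σ} n<q s c = Extension.realise s n<q (λ i → <⇒≤ (proj₂ (vecBound σ) i)) c

    -- The tuple is similar to itself, so every `c` is matched, over the same tuple, by some `d`
    -- within the bound.
    bounded-∀ : ∀ {n} q B (A : Formula 𝓖 (suc n)) (ρ : Vec ℕ n) → suc n + quantifiers A ≤ q → (∀ i → lookup ρ i ≤ B) →
                (∀ c → c < suc (bound q B) → Satisfies graph (c ∷ ρ) A) → ∀ c → Satisfies graph (c ∷ ρ) A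
    bounded-∀ {n} q B A ρ h ρ≤B t c =
      let d , d≤ , s = Extension.realise {ρ = ρ} {ρ} Sim-refl (≤-trans (m≤m+n (suc n) _) h) ρ≤B c in
      proj₂ (sim-truth q A h s) (t d (s≤s d≤))

    module _ (fin : ∀ n → ∃ λ S → ∀ s → act n s → s < S) where

      private
        cap : ℕ → ℕ
        cap zero    = 0
        cap (suc m) = cap m ⊔ proj₁ (fin m)

        cap-< : ∀ {m n s} → n < m → act n s → s < cap m
        cap-< {suc m} {n} (s≤s n≤m) a with m≤n⇒m<n∨m≡n n≤m
        ... | inj₁ n<m  = <-≤-trans (cap-< n<m a) (m≤m⊔n (cap m) _)
        ... | inj₂ refl = <-≤-trans (proj₂ (fin n) _ a) (m≤n⊔m (cap m) _)

        Query : ℕ → Set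
        Query m = (Fin m × Fin m) ⊎ (Fin m × Fin m) ⊎ Fin m ⊎ (Fin m × Fin (cap m) × Vec (Fin m) m)

        queries : ∀ m → Listable (Query m)
        queries m = listable-⊎ (listable-× listable-Fin listable-Fin) (listable-⊎ (listable-× listable-Fin listable-Fin)
          (listable-⊎ listable-Fin (listable-× listable-Fin (listable-× listable-Fin (listable-Vec m listable-Fin)))))

        at-index : ∀ {m} → Fin m → Vec (Fin m) m → ℕ → Fin m
        at-index {suc m} _ v j = lookup v (clip m j)

        Holds : ∀ {m} → Query m → Vec ℕ m → Set
        Holds (inj₁ (i , j))               ρ = lookup ρ i ≡ lookup ρ j
        Holds (inj₂ (inj₁ (i , j)))        ρ = Edge (lookup ρ i) (lookup ρ j)
        Holds (inj₂ (inj₂ (inj₁ i)))       ρ = Ok (lookup ρ i)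
        Holds (inj₂ (inj₂ (inj₂ (n , s , v)))) ρ = Forbidden (size (toℕ n) (toℕ s)) (toℕ n) (lookup ρ ∘ at-index n v)

        at-index-≡ : ∀ {m} (n : Fin m) (g : ℕ → Fin m) j → j < m → at-index n (tabulate (g ∘ toℕ)) j ≡ g j
        at-index-≡ {suc m} n g j j<m = trans (Vec.lookup∘tabulate (g ∘ toℕ) (clip m j)) (cong g (toℕ-clip m j<m))

        -- The tuples compared in `sim-F` are cliques, so n < m, and activity then bounds s by
        -- `cap m`. Hence finitely many queries decide similarity for all q at once.
        agree⇒Sim : ∀ {m} q (ρ σ : Vec ℕ m) → (∀ k → Holds k ρ ⟷ Holds k σ) → Sim q ρ σ
        agree⇒Sim {m} q ρ σ h = record
          { sim-≡ = λ i j → h (inj₁ (i , j)) ; sim-E = λ i j → h (inj₂ (inj₁ (i , j))) ; sim-O = λ i →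
              h (inj₂ (inj₂ (inj₁ i)))
          ; sim-F = forbidden }
          where
          forbidden : ∀ {n s} → act n s → size n s ≤ q → (g : ℕ → Fin m) → OkClique (suc n) (lookup ρ ∘ g) →
                      Forbidden (size n s) n (lookup ρ ∘ g) ⟷ Forbidden (size n s) n (lookup σ ∘ g)
          forbidden {n} {s} a _ g (_ , c) = ⟷-trans (shift ρ) (⟷-trans (subst₂ (λ n′ s′ →
                Forbidden (size n′ s′) n′ (lookup ρ ∘ at-index idx v) ⟷
                    Forbidden (size n′ s′) n′ (lookup σ ∘ at-index idx v))
                (Fin.toℕ-fromℕ< n<m) (Fin.toℕ-fromℕ< s<cap) (h (inj₂ (inj₂ (inj₂ (idx , fromℕ< s<cap , v))))))
              (⟷-sym (shift σ)))
            where
            n<m : n < m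
            n<m = Clique-size (lookup ρ) c g (λ _ _ → refl)
            s<cap : s < cap m
            s<cap = cap-< n<m a
            idx : Fin m
            idx = fromℕ< n<m
            v : Vec (Fin m) m
            v = tabulate (g ∘ toℕ)
            shift : ∀ τ → Forbidden (size n s) n (lookup τ ∘ g) ⟷ Forbidden (size n s) n (lookup τ ∘ at-index idx v)
            shift τ = Forbidden-cong (λ j j<n → sym (cong (lookup τ) (at-index-≡ idx g j (<-≤-trans j<n n<m)))) ,
                      Forbidden-cong (λ j j<n → cong (lookup τ) (at-index-≡ idx g j (<-≤-trans j<n n<m)))

      -- `finiteIndex` is applied twice: the queries leave finitely many representative tuples, and
      -- the truth values on these leave finitely many formulas. Similarity is available for any q,
      -- so q is taken large enough for both formulas.
      finite⇒finitary : Finitary (Th graph)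
      finite⇒finitary m = Δ , λ ψ → let δ , p , s = classify ψ in δ , p ,
          proj₂ (Sat.tr-allⁿ graph m (iff ψ δ)) (λ ρ → proj₂ (Sat.tr-iff graph ψ δ) (
            let θ , r , t = represent ρ
                q = (m + quantifiers ψ) ⊔ (m + quantifiers δ)
                S = agree⇒Sim q ρ θ (λ k → t (proj₂ (queries m) k))
            in ⟷-trans (sim-truth q ψ (m≤m⊔n _ _) S)
                (⟷-trans (s r) (⟷-sym (sim-truth q δ (m≤n⊔m (m + quantifiers ψ) _) S)))))
        where
        Θ = proj₁ (finiteIndex {I = Vec ℕ m} Holds (proj₁ (queries m)))
        represent = proj₂ (finiteIndex {I = Vec ℕ m} Holds (proj₁ (queries m)))
        Δ = proj₁ (finiteIndex {I = Formula 𝓖 m} (λ ρ ψ → Satisfies graph ρ ψ) Θ)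
        classify = proj₂ (finiteIndex {I = Formula 𝓖 m} (λ ρ ψ → Satisfies graph ρ ψ) Θ)

    -- The latest element is listed first.
    Ext : ∀ {k} → ℕ → Vec ℕ k → Set
    Ext zero    v = ⊤
    Ext (suc j) v = ∃ λ a → (∀ i → Edge a (lookup v i)) × Ext j (a ∷ v)

    sat-ext : ∀ {k} j (v : Vec ℕ k) → Satisfies graph v (ext j) ⟷ Ext j v
    sat-ext zero    v = (λ _ → tt) , (λ _ → id)
    sat-ext {k} (suc j) v = ⟷-trans (Sat.tr-∃ graph (adjacent ∧̇ ext j))
      ((λ { (a , s) → let p , t = proj₁ (Sat.tr-∧ graph adjacent (ext j)) s in
            a , (λ i → All.lookup (proj₁ (Sat.tr-⋀ graph links) p)
                (List.∈-map⁺ (λ i → edge zero (suc i)) (List.∈-allFin i))) ,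
            proj₁ (sat-ext j (a ∷ v)) t }) ,
       (λ { (a , p , t) → a , proj₂ (Sat.tr-∧ graph adjacent (ext j))
            (proj₂ (Sat.tr-⋀ graph links) (All.map⁺ {xs = List.allFin k} {f = λ i → edge zero (suc i)}
                (All.tabulate (λ {i} _ → p i))) ,
             proj₂ (sat-ext j (a ∷ v)) t) }))
      where
      links : List (Formula 𝓖 (suc k))
      links = List.map (λ i → edge zero (suc i)) (List.allFin k)
      adjacent : Formula 𝓖 (suc k)
      adjacent = ⋀ links

    -- The elements in the order of their choice: the oldest, last in the vector, has number 0.
    seq : ∀ {k} → Vec ℕ k → ℕ → ℕ
    seq []              i = 0
    seq (_∷_ {n = k} a v) i with i ≟ k
    ... | yes _ = a
    ... | no _  = seq v i

    seq-new : ∀ {k} a (v : Vec ℕ k) → seq (a ∷ v) k ≡ a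
    seq-new {k} a v with k ≟ k
    ... | yes _ = refl
    ... | no ne = ⊥-elim (ne refl)

    seq-old : ∀ {k} a (v : Vec ℕ k) i → i < k → seq (a ∷ v) i ≡ seq v i
    seq-old {k} a v i i<k with i ≟ k
    ... | yes refl = ⊥-elim (<-irrefl refl i<k)
    ... | no _     = refl

    seq-lookup : ∀ {k} (v : Vec ℕ k) i → i < k → ∃ λ j → seq v i ≡ lookup v j
    seq-lookup {suc k} (a ∷ v) i (s≤s i≤k) with i ≟ k
    ... | yes _ = zero , refl
    ... | no ne = let j , e = seq-lookup v i (≤∧≢⇒< i≤k ne) in suc j , e

    Ext⇒clique : ∀ {k} j (v : Vec ℕ (suc k)) → OkClique (suc k) (seq v) → Ext j v →
                 ∃ λ z → OkClique (j + suc k) z × (∀ i → i < suc k → z i ≡ seq v i)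
    Ext⇒clique zero    v c _ = seq v , c , λ _ _ → refl
    Ext⇒clique {k} (suc j) v (o , c) (a , p , x) =
      let z , c′ , e = Ext⇒clique j (a ∷ v) (oks , edges) x in
      z , subst (λ N → OkClique N z) (+-suc j (suc k)) c′ ,
      λ i i<k → trans (e i (m<n⇒m<1+n i<k)) (seq-old a v i i<k)
      where
      oks : ∀ i → i < suc (suc k) → Ok (seq (a ∷ v) i)
      oks i (s≤s i≤k) with m≤n⇒m<n∨m≡n i≤k
      ... | inj₁ i<k  = subst Ok (sym (seq-old a v i i<k)) (o i i<k)
      ... | inj₂ refl = subst Ok (sym (seq-new a v)) (proj₁ (p zero))
      edges : Clique (suc (suc k)) (seq (a ∷ v))
      edges i i′ i<i′ (s≤s i′≤k) with m≤n⇒m<n∨m≡n i′≤k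
      ... | inj₁ i′<k = subst₂ RawEdge (sym (seq-old a v i (<-trans i<i′ i′<k))) (sym (seq-old a v i′ i′<k))
          (c i i′ i<i′ i′<k)
      ... | inj₂ refl = let x , e = seq-lookup v i i<i′ in
        subst₂ RawEdge (sym (trans (seq-old a v i i<i′) e)) (sym (seq-new a v)) (RawEdge-sym (proj₂ (proj₂ (p x))))

    -- A clique y₀, y₁, … in which yₙ forbids that y₀, …, yₙ extend to N elements.
    module Witness (n s : ℕ) (a : act n s) where

      N : ℕ
      N = size n s

      -- The description to be stored by yₙ, in which its own entry, the last one, is 0.
      key : (ℕ → ℕ) → ℕ → ℕ
      key f j with j <? n
      ... | yes _ = suc (f j)
      ... | no _  = 0

      key-< : ∀ f {j} → j < n → key f j ≡ suc (f j)
      key-< f {j} j<n with j <? n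
      ... | yes _ = refl
      ... | no ne = ⊥-elim (ne j<n)

      key-n : ∀ f → key f n ≡ 0
      key-n f with n <? n
      ... | yes n<n = ⊥-elim (<-irrefl refl n<n)
      ... | no _    = refl

      keyCode : (ℕ → ℕ) → ℕ
      keyCode f = sequenceCode (key f) (suc n)

      prohibition : ℕ → (ℕ → ℕ) → List ℕ
      prohibition k f with k ≟ n
      ... | yes _ = forbid N (keyCode f) ∷ []
      ... | no _  = []

      contents : ℕ → (ℕ → ℕ) → List ℕ
      contents k f = prohibition k f ++ List.map (link ∘ f) (List.upTo k)

      build : ℕ → (ℕ → ℕ) → ℕ
      build k f = setCode (contents k f)

      -- Course-of-values recursion: below k this is already the sequence y, from which the next
      -- element is built.
      approx : ℕ → ℕ → ℕ
      approx zero    j = 0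
      approx (suc k) = updated k (build k (approx k)) (approx k)

      y : ℕ → ℕ
      y k = build k (approx k)

      approx-y : ∀ k j → j < k → approx k j ≡ y j
      approx-y (suc k) j (s≤s j≤k) with m≤n⇒m<n∨m≡n j≤k
      ... | inj₁ j<k  = trans (updated-< (y k) (approx k) j<k) (approx-y k j j<k)
      ... | inj₂ refl = updated-≡ k (y k) (approx k)

      y-links : ∀ j k → j < k → mem (link (y j)) (y k)
      y-links j k j<k = subst (λ x → mem (link x) (y k)) (approx-y k j j<k)
        (mem-setCode (contents k (approx k))
            (List.∈-++⁺ʳ (prohibition k (approx k)) (List.∈-map⁺ (link ∘ approx k) (List.∈-upTo⁺ j<k))))

      K : ℕ
      K = keyCode (approx n)

      y-forbids : mem (forbid N K) (y n)
      y-forbids = mem-setCode (contents n (approx n)) (List.∈-++⁺ˡ prohibited)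
        where
        prohibited : forbid N K ∈ prohibition n (approx n)
        prohibited with n ≟ n
        ... | yes _ = here refl
        ... | no ne = ⊥-elim (ne refl)

      K-describes : Describes n K (y n) y
      K-describes j (s≤s j≤n) with m≤n⇒m<n∨m≡n j≤n
      ... | inj₁ j<n  = inj₂ (trans (lk-sequenceCode (key (approx n)) (suc n) j (s≤s j≤n))
                          (trans (key-< (approx n) j<n) (cong suc (approx-y n j j<n))))
      ... | inj₂ refl = inj₁ (refl , trans (lk-sequenceCode (key (approx n)) (suc n) n ≤-refl) (key-n (approx n)))

      y-members : ∀ k {u} → mem u (y k) → (k ≡ n × u ≡ forbid N (keyCode (approx k))) ⊎ (∃ λ j → j < k × u ≡ link (y j))
      y-members k {u} p with List.∈-++⁻ (prohibition k (approx k)) (setCode-mem (contents k (approx k)) p)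
      ... | inj₁ q = inj₁ (prohibited q)
        where
        prohibited : u ∈ prohibition k (approx k) → k ≡ n × u ≡ forbid N (keyCode (approx k))
        prohibited q with k ≟ n
        prohibited (here e) | yes k≡n = k≡n , e
      ... | inj₂ q = inj₂ (linked (List.∈-map⁻ (link ∘ approx k) q))
        where
        linked : (∃ λ j → j ∈ List.upTo k × u ≡ link (approx k j)) → ∃ λ j → j < k × u ≡ link (y j)
        linked (j , r , e) = j , List.∈-upTo⁻ r , trans e (cong link (approx-y k j (List.∈-upTo⁻ r)))

      link-y : ∀ k {x} → mem (link x) (y k) → ∃ λ j → j < k × x ≡ y j
      link-y k p with y-members k p
      ... | inj₁ (_ , e)       = ⊥-elim (link≢forbid e)
      ... | inj₂ (j , j<k , e) = j , j<k , link-injective e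

      -- Below N elements no clique is large enough to be forbidden.
      y-ok : ∀ k → suc k < N → Ok (y k)
      y-ok k k<N = notJunk , notBad
        where
        notJunk : ¬ mem junk (y k)
        notJunk p with y-members k p
        ... | inj₁ (_ , e)     = junk≢forbid e
        ... | inj₂ (_ , _ , e) = junk≢link e
        notBad : ¬ Bad (y k)
        notBad (n′ , s′ , z , _ , c , (i , i<n , K′ , _ , p , _) , z≤ , i₀ , i₀<N , z₀) =
          -- The only prohibition in the whole sequence has size N, so a bad clique would need N
          -- elements among y₀, ..., yₖ.
          <⇒≱ k<N (subst (_≤ suc k) size≡ (Clique-size (y ∘ toℕ) c g place-≡))
          where
          place : ∀ j → j < size n′ s′ → ∃ λ (x : Fin (suc k)) → z j ≡ y (toℕ x)
          place j j<N with z j ≟ y k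
          ... | yes e = fromℕ< (n<1+n k) , trans e (cong y (sym (Fin.toℕ-fromℕ< (n<1+n k))))
          ... | no ne = let x , x<k , e = link-y k (RawEdge-< (z≤ j j<N) (toward (<-cmp j i₀))) in
                        fromℕ< (m<n⇒m<1+n x<k) , trans e (cong y (sym (Fin.toℕ-fromℕ< (m<n⇒m<1+n x<k))))
            where
            toward : Tri (j < i₀) (j ≡ i₀) (i₀ < j) → RawEdge (y k) (z j)
            toward (tri< l _ _) = subst (λ x → RawEdge x (z j)) z₀ (RawEdge-sym (c j i₀ l i₀<N))
            toward (tri≈ _ e _) = ⊥-elim (ne (trans (cong z e) z₀))
            toward (tri> _ _ l) = subst (λ x → RawEdge x (z j)) z₀ (c i₀ j l j<N)
          g : ℕ → Fin (suc k)
          g j with j <? size n′ s′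
          ... | yes j<N = proj₁ (place j j<N)
          ... | no _    = zero
          place-≡ : ∀ j → j < size n′ s′ → z j ≡ y (toℕ (g j))
          place-≡ j j<N with j <? size n′ s′
          ... | yes q = proj₂ (place j q)
          ... | no q  = ⊥-elim (q j<N)
          size≡ : size n′ s′ ≡ N
          size≡ = let i<N = <-trans i<n (size-> n′ s′) in
            fromMember (y-members (toℕ (g i)) (subst (mem (forbid (size n′ s′) K′)) (place-≡ i i<N) p))
            where
            fromMember : ∀ {k} → (k ≡ n × forbid (size n′ s′) K′ ≡ forbid N (keyCode (approx k))) ⊎
                (∃ λ j → j < k × forbid (size n′ s′) K′ ≡ link (y j)) →
                         size n′ s′ ≡ N
            fromMember (inj₁ (_ , e))     = proj₁ (forbid-injective e)
            fromMember (inj₂ (_ , _ , e)) = ⊥-elim (link≢forbid (sym e))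

      y-edge : ∀ j k → j < k → suc k < N → Edge (y k) (y j)
      y-edge j k j<k k<N = y-ok k k<N , y-ok j (<-trans (s≤s j<k) k<N) , inj₁ (y-links j k j<k)

      ys : ∀ k → Vec ℕ k
      ys zero    = []
      ys (suc k) = y k ∷ ys k

      lookup-ys : ∀ k (i : Fin k) → ∃ λ j → j < k × lookup (ys k) i ≡ y j
      lookup-ys (suc k) zero    = k , n<1+n k , refl
      lookup-ys (suc k) (suc i) = let j , j<k , e = lookup-ys k i in j , m<n⇒m<1+n j<k , e

      seq-ys : ∀ k i → i < k → seq (ys k) i ≡ y i
      seq-ys (suc k) i (s≤s i≤k) with m≤n⇒m<n∨m≡n i≤k
      ... | inj₁ i<k  = trans (seq-old (y k) (ys k) i i<k) (seq-ys k i i<k)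
      ... | inj₂ refl = seq-new (y k) (ys k)

      extends : ∀ j k → suc (j + k) ≤ N → Ext j (ys k)
      extends zero    k _ = tt
      extends (suc j) k h = y k , (λ i → let x , x<k , e = lookup-ys k i in
          subst (Edge (y k)) (sym e) (y-edge x k x<k (≤-trans (s≤s (s≤s (m≤n+m k j))) h))) ,
        extends j (suc k) (subst (_≤ N) (cong suc (sym (+-suc j k))) h)

      ¬extends : ∀ j → j + suc n ≡ N → ¬ Ext j (ys (suc n))
      ¬extends j e x =
        let z , c , h = Ext⇒clique j (ys (suc n)) (oks , edges) x
            z≡y = λ i (i<n : i < suc n) → trans (h i i<n) (seq-ys (suc n) i i<n)
        in notForbidden a (subst (λ N → OkClique N z) e c)
             (Forbidden-cong (λ i i<n → sym (z≡y i i<n))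
               (n , n<1+n n , K , ≤-<-trans (≤forbid N K) (mem-< y-forbids) , y-forbids , K-describes))
        where
        oks : ∀ i → i < suc n → Ok (seq (ys (suc n)) i)
        oks i i<n = subst Ok (sym (seq-ys (suc n) i i<n)) (y-ok i (≤-<-trans i<n (size-> n s)))
        edges : Clique (suc n) (seq (ys (suc n)))
        edges i j i<j j<n = subst₂ RawEdge (sym (seq-ys (suc n) i (<-trans i<j j<n))) (sym (seq-ys (suc n) j j<n))
            (inj₂ (y-links i j i<j))

    -- Among more formulas `ext` than Δ has members two share a representative. The witness clique
    -- for the larger of the two sizes extends by the smaller number of elements but not by the
    -- larger.
    infinite⇒¬finitary : ∀ n → (∀ b → ∃ λ s → b ≤ s × act n s) → ¬ Finitary (Th graph)
    infinite⇒¬finitary n inf fin = clash (Fin.pigeonhole (n<1+n (List.length Δ)) (λ x → Any.index (δ∈ x)))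
      where
      enum = enumerateSubset (act n) inf
      r = proj₁ enum
      N : ℕ → ℕ
      N x = size n (r x)
      extra : ℕ → ℕ
      extra x = N x ∸ suc n
      extra-≡ : ∀ x → extra x + suc n ≡ N x
      extra-≡ x = m∸n+n≡m (<⇒≤ (size-> n (r x)))
      extra-< : ∀ {x x′} → x < x′ → extra x < extra x′
      extra-< {x} p = ∸-monoˡ-< (size-mono-< (increasing r (proj₁ (proj₂ enum)) p)) (<⇒≤ (size-> n (r x)))
      Δ = proj₁ (fin (suc n))
      class = proj₂ (fin (suc n))
      χᵉ : ℕ → Formula 𝓖 (suc n)
      χᵉ x = ext (extra x)
      δ∈ : (x : Fin (suc (List.length Δ))) → proj₁ (class (χᵉ (toℕ x))) ∈ Δ
      δ∈ x = proj₁ (proj₂ (class (χᵉ (toℕ x))))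
      index-≡ : ∀ {δ δ′} (p : δ ∈ Δ) (p′ : δ′ ∈ Δ) → Any.index p ≡ Any.index p′ → δ ≡ δ′
      index-≡ p p′ e = trans (lookup-index p) (trans (cong (List.lookup Δ) e) (sym (lookup-index p′)))
        where
        lookup-index : ∀ {δ : Formula 𝓖 (suc n)} {l} (p : δ ∈ l) → δ ≡ List.lookup l (Any.index p)
        lookup-index (here e)  = e
        lookup-index (there p) = lookup-index p
      equivalent : ∀ x ρ → Satisfies graph ρ (χᵉ x) ⟷ Satisfies graph ρ (proj₁ (class (χᵉ x)))
      equivalent x ρ = proj₁ (Sat.tr-iff graph (χᵉ x) (proj₁ (class (χᵉ x))))
        (proj₁ (Sat.tr-allⁿ graph (suc n) (iff (χᵉ x) (proj₁ (class (χᵉ x))))) (proj₂ (proj₂ (class (χᵉ x)))) ρ)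
      clash : (∃₂ λ x x′ → x Fin.< x′ × Any.index (δ∈ x) ≡ Any.index (δ∈ x′)) → ⊥
      clash (x , x′ , x<x′ , e) =
        W.¬extends (extra (toℕ x′)) (extra-≡ (toℕ x′)) (proj₁ (sat-ext (extra (toℕ x′)) ρ)
          (proj₂ (equivalent (toℕ x′) ρ) (subst (Satisfies graph ρ) (index-≡ (δ∈ x) (δ∈ x′) e)
            (proj₁ (equivalent (toℕ x) ρ) (proj₂ (sat-ext (extra (toℕ x)) ρ)
              (W.extends (extra (toℕ x)) (suc n) (subst (extra (toℕ x) + suc n <_) (extra-≡ (toℕ x′))
                  (+-monoˡ-< (suc n) (extra-< x<x′)))))))))
        where
        module W = Witness n (r (toℕ x′)) (proj₁ (proj₂ (proj₂ enum)) (toℕ x′))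
        ρ = W.ys (suc n)

  -- Computability of the graphs, uniformly in a parameter x

  bndᶠ : Fn k → Fn k → Fn k
  bndᶠ = binary (prec zeroF (S ⟪ 𝕧 2 , 𝕧 1 ⟫)) bnd run
    where
    run : ∀ ℓ v → fn (prec zeroF (S ⟪ 𝕧 2 , 𝕧 1 ⟫)) (ℓ ∷ v ∷ []) ≡ bnd ℓ v
    run zero    v = refl
    run (suc ℓ) v = cong (λ b → suc ⟨ v , b ⟩) (run ℓ v)

  memᴰ : Dc 2
  memᴰ = asᴰ (∃<ᴰ (𝕧 1) (lkᶠ (𝕧 2) (𝕧 0) ≐ᴰ S (𝕧 1))) (λ { (u ∷ y ∷ []) → mem u y })
    (λ { (u ∷ y ∷ []) p → p }) (λ { (u ∷ y ∷ []) p → p })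

  rawᴰ : Dc 2
  rawᴰ = asᴰ (subᴰ memᴰ (linkᶠ (𝕧 1) ∷ˢ 𝕧 0 ∷ˢ []ˢ) ∨ᴰ subᴰ memᴰ (linkᶠ (𝕧 0) ∷ˢ 𝕧 1 ∷ˢ []ˢ))
    (λ { (y ∷ z ∷ []) → RawEdge y z }) (λ { (y ∷ z ∷ []) p → p }) (λ { (y ∷ z ∷ []) p → p })

  describesᴰ : Dc 4
  describesᴰ = asᴰ (∀<ᴰ (S (𝕧 0)) ((lkᶠ (𝕧 4) (𝕧 0) ≐ᴰ 𝕧 3) ∧ᴰ (lkᶠ (𝕧 2) (𝕧 0) ≐ᴰ lit 0) ∨ᴰ
      (lkᶠ (𝕧 2) (𝕧 0) ≐ᴰ S (lkᶠ (𝕧 4) (𝕧 0)))))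
    (λ { (n ∷ K ∷ y ∷ Z ∷ []) → Describes n K y (lk Z) }) (λ { (n ∷ K ∷ y ∷ Z ∷ []) p → p })
        (λ { (n ∷ K ∷ y ∷ Z ∷ []) p → p })

  forbiddenᴰ : Dc 3
  forbiddenᴰ = asᴰ (∃<ᴰ (S (𝕧 1)) (∃<ᴰ (lkᶠ (𝕧 3) (𝕧 0))
      (subᴰ memᴰ (forbidᶠ (𝕧 2) (𝕧 0) ∷ˢ lkᶠ (𝕧 4) (𝕧 1) ∷ˢ []ˢ) ∧ᴰ
       subᴰ describesᴰ (𝕧 3 ∷ˢ 𝕧 0 ∷ˢ lkᶠ (𝕧 4) (𝕧 1) ∷ˢ 𝕧 4 ∷ˢ []ˢ))))
    (λ { (N ∷ n ∷ Z ∷ []) → Forbidden N n (lk Z) }) (λ { (N ∷ n ∷ Z ∷ []) p → p }) (λ { (N ∷ n ∷ Z ∷ []) p → p })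

  cliqueᴰ : Dc 2
  cliqueᴰ = asᴰ (∀<ᴰ (𝕧 0) (∀<ᴰ (𝕧 0) (subᴰ rawᴰ (lkᶠ (𝕧 3) (𝕧 0) ∷ˢ lkᶠ (𝕧 3) (𝕧 1) ∷ˢ []ˢ))))
    (λ { (N ∷ Z ∷ []) → Clique N (lk Z) })
    (λ { (N ∷ Z ∷ []) p i j i<j j<N → p j j<N i i<j }) (λ { (N ∷ Z ∷ []) p j j<N i i<j → p i j i<j j<N })

  boundᶠ : Fn k → Fn k → Fn k
  boundᶠ q B = bndᶠ (S (S b₁)) (b₁ +ᶠ S (dummyᶠ B) +ᶠ S junkᶠ +ᶠ S (S B))
    where b₁ = S (linkᶠ B +ᶠ forbidᶠ q (bndᶠ q (S B)))

  snd<pair : ∀ t u → u < ⟨ suc t , u ⟩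
  snd<pair t u = s≤s (≤-trans (≤-trans (m≤n+m u t) (m≤m+n (t + u) (triangle (t + u))))
      (m≤m+n (t + u + triangle (t + u)) (suc t)))

  quantifiers≤gödel : (A : Formula 𝓖 n) → quantifiers A ≤ gödel A
  quantifiers≤gödel = formulaElim (λ A → quantifiers A ≤ gödel A) z≤n (λ _ _ → z≤n) (λ _ _ → z≤n)
    (λ {_} {A} {B} p q → ⊔-lub
      (≤-trans p (≤-trans (fst≤pair (gödel A) (gödel B)) (snd≤pair 3 ⟨ gödel A , gödel B ⟩)))
      (≤-trans q (≤-trans (snd≤pair (gödel A) (gödel B)) (snd≤pair 3 ⟨ gödel A , gödel B ⟩))))
    (λ {_} {A} p → ≤-<-trans p (snd<pair 3 (gödel A)))

  length≤vecCode : (v : Vec ℕ n) → n ≤ vecCode v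
  length≤vecCode []      = z≤n
  length≤vecCode (x ∷ v) = s≤s (≤-trans (length≤vecCode v) (snd≤pair x (vecCode v)))

  lookup≤vecCode : (v : Vec ℕ n) → ∀ i → lookup v i ≤ vecCode v
  lookup≤vecCode (x ∷ v) zero    = m≤n⇒m≤1+n (fst≤pair x (vecCode v))
  lookup≤vecCode (x ∷ v) (suc i) = m≤n⇒m≤1+n (≤-trans (lookup≤vecCode v i) (snd≤pair x (vecCode v)))

  -- Unbounded search decides complementary enumerable predicates.
  complementary : (A B : Re k) → (∀ xs → ⟦ A ⟧ᴿ xs ⊎ ⟦ B ⟧ᴿ xs) → (∀ xs → ⟦ A ⟧ᴿ xs → ¬ ⟦ B ⟧ᴿ xs) → Dc k
  complementary {k} A B total disjoint = record
    { ⟦_⟧ᴰ = ⟦ A ⟧ᴿ ; χ = app (χ (ker A)) (search ∷ˢ idˢ) ; dec = λ xs → conclude xs (dec (ker A) (fn search xs ∷ xs)) }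
    where
    stop : Dc (suc k)
    stop = ker A ∨ᴰ ker B
    halts : ∀ xs → ∃ λ w → ⟦ stop ⟧ᴰ (w ∷ xs)
    halts xs with total xs
    ... | inj₁ a = let w , p = into A xs a in w , inj₁ p
    ... | inj₂ b = let w , p = into B xs b in w , inj₂ p
    first : ∀ xs → ∃ λ w → ⟦ stop ⟧ᴰ (w ∷ xs) × (∀ v → v < w → ¬ ⟦ stop ⟧ᴰ (v ∷ xs))
    first xs = least (λ w → ⟦ stop ⟧ᴰ (w ∷ xs)) (halts xs)
    test : Fn (suc k)
    test = lit 1 ∸ᶠ χ stop
    hit : ∀ w xs → ⟦ stop ⟧ᴰ (w ∷ xs) → prog test [ w ∷ xs ]⇓ 0
    hit w xs p = case dec stop (w ∷ xs) of λ
      { (inj₁ (_ , e)) → subst (λ c → prog test [ w ∷ xs ]⇓ (1 ∸ c)) e (sound test (w ∷ xs)) ; (inj₂ (n , _)) →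
          ⊥-elim (n p) }
    miss : ∀ w xs → ¬ ⟦ stop ⟧ᴰ (w ∷ xs) → prog test [ w ∷ xs ]⇓ 1
    miss w xs n = case dec stop (w ∷ xs) of λ
      { (inj₁ (p , _)) → ⊥-elim (n p) ; (inj₂ (_ , e)) →
          subst (λ c → prog test [ w ∷ xs ]⇓ (1 ∸ c)) e (sound test (w ∷ xs)) }
    search : Fn k
    -- The value is obtained classically; the program is the unbounded search, which is certified to
    -- stop there.
    search = mkFn (λ xs → proj₁ (first xs)) (μ (prog test)) (λ xs →
      μ⇓ (λ v v<w → 0 , miss v xs (proj₂ (proj₂ (first xs)) v v<w)) (hit (proj₁ (first xs)) xs (proj₁ (proj₂ (first xs)))))
    conclude : ∀ xs → Indicates (fn (χ (ker A)) (fn search xs ∷ xs)) (⟦ ker A ⟧ᴰ (fn search xs ∷ xs)) →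
               Indicates (fn (χ (ker A)) (fn search xs ∷ xs)) (⟦ A ⟧ᴿ xs)
    conclude xs (inj₁ (p , e)) = inj₁ (outof A xs _ p , e)
    conclude xs (inj₂ (n , e)) with proj₁ (proj₂ (first xs))
    ... | inj₁ p = ⊥-elim (n p)
    ... | inj₂ q = inj₂ ((λ a → disjoint xs a (outof B xs _ q)) , e)

  -- [0, n, a]: a is not the code of a formula in n variables.
  notFormulaRules : List Rule
  notFormulaRules =
      (fact′ {2} (𝕧 0) ⟪ lit 0 , S (𝕧 1) ⟫ ⟵ [])
    ∷ rule 2 (∀<ᴰ (𝕧 0) (∀<ᴰ (𝕧 1) (¬ᴰ (𝕧 3 ≐ᴰ ⟪ ⟪ lit 0 , 𝕧 1 ⟫ , ⟪ lit 0 , 𝕧 0 ⟫ ⟫)))) [] (fact′ (𝕧 0) ⟪ lit 1 , 𝕧 1 ⟫)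
    ∷ rule 2 (∀<ᴰ (𝕧 0) (∀<ᴰ (𝕧 1) (¬ᴰ (𝕧 3 ≐ᴰ ⟪ lit 0 , S ⟪ ⟪ lit 0 , 𝕧 1 ⟫ , S ⟪ ⟪ lit 0 , 𝕧 0 ⟫ , lit 0 ⟫ ⟫ ⟫))))
        [] (fact′ (𝕧 0) ⟪ lit 2 , 𝕧 1 ⟫)
    ∷ (fact′ {3} (𝕧 0) ⟪ lit 3 , ⟪ 𝕧 1 , 𝕧 2 ⟫ ⟫ ⟵ fact′ (𝕧 0) (𝕧 1) ∷ [])
    ∷ (fact′ {3} (𝕧 0) ⟪ lit 3 , ⟪ 𝕧 1 , 𝕧 2 ⟫ ⟫ ⟵ fact′ (𝕧 0) (𝕧 2) ∷ [])
    ∷ (fact′ {2} (𝕧 0) ⟪ lit 4 , 𝕧 1 ⟫ ⟵ fact′ (S (𝕧 0)) (𝕧 1) ∷ [])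
    ∷ (fact′ {3} (𝕧 0) ⟪ S (S (S (S (S (𝕧 1))))) , 𝕧 2 ⟫ ⟵ [])
    ∷ []
    where
    fact′ : Fn k → Fn k → Sub k 5
    fact′ n a = lit 0 ∷ˢ n ∷ˢ a ∷ˢ lit 0 ∷ˢ lit 0 ∷ˢ []ˢ

  NotFormula : ℕ → ℕ → Set
  NotFormula n a = ¬ (∃ λ (A : Formula 𝓖 n) → gödel A ≡ a)

  NotFormulaDer : ℕ → ℕ → Set
  NotFormulaDer n a = Der notFormulaRules (0 ∷ n ∷ a ∷ 0 ∷ 0 ∷ [])

  NotFormulaGood : Fact → Set
  NotFormulaGood (_ ∷ n ∷ a ∷ _) = NotFormula n a

  notFormulaSound : All (Sound NotFormulaGood) notFormulaRules
  notFormulaSound =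
      (λ { (n ∷ u ∷ []) _ _ (A , e) → noZero {u = u} (formulaView A 0 (suc u) e) e })
    ∷ (λ { (n ∷ u ∷ []) s _ (A , e) → noEq s (formulaView A 1 u e) })
    ∷ (λ { (n ∷ u ∷ []) s _ (A , e) → noEdge s (formulaView A 2 u e) })
    ∷ (λ { (n ∷ a ∷ b ∷ []) _ (p ∷ []) (A , e) → noLeft {a = a} {b} p (formulaView A 3 ⟨ a , b ⟩ e) refl })
    ∷ (λ { (n ∷ a ∷ b ∷ []) _ (p ∷ []) (A , e) → noRight {a = a} {b} p (formulaView A 3 ⟨ a , b ⟩ e) refl })
    ∷ (λ { (n ∷ a ∷ []) _ (p ∷ []) (A , e) → noAll p (formulaView A 4 a e) })
    ∷ (λ { (n ∷ t ∷ u ∷ []) _ _ (A , e) → noTag (formulaView A (suc (suc (suc (suc (suc t))))) u e) })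
    ∷ []
    where
    noZero : ∀ {n u u′} {A : Formula 𝓖 n} → FormulaView A 0 u′ → gödel A ≢ ⟨ 0 , suc u ⟩
    noZero {u = u} ⊥ⱽ e = case proj₂ (pair-injective 0 0 0 (suc u) e) of λ ()
    noEq : ∀ {n u} {A : Formula 𝓖 n} → (∀ i → i < n → ∀ j → j < n → ¬ u ≡ ⟨ ⟨ 0 , i ⟩ , ⟨ 0 , j ⟩ ⟩) → ¬ FormulaView A 1 u
    noEq s (≐ⱽ i j e) = s (toℕ i) (Fin.toℕ<n i) (toℕ j) (Fin.toℕ<n j) (sym e)
    noEdge : ∀ {n u} {A : Formula 𝓖 n} →
        (∀ i → i < n → ∀ j → j < n → ¬ u ≡ ⟨ 0 , suc ⟨ ⟨ 0 , i ⟩ , suc ⟨ ⟨ 0 , j ⟩ , 0 ⟩ ⟩ ⟩) → ¬ FormulaView A 2 u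
    noEdge s (edgeⱽ i j e) = s (toℕ i) (Fin.toℕ<n i) (toℕ j) (Fin.toℕ<n j) (sym e)
    noLeft : ∀ {n a b u} {A : Formula 𝓖 n} → NotFormula n a → FormulaView A 3 u → u ≢ ⟨ a , b ⟩
    noLeft {a = a} {b} p (⇒ⱽ A B r) s = p (A , proj₁ (pair-injective (gödel A) (gödel B) a b (trans r s)))
    noRight : ∀ {n a b u} {A : Formula 𝓖 n} → NotFormula n b → FormulaView A 3 u → u ≢ ⟨ a , b ⟩
    noRight {a = a} {b} p (⇒ⱽ A B r) s = p (B , proj₂ (pair-injective (gödel A) (gödel B) a b (trans r s)))
    noAll : ∀ {n a} {A : Formula 𝓖 n} → NotFormula (suc n) a → ¬ FormulaView A 4 a
    noAll p (allⱽ A r) = p (A , r)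
    noTag : ∀ {n t u} {A : Formula 𝓖 n} → ¬ FormulaView A (suc (suc (suc (suc (suc t))))) u
    noTag ()

  -- Strong induction on the number, split into tag and body. For an implication whose left part
  -- codes a formula, the right part cannot.
  notFormula-complete : ∀ a n → NotFormula n a → NotFormulaDer n a
  notFormula-complete = <-rec (λ a → ∀ n → NotFormula n a → NotFormulaDer n a) λ a rec n h →
    subst (NotFormulaDer n) (pair-π a) (split (π₁ a) (π₂ a) n (λ b b<a → rec (subst (b <_) (pair-π a) b<a))
        (subst (NotFormula n) (sym (pair-π a)) h))
    where
    split : ∀ t u n → (∀ b → b < ⟨ t , u ⟩ → ∀ n → NotFormula n b → NotFormulaDer n b) → NotFormula n ⟨ t , u ⟩ →
        NotFormulaDer n ⟨ t , u ⟩
    impl : ∀ b c n → (∀ x → x < ⟨ 3 , ⟨ b , c ⟩ ⟩ → ∀ n → NotFormula n x → NotFormulaDer n x) → NotFormula n ⟨ 3 ,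
        ⟨ b , c ⟩ ⟩ →
           Dec (∃ λ (B : Formula 𝓖 n) → gödel B ≡ b) → NotFormulaDer n ⟨ 3 , ⟨ b , c ⟩ ⟩
    split 0 zero    n rec h = ⊥-elim (h (⊥̇ , refl))
    split 0 (suc u) n rec h = by (# 0) (n ∷ u ∷ []) tt []
    split 1 u n rec h = by (# 1) (n ∷ u ∷ []) (λ i i<n j j<n e → h ((var (fromℕ< i<n) ≐ var (fromℕ< j<n)) ,
      trans (cong₂ eqCode (Fin.toℕ-fromℕ< i<n) (Fin.toℕ-fromℕ< j<n)) (cong ⟨ 1 ,_⟩ (sym e)))) []
    split 2 u n rec h = by (# 2) (n ∷ u ∷ []) (λ i i<n j j<n e → h (edge (fromℕ< i<n) (fromℕ< j<n) ,
      trans (cong₂ edgeCode (Fin.toℕ-fromℕ< i<n) (Fin.toℕ-fromℕ< j<n)) (cong ⟨ 2 ,_⟩ (sym e)))) []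
    split 3 u n rec h = subst (λ u → NotFormulaDer n ⟨ 3 , u ⟩) (pair-π u)
      (impl (π₁ u) (π₂ u) n (λ x p → rec x (subst (λ u → x < ⟨ 3 , u ⟩) (pair-π u) p))
          (subst (λ u → NotFormula n ⟨ 3 , u ⟩) (sym (pair-π u)) h) em)
    split 4 u n rec h = let d = rec u (snd<pair 3 u) (suc n) (λ { (A , e) → h (all A , cong ⟨ 4 ,_⟩ e) }) in
      by (# 5) (n ∷ u ∷ []) tt (d ∷ [])
    split (suc (suc (suc (suc (suc t))))) u n rec h = by (# 6) (n ∷ t ∷ u ∷ []) tt []
    impl b c n rec h (no p) = let d = rec b (≤-<-trans (fst≤pair b c) (snd<pair 2 ⟨ b , c ⟩)) n p in
      by (# 3) (n ∷ b ∷ c ∷ []) tt (d ∷ [])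
    impl b c n rec h (yes (B , b≡)) =
      let d = rec c (≤-<-trans (snd≤pair b c) (snd<pair 2 ⟨ b , c ⟩)) n (λ { (C , c≡) → h ((B ⇒ C) , cong₂ impCode b≡ c≡) }) in
      by (# 4) (n ∷ b ∷ c ∷ []) tt (d ∷ [])

  -- Deciding truth in the graph, given a decision of activity.

  module Decision (actᴰ : Dc 3) where

    act : ℕ → ℕ → ℕ → Set
    act x n s = ⟦ actᴰ ⟧ᴰ (x ∷ n ∷ s ∷ [])

    open Graph

    -- The size is part of the stored prohibition, so the storing vertex, and with it y, exceeds the
    -- size and both of its coordinates. The clique is then a list of fewer than y entries that are
    -- at most y.
    bounded-search : ∀ x y → Bad (act x) y → ∃ λ n → n < y × ∃ λ s → s < y × ∃ λ Z → Z < suc (bnd y y) ×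
      act x n s × Clique (size n s) (lk Z) × Forbidden (size n s) n (lk Z) ×
      (∀ j → j < size n s → lk Z j < suc y) × ∃ λ i → i < size n s × lk Z i ≡ y
    bounded-search x y (n , s , z , a , c , (i , i<n , K , K< , p , h) , z≤ , i₀ , i₀<N , e) =
      n , <-trans (<-trans (n<1+n n) (size-> n s)) N<y , s , ≤-<-trans (size≥ n s) N<y , Z ,
      s≤s (≤-trans (sequenceCode≤bnd z N z≤) (bnd-monoˡ y (<⇒≤ N<y))) , a ,
      (λ j j′ p q → subst₂ RawEdge (sym (entry j (<-trans p q))) (sym (entry j′ q)) (c j j′ p q)) ,
      Forbidden-cong (λ j j<n → sym (entry j (<-trans j<n (size-> n s)))) (i , i<n , K , K< , p , h) ,
      (λ j j<N → s≤s (subst (_≤ y) (sym (entry j j<N)) (z≤ j j<N))) ,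
      i₀ , i₀<N , trans (entry i₀ i₀<N) e
      where
      N Z : ℕ
      N = size n s
      Z = sequenceCode z N
      entry : ∀ j → j < N → lk Z j ≡ z j
      entry = lk-sequenceCode z N
      N<y : N < y
      N<y = ≤-<-trans (size≤forbid N K) (<-≤-trans (mem-< {forbid N K} {z i} p) (z≤ i (<-trans i<n (size-> n s))))

    opaque
      badᴰ : Dc 2
      badᴰ = asᴰ (∃<ᴰ (𝕧 1) (∃<ᴰ (𝕧 2) (∃<ᴰ (S (bndᶠ (𝕧 3) (𝕧 3)))
          (subᴰ actᴰ (𝕧 3 ∷ˢ 𝕧 2 ∷ˢ 𝕧 1 ∷ˢ []ˢ) ∧ᴰ
           subᴰ cliqueᴰ (sizeᶠ (𝕧 2) (𝕧 1) ∷ˢ 𝕧 0 ∷ˢ []ˢ) ∧ᴰ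
           subᴰ forbiddenᴰ (sizeᶠ (𝕧 2) (𝕧 1) ∷ˢ 𝕧 2 ∷ˢ 𝕧 0 ∷ˢ []ˢ) ∧ᴰ
           ∀<ᴰ (sizeᶠ (𝕧 2) (𝕧 1)) (lkᶠ (𝕧 1) (𝕧 0) <ᴰ S (𝕧 5)) ∧ᴰ
           ∃<ᴰ (sizeᶠ (𝕧 2) (𝕧 1)) (lkᶠ (𝕧 1) (𝕧 0) ≐ᴰ 𝕧 5)))))
        (λ { (x ∷ y ∷ []) → Bad (act x) y })
        (λ { (x ∷ y ∷ []) (n , _ , s , _ , Z , _ , a , c , f , z≤ , i , i<N , e) →
             n , s , lk Z , a , c , f , (λ j j<N → ≤-pred (z≤ j j<N)) , i , i<N , e })
        (λ { (x ∷ y ∷ []) b → bounded-search x y b })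

      badᴰ-spec : ∀ x y → ⟦ badᴰ ⟧ᴰ (x ∷ y ∷ []) ≡ Bad (act x) y
      badᴰ-spec x y = refl

    opaque
      edgeᴰ : Dc 3
      edgeᴰ = asᴰ (okᴰ (𝕧 1) ∧ᴰ okᴰ (𝕧 2) ∧ᴰ subᴰ rawᴰ (𝕧 1 ∷ˢ 𝕧 2 ∷ˢ []ˢ)) (λ { (x ∷ y ∷ z ∷ []) → Edge (act x) y z })
        (λ { (x ∷ y ∷ z ∷ []) (p , q , r) → ok-to x y p , ok-to x z q , r })
        (λ { (x ∷ y ∷ z ∷ []) (p , q , r) → ok-from x y p , ok-from x z q , r })
        where
        okᴰ : Fn 3 → Dc 3
        okᴰ y = (¬ᴰ subᴰ memᴰ (junkᶠ ∷ˢ y ∷ˢ []ˢ)) ∧ᴰ (¬ᴰ subᴰ badᴰ (𝕧 0 ∷ˢ y ∷ˢ []ˢ))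
        ok-to : ∀ x y → ¬ mem junk y × ¬ ⟦ badᴰ ⟧ᴰ (x ∷ y ∷ []) → Ok (act x) y
        ok-to x y (p , q) = p , subst ¬_ (badᴰ-spec x y) q
        ok-from : ∀ x y → Ok (act x) y → ¬ mem junk y × ¬ ⟦ badᴰ ⟧ᴰ (x ∷ y ∷ [])
        ok-from x y (p , q) = p , subst ¬_ (sym (badᴰ-spec x y)) q

      edgeᴰ-spec : ∀ x y z → ⟦ edgeᴰ ⟧ᴰ (x ∷ y ∷ z ∷ []) ≡ Edge (act x) y z
      edgeᴰ-spec x y z = refl

    -- Facts: [0, ρ, a, x] and [1, ρ, a, x]: the formula a is true, false, at ρ in the
    -- graph of x; [2, ρ, a, x, k]: a is true at all c ∷ ρ with c < k.
    truthRules : List Rule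
    truthRules =
        (tag {2} 1 (𝕧 0) (lit 0) (𝕧 1) (lit 0) ⟵ [])
      ∷ rule 4 (lkᶠ (𝕧 0) (𝕧 2) ≐ᴰ lkᶠ (𝕧 0) (𝕧 3)) [] (tag 0 (𝕧 0) (eqᶠ (𝕧 2) (𝕧 3)) (𝕧 1) (lit 0))
      ∷ rule 4 (¬ᴰ (lkᶠ (𝕧 0) (𝕧 2) ≐ᴰ lkᶠ (𝕧 0) (𝕧 3))) [] (tag 1 (𝕧 0) (eqᶠ (𝕧 2) (𝕧 3)) (𝕧 1) (lit 0))
      ∷ rule 4 (subᴰ edgeᴰ entries) [] (tag 0 (𝕧 0) (edgeᶠ (𝕧 2) (𝕧 3)) (𝕧 1) (lit 0))
      ∷ rule 4 (¬ᴰ subᴰ edgeᴰ entries) [] (tag 1 (𝕧 0) (edgeᶠ (𝕧 2) (𝕧 3)) (𝕧 1) (lit 0))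
      ∷ (tag {4} 0 (𝕧 0) (impᶠ (𝕧 2) (𝕧 3)) (𝕧 1) (lit 0) ⟵ tag 1 (𝕧 0) (𝕧 2) (𝕧 1) (lit 0) ∷ [])
      ∷ (tag {4} 0 (𝕧 0) (impᶠ (𝕧 2) (𝕧 3)) (𝕧 1) (lit 0) ⟵ tag 0 (𝕧 0) (𝕧 3) (𝕧 1) (lit 0) ∷ [])
      ∷ (tag {4} 1 (𝕧 0) (impᶠ (𝕧 2) (𝕧 3)) (𝕧 1) (lit 0) ⟵
           tag 0 (𝕧 0) (𝕧 2) (𝕧 1) (lit 0) ∷ tag 1 (𝕧 0) (𝕧 3) (𝕧 1) (lit 0) ∷ [])
      ∷ (tag {4} 1 (𝕧 0) ⟪ lit 4 , 𝕧 2 ⟫ (𝕧 1) (lit 0) ⟵ tag 1 (consᶠ (𝕧 3) (𝕧 0)) (𝕧 2) (𝕧 1) (lit 0) ∷ [])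
      ∷ (tag {3} 0 (𝕧 0) ⟪ lit 4 , 𝕧 2 ⟫ (𝕧 1) (lit 0) ⟵ tag 2 (𝕧 0) (𝕧 2) (𝕧 1) (S limitᶠ) ∷ [])
      ∷ (tag {3} 2 (𝕧 0) (𝕧 2) (𝕧 1) (lit 0) ⟵ [])
      ∷ (tag {4} 2 (𝕧 0) (𝕧 2) (𝕧 1) (S (𝕧 3)) ⟵
           tag 2 (𝕧 0) (𝕧 2) (𝕧 1) (𝕧 3) ∷ tag 0 (consᶠ (𝕧 3) (𝕧 0)) (𝕧 2) (𝕧 1) (lit 0) ∷ [])
      ∷ []
      where
      tag : ℕ → Fn k → Fn k → Fn k → Fn k → Sub k 5
      tag t a b c d = lit t ∷ˢ a ∷ˢ b ∷ˢ c ∷ˢ d ∷ˢ []ˢ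
      entries : Sub 4 3
      entries = 𝕧 1 ∷ˢ lkᶠ (𝕧 0) (𝕧 2) ∷ˢ lkᶠ (𝕧 0) (𝕧 3) ∷ˢ []ˢ
      limitᶠ : Fn 3
      limitᶠ = boundᶠ (𝕧 0 +ᶠ ⟪ lit 4 , 𝕧 2 ⟫) (𝕧 0)

    TruthDer : ℕ → ℕ → ℕ → ℕ → ℕ → Set
    TruthDer t ρ a x k = Der truthRules (t ∷ ρ ∷ a ∷ x ∷ k ∷ [])

    model : ℕ → Structure 𝓖
    model x = graph (act x)

    IsTrue IsFalse : ℕ → ℕ → ℕ → Set
    IsTrue ρ a x  = ∀ {n} (A : Formula 𝓖 n) r → gödel A ≡ a → vecCode r ≡ ρ → Satisfies (model x) r A
    IsFalse ρ a x = ∀ {n} (A : Formula 𝓖 n) r → gödel A ≡ a → vecCode r ≡ ρ → ¬ Satisfies (model x) r A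

    TrueBelow : ℕ → ℕ → ℕ → ℕ → Set
    TrueBelow ρ a x k = ∀ {n} (A : Formula 𝓖 (suc n)) r → gödel A ≡ a → vecCode r ≡ ρ → ∀ c → c < k →
        Satisfies (model x) (c ∷ r) A

    TruthGood : Fact → Set
    TruthGood (0 ∷ ρ ∷ a ∷ x ∷ _)      = IsTrue ρ a x
    TruthGood (1 ∷ ρ ∷ a ∷ x ∷ _)      = IsFalse ρ a x
    TruthGood (2 ∷ ρ ∷ a ∷ x ∷ k ∷ []) = TrueBelow ρ a x k
    TruthGood _ = ⊤

    private
      isFalse-⊥ : ∀ {n x u} {A : Formula 𝓖 n} {r} → FormulaView A 0 u → ¬ Satisfies (model x) r A
      isFalse-⊥ ⊥ⱽ s = s

      sat-≐ : ∀ {n x u i j ρ} {A : Formula 𝓖 n} {r} → FormulaView A 1 u → u ≡ ⟨ ⟨ 0 , i ⟩ , ⟨ 0 , j ⟩ ⟩ → vecCode r ≡ ρ →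
              Satisfies (model x) r A ⟷ (lk ρ i ≡ lk ρ j)
      sat-≐ {i = i} {j} {r = r} (≐ⱽ i′ j′ e) s refl =
        let p , q = eqBody-injective (toℕ i′) (toℕ j′) i j (trans e s) in
        ⟷-≡ (cong₂ _≡_ (trans (sym (lk-vecCode r i′)) (cong (lk (vecCode r)) p))
            (trans (sym (lk-vecCode r j′)) (cong (lk (vecCode r)) q)))

      sat-edge : ∀ {n x u i j ρ} {A : Formula 𝓖 n} {r} → FormulaView A 2 u →
                 u ≡ ⟨ 0 , suc ⟨ ⟨ 0 , i ⟩ , suc ⟨ ⟨ 0 , j ⟩ , 0 ⟩ ⟩ ⟩ → vecCode r ≡ ρ →
                 Satisfies (model x) r A ⟷ ⟦ edgeᴰ ⟧ᴰ (x ∷ lk ρ i ∷ lk ρ j ∷ [])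
      sat-edge {x = x} {i = i} {j} {r = r} (edgeⱽ i′ j′ e) s refl =
        let p , q = edgeBody-injective (toℕ i′) (toℕ j′) i j (trans e s) in
        ⟷-≡ (trans (cong₂ (Edge (act x)) (trans (sym (lk-vecCode r i′)) (cong (lk (vecCode r)) p))
            (trans (sym (lk-vecCode r j′)) (cong (lk (vecCode r)) q)))
          (sym (edgeᴰ-spec x (lk (vecCode r) i) (lk (vecCode r) j))))

      true-⇒₁ : ∀ {n ρ a b x u} {A : Formula 𝓖 n} {r} → IsFalse ρ a x → FormulaView A 3 u → u ≡ ⟨ a , b ⟩ →
          vecCode r ≡ ρ → Satisfies (model x) r A
      true-⇒₁ {a = a} {b} {r = r} p (⇒ⱽ A B e) s e′ t = ⊥-elim
          (p A r (proj₁ (pair-injective (gödel A) (gödel B) a b (trans e s))) e′ t)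

      true-⇒₂ : ∀ {n ρ a b x u} {A : Formula 𝓖 n} {r} → IsTrue ρ b x → FormulaView A 3 u → u ≡ ⟨ a , b ⟩ →
          vecCode r ≡ ρ → Satisfies (model x) r A
      true-⇒₂ {a = a} {b} {r = r} p (⇒ⱽ A B e) s e′ _ = p B r (proj₂ (pair-injective (gödel A) (gödel B) a b (trans e s))) e′

      false-⇒ : ∀ {n ρ a b x u} {A : Formula 𝓖 n} {r} → IsTrue ρ a x → IsFalse ρ b x → FormulaView A 3 u → u ≡ ⟨ a ,
          b ⟩ → vecCode r ≡ ρ → ¬ Satisfies (model x) r A
      false-⇒ {a = a} {b} {r = r} p q (⇒ⱽ A B e) s e′ t = let a≡ , b≡ = pair-injective (gödel A) (gödel B) a b (trans e s) in
        q B r b≡ e′ (t (p A r a≡ e′))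

      false-∀ : ∀ {n ρ a x c} {A : Formula 𝓖 n} {r} → IsFalse (suc ⟨ c , ρ ⟩) a x → FormulaView A 4 a →
          vecCode r ≡ ρ → ¬ Satisfies (model x) r A
      false-∀ {c = c} {r = r} p (allⱽ A e) e′ t = p A (c ∷ r) e (cong (λ ρ → suc ⟨ c , ρ ⟩) e′) (t c)

      -- The code of the tuple bounds its length and its entries, and the code of the formula bounds
      -- its quantifiers, so the limit in the rule is large enough for `bounded-∀`.
      true-∀ : ∀ {n ρ a x} {A : Formula 𝓖 n} {r} → TrueBelow ρ a x (suc (bound (act x) (ρ + ⟨ 4 , a ⟩) ρ)) →
          FormulaView A 4 a → vecCode r ≡ ρ → Satisfies (model x) r A
      true-∀ {n} {ρ} {a} {x} {r = r} p (allⱽ A e) e′ = bounded-∀ (act x) (ρ + ⟨ 4 , a ⟩) ρ A r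
        (subst (_≤ ρ + ⟨ 4 , a ⟩) (+-suc n (quantifiers A)) (+-mono-≤ (subst (n ≤_) e′ (length≤vecCode r))
          (subst (λ a → suc (quantifiers A) ≤ ⟨ 4 , a ⟩) e (≤-<-trans (quantifiers≤gödel A) (snd<pair 3 (gödel A))))))
        (λ i → subst (lookup r i ≤_) e′ (lookup≤vecCode r i)) (p A r e e′)

      true-below : ∀ {ρ a x k} → TrueBelow ρ a x k → IsTrue (suc ⟨ k , ρ ⟩) a x → TrueBelow ρ a x (suc k)
      true-below {k = k} p q A r e e′ c (s≤s c≤k) with m≤n⇒m<n∨m≡n c≤k
      ... | inj₁ c<k  = p A r e e′ c c<k
      ... | inj₂ refl = q A (c ∷ r) e (cong (λ ρ → suc ⟨ c , ρ ⟩) e′)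

    truthSound : All (Sound TruthGood) truthRules
    truthSound =
        (λ { (ρ ∷ x ∷ []) _ _ A r e e′ → isFalse-⊥ {x = x} {r = r} (formulaView A 0 0 e) })
      ∷ (λ { (ρ ∷ x ∷ i ∷ j ∷ []) s _ A r e e′ → proj₂ (sat-≐ {x = x} {i = i} {j} (formulaView A 1 _ e) refl e′) s })
      ∷ (λ { (ρ ∷ x ∷ i ∷ j ∷ []) s _ A r e e′ → s ∘ proj₁ (sat-≐ {x = x} {i = i} {j} (formulaView A 1 _ e) refl e′) })
      ∷ (λ { (ρ ∷ x ∷ i ∷ j ∷ []) s _ A r e e′ → proj₂ (sat-edge {x = x} {i = i} {j} (formulaView A 2 _ e) refl e′) s })
      ∷ (λ { (ρ ∷ x ∷ i ∷ j ∷ []) s _ A r e e′ → s ∘ proj₁ (sat-edge {x = x} {i = i} {j} (formulaView A 2 _ e) refl e′) })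
      ∷ (λ { (ρ ∷ x ∷ a ∷ b ∷ []) _ (p ∷ []) A r e e′ →
          true-⇒₁ {ρ = ρ} {a} {b} {x} p (formulaView A 3 ⟨ a , b ⟩ e) refl e′ })
      ∷ (λ { (ρ ∷ x ∷ a ∷ b ∷ []) _ (p ∷ []) A r e e′ →
          true-⇒₂ {ρ = ρ} {a} {b} {x} p (formulaView A 3 ⟨ a , b ⟩ e) refl e′ })
      ∷ (λ { (ρ ∷ x ∷ a ∷ b ∷ []) _ (p ∷ q ∷ []) A r e e′ →
          false-⇒ {ρ = ρ} {a} {b} {x} p q (formulaView A 3 ⟨ a , b ⟩ e) refl e′ })
      ∷ (λ { (ρ ∷ x ∷ a ∷ c ∷ []) _ (p ∷ []) A r e e′ → false-∀ {ρ = ρ} {a} {x} {c} p (formulaView A 4 a e) e′ })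
      ∷ (λ { (ρ ∷ x ∷ a ∷ []) _ (p ∷ []) A r e e′ → true-∀ {ρ = ρ} {a} {x} p (formulaView A 4 a e) e′ })
      ∷ (λ { (ρ ∷ x ∷ a ∷ []) _ _ A r e e′ c () })
      ∷ (λ { (ρ ∷ x ∷ a ∷ k ∷ []) _ (p ∷ q ∷ []) → true-below {ρ} {a} {x} {k} p q })
      ∷ []

    truth-complete : ∀ x {n} (A : Formula 𝓖 n) r →
      (Satisfies (model x) r A → TruthDer 0 (vecCode r) (gödel A) x 0) ×
      (¬ Satisfies (model x) r A → TruthDer 1 (vecCode r) (gödel A) x 0)
    truth-complete x = formulaElim (λ {n} A → (r : Vec ℕ n) →
        (Satisfies (model x) r A → TruthDer 0 (vecCode r) (gödel A) x 0) ×
        (¬ Satisfies (model x) r A → TruthDer 1 (vecCode r) (gödel A) x 0))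
      (λ r → (λ ()) , (λ _ → by (# 0) (vecCode r ∷ x ∷ []) tt []))
      (λ i j r → let e = cong₂ _≡_ (sym (lk-vecCode r i)) (sym (lk-vecCode r j)) in
        (λ s → by (# 1) (vecCode r ∷ x ∷ toℕ i ∷ toℕ j ∷ []) (subst id e s) []) ,
        (λ s → by (# 2) (vecCode r ∷ x ∷ toℕ i ∷ toℕ j ∷ []) (subst ¬_ e s) []))
      (λ i j r → let e = trans (cong₂ (Edge (act x)) (sym (lk-vecCode r i)) (sym (lk-vecCode r j)))
                           (sym (edgeᴰ-spec x (lk (vecCode r) (toℕ i)) (lk (vecCode r) (toℕ j)))) in
        (λ s → by (# 3) (vecCode r ∷ x ∷ toℕ i ∷ toℕ j ∷ []) (subst id e s) []) ,
        (λ s → by (# 4) (vecCode r ∷ x ∷ toℕ i ∷ toℕ j ∷ []) (subst ¬_ e s) []))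
      (λ {_} {A} {B} p q r → implies A B r (p r) (q r))
      (λ {_} {A} p r → universal A r p)
      where
      Complete : ∀ {n} → Formula 𝓖 n → Vec ℕ n → Set
      Complete A r = (Satisfies (model x) r A → TruthDer 0 (vecCode r) (gödel A) x 0) ×
                     (¬ Satisfies (model x) r A → TruthDer 1 (vecCode r) (gödel A) x 0)
      implies : ∀ {n} (A B : Formula 𝓖 n) r → Complete A r → Complete B r → Complete (A ⇒ B) r
      implies A B r (p , p′) (q , q′) = holds , fails
        where
        params′ = vecCode r ∷ x ∷ gödel A ∷ gödel B ∷ []
        holds : (Satisfies (model x) r A → Satisfies (model x) r B) → TruthDer 0 (vecCode r) ⟨ 3 , ⟨ gödel A ,
            gödel B ⟩ ⟩ x 0
        holds s = split em
          where
          split : Dec (Satisfies (model x) r A) → TruthDer 0 (vecCode r) ⟨ 3 , ⟨ gödel A , gödel B ⟩ ⟩ x 0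
          split (no t)  = let d = p′ t in by (# 5) params′ tt (d ∷ [])
          split (yes t) = let d = q (s t) in by (# 6) params′ tt (d ∷ [])
        fails : ¬ (Satisfies (model x) r A → Satisfies (model x) r B) → TruthDer 1 (vecCode r) ⟨ 3 , ⟨ gödel A ,
            gödel B ⟩ ⟩ x 0
        fails s = let d = p (stable (λ t → s (⊥-elim ∘ t))) ; d′ = q′ (λ t → s (λ _ → t)) in by (# 7) params′ tt (d ∷ d′ ∷ [])
      below-all : ∀ {n} (A : Formula 𝓖 (suc n)) r → (∀ r → Complete A r) → (∀ c → Satisfies (model x) (c ∷ r) A) →
                  ∀ k → TruthDer 2 (vecCode r) (gödel A) x k
      below-all A r p s zero    = by (# 10) (vecCode r ∷ x ∷ gödel A ∷ []) tt []
      below-all A r p s (suc k) = let d = below-all A r p s k ; d′ = proj₁ (p (k ∷ r)) (s k) in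
        by (# 11) (vecCode r ∷ x ∷ gödel A ∷ k ∷ []) tt (d ∷ d′ ∷ [])
      universal : ∀ {n} (A : Formula 𝓖 (suc n)) r → (∀ r → Complete A r) → Complete (all A) r
      universal A r p =
        (λ s → let d = below-all A r p s (suc (bound (act x) (vecCode r + ⟨ 4 , gödel A ⟩) (vecCode r))) in
          by (# 9) (vecCode r ∷ x ∷ gödel A ∷ []) tt (d ∷ [])) ,
        (λ s → let c , t = stable (λ u → s (λ c → stable (λ v → u (c , v)))) ; d = proj₂ (p (c ∷ r)) t in
          by (# 8) (vecCode r ∷ x ∷ gödel A ∷ c ∷ []) tt (d ∷ []))

    opaque
      -- Numbers that code no sentence must be rejected as well; the rules for non-formulas make the
      -- complement enumerable.
      trueᴿ falseᴿ : Re 2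
      trueᴿ = asᴿ (subᴿ formulaᴿ (lit 0 ∷ˢ 𝕧 1 ∷ˢ []ˢ) ∧ᴿ
                   subᴿ (derᴿ truthRules) (lit 0 ∷ˢ lit 0 ∷ˢ 𝕧 1 ∷ˢ 𝕧 0 ∷ˢ lit 0 ∷ˢ []ˢ))
        (λ { (x ∷ a ∷ []) → GödelNumbers (Th (model x)) a })
        (λ { (x ∷ a ∷ []) ((A , e) , d) → A , Der-sound {G = TruthGood} truthSound d A [] e refl , e })
        (λ { (x ∷ a ∷ []) (A , s , refl) → (A , refl) , proj₁ (truth-complete x A []) s })
      falseᴿ = asᴿ (subᴿ (derᴿ notFormulaRules) (lit 0 ∷ˢ lit 0 ∷ˢ 𝕧 1 ∷ˢ lit 0 ∷ˢ lit 0 ∷ˢ []ˢ) ∨ᴿ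
                    subᴿ (derᴿ truthRules) (lit 1 ∷ˢ lit 0 ∷ˢ 𝕧 1 ∷ˢ 𝕧 0 ∷ˢ lit 0 ∷ˢ []ˢ))
        (λ { (x ∷ a ∷ []) → ¬ GödelNumbers (Th (model x)) a })
        (λ { (x ∷ a ∷ []) (inj₁ d) (A , s , e) → Der-sound {G = NotFormulaGood} notFormulaSound d (A , e)
           ; (x ∷ a ∷ []) (inj₂ d) (A , s , e) → Der-sound {G = TruthGood} truthSound d A [] e refl s })
        (λ { (x ∷ a ∷ []) n → refute x a n em })
        where
        refute : ∀ x a → ¬ GödelNumbers (Th (model x)) a → Dec (∃ λ (A : Sentence 𝓖) → gödel A ≡ a) →
                 NotFormulaDer 0 a ⊎ TruthDer 1 0 a x 0
        refute x a n (no h)           = inj₁ (notFormula-complete a 0 h)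
        refute x a n (yes (A , refl)) = inj₂ (proj₂ (truth-complete x A []) (λ s → n (A , s , refl)))

      theoryᴰ : Dc 2
      theoryᴰ = complementary trueᴿ falseᴿ
        (λ { (x ∷ a ∷ []) → case em of λ { (yes p) → inj₁ p ; (no p) → inj₂ p } })
        (λ { (x ∷ a ∷ []) p n → n p })

      theoryᴰ-spec : ∀ x a → ⟦ theoryᴰ ⟧ᴰ (x ∷ a ∷ []) ≡ GödelNumbers (Th (model x)) a
      theoryᴰ-spec x a = refl

  -- The reduction.

  constant : ℕ → Rec 1
  constant zero    = comp zeroᶠ []
  constant (suc x) = comp sucᶠ (constant x ∷ [])

  constant⇓ : ∀ x y → constant x [ y ∷ [] ]⇓ x
  constant⇓ zero    y = comp⇓ [] zero⇓
  constant⇓ (suc x) y = comp⇓ (constant⇓ x y ∷ []) suc⇓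

  -- The s-m-n construction; `specialiseᶠ` computes its code from the parameter.
  specialise : Rec 2 → ℕ → Rec 1
  specialise p x = comp p (constant x ∷ proj zero ∷ [])

  constantᶠ : Fn 1
  constantᶠ = retarget (prec (lit (code (constant 0))) ⟪ lit 3 , ⟪ lit (code sucᶠ) , consᶠ (𝕧 1) (lit 0) ⟫ ⟫)
      (λ { (x ∷ []) → code (constant x) })
    (λ { (x ∷ []) → run x })
    where
    run : ∀ x → fold (fn (lit {0} (code (constant 0))))
        (fn {2} ⟪ lit 3 , ⟪ lit (code sucᶠ) , consᶠ (𝕧 1) (lit 0) ⟫ ⟫) x [] ≡ code (constant x)
    run zero    = refl
    run (suc x) = cong (λ c → ⟨ 3 , ⟨ ⟨ 1 , 0 ⟩ , suc ⟨ c , 0 ⟩ ⟩ ⟩) (run x)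

  opaque
    programCode : Rec 2 → ℕ
    programCode p = code p

    programCode-def : ∀ p → programCode p ≡ code p
    programCode-def p = refl

  specialiseᶠ : Rec 2 → Fn 1
  specialiseᶠ p = retarget ⟪ lit 3 , ⟪ lit (programCode p) , consᶠ constantᶠ (consᶠ (lit ⟨ 2 , 0 ⟩) (lit 0)) ⟫ ⟫
    (λ { (x ∷ []) → code (specialise p x) })
    (λ { (x ∷ []) → trans (cong (λ c → ⟨ 3 , ⟨ c , suc ⟨ code (constant x) , suc ⟨ ⟨ 2 , 0 ⟩ , 0 ⟩ ⟩ ⟩ ⟩)
        (lit-≡ (programCode p) (x ∷ [])))
      (cong (λ c → ⟨ 3 , ⟨ c , suc ⟨ code (constant x) , suc ⟨ ⟨ 2 , 0 ⟩ , 0 ⟩ ⟩ ⟩ ⟩) (programCode-def p)) })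
    where
    lit-≡ : ∀ n (xs : Vec ℕ 1) → fn (lit n) xs ≡ n
    lit-≡ zero    xs = refl
    lit-≡ (suc n) xs = cong suc (lit-≡ n xs)

  AllRefuted : (ℕ → ℕ → Set) → ℕ → ℕ → Set
  AllRefuted Q z w = ∀ z′ → z′ < suc z → ∃ λ w′ → w′ < w × Q z′ w′

  -- s codes z and the least w at which all z′ ≤ z are seen to be refuted.
  Active : (ℕ → ℕ → Set) → ℕ → Set
  Active Q s = AllRefuted Q (π₁ s) (suc (π₂ s)) × ¬ AllRefuted Q (π₁ s) (π₂ s)

  module _ (Q : ℕ → ℕ → Set) where

    AllRefuted-mono : ∀ {z w w′} → w ≤ w′ → AllRefuted Q z w → AllRefuted Q z w′
    AllRefuted-mono p r z′ z′≤z = let v , v<w , q = r z′ z′≤z in v , <-≤-trans v<w p , q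

    Active-unique : ∀ {s s′} → Active Q s → Active Q s′ → π₁ s ≡ π₁ s′ → s ≡ s′
    Active-unique {s} {s′} (r , n) (r′ , n′) e =
      trans (sym (pair-π s)) (trans (cong₂ ⟨_,_⟩ e (same (<-cmp (π₂ s) (π₂ s′)))) (pair-π s′))
      where
      same : Tri (π₂ s < π₂ s′) (π₂ s ≡ π₂ s′) (π₂ s′ < π₂ s) → π₂ s ≡ π₂ s′
      same (tri≈ _ e _) = e
      same (tri< l _ _) = ⊥-elim (n′ (subst (λ z → AllRefuted Q z (π₂ s′)) e (AllRefuted-mono {π₁ s} l r)))
      same (tri> _ _ l) = ⊥-elim (n (subst (λ z → AllRefuted Q z (π₂ s)) (sym e) (AllRefuted-mono {π₁ s′} l r′)))

    -- Since z₀ is never refuted, only codes with first component below z₀ can be active, at most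
    -- one for each component by `Active-unique`.
    active-finite : (∃ λ z → ∀ w → ¬ Q z w) → ∃ λ b → ∀ s → Active Q s → s < b
    active-finite (z₀ , h) = let b , p = upTo z₀ in b , λ s a → p s (≰⇒> (λ z₀≤z → let w , _ , q = proj₁ a z₀ (s≤s z₀≤z) in h w q)) a
      where
      upTo : ∀ z → ∃ λ b → ∀ s → π₁ s < z → Active Q s → s < b
      upTo zero    = 0 , λ _ ()
      upTo (suc z) = extend em
        where
        b = proj₁ (upTo z)
        old : ∀ {s c} → π₁ s < z → Active Q s → b ≤ c → s < c
        old {s} l a b≤c = <-≤-trans (proj₂ (upTo z) s l a) b≤c
        extend : Dec (∃ λ s → π₁ s ≡ z × Active Q s) → ∃ λ b → ∀ s → π₁ s < suc z → Active Q s → s < b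
        extend (no none) = b , λ s z≤ a → case m≤n⇒m<n∨m≡n (≤-pred z≤) of λ
          { (inj₁ l) → old l a ≤-refl ; (inj₂ e) → ⊥-elim (none (s , e , a)) }
        extend (yes (s₁ , e₁ , a₁)) = b ⊔ suc s₁ , λ s z≤ a → case m≤n⇒m<n∨m≡n (≤-pred z≤) of λ
          { (inj₁ l) → old l a (m≤m⊔n b (suc s₁))
          ; (inj₂ e) → subst (_< b ⊔ suc s₁) (Active-unique a₁ a (trans e₁ (sym e))) (m≤n⊔m b (suc s₁)) }

    -- The first stage at which everything up to b is refuted gives an active code with first
    -- component b, which is at least b.
    active-infinite : (∀ z → ∃ λ w → Q z w) → ∀ b → ∃ λ s → b ≤ s × Active Q s
    active-infinite h b = reached (least (AllRefuted Q b) (collected (collect (λ w z → Q z w) (suc b) (λ z _ → h z))))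
      where
      collected : (∃ λ c → ∀ i → i < suc b → ∃ λ w → w < c × Q i w) → ∃ (AllRefuted Q b)
      collected p = p
      reached : (∃ λ w → AllRefuted Q b w × (∀ v → v < w → ¬ AllRefuted Q b v)) → ∃ λ s → b ≤ s × Active Q s
      reached (zero , r , _)    = case proj₁ (proj₂ (r 0 (s≤s z≤n))) of λ ()
      reached (suc w , r , min) = ⟨ b , w ⟩ , fst≤pair b w ,
        subst₂ (λ z w → AllRefuted Q z (suc w)) (sym (π₁-pair b w)) (sym (π₂-pair b w)) r ,
        subst₂ (λ z w → ¬ AllRefuted Q z w) (sym (π₁-pair b w)) (sym (π₂-pair b w)) (min w (n<1+n w))

  computable⇒Fn : ∀ {ℓ} {D : Pred ℕ ℓ} → ComputableSet D → ∃ λ (F : Fn 1) → ∀ u → (D u → fn F (u ∷ []) ≢ 0) ×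
      (¬ D u → fn F (u ∷ []) ≡ 0)
  computable⇒Fn {D = D} (e , d) = mkFn (λ { (u ∷ []) → proj₁ (d u) }) f₀ (λ { (u ∷ []) →
      φ-transport {f₀} (subst (λ e → φ e u (proj₁ (d u))) (sym c₀) (proj₁ (proj₂ (d u)))) }) ,
    λ u → value (proj₂ (proj₂ (d u)))
    where
    -- Totality at 0 provides a program with code e; the runs on other inputs are transported to it.
    f₀ = proj₁ (proj₁ (proj₂ (d 0)))
    c₀ = proj₁ (proj₂ (proj₁ (proj₂ (d 0))))
    value : ∀ {u y} → D u × sgn y ≡ 1 ⊎ ¬ D u × sgn y ≡ 0 → (D u → y ≢ 0) × (¬ D u → y ≡ 0)
    value (inj₁ (p , s)) = (λ { _ refl → case s of λ () }) , (λ n → ⊥-elim (n p))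
    value {y = zero}  (inj₂ (n , s)) = (λ p → ⊥-elim (n p)) , (λ _ → refl)
    value {y = suc _} (inj₂ (n , ()))

  module _ (F : Fn 1) where

    -- The nesting of the pairs is the one that arises from unfolding `Π⁰ 3`; F computes the
    -- innermost set, with 0 for non-membership.
    Refuted : ℕ → ℕ → ℕ → ℕ → Set
    Refuted x n z w = fn F (⟨ ⟨ ⟨ x , n ⟩ , z ⟩ , w ⟩ ∷ []) ≡ 0

    opaque
      allRefutedᴰ : Dc 4
      allRefutedᴰ = asᴰ (∀<ᴰ (S (𝕧 2)) (∃<ᴰ (𝕧 4) (app F (⟪ ⟪ ⟪ 𝕧 2 , 𝕧 3 ⟫ , 𝕧 1 ⟫ , 𝕧 0 ⟫ ∷ˢ []ˢ) ≐ᴰ lit 0)))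
        (λ { (x ∷ n ∷ z ∷ w ∷ []) → AllRefuted (Refuted x n) z w })
        (λ { (x ∷ n ∷ z ∷ w ∷ []) p → p }) (λ { (x ∷ n ∷ z ∷ w ∷ []) p → p })

      allRefutedᴰ-spec : ∀ x n z w → ⟦ allRefutedᴰ ⟧ᴰ (x ∷ n ∷ z ∷ w ∷ []) ≡ AllRefuted (Refuted x n) z w
      allRefutedᴰ-spec x n z w = refl

    activeᴰ : Dc 3
    activeᴰ = asᴰ (subᴰ allRefutedᴰ (𝕧 0 ∷ˢ 𝕧 1 ∷ˢ π₁ᶠ (𝕧 2) ∷ˢ S (π₂ᶠ (𝕧 2)) ∷ˢ []ˢ) ∧ᴰ
                   (¬ᴰ subᴰ allRefutedᴰ (𝕧 0 ∷ˢ 𝕧 1 ∷ˢ π₁ᶠ (𝕧 2) ∷ˢ π₂ᶠ (𝕧 2) ∷ˢ []ˢ)))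
      (λ { (x ∷ n ∷ s ∷ []) → Active (Refuted x n) s })
      (λ { (x ∷ n ∷ s ∷ []) (p , q) → subst id (allRefutedᴰ-spec x n (π₁ s) (suc (π₂ s))) p ,
                                      subst ¬_ (allRefutedᴰ-spec x n (π₁ s) (π₂ s)) q })
      (λ { (x ∷ n ∷ s ∷ []) (p , q) → subst id (sym (allRefutedᴰ-spec x n (π₁ s) (suc (π₂ s)))) p ,
                                      subst ¬_ (sym (allRefutedᴰ-spec x n (π₁ s) (π₂ s))) q })

    open Decision activeᴰ

    index : ℕ → ℕ
    index x = code (specialise (prog (χ theoryᴰ)) x)

    index-computable : ComputableFunction index
    index-computable = code (prog f) , λ x → prog f , refl , sound f (x ∷ [])
      where
      f : Fn 1
      f = specialiseᶠ (prog (χ theoryᴰ))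

    index-decides : ∀ x → index x Decides GödelNumbers (Th (model x))
    index-decides x a = fn (χ theoryᴰ) (x ∷ a ∷ []) ,
      (specialise (prog (χ theoryᴰ)) x , refl , comp⇓ (constant⇓ x a ∷ proj⇓ zero ∷ []) (sound (χ theoryᴰ) (x ∷ a ∷ []))) ,
      indicates (subst (Indicates (fn (χ theoryᴰ) (x ∷ a ∷ []))) (theoryᴰ-spec x a) (dec theoryᴰ (x ∷ a ∷ [])))
      where
      indicates : ∀ {c} {P : Set} → Indicates c P → P × sgn c ≡ 1 ⊎ ¬ P × sgn c ≡ 0
      indicates (inj₁ (p , refl)) = inj₁ (p , refl)
      indicates (inj₂ (p , refl)) = inj₂ (p , refl)

    index-categorical : ∀ x → (∀ n → ∃ λ z → ∀ w → ¬ Refuted x n z w) → ωCategoricalIndices 𝓖 (index x)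
    index-categorical x h = Th (model x) , Th-complete (model x) ,
      infinite-finitary⇒ωCategorical (Th-complete (model x))
        (countablyInfinite⇒moreThan (model x) (mk↔ₛ′ id id (λ _ → refl) (λ _ → refl)))
        (finite⇒finitary (act x) (λ n → active-finite (Refuted x n) (h n))) ,
      index-decides x

    -- The same index decides `T` and the theory of the model, so the finite lists for `T` serve the
    -- graph, contrary to infinitely many active s.
    categorical-index : ∀ x → ωCategoricalIndices 𝓖 (index x) → ∀ n → ¬ (∀ z → ∃ λ w → Refuted x n z w)
    categorical-index x (T , complete , cat , D) n h =
      infinite⇒¬finitary (act x) n (active-infinite (Refuted x n) h) λ m →
        let Δ , f = ωCategorical⇒finitary complete cat m in Δ , λ ψ → let δ , p , t = f ψ in δ , p , true-in-model _ t
      where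
      true-in-model : ∀ A → T A → Satisfies (model x) [] A
      true-in-model A t =
        let B , s , e = proj₁ (accepts⟷ (index-decides x) (gödel A)) (proj₂ (accepts⟷ D (gödel A)) (A , t , refl)) in
        subst (Satisfies (model x) []) (gödel-injective B A e) s

  -- Conversely to `index-categorical`, if no z works for some n, then each z is refuted at some w,
  -- which `categorical-index` excludes. The given predicates take values in `Set₁`, so this
  -- argument by contradiction is made at that level.
  Π₃-hard : (∀ {P : Set₁} → Dec P) → (A : Pred ℕ (lsuc 0ℓ)) → Π⁰ 3 A → A ≤ₘ ωCategoricalIndices 𝓖
  Π₃-hard em₁ A (B , (C , (D , Level.lift D-computable , C⇔) , B⇔) , A⇔) =
    index F , index-computable F , λ x → mk⇔ (to′ x) (from′ x)
    where
    F = proj₁ (computable⇒Fn D-computable)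
    F-spec = proj₂ (computable⇒Fn D-computable)
    stable₁ : ∀ {P : Set₁} → ¬ ¬ P → P
    stable₁ {P} nn = case em₁ {P} of λ { (yes p) → p ; (no n) → ⊥-elim (nn n) }
    to′ : ∀ x → A x → ωCategoricalIndices 𝓖 (index F x)
    to′ x a = index-categorical F x λ n →
      let z , c = Equivalence.to (B⇔ ⟨ x , n ⟩) (Equivalence.to (A⇔ x) a n) in
      z , λ w → proj₁ (F-spec ⟨ ⟨ ⟨ x , n ⟩ , z ⟩ , w ⟩) (Equivalence.to (C⇔ ⟨ ⟨ x , n ⟩ , z ⟩) c w)
    from′ : ∀ x → ωCategoricalIndices 𝓖 (index F x) → A x
    from′ x i = Equivalence.from (A⇔ x) λ n → stable₁ λ ¬b → categorical-index F x i n λ z →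
      stable λ none → ¬b (Equivalence.from (B⇔ ⟨ x , n ⟩) (z , Equivalence.from (C⇔ ⟨ ⟨ x , n ⟩ , z ⟩) λ w →
        stable₁ λ ¬d → none (w , proj₂ (F-spec ⟨ ⟨ ⟨ x , n ⟩ , z ⟩ , w ⟩) ¬d)))

theorem11 : ExcludedMiddle (lsuc 0ℓ) → ∃ λ (L : FiniteLanguage) → Π⁰-Complete 3 (ωCategoricalIndices L)
theorem11 em₁ = 𝓖 , ωCategoricalIndices-Π₃ em , Π₃-hard em (λ {P} → em₁ {P})
  where
  em : {P : Set} → Dec P
  em {P} = case em₁ {Level.Lift (lsuc 0ℓ) P} of λ
    { (yes p) → yes (Level.lower p) ; (no n) → no (λ p → n (Level.lift p)) }
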